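{- For every positive integer $k$, as $n\to\infty$, \[ \mathcal{N}_{\mathcal{P}}(n,K_3^{(k)})=\frac{1}{(k!)^3}\Bigl(\frac{n}{3}\Bigr)^{3k}+O\bigl(n^{3k-k/(k+4)}\bigr), \qquad \mathcal{N}_{\mathcal{P}}(n,K_4^{(k)})=\frac{1}{(k!)^6}\Bigl(\frac{n}{6}\Bigr)^{6k}+O\bigl(n^{6k-k/(k+4)}\bigr). \]
   Context: $K_t$ is the complete graph on $t$ vertices. For a graph $H=(V,E)$ and a positive integer $k$, the $k$-edge-blow-up $H^{(k)}$ is the graph obtained from $H$ by replacing every edge $xy\in E$ by an independent set of $k$ new vertices, each joined to both $x$ and $y$ (the edge $xy$ itself is removed). For graphs $G,H$, a copy of $H$ in $G$ is a subgraph of $G$ isomorphic to $H$ (counted as unlabeled subgraphs). $\mathcal{N}_{\mathcal{P}}(n,H)$ is the maximum number of copies of $H$ in a planar graph on $n$ vertices. -}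

module Defs where

open import Data.Nat as ℕ using (ℕ; zero; suc; _+_; _*_; _∸_; _^_; _≤_; _!)
open import Data.Integer as ℤ using (ℤ; +_; ∣_∣)
open import Data.Rational as ℚ using (ℚ; 0ℚ; 1ℚ)
open import Data.Bool using (Bool; true; false; not; _∨_)
open import Data.Fin as Fin using (Fin; toℕ; inject₁; fromℕ)
open import Data.Vec using (Vec; lookup)
open import Data.List using (List; length)
open import Data.List.Membership.Propositional using (_∈_)
open import Data.List.Relation.Unary.Unique.Propositional using (Unique)
open import Data.Product using (Σ; Σ-syntax; ∃; ∃-syntax; _×_; _,_)
open import Data.Sum using (_⊎_; inj₁; inj₂)
open import Relation.Nullary using (¬_)
open import Relation.Nullary.Decidable using (⌊_⌋)
open import Relation.Binary.PropositionalEquality using (_≡_; _≢_)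
open import Function.Bundles using (_⇔_)

record Graph (n : ℕ) : Set where
  field
    adjM  : Vec (Vec Bool n) n
  adj : Fin n → Fin n → Bool
  adj u v = lookup (lookup adjM u) v
  field
    sym     : ∀ u v → adj u v ≡ adj v u
    loopless : ∀ u → adj u u ≡ false

Point : Set
Point = ℚ × ℚ

OnSeg : Point → Point → Point → Set
OnSeg (p₁ , p₂) (q₁ , q₂) (x₁ , x₂) =
  Σ[ t ∈ ℚ ] (0ℚ ℚ.≤ t × t ℚ.≤ 1ℚ ×
              x₁ ≡ p₁ ℚ.+ t ℚ.* (q₁ ℚ.- p₁) ×
              x₂ ≡ p₂ ℚ.+ t ℚ.* (q₂ ℚ.- p₂))

record PolyPath : Set where
  field
    len : ℕ
    pts : Fin (suc (suc len)) → Point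
  start : Point
  start = pts Fin.zero
  end : Point
  end = pts (fromℕ (suc len))
  OnSegment : Fin (suc len) → Point → Set
  OnSegment i = OnSeg (pts (inject₁ i)) (pts (Fin.suc i))
  OnPath : Point → Set
  OnPath x = Σ[ i ∈ Fin (suc len) ] OnSegment i x
  IsArc : Set
  IsArc = (∀ i → pts (inject₁ i) ≢ pts (Fin.suc i)) ×
          (∀ (i j : Fin (suc len)) → toℕ i ℕ.< toℕ j → ∀ x →
             OnSegment i x → OnSegment j x →
             (toℕ j ≡ suc (toℕ i)) × (x ≡ pts (Fin.suc i)))

record PlaneDrawing {n : ℕ} (G : Graph n) : Set where
  open Graph G
  field
    pos    : Fin n → Point
    pos-inj : ∀ u v → pos u ≡ pos v → u ≡ v
    arc    : Fin n → Fin n → PolyPath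
    arc-ok : ∀ u v → toℕ u ℕ.< toℕ v → adj u v ≡ true →
               PolyPath.IsArc (arc u v) ×
               PolyPath.start (arc u v) ≡ pos u ×
               PolyPath.end (arc u v) ≡ pos v ×
               (∀ w → w ≢ u → w ≢ v → ¬ PolyPath.OnPath (arc u v) (pos w))
    arcs-disjoint : ∀ u v u' v' →
               toℕ u ℕ.< toℕ v → adj u v ≡ true →
               toℕ u' ℕ.< toℕ v' → adj u' v' ≡ true →
               ¬ ((u ≡ u') × (v ≡ v')) →
               ∀ x → PolyPath.OnPath (arc u v) x → PolyPath.OnPath (arc u' v') x →
               Σ[ w ∈ Fin n ] (x ≡ pos w × (w ≡ u ⊎ w ≡ v) × (w ≡ u' ⊎ w ≡ v'))

Planar : {n : ℕ} → Graph n → Set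
Planar G = PlaneDrawing G

record Pattern : Set₁ where
  field
    V   : Set
    adj : V → V → Bool

-- A subgraph of G: vertex subset S and edge set F (as an adjacency matrix).
SubData : ℕ → Set
SubData n = Vec Bool n × Vec (Vec Bool n) n

IsCopy : {n : ℕ} → Graph n → Pattern → SubData n → Set
IsCopy {n} G H (S , F) =
  (∀ u v → Fu u v ≡ true → Graph.adj G u v ≡ true) ×
  (∀ u v → Fu u v ≡ true → (lookup S u ≡ true × lookup S v ≡ true)) ×
  Σ[ φ ∈ (Pattern.V H → Fin n) ]
    ((∀ a b → φ a ≡ φ b → a ≡ b) ×
     (∀ a → lookup S (φ a) ≡ true) ×
     (∀ u → lookup S u ≡ true → Σ[ a ∈ Pattern.V H ] φ a ≡ u) ×
     (∀ a b → Pattern.adj H a b ≡ Fu (φ a) (φ b)))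
  where
  Fu : Fin n → Fin n → Bool
  Fu u v = lookup (lookup F u) v

CopyCount : {n : ℕ} → Graph n → Pattern → ℕ → Set
CopyCount {n} G H N =
  Σ[ cs ∈ List (SubData n) ]
    (Unique cs × length cs ≡ N × (∀ x → (x ∈ cs) ⇔ IsCopy G H x))

IsNP : ℕ → Pattern → ℕ → Set
IsNP n H M =
  (Σ[ G ∈ Graph n ] (Planar G × CopyCount G H M)) ×
  (∀ (G : Graph n) → Planar G → ∀ N → CopyCount G H N → N ≤ M)

K : (t : ℕ) → Fin t → Fin t → Bool
K t i j = not ⌊ i Fin.≟ j ⌋

-- k-edge-blow-up of a graph on Fin t with adjacency A: the original
-- vertices, plus k new vertices for every edge ij (i<j), each joined to
-- i and j; the original edges are removed.
BlowUpV : (t : ℕ) → (Fin t → Fin t → Bool) → ℕ → Set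
BlowUpV t A k =
  Fin t ⊎ (Σ[ i ∈ Fin t ] Σ[ j ∈ Fin t ] ((toℕ i ℕ.< toℕ j × A i j ≡ true) × Fin k))

blowUpAdj : (t : ℕ) (A : Fin t → Fin t → Bool) (k : ℕ) →
            BlowUpV t A k → BlowUpV t A k → Bool
blowUpAdj t A k (inj₁ x) (inj₁ y) = false
blowUpAdj t A k (inj₁ x) (inj₂ (i , j , _)) = ⌊ x Fin.≟ i ⌋ ∨ ⌊ x Fin.≟ j ⌋
blowUpAdj t A k (inj₂ (i , j , _)) (inj₁ x) = ⌊ x Fin.≟ i ⌋ ∨ ⌊ x Fin.≟ j ⌋
blowUpAdj t A k (inj₂ _) (inj₂ _) = false

BlowUp : (t : ℕ) → (Fin t → Fin t → Bool) → ℕ → Pattern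
BlowUp t A k = record { V = BlowUpV t A k ; adj = blowUpAdj t A k }

KBlow : ℕ → ℕ → Pattern
KBlow t k = BlowUp t (K t) k

-- The asymptotic statement, cleared of denominators and of the
-- fractional exponent:
--   M = (1/(k!)^e) (n/e)^{ek} + O(n^{ek - k/(k+4)})
-- is stated as: ∃ C n₀, ∀ n ≥ n₀, ∀ M = 𝒩_𝒫(n,H),
--   |M·e^{ek}·(k!)^e − n^{ek}|^{k+4} ≤ C · n^{ek(k+4) − k}.
AsymptoticNP : (H : Pattern) (e k : ℕ) → Set
AsymptoticNP H e k =
  Σ[ C ∈ ℕ ] Σ[ n₀ ∈ ℕ ] ∀ n → n₀ ≤ n → ∀ M → IsNP n H M →
    ∣ (+ (M * (e ^ (e * k) * (k !) ^ e))) ℤ.- (+ (n ^ (e * k))) ∣ ^ (k + 4)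
      ≤ C * n ^ ((e * k) * (k + 4) ∸ k)

{-# OPTIONS --safe #-}
module Submission where

-- Upper bound. The crossing parity of disjoint polygonal chains shows that a plane drawing has no
-- K₃,₃ minor; by Mader's contraction argument every set of vertices spans linearly many edges. Let A
-- be the set of vertices of degree at least n/τ. Few vertices have three neighbours in A, and each of
-- the others lies in the class of at most one pair of members of A, so that the common neighbours
-- give weights of total at most n to the pairs. The number of weighted triangles (or K₄'s) is largest
-- for equal weights: remove a vertex of least degree and apply the inequality of the arithmetic and
-- geometric means. Every other copy has a small hub or a crowded vertex; matching the hubs with
-- adjacent vertices of the classes makes each hub cost O(n) choices of an edge, which saves a power
-- of n. For k = 1 and K₃ (hexagons), rotating the copy exchanges hubs with the other vertices, and
-- Chiba and Nishizeki's bound on the sum of min(deg x, deg y) over the edges xy is needed.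
--
-- Lower bound. In a straight-line drawing of K₄ replace each edge by a thin triangle carrying about
-- n/6 vertices, all joined to both ends; separating affine functions show that no edges cross.

open import Defs
open import Data.Nat using (ℕ; _≤_)
open import Data.Product using (_×_)

open import Axiom.UniquenessOfIdentityProofs using (module Decidable⇒UIP)
open import Data.Bool using (Bool; true; false; not; _∧_; _∨_; _xor_; if_then_else_)
import Data.Bool.Properties as BoolP
open import Data.Bool.Solver using (module xor-∧-Solver)
open import Data.Empty using (⊥; ⊥-elim)
open import Data.Fin as Fin using (Fin; toℕ; inject₁; fromℕ; #_)
import Data.Fin.Properties as FinP
open import Data.Integer as ℤ using (ℤ; ∣_∣)
import Data.Integer.Properties as ℤP
open import Data.List using (List; []; _∷_; _++_; map; length; filter; filterᵇ; allFin; cartesianProductWith; deduplicate)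
import Data.List.Properties as ListP
open import Data.List.Membership.Propositional using (_∈_; _∉_; find)
import Data.List.Membership.Propositional.Properties as ∈P
open import Data.List.Relation.Binary.Permutation.Propositional as Perm using (_↭_; prep; swap; ↭-sym)
import Data.List.Relation.Binary.Permutation.Propositional.Properties as PermP
open import Data.List.Relation.Unary.All as All using ([]; _∷_)
open import Data.List.Relation.Unary.AllPairs using ([]; _∷_)
open import Data.List.Relation.Unary.Any as Any using (Any; here; there)
open import Data.List.Relation.Unary.Unique.DecPropositional.Properties using (deduplicate-!)
open import Data.List.Relation.Unary.Unique.Propositional using (Unique)
import Data.List.Relation.Unary.Unique.Propositional.Properties as UniqueP
open import Data.Nat as ℕ using (zero; suc; _+_; _*_; _∸_; _^_; _<_; z≤n; s≤s; _!; _⊓_)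
open import Data.Nat.DivMod using (_%_; _/_; _mod_; m≡m%n+[m/n]*n; [m+kn]%n≡m%n; m<n⇒m%n≡m; m%n<n)
import Data.Nat.Properties as ℕP
open import Data.Nat.Solver using (module +-*-Solver)
open import Data.Product using (Σ-syntax; ∃; _,_; proj₁; proj₂)
import Data.Product.Properties as ProductP
open import Data.Rational as ℚ using (ℚ; 0ℚ; 1ℚ; ½)
import Data.Rational.Properties as ℚP
import Data.Rational.Solver as ℚSolver
open import Data.Sum using (_⊎_; inj₁; inj₂)
import Data.Vec
open Data.Vec using (Vec; lookup; tabulate)
import Data.Vec.Properties as VecP
open import Function using (_∘_; case_of_)
open import Function.Bundles using (Equivalence; mk⇔)
open import Relation.Binary.Definitions using (tri<; tri≈; tri>)
open import Relation.Binary.PropositionalEquality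
open import Relation.Nullary using (¬_; Dec; yes; no)
open import Relation.Nullary.Decidable using (⌊_⌋; from-yes; _×-dec_; _⊎-dec_; _→-dec_)

-- A drawing consists of arbitrary polygonal arcs, and crossing parity replaces any theory of faces:
-- only the exclusion of K₃,₃ is extracted from it. The price is the constant 24 = 3·2³ where
-- Euler's formula would give 6 (edges are counted as ordered pairs); it affects the O-term only.
-- Errors stay in ℕ as m·X ≤ m·N + N·c, with 1/m the relative precision, so that the fractional
-- exponent enters only through the choice of m. For classes of size k, the copies with large hubs
-- and a crowded vertex have relative size O(τ³/n); those with a small hub have O(1/τ^(2k-1)) for K₃
-- with k ≥ 2, and O(1/τ^(3k-1)) for K₄. If τ is maximal with mτ³ ≤ n, then m ≈ n^(k/(k+4)) is
-- O(τ^(2k-1)), because 3k ≤ 4(2k-1). In a hexagon the class opposite a small hub is a single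
-- vertex, which cannot be matched with both remaining hubs; its separate treatment still saves the
-- factor τ.

-- Indicators and finite sums.

⟦_⟧ : Bool → ℕ
⟦ true ⟧ = 1
⟦ false ⟧ = 0

⟦⟧≤1 : ∀ b → ⟦ b ⟧ ≤ 1
⟦⟧≤1 true = ℕP.≤-refl
⟦⟧≤1 false = z≤n

⟦∧⟧ : ∀ a b → ⟦ a ∧ b ⟧ ≡ ⟦ a ⟧ * ⟦ b ⟧
⟦∧⟧ true b = sym (ℕP.+-identityʳ ⟦ b ⟧)
⟦∧⟧ false b = refl

⟦⟧*≤ : ∀ b m → ⟦ b ⟧ * m ≤ m
⟦⟧*≤ true m = ℕP.≤-reflexive (ℕP.+-identityʳ m)
⟦⟧*≤ false m = z≤n

1≤⟦⟧ : ∀ {b} → 1 ≤ ⟦ b ⟧ → b ≡ true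
1≤⟦⟧ {true} _ = refl

⟦⟧-cond : ∀ b {m k} → (b ≡ true → m ≤ k) → ⟦ b ⟧ * m ≤ ⟦ b ⟧ * k
⟦⟧-cond true h = ℕP.+-monoˡ-≤ 0 (h refl)
⟦⟧-cond false h = z≤n

∧-true : ∀ {a b} → a ∧ b ≡ true → a ≡ true × b ≡ true
∧-true {true} {true} _ = refl , refl

∧-intro : ∀ {a b} → a ≡ true → b ≡ true → a ∧ b ≡ true
∧-intro refl refl = refl

not-true : ∀ {a} → not a ≡ true → a ≡ false
not-true {false} _ = refl

infix 4 _==_
_==_ : ∀ {n} → Fin n → Fin n → Bool
i == j = ⌊ i Fin.≟ j ⌋

==-refl : ∀ {n} (i : Fin n) → (i == i) ≡ true
==-refl i with i Fin.≟ i
... | yes _ = refl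
... | no ne = ⊥-elim (ne refl)

==⇒≡ : ∀ {n} {i j : Fin n} → (i == j) ≡ true → i ≡ j
==⇒≡ {i = i} {j} e with i Fin.≟ j
... | yes eq = eq

≢⇒== : ∀ {n} {i j : Fin n} → i ≢ j → (i == j) ≡ false
≢⇒== {i = i} {j} ne with i Fin.≟ j
... | yes eq = ⊥-elim (ne eq)
... | no _ = refl

==-false : ∀ {n} {i j : Fin n} → (i == j) ≡ false → i ≢ j
==-false {i = i} e refl = case trans (sym (==-refl i)) e of λ ()

==-sym : ∀ {n} (i j : Fin n) → (i == j) ≡ (j == i)
==-sym i j with i Fin.≟ j
... | yes refl = sym (==-refl i)
... | no ne = sym (≢⇒== (λ e → ne (sym e)))

module _ {A : Set} where

  ∑ : List A → (A → ℕ) → ℕ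
  ∑ [] f = 0
  ∑ (x ∷ xs) f = f x + ∑ xs f

  ∑-cong : ∀ xs {f g : A → ℕ} → (∀ x → f x ≡ g x) → ∑ xs f ≡ ∑ xs g
  ∑-cong [] h = refl
  ∑-cong (x ∷ xs) h = cong₂ _+_ (h x) (∑-cong xs h)

  ∑-mono-∈ : ∀ xs {f g : A → ℕ} → (∀ x → x ∈ xs → f x ≤ g x) → ∑ xs f ≤ ∑ xs g
  ∑-mono-∈ [] h = z≤n
  ∑-mono-∈ (x ∷ xs) h = ℕP.+-mono-≤ (h x (here refl)) (∑-mono-∈ xs (λ y m → h y (there m)))

  ∑-mono : ∀ xs {f g : A → ℕ} → (∀ x → f x ≤ g x) → ∑ xs f ≤ ∑ xs g
  ∑-mono xs h = ∑-mono-∈ xs (λ x _ → h x)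

  ∑-+ : ∀ xs (f g : A → ℕ) → ∑ xs (λ x → f x + g x) ≡ ∑ xs f + ∑ xs g
  ∑-+ [] f g = refl
  ∑-+ (x ∷ xs) f g = trans (cong (f x + g x +_) (∑-+ xs f g))
    (solve 4 (λ a b c d → (a :+ b) :+ (c :+ d) := (a :+ c) :+ (b :+ d)) refl (f x) (g x) (∑ xs f) (∑ xs g))
    where open +-*-Solver

  ∑-*ˡ : ∀ xs c (f : A → ℕ) → ∑ xs (λ x → c * f x) ≡ c * ∑ xs f
  ∑-*ˡ [] c f = sym (ℕP.*-zeroʳ c)
  ∑-*ˡ (x ∷ xs) c f = trans (cong (c * f x +_) (∑-*ˡ xs c f)) (sym (ℕP.*-distribˡ-+ c (f x) (∑ xs f)))

  ∑-*ʳ : ∀ xs c (f : A → ℕ) → ∑ xs (λ x → f x * c) ≡ ∑ xs f * c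
  ∑-*ʳ xs c f = trans (∑-cong xs (λ x → ℕP.*-comm (f x) c)) (trans (∑-*ˡ xs c f) (ℕP.*-comm c (∑ xs f)))

  ∑-const : ∀ xs c → ∑ xs (λ _ → c) ≡ length xs * c
  ∑-const [] c = refl
  ∑-const (x ∷ xs) c = cong (c +_) (∑-const xs c)

  ∑-1 : ∀ xs → ∑ xs (λ _ → 1) ≡ length xs
  ∑-1 xs = trans (∑-const xs 1) (ℕP.*-identityʳ (length xs))

  ∑-zero : ∀ xs → ∑ xs (λ _ → 0) ≡ 0
  ∑-zero xs = trans (∑-const xs 0) (ℕP.*-zeroʳ (length xs))

  ∑-++ : ∀ xs ys (f : A → ℕ) → ∑ (xs ++ ys) f ≡ ∑ xs f + ∑ ys f
  ∑-++ [] ys f = refl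
  ∑-++ (x ∷ xs) ys f = trans (cong (f x +_) (∑-++ xs ys f)) (sym (ℕP.+-assoc (f x) (∑ xs f) (∑ ys f)))

  ∑-filter : ∀ p xs (f : A → ℕ) → ∑ (filterᵇ p xs) f ≡ ∑ xs (λ x → ⟦ p x ⟧ * f x)
  ∑-filter p [] f = refl
  ∑-filter p (x ∷ xs) f with p x
  ... | true = cong₂ _+_ (sym (ℕP.+-identityʳ (f x))) (∑-filter p xs f)
  ... | false = ∑-filter p xs f

  length-filter : ∀ p xs → length (filterᵇ p xs) ≡ ∑ xs (λ x → ⟦ p x ⟧)
  length-filter p xs = trans (sym (∑-1 (filterᵇ p xs)))
    (trans (∑-filter p xs (λ _ → 1)) (∑-cong xs (λ x → ℕP.*-identityʳ ⟦ p x ⟧)))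

  ∑-∈ : ∀ {xs x} (f : A → ℕ) → x ∈ xs → f x ≤ ∑ xs f
  ∑-∈ {x ∷ xs} f (here refl) = ℕP.m≤m+n (f x) (∑ xs f)
  ∑-∈ {y ∷ xs} f (there m) = ℕP.≤-trans (∑-∈ f m) (ℕP.m≤n+m (∑ xs f) (f y))

  ∑-positive : ∀ xs (f : A → ℕ) → 1 ≤ ∑ xs f → ∃ λ x → x ∈ xs × 1 ≤ f x
  ∑-positive (x ∷ xs) f h with f x in eq
  ... | suc k = x , here refl , subst (1 ≤_) (sym eq) (s≤s z≤n)
  ... | zero with ∑-positive xs f h
  ...   | y , m , q = y , there m , q

∑-map : ∀ {A B : Set} (g : A → B) xs (f : B → ℕ) → ∑ (map g xs) f ≡ ∑ xs (λ x → f (g x))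
∑-map g [] f = refl
∑-map g (x ∷ xs) f = cong (f (g x) +_) (∑-map g xs f)

∑-swap : ∀ {A B : Set} (xs : List A) (ys : List B) (f : A → B → ℕ) →
  ∑ xs (λ x → ∑ ys (f x)) ≡ ∑ ys (λ y → ∑ xs (λ x → f x y))
∑-swap [] ys f = sym (∑-zero ys)
∑-swap (x ∷ xs) ys f = trans (cong (∑ ys (f x) +_) (∑-swap xs ys f)) (sym (∑-+ ys (f x) (λ y → ∑ xs (λ x → f x y))))

module _ {n : ℕ} where

  ∑ᶠ : (Fin n → ℕ) → ℕ
  ∑ᶠ f = ∑ (allFin n) f

  count : (Fin n → Bool) → ℕ
  count p = ∑ᶠ (λ i → ⟦ p i ⟧)

  private
    ∑-δ-∉ : ∀ xs (j : Fin n) (f : Fin n → ℕ) → j ∉ xs → ∑ xs (λ i → ⟦ i == j ⟧ * f i) ≡ 0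
    ∑-δ-∉ [] j f _ = refl
    ∑-δ-∉ (x ∷ xs) j f j∉ rewrite ≢⇒== {i = x} {j} (λ e → j∉ (here (sym e))) = ∑-δ-∉ xs j f (λ m → j∉ (there m))

    ∑-δ-∈ : ∀ xs (j : Fin n) (f : Fin n → ℕ) → Unique xs → j ∈ xs → ∑ xs (λ i → ⟦ i == j ⟧ * f i) ≡ f j
    ∑-δ-∈ (x ∷ xs) .x f (px ∷ u) (here refl) rewrite ==-refl x =
      trans (cong₂ _+_ (ℕP.+-identityʳ (f x)) (∑-δ-∉ xs x f (λ m → All.lookup px m refl))) (ℕP.+-identityʳ (f x))
    ∑-δ-∈ (x ∷ xs) j f (px ∷ u) (there m) rewrite ≢⇒== {i = x} {j} (All.lookup px m) = ∑-δ-∈ xs j f u m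

  Σ-δ : ∀ (j : Fin n) (f : Fin n → ℕ) → ∑ᶠ (λ i → ⟦ i == j ⟧ * f i) ≡ f j
  Σ-δ j f = ∑-δ-∈ (allFin n) j f (UniqueP.allFin⁺ n) (∈P.∈-allFin j)

  count-δ : ∀ (j : Fin n) → count (_== j) ≡ 1
  count-δ j = trans (∑-cong (allFin n) (λ i → sym (ℕP.*-identityʳ ⟦ i == j ⟧))) (Σ-δ j (λ _ → 1))

  Σ-∈ : ∀ (f : Fin n → ℕ) i → f i ≤ ∑ᶠ f
  Σ-∈ f i = ∑-∈ f (∈P.∈-allFin i)

  length-allFin : length (allFin n) ≡ n
  length-allFin = ListP.length-tabulate (λ i → i)

  count≤n : ∀ p → count p ≤ n
  count≤n p = ℕP.≤-trans (∑-mono (allFin n) (λ i → ⟦⟧≤1 (p i)))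
    (ℕP.≤-reflexive (trans (∑-1 (allFin n)) length-allFin))

  without : (Fin n → Bool) → Fin n → Fin n → Bool
  without p j i = p i ∧ not (i == j)

  count-without : ∀ p j → p j ≡ true → count p ≡ suc (count (without p j))
  count-without p j pj = trans (∑-cong (allFin n) split)
      (trans (∑-+ (allFin n) (λ i → ⟦ i == j ⟧) (λ i → ⟦ without p j i ⟧)) (cong (_+ count (without p j)) (count-δ j)))
    where
    split : ∀ i → ⟦ p i ⟧ ≡ ⟦ i == j ⟧ + ⟦ without p j i ⟧
    split i with i == j in e
    ... | true rewrite ==⇒≡ {i = i} {j} e | pj = refl
    ... | false with p i
    ...   | true = refl
    ...   | false = refl

  pick : ∀ p → 1 ≤ count p → ∃ λ i → p i ≡ true
  pick p h = let (i , _ , q) = ∑-positive (allFin n) (λ i → ⟦ p i ⟧) h in i , 1≤⟦⟧ q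

  pick₃ : ∀ p → 3 ≤ count p → Σ[ i ∈ Fin n ] Σ[ j ∈ Fin n ] Σ[ k ∈ Fin n ]
    ((p i ≡ true × p j ≡ true × p k ≡ true) × (i ≢ j × i ≢ k × j ≢ k))
  pick₃ p h =
    let (i , pi) = pick p (ℕP.≤-trans (s≤s z≤n) h)
        h₁ = ℕP.≤-pred (subst (3 ≤_) (count-without p i pi) h)
        (j , pj) = pick (without p i) (ℕP.≤-trans (s≤s z≤n) h₁)
        h₂ = ℕP.≤-pred (subst (2 ≤_) (count-without (without p i) j pj) h₁)
        (k , pk) = pick (without (without p i) j) h₂
        (pj' , ji) = ∧-true pj
        (pk' , kj) = ∧-true pk
        (pk'' , ki) = ∧-true pk'
    in i , j , k , (pi , pj' , pk'') ,
       ((λ e → ==-false (not-true ji) (sym e)) , (λ e → ==-false (not-true ki) (sym e)) , (λ e → ==-false (not-true kj) (sym e)))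

-- Signs and the lexicographic order of the plane.

private
  0≤-0< : ∀ {x} → ¬ (x ℚ.< 0ℚ) → 0ℚ ℚ.≤ x
  0≤-0< = ℚP.≮⇒≥

  neg-flip< : ∀ {x} → 0ℚ ℚ.< x → ℚ.- x ℚ.< 0ℚ
  neg-flip< = ℚP.neg-antimono-<

  neg-flip≤ : ∀ {x} → 0ℚ ℚ.≤ x → ℚ.- x ℚ.≤ 0ℚ
  neg-flip≤ = ℚP.neg-antimono-≤

  pos-flip≤ : ∀ {x} → x ℚ.≤ 0ℚ → 0ℚ ℚ.≤ ℚ.- x
  pos-flip≤ = ℚP.neg-antimono-≤

  sub-pos : ∀ {x y} → x ℚ.< y → 0ℚ ℚ.< y ℚ.- x
  sub-pos {x} {y} lt = subst (ℚ._< y ℚ.- x) (ℚP.+-inverseʳ x) (ℚP.+-monoˡ-< (ℚ.- x) lt)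

  sub-nonneg : ∀ {x y} → x ℚ.≤ y → 0ℚ ℚ.≤ y ℚ.- x
  sub-nonneg {x} {y} le = subst (ℚ._≤ y ℚ.- x) (ℚP.+-inverseʳ x) (ℚP.+-monoˡ-≤ (ℚ.- x) le)

  neg*pos : ∀ {a x} → a ℚ.< 0ℚ → 0ℚ ℚ.< x → a ℚ.* x ℚ.< 0ℚ
  neg*pos {a} {x} a<0 0<x =
    ℚP.negative⁻¹ (a ℚ.* x) {{ℚP.neg*pos⇒neg a {{ℚ.negative a<0}} x {{ℚ.positive 0<x}}}}

  nonneg*nonneg : ∀ {a x} → 0ℚ ℚ.≤ a → 0ℚ ℚ.≤ x → 0ℚ ℚ.≤ a ℚ.* x
  nonneg*nonneg {a} {x} p q =
    ℚP.nonNegative⁻¹ (a ℚ.* x) {{ℚP.nonNeg*nonNeg⇒nonNeg a {{ℚ.nonNegative p}} x {{ℚ.nonNegative q}}}}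

-- Vectors of ℚ² are ordered lexicographically, which makes ℚ² an ordered
-- vector space: this removes all degenerate (vertical) cases below.
LexPos LexNeg LexNonPos : Point → Set
LexPos (x , y) = (0ℚ ℚ.< x) ⊎ (x ≡ 0ℚ × 0ℚ ℚ.< y)
LexNeg (x , y) = (x ℚ.< 0ℚ) ⊎ (x ≡ 0ℚ × y ℚ.< 0ℚ)
LexNonPos v = LexNeg v ⊎ v ≡ (0ℚ , 0ℚ)

infixl 6 _⊕_ _⊖_
infixl 7 _⊛_
opaque
  _⊕_ _⊖_ : Point → Point → Point
  (a , b) ⊕ (c , d) = a ℚ.+ c , b ℚ.+ d
  (a , b) ⊖ (c , d) = a ℚ.- c , b ℚ.- d
  _⊛_ : ℚ → Point → Point
  s ⊛ (a , b) = s ℚ.* a , s ℚ.* b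

  scale-neg : ∀ {a} x → a ℚ.< 0ℚ → LexPos x → LexNeg (a ⊛ x)
  scale-neg x a<0 (inj₁ p) = inj₁ (neg*pos a<0 p)
  scale-neg {a} x a<0 (inj₂ (refl , p)) = inj₂ (ℚP.*-zeroʳ a , neg*pos a<0 p)

  zero-⊛ : ∀ x → 0ℚ ⊛ x ≡ (0ℚ , 0ℚ)
  zero-⊛ (x , y) = cong₂ _,_ (ℚP.*-zeroˡ x) (ℚP.*-zeroˡ y)

scale-nonpos : ∀ {a} x → a ℚ.≤ 0ℚ → LexPos x → LexNonPos (a ⊛ x)
scale-nonpos {a} x a≤0 p with a ℚP.<? 0ℚ
... | yes a<0 = inj₁ (scale-neg x a<0 p)
... | no a≮0 = inj₂ (trans (cong (_⊛ x) (ℚP.≤-antisym a≤0 (0≤-0< a≮0))) (zero-⊛ x))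

opaque
  unfolding _⊕_
  add-neg : ∀ x y → LexNeg x → LexNonPos y → LexNeg (x ⊕ y)
  add-neg x y (inj₁ p) (inj₁ (inj₁ q)) = inj₁ (ℚP.+-mono-< p q)
  add-neg (x , _) y (inj₁ p) (inj₁ (inj₂ (refl , q))) = inj₁ (subst (ℚ._< 0ℚ) (sym (ℚP.+-identityʳ x)) p)
  add-neg x (y , _) (inj₂ (refl , p)) (inj₁ (inj₁ q)) = inj₁ (subst (ℚ._< 0ℚ) (sym (ℚP.+-identityˡ y)) q)
  add-neg x y (inj₂ (refl , p)) (inj₁ (inj₂ (refl , q))) = inj₂ (refl , ℚP.+-mono-< p q)
  add-neg (x , _) y (inj₁ p) (inj₂ refl) = inj₁ (subst (ℚ._< 0ℚ) (sym (ℚP.+-identityʳ x)) p)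
  add-neg (_ , x) y (inj₂ (refl , p)) (inj₂ refl) = inj₂ (refl , subst (ℚ._< 0ℚ) (sym (ℚP.+-identityʳ x)) p)

¬LexNeg0 : ¬ LexNeg (0ℚ , 0ℚ)
¬LexNeg0 (inj₁ p) = ℚP.<-irrefl refl p
¬LexNeg0 (inj₂ (_ , p)) = ℚP.<-irrefl refl p

-- The left side would be a negative vector. Every sign argument about two segments below is an
-- application of this to an affine relation between their end points.
no-relation : ∀ {a b c} x y z → a ℚ.< 0ℚ → b ℚ.≤ 0ℚ → c ℚ.≤ 0ℚ →
  LexPos x → LexPos y → LexPos z → (a ⊛ x) ⊕ (b ⊛ y) ⊕ (c ⊛ z) ≡ (0ℚ , 0ℚ) → ⊥
no-relation x y z a<0 b≤0 c≤0 px py pz eq =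
  ¬LexNeg0 (subst LexNeg eq (add-neg _ _ (add-neg _ _ (scale-neg x a<0 px) (scale-nonpos y b≤0 py)) (scale-nonpos z c≤0 pz)))

infix 4 _⊏_ _⊑_
_⊏_ _⊑_ : Point → Point → Set
(p , p') ⊏ (q , q') = (p ℚ.< q) ⊎ (p ≡ q × p' ℚ.< q')
p ⊑ q = p ⊏ q ⊎ p ≡ q

opaque
  unfolding _⊖_
  ⊏⇒pos : ∀ p q → p ⊏ q → LexPos (q ⊖ p)
  ⊏⇒pos p q (inj₁ x) = inj₁ (sub-pos x)
  ⊏⇒pos p q (inj₂ (refl , y)) = inj₂ (ℚP.+-inverseʳ (proj₁ p) , sub-pos y)

⊏-irrefl : ∀ p → ¬ (p ⊏ p)
⊏-irrefl p (inj₁ x) = ℚP.<-irrefl refl x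
⊏-irrefl p (inj₂ (_ , y)) = ℚP.<-irrefl refl y

⊏-trans : ∀ {p q r} → p ⊏ q → q ⊏ r → p ⊏ r
⊏-trans (inj₁ a) (inj₁ b) = inj₁ (ℚP.<-trans a b)
⊏-trans (inj₁ a) (inj₂ (refl , b)) = inj₁ a
⊏-trans (inj₂ (refl , a)) (inj₁ b) = inj₁ b
⊏-trans (inj₂ (refl , a)) (inj₂ (refl , b)) = inj₂ (refl , ℚP.<-trans a b)

⊏-⊑-trans : ∀ {p q r} → p ⊏ q → q ⊑ r → p ⊏ r
⊏-⊑-trans a (inj₁ b) = ⊏-trans a b
⊏-⊑-trans a (inj₂ refl) = a

⊏-asym : ∀ {p q} → p ⊏ q → ¬ (q ⊏ p)
⊏-asym a b = ⊏-irrefl _ (⊏-trans a b)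

data Tri (p q : Point) : Set where
  before : p ⊏ q → Tri p q
  equal : p ≡ q → Tri p q
  after : q ⊏ p → Tri p q

tri : ∀ p q → Tri p q
tri (p , p') (q , q') with ℚP.<-cmp p q
... | tri< a _ _ = before (inj₁ a)
... | tri> _ _ a = after (inj₁ a)
... | tri≈ _ refl _ with ℚP.<-cmp p' q'
...   | tri< a _ _ = before (inj₂ (refl , a))
...   | tri≈ _ refl _ = equal refl
...   | tri> _ _ a = after (inj₂ (refl , a))

opaque
  leB : Point → Point → Bool
  leB p q with tri p q
  ... | before _ = true
  ... | equal _ = true
  ... | after _ = false

  leB-⊑ : ∀ {p q} → p ⊑ q → leB p q ≡ true
  leB-⊑ {p} {q} a with tri p q
  ... | before _ = refl
  ... | equal _ = refl
  leB-⊑ {p} {q} (inj₁ a) | after b = ⊥-elim (⊏-asym a b)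
  leB-⊑ {p} {q} (inj₂ refl) | after b = ⊥-elim (⊏-irrefl _ b)

  leB-⊏ : ∀ {p q} → p ⊏ q → leB p q ≡ true
  leB-⊏ a = leB-⊑ (inj₁ a)

  leB-⊐ : ∀ {p q} → q ⊏ p → leB p q ≡ false
  leB-⊐ {p} {q} a with tri p q
  ... | before b = ⊥-elim (⊏-asym a b)
  ... | equal refl = ⊥-elim (⊏-irrefl _ a)
  ... | after _ = refl

  leB-flip : ∀ {p q} → p ≢ q → leB q p ≡ not (leB p q)
  leB-flip {p} {q} ne with tri p q
  ... | before a = leB-⊐ a
  ... | equal e = ⊥-elim (ne e)
  ... | after a = leB-⊏ a

-- Orientation and crossing parity of two segments.

opaque
  -- Twice the signed area of the triangle `u v p`. If `u` precedes `v`, a negative value means that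
  -- `p` lies below the line `uv`.
  det : Point → Point → Point → ℚ
  det (u₁ , u₂) (v₁ , v₂) (p₁ , p₂) = (v₁ ℚ.- u₁) ℚ.* (p₂ ℚ.- u₂) ℚ.- (v₂ ℚ.- u₂) ℚ.* (p₁ ℚ.- u₁)

opaque
  negB : ℚ → Bool
  negB x = ⌊ x ℚP.<? 0ℚ ⌋

  negB-yes : ∀ {x} → x ℚ.< 0ℚ → negB x ≡ true
  negB-yes {x} a with x ℚP.<? 0ℚ
  ... | yes _ = refl
  ... | no ¬a = ⊥-elim (¬a a)

  negB-no : ∀ {x} → ¬ (x ℚ.< 0ℚ) → negB x ≡ false
  negB-no {x} ¬a with x ℚP.<? 0ℚ
  ... | yes a = ⊥-elim (¬a a)
  ... | no _ = refl

opaque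
  -- The segment is directed from its smaller to its larger end point first, so that a negative sign
  -- means "strictly below" whichever end is named first.
  belowB : Point → Point → Point → Bool
  belowB p u v = if leB u v then negB (det u v p) else negB (det v u p)

  -- The ray is the upward vertical one from p, the segment is uv.
  rayB : Point → Point → Point → Bool
  rayB p u v = (leB u p xor leB v p) ∧ belowB p u v

  belowB-sym : ∀ p u v → belowB p u v ≡ belowB p v u
  belowB-sym p u v = go (tri u v)
    where
    go : Tri u v → belowB p u v ≡ belowB p v u
    go (equal refl) = refl
    go (before a) = trans (cong (if_then negB (det u v p) else negB (det v u p)) (leB-⊏ a))
                      (sym (cong (if_then negB (det v u p) else negB (det u v p)) (leB-⊐ a)))
    go (after a) = trans (cong (if_then negB (det u v p) else negB (det v u p)) (leB-⊐ a))
                      (sym (cong (if_then negB (det v u p) else negB (det u v p)) (leB-⊏ a)))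

  rayB-sym : ∀ p u v → rayB p u v ≡ rayB p v u
  rayB-sym p u v = cong₂ _∧_ (BoolP.xor-comm (leB u p) (leB v p)) (belowB-sym p u v)

  rayB-triv : ∀ p u v b → leB u p ≡ b → leB v p ≡ b → rayB p u v ≡ false
  rayB-triv p u v true e f rewrite e | f = refl
  rayB-triv p u v false e f rewrite e | f = refl

  rayB-cross : ∀ p u v → leB u p ≡ true → leB v p ≡ false → leB u v ≡ true → rayB p u v ≡ negB (det u v p)
  rayB-cross p u v e f g rewrite e | f | g = refl

negB-cases : ∀ x → (x ℚ.< 0ℚ × negB x ≡ true) ⊎ (0ℚ ℚ.≤ x × negB x ≡ false)
negB-cases x = go (x ℚP.<? 0ℚ)
  where
  go : Dec (x ℚ.< 0ℚ) → (x ℚ.< 0ℚ × negB x ≡ true) ⊎ (0ℚ ℚ.≤ x × negB x ≡ false)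
  go (yes a) = inj₁ (a , negB-yes a)
  go (no a) = inj₂ (ℚP.≮⇒≥ a , negB-no a)

sum8 : Bool → Bool → Bool → Bool → Bool → Bool → Bool → Bool → Bool
sum8 a b c d e f g h = ((a xor b) xor (c xor d)) xor ((e xor f) xor (g xor h))

sum8-cong : ∀ {a b c d e f g h a' b' c' d' e' f' g' h'} → a ≡ a' → b ≡ b' → c ≡ c' → d ≡ d' →
  e ≡ e' → f ≡ f' → g ≡ g' → h ≡ h' → sum8 a b c d e f g h ≡ sum8 a' b' c' d' e' f' g' h'
sum8-cong refl refl refl refl refl refl refl refl = refl

-- The crossing parity of the segments pq and uv: the regions above them are
-- bounded by the segment and two vertical rays, and two closed curves cross
-- evenly; all ray contributions depend on end points only.
crossB : Point → Point → Point → Point → Bool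
crossB p q u v = sum8 (rayB p u v) (rayB q u v) (rayB u p q) (rayB v p q)
                      (leB p u) (leB p v) (leB q u) (leB q v)

module _ where
  open xor-∧-Solver
  sum8-swapˡ : ∀ a b c d e f g h → sum8 a b c d e f g h ≡ sum8 b a c d g h e f
  sum8-swapˡ = solve 8 (λ a b c d e f g h →
    ((a :+ b) :+ (c :+ d)) :+ ((e :+ f) :+ (g :+ h)) := ((b :+ a) :+ (c :+ d)) :+ ((g :+ h) :+ (e :+ f))) refl
  sum8-swapʳ : ∀ a b c d e f g h → sum8 a b c d e f g h ≡ sum8 a b d c f e h g
  sum8-swapʳ = solve 8 (λ a b c d e f g h →
    ((a :+ b) :+ (c :+ d)) :+ ((e :+ f) :+ (g :+ h)) := ((a :+ b) :+ (d :+ c)) :+ ((f :+ e) :+ (h :+ g))) refl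
  sum8-exchange : ∀ a b c d e f g h → sum8 a b c d e f g h ≡ sum8 c d a b (not e) (not g) (not f) (not h)
  sum8-exchange = solve 8 (λ a b c d e f g h →
    ((a :+ b) :+ (c :+ d)) :+ ((e :+ f) :+ (g :+ h))
      := ((c :+ d) :+ (a :+ b)) :+ (((con true :+ e) :+ (con true :+ g)) :+ ((con true :+ f) :+ (con true :+ h)))) refl

Meet : Point → Point → Point → Point → Set
Meet p q u v = Σ[ x ∈ Point ] (OnSeg p q x × OnSeg u v x)

OnSeg-sym : ∀ p q x → OnSeg p q x → OnSeg q p x
OnSeg-sym (p₁ , p₂) (q₁ , q₂) x (t , a , b , c , d) =
  (1ℚ ℚ.- t) , sub-nonneg b
  , subst (1ℚ ℚ.- t ℚ.≤_) (ℚP.+-identityʳ 1ℚ) (ℚP.+-monoʳ-≤ 1ℚ (neg-flip≤ a))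
  , trans c (alg t p₁ q₁) , trans d (alg t p₂ q₂)
  where
  open ℚSolver.+-*-Solver
  alg : ∀ t p q → p ℚ.+ t ℚ.* (q ℚ.- p) ≡ q ℚ.+ (1ℚ ℚ.- t) ℚ.* (p ℚ.- q)
  alg = solve 3 (λ t p q → p :+ t :* (q :- p) := q :+ (con 1ℚ :- t) :* (p :- q)) refl

OnSeg-start : ∀ p q → OnSeg p q p
OnSeg-start (p₁ , p₂) (q₁ , q₂) = 0ℚ , ℚP.≤-refl , ℚP.<⇒≤ (ℚP.positive⁻¹ 1ℚ) , alg p₁ q₁ , alg p₂ q₂
  where
  alg : ∀ p q → p ≡ p ℚ.+ 0ℚ ℚ.* (q ℚ.- p)
  alg p q = sym (trans (cong (p ℚ.+_) (ℚP.*-zeroˡ (q ℚ.- p))) (ℚP.+-identityʳ p))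

OnSeg-end : ∀ p q → OnSeg p q q
OnSeg-end p q = OnSeg-sym q p q (OnSeg-start q p)

-- The two affine relations between four points of the plane.
opaque
  unfolding det _⊕_
  det-relation₁ : ∀ p q u v →
    (det p q u ⊛ (v ⊖ q)) ⊕ (det u v q ⊛ (q ⊖ p)) ⊕ (det p q v ⊛ (q ⊖ u)) ≡ (0ℚ , 0ℚ)
  det-relation₁ (p₁ , p₂) (q₁ , q₂) (u₁ , u₂) (v₁ , v₂) =
    cong₂ _,_
     (solve 8 (λ p1 p2 q1 q2 u1 u2 v1 v2 →
        D p1 p2 q1 q2 u1 u2 :* (v1 :- q1) :+ D u1 u2 v1 v2 q1 q2 :* (q1 :- p1) :+ D p1 p2 q1 q2 v1 v2 :* (q1 :- u1) := con 0ℚ)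
        refl p₁ p₂ q₁ q₂ u₁ u₂ v₁ v₂)
     (solve 8 (λ p1 p2 q1 q2 u1 u2 v1 v2 →
        D p1 p2 q1 q2 u1 u2 :* (v2 :- q2) :+ D u1 u2 v1 v2 q1 q2 :* (q2 :- p2) :+ D p1 p2 q1 q2 v1 v2 :* (q2 :- u2) := con 0ℚ)
        refl p₁ p₂ q₁ q₂ u₁ u₂ v₁ v₂)
    where
    open ℚSolver.+-*-Solver
    D : ∀ {n} → Polynomial n → Polynomial n → Polynomial n → Polynomial n → Polynomial n → Polynomial n → Polynomial n
    D u1 u2 v1 v2 p1 p2 = (v1 :- u1) :* (p2 :- u2) :- (v2 :- u2) :* (p1 :- u1)

  det-relation₂ : ∀ p q u v →
    (det p q u ⊛ (v ⊖ p)) ⊕ ((ℚ.- det p q v) ⊛ (u ⊖ p)) ⊕ (det u v p ⊛ (q ⊖ p)) ≡ (0ℚ , 0ℚ)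
  det-relation₂ (p₁ , p₂) (q₁ , q₂) (u₁ , u₂) (v₁ , v₂) =
    cong₂ _,_
     (solve 8 (λ p1 p2 q1 q2 u1 u2 v1 v2 →
        D p1 p2 q1 q2 u1 u2 :* (v1 :- p1) :+ (:- D p1 p2 q1 q2 v1 v2) :* (u1 :- p1) :+ D u1 u2 v1 v2 p1 p2 :* (q1 :- p1) := con 0ℚ)
        refl p₁ p₂ q₁ q₂ u₁ u₂ v₁ v₂)
     (solve 8 (λ p1 p2 q1 q2 u1 u2 v1 v2 →
        D p1 p2 q1 q2 u1 u2 :* (v2 :- p2) :+ (:- D p1 p2 q1 q2 v1 v2) :* (u2 :- p2) :+ D u1 u2 v1 v2 p1 p2 :* (q2 :- p2) := con 0ℚ)
        refl p₁ p₂ q₁ q₂ u₁ u₂ v₁ v₂)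
    where
    open ℚSolver.+-*-Solver
    D : ∀ {n} → Polynomial n → Polynomial n → Polynomial n → Polynomial n → Polynomial n → Polynomial n → Polynomial n
    D u1 u2 v1 v2 p1 p2 = (v1 :- u1) :* (p2 :- u2) :- (v2 :- u2) :* (p1 :- u1)

opaque
  unfolding _⊕_
  scale-relation : ∀ {a b c} x y z → (a ⊛ x) ⊕ (b ⊛ y) ⊕ (c ⊛ z) ≡ (0ℚ , 0ℚ) →
    ((ℚ.- a) ⊛ x) ⊕ ((ℚ.- b) ⊛ y) ⊕ ((ℚ.- c) ⊛ z) ≡ (0ℚ , 0ℚ)
  scale-relation {a} {b} {c} (x , x') (y , y') (z , z') e =
    cong₂ _,_ (trans (alg a b c x y z) (cong ℚ.-_ (cong proj₁ e))) (trans (alg a b c x' y' z') (cong ℚ.-_ (cong proj₂ e)))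
    where
    open ℚSolver.+-*-Solver
    alg : ∀ a b c x y z → (ℚ.- a) ℚ.* x ℚ.+ (ℚ.- b) ℚ.* y ℚ.+ (ℚ.- c) ℚ.* z ≡ ℚ.- (a ℚ.* x ℚ.+ b ℚ.* y ℚ.+ c ℚ.* z)
    alg = solve 6 (λ a b c x y z → (:- a) :* x :+ (:- b) :* y :+ (:- c) :* z := :- (a :* x :+ b :* y :+ c :* z)) refl

  nested-relation : ∀ {a b c} p q u v → (a ⊛ (v ⊖ q)) ⊕ (b ⊛ (q ⊖ p)) ⊕ (c ⊛ (q ⊖ u)) ≡ (0ℚ , 0ℚ) →
    (a ⊛ (q ⊖ v)) ⊕ ((ℚ.- b) ⊛ (q ⊖ p)) ⊕ ((ℚ.- c) ⊛ (q ⊖ u)) ≡ (0ℚ , 0ℚ)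
  nested-relation {a} {b} {c} (p , p') (q , q') (u , u') (v , v') e =
    cong₂ _,_ (trans (alg a b c v q p u) (cong ℚ.-_ (cong proj₁ e))) (trans (alg a b c v' q' p' u') (cong ℚ.-_ (cong proj₂ e)))
    where
    open ℚSolver.+-*-Solver
    alg : ∀ a b c v q p u → a ℚ.* (q ℚ.- v) ℚ.+ (ℚ.- b) ℚ.* (q ℚ.- p) ℚ.+ (ℚ.- c) ℚ.* (q ℚ.- u)
        ≡ ℚ.- (a ℚ.* (v ℚ.- q) ℚ.+ b ℚ.* (q ℚ.- p) ℚ.+ c ℚ.* (q ℚ.- u))
    alg = solve 7 (λ a b c v q p u → a :* (q :- v) :+ (:- b) :* (q :- p) :+ (:- c) :* (q :- u)
        := :- (a :* (v :- q) :+ b :* (q :- p) :+ c :* (q :- u))) refl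

opaque
  unfolding det
  det-swap : ∀ u v p → det v u p ≡ ℚ.- det u v p
  det-swap (u₁ , u₂) (v₁ , v₂) (p₁ , p₂) =
    solve 6 (λ u1 u2 v1 v2 p1 p2 → (u1 :- v1) :* (p2 :- v2) :- (u2 :- v2) :* (p1 :- v1)
       := :- ((v1 :- u1) :* (p2 :- u2) :- (v2 :- u2) :* (p1 :- u1))) refl u₁ u₂ v₁ v₂ p₁ p₂
    where open ℚSolver.+-*-Solver

opaque
  unfolding det _⊕_
  -- Cramer's rule: dividing by the first coefficient shows that the lines `pq` and `uv` meet at the
  -- parameter `det u v p / den` on `pq` and `− det p q u / den` on `uv`, where
  -- `den = det p q v − det p q u`.
  det-relation₃ : ∀ p q u v →
    ((det p q v ℚ.- det p q u) ⊛ (p ⊖ u)) ⊕ (det u v p ⊛ (q ⊖ p)) ⊕ (det p q u ⊛ (v ⊖ u)) ≡ (0ℚ , 0ℚ)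
  det-relation₃ (p₁ , p₂) (q₁ , q₂) (u₁ , u₂) (v₁ , v₂) =
    cong₂ _,_
     (solve 8 (λ p1 p2 q1 q2 u1 u2 v1 v2 →
        (D p1 p2 q1 q2 v1 v2 :- D p1 p2 q1 q2 u1 u2) :* (p1 :- u1) :+ D u1 u2 v1 v2 p1 p2 :* (q1 :- p1) :+ D p1 p2 q1 q2 u1 u2 :* (v1 :- u1) := con 0ℚ)
        refl p₁ p₂ q₁ q₂ u₁ u₂ v₁ v₂)
     (solve 8 (λ p1 p2 q1 q2 u1 u2 v1 v2 →
        (D p1 p2 q1 q2 v1 v2 :- D p1 p2 q1 q2 u1 u2) :* (p2 :- u2) :+ D u1 u2 v1 v2 p1 p2 :* (q2 :- p2) :+ D p1 p2 q1 q2 u1 u2 :* (v2 :- u2) := con 0ℚ)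
        refl p₁ p₂ q₁ q₂ u₁ u₂ v₁ v₂)
    where
    open ℚSolver.+-*-Solver
    D : ∀ {n} → Polynomial n → Polynomial n → Polynomial n → Polynomial n → Polynomial n → Polynomial n → Polynomial n
    D u1 u2 v1 v2 p1 p2 = (v1 :- u1) :* (p2 :- u2) :- (v2 :- u2) :* (p1 :- u1)

  -- Both `det p q v − det p q u` and `det u v p − det u v q` are the cross product of the
  -- directions of `pq` and `uv`. This bounds the parameter on `pq` by 1 once `q` is on the right
  -- side of `uv`.
  det-difference : ∀ p q u v → det u v p ≡ (det p q v ℚ.- det p q u) ℚ.+ det u v q
  det-difference (p₁ , p₂) (q₁ , q₂) (u₁ , u₂) (v₁ , v₂) =
    solve 8 (λ p1 p2 q1 q2 u1 u2 v1 v2 →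
      D u1 u2 v1 v2 p1 p2 := (D p1 p2 q1 q2 v1 v2 :- D p1 p2 q1 q2 u1 u2) :+ D u1 u2 v1 v2 q1 q2)
      refl p₁ p₂ q₁ q₂ u₁ u₂ v₁ v₂
    where
    open ℚSolver.+-*-Solver
    D : ∀ {n} → Polynomial n → Polynomial n → Polynomial n → Polynomial n → Polynomial n → Polynomial n → Polynomial n
    D u1 u2 v1 v2 p1 p2 = (v1 :- u1) :* (p2 :- u2) :- (v2 :- u2) :* (p1 :- u1)

private
  module Intersection (α γ den : ℚ) (0<den : 0ℚ ℚ.< den) where
    instance
      den-Positive : ℚ.Positive den
      den-Positive = ℚ.positive 0<den
      den-NonZero : ℚ.NonZero den
      den-NonZero = ℚP.pos⇒nonZero den
    i s t : ℚ
    i = ℚ.1/ den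
    s = γ ℚ.* i
    t = (ℚ.- α) ℚ.* i
    0≤i : 0ℚ ℚ.≤ i
    0≤i = ℚP.<⇒≤ (ℚP.positive⁻¹ i {{ℚP.1/pos⇒pos den}})
    den*i : den ℚ.* i ≡ 1ℚ
    den*i = ℚP.*-inverseʳ den
    ≤den : ∀ {x} → x ℚ.≤ den → x ℚ.* i ℚ.≤ 1ℚ
    ≤den {x} le = subst (x ℚ.* i ℚ.≤_) den*i (ℚP.*-monoʳ-≤-nonNeg i {{ℚ.nonNegative 0≤i}} le)
    expand : ∀ p q u v i d γ α → p ℚ.+ (γ ℚ.* i) ℚ.* (q ℚ.- p)
       ≡ (u ℚ.+ ((ℚ.- α) ℚ.* i) ℚ.* (v ℚ.- u)) ℚ.+ (1ℚ ℚ.- d ℚ.* i) ℚ.* (p ℚ.- u)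
         ℚ.+ i ℚ.* (d ℚ.* (p ℚ.- u) ℚ.+ γ ℚ.* (q ℚ.- p) ℚ.+ α ℚ.* (v ℚ.- u))
    expand = solve 8 (λ p q u v i d γ α → p :+ (γ :* i) :* (q :- p)
       := (u :+ ((:- α) :* i) :* (v :- u)) :+ (con 1ℚ :- d :* i) :* (p :- u)
         :+ i :* (d :* (p :- u) :+ γ :* (q :- p) :+ α :* (v :- u))) refl
      where open ℚSolver.+-*-Solver
    collapse : ∀ X d p u y → d ≡ 1ℚ → y ≡ 0ℚ → X ℚ.+ (1ℚ ℚ.- d) ℚ.* (p ℚ.- u) ℚ.+ i ℚ.* y ≡ X
    collapse X d p u y refl refl =
      trans (cong₂ (λ a b → X ℚ.+ a ℚ.+ b) (ℚP.*-zeroˡ (p ℚ.- u)) (ℚP.*-zeroʳ i))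
        (trans (ℚP.+-identityʳ (X ℚ.+ 0ℚ)) (ℚP.+-identityʳ X))
    same : ∀ p q u v → den ℚ.* (p ℚ.- u) ℚ.+ γ ℚ.* (q ℚ.- p) ℚ.+ α ℚ.* (v ℚ.- u) ≡ 0ℚ →
      u ℚ.+ t ℚ.* (v ℚ.- u) ≡ p ℚ.+ s ℚ.* (q ℚ.- p)
    same p q u v e = sym (trans (expand p q u v i den γ α)
      (collapse (u ℚ.+ t ℚ.* (v ℚ.- u)) (den ℚ.* i) p u _ den*i e))

opaque
  unfolding _⊕_
  meet-at-parameters : ∀ p q u v (α γ δ den : ℚ) → 0ℚ ℚ.< den → γ ≡ den ℚ.+ δ →
    0ℚ ℚ.≤ γ → δ ℚ.≤ 0ℚ → α ℚ.≤ 0ℚ → ℚ.- α ℚ.≤ den →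
    (den ⊛ (p ⊖ u)) ⊕ (γ ⊛ (q ⊖ p)) ⊕ (α ⊛ (v ⊖ u)) ≡ (0ℚ , 0ℚ) → Meet p q u v
  meet-at-parameters (p₁ , p₂) (q₁ , q₂) (u₁ , u₂) (v₁ , v₂) α γ δ den 0<den γ≡ 0≤γ δ≤0 α≤0 -α≤den rel =
    (u₁ ℚ.+ t ℚ.* (v₁ ℚ.- u₁) , u₂ ℚ.+ t ℚ.* (v₂ ℚ.- u₂))
    , (s , nonneg*nonneg 0≤γ 0≤i , ≤den (subst₂ ℚ._≤_ (sym γ≡) (ℚP.+-identityʳ den) (ℚP.+-monoʳ-≤ den δ≤0))
        , same p₁ q₁ u₁ v₁ (cong proj₁ rel)
        , same p₂ q₂ u₂ v₂ (cong proj₂ rel))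
    , (t , nonneg*nonneg (pos-flip≤ α≤0) 0≤i , ≤den -α≤den , refl , refl)
    where open Intersection α γ den 0<den

-- Each line weakly separates the end points of the other segment; the last hypothesis excludes
-- parallel segments, for which the intersection parameters are undefined.
meet-if-separated : ∀ p q u v → det p q u ℚ.≤ 0ℚ → 0ℚ ℚ.≤ det p q v → 0ℚ ℚ.≤ det u v p → det u v q ℚ.≤ 0ℚ →
  0ℚ ℚ.< det p q v ℚ.- det p q u → Meet p q u v
meet-if-separated p q u v α≤0 0≤β 0≤γ δ≤0 0<den =
  meet-at-parameters p q u v α (det u v p) (det u v q) (β ℚ.- α) 0<den (det-difference p q u v) 0≤γ δ≤0 α≤0
    (subst (ℚ._≤ β ℚ.- α) (ℚP.+-identityˡ (ℚ.- α)) (ℚP.+-monoˡ-≤ (ℚ.- α) 0≤β)) (det-relation₃ p q u v)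
  where
  α = det p q u
  β = det p q v

Meet-flip : ∀ p q u v → Meet p q v u → Meet p q u v
Meet-flip p q u v (x , a , b) = x , a , OnSeg-sym v u x b

private
  module OnLine where
    open ℚSolver.+-*-Solver
    alg₁ : ∀ d i u p → u ≡ p ℚ.+ i ℚ.* (d ℚ.* (u ℚ.- p)) ℚ.+ (1ℚ ℚ.- d ℚ.* i) ℚ.* (u ℚ.- p)
    alg₁ = solve 4 (λ d i u p → u := p :+ i :* (d :* (u :- p)) :+ (con 1ℚ :- d :* i) :* (u :- p)) refl
    alg₂ : ∀ p i f w → p ℚ.+ i ℚ.* (f ℚ.* w) ≡ p ℚ.+ (w ℚ.* i) ℚ.* f
    alg₂ = solve 4 (λ p i f w → p :+ i :* (f :* w) := p :+ (w :* i) :* f) refl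
    collapse : ∀ X x y → y ≡ 1ℚ → X ℚ.+ (1ℚ ℚ.- y) ℚ.* x ≡ X
    collapse X x y refl = trans (cong (X ℚ.+_) (ℚP.*-zeroˡ x)) (ℚP.+-identityʳ X)
    solve-coordinate : ∀ d f i w u p → d ℚ.* i ≡ 1ℚ → d ℚ.* (u ℚ.- p) ≡ f ℚ.* w → u ≡ p ℚ.+ (w ℚ.* i) ℚ.* f
    solve-coordinate d f i w u p e₁ e₂ = begin
      u ≡⟨ alg₁ d i u p ⟩
      p ℚ.+ i ℚ.* (d ℚ.* (u ℚ.- p)) ℚ.+ (1ℚ ℚ.- d ℚ.* i) ℚ.* (u ℚ.- p) ≡⟨ collapse _ (u ℚ.- p) (d ℚ.* i) e₁ ⟩
      p ℚ.+ i ℚ.* (d ℚ.* (u ℚ.- p)) ≡⟨ cong (λ z → p ℚ.+ i ℚ.* z) e₂ ⟩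
      p ℚ.+ i ℚ.* (f ℚ.* w) ≡⟨ alg₂ p i f w ⟩
      p ℚ.+ (w ℚ.* i) ℚ.* f ∎
      where open ≡-Reasoning
    alg₃ : ∀ a b → a ≡ (a ℚ.- b) ℚ.+ b
    alg₃ = solve 2 (λ a b → a := (a :- b) :+ b) refl
    -- x lies on pq at the parameter (x - p) / (q - p), read off in a coordinate in which p and q differ
    param : ∀ (p₁ q₁ u₁ p₂ q₂ u₂ : ℚ) → p₁ ℚ.< q₁ → p₁ ℚ.≤ u₁ → u₁ ℚ.≤ q₁ →
      (q₁ ℚ.- p₁) ℚ.* (u₂ ℚ.- p₂) ≡ (q₂ ℚ.- p₂) ℚ.* (u₁ ℚ.- p₁) →
      Σ[ t ∈ ℚ ] (0ℚ ℚ.≤ t × t ℚ.≤ 1ℚ × u₁ ≡ p₁ ℚ.+ t ℚ.* (q₁ ℚ.- p₁) × u₂ ≡ p₂ ℚ.+ t ℚ.* (q₂ ℚ.- p₂))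
    param p₁ q₁ u₁ p₂ q₂ u₂ p<q p≤u u≤q e = t , nonneg*nonneg (sub-nonneg p≤u) 0≤i , t≤1 , c₁ , c₂
      where
      d = q₁ ℚ.- p₁
      instance
        _ : ℚ.Positive d
        _ = ℚ.positive (sub-pos p<q)
        nz : ℚ.NonZero d
        nz = ℚP.pos⇒nonZero d
      i = ℚ.1/ d
      0≤i : 0ℚ ℚ.≤ i
      0≤i = ℚP.<⇒≤ (ℚP.positive⁻¹ i {{ℚP.1/pos⇒pos d}})
      d*i : d ℚ.* i ≡ 1ℚ
      d*i = ℚP.*-inverseʳ d
      t = (u₁ ℚ.- p₁) ℚ.* i
      t≤1 : t ℚ.≤ 1ℚ
      t≤1 = subst (t ℚ.≤_) d*i (ℚP.*-monoʳ-≤-nonNeg i {{ℚ.nonNegative 0≤i}} (ℚP.+-monoˡ-≤ (ℚ.- p₁) u≤q))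
      c₁ : u₁ ≡ p₁ ℚ.+ t ℚ.* (q₁ ℚ.- p₁)
      c₁ = solve-coordinate (q₁ ℚ.- p₁) (q₁ ℚ.- p₁) i (u₁ ℚ.- p₁) u₁ p₁ d*i refl
      c₂ : u₂ ≡ p₂ ℚ.+ t ℚ.* (q₂ ℚ.- p₂)
      c₂ = solve-coordinate (q₁ ℚ.- p₁) (q₂ ℚ.- p₂) i (u₁ ℚ.- p₁) u₂ p₂ d*i e
    sub-0 : ∀ {a b} → a ℚ.- b ≡ 0ℚ → a ≡ b
    sub-0 {a} {b} e = trans (alg₃ a b) (trans (cong (ℚ._+ b) e) (ℚP.+-identityˡ b))

    collinear : ∀ p p' q q' u u' → (q ℚ.- p) ℚ.* (u' ℚ.- p') ℚ.- (q' ℚ.- p') ℚ.* (u ℚ.- p) ≡ 0ℚ →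
      (p , p') ⊏ (u , u') → (u , u') ⊏ (q , q') → OnSeg (p , p') (q , q') (u , u')
    collinear p p' q q' u u' e lt₁ lt₂ = go lt₁ lt₂
      where
      e' : (q ℚ.- p) ℚ.* (u' ℚ.- p') ≡ (q' ℚ.- p') ℚ.* (u ℚ.- p)
      e' = sub-0 {(q ℚ.- p) ℚ.* (u' ℚ.- p')} {(q' ℚ.- p') ℚ.* (u ℚ.- p)} e
      go₁ : p ℚ.< q → p ℚ.≤ u → u ℚ.≤ q → OnSeg (p , p') (q , q') (u , u')
      go₁ a b c = param p q u p' q' u' a b c e'
      go₂ : p' ℚ.< q' → p' ℚ.≤ u' → u' ℚ.≤ q' → OnSeg (p , p') (q , q') (u , u')
      go₂ a b c = let (t , x , y , c₂ , c₁) = param p' q' u' p q u a b c (sym e') in t , x , y , c₁ , c₂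
      go : (p , p') ⊏ (u , u') → (u , u') ⊏ (q , q') → OnSeg (p , p') (q , q') (u , u')
      go (inj₁ a) (inj₁ b) = go₁ (ℚP.<-trans a b) (ℚP.<⇒≤ a) (ℚP.<⇒≤ b)
      go (inj₁ a) (inj₂ (b , _)) = go₁ (subst (p ℚ.<_) b a) (ℚP.<⇒≤ a) (ℚP.≤-reflexive b)
      go (inj₂ (a , _)) (inj₁ b) = go₁ (subst (ℚ._< q) (sym a) b) (ℚP.≤-reflexive a) (ℚP.<⇒≤ b)
      go (inj₂ (_ , a)) (inj₂ (_ , b)) = go₂ (ℚP.<-trans a b) (ℚP.<⇒≤ a) (ℚP.<⇒≤ b)

opaque
  unfolding det
  on-line : ∀ p q u → p ⊏ u → u ⊏ q → det p q u ≡ 0ℚ → OnSeg p q u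
  on-line (p , p') (q , q') (u , u') lt₁ lt₂ e = OnLine.collinear p p' q q' u u' e lt₁ lt₂

module _ (p q u v : Point) (p⊏u : p ⊏ u) (u⊏q : u ⊏ q) where
  private
    α = det p q u
    β = det p q v
    γ = det u v p
    δ = det u v q
    p⊏q : p ⊏ q
    p⊏q = ⊏-trans p⊏u u⊏q

  meet-on-line : α ≡ 0ℚ → Meet p q u v
  meet-on-line α≡0 = u , on-line p q u p⊏u u⊏q α≡0 , OnSeg-start u v

  det-relation₁' : (α ⊛ (v ⊖ q)) ⊕ (δ ⊛ (q ⊖ p)) ⊕ (β ⊛ (q ⊖ u)) ≡ (0ℚ , 0ℚ)
  det-relation₁' = det-relation₁ p q u v
  det-relation₂' : (α ⊛ (v ⊖ p)) ⊕ ((ℚ.- β) ⊛ (u ⊖ p)) ⊕ (γ ⊛ (q ⊖ p)) ≡ (0ℚ , 0ℚ)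
  det-relation₂' = det-relation₂ p q u v

  -- Otherwise α, -β and γ would all be nonpositive coefficients of positive vectors in
  -- `det-relation₂′`, with α strictly negative.
  γ-nonneg : p ⊏ v → α ℚ.< 0ℚ → 0ℚ ℚ.≤ β → 0ℚ ℚ.≤ γ
  γ-nonneg p⊏v α<0 0≤β = ℚP.≮⇒≥ λ γ<0 →
    no-relation _ _ _ α<0 (neg-flip≤ 0≤β) (ℚP.<⇒≤ γ<0)
      (⊏⇒pos _ _ p⊏v) (⊏⇒pos _ _ p⊏u) (⊏⇒pos _ _ p⊏q) det-relation₂'

  den-pos : α ℚ.< 0ℚ → 0ℚ ℚ.≤ β → 0ℚ ℚ.< β ℚ.- α
  den-pos α<0 0≤β = sub-pos (ℚP.<-≤-trans α<0 0≤β)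

  -- Both `u` and `v` lie between `p` and `q` in the order. Then `v ⊖ q` is negative, so
  -- `det-relation₁′` is rewritten with `q ⊖ v` before the signs are compared; the outcome is δ ≤ 0.
  meet-nested : p ⊏ v → v ⊏ q → α ℚ.< 0ℚ → 0ℚ ℚ.≤ β → Meet p q u v
  meet-nested p⊏v v⊏q α<0 0≤β =
    meet-if-separated p q u v (ℚP.<⇒≤ α<0) 0≤β (γ-nonneg p⊏v α<0 0≤β) δ≤0 (den-pos α<0 0≤β)
    where
    δ≤0 : δ ℚ.≤ 0ℚ
    δ≤0 = ℚP.≮⇒≥ λ 0<δ →
      no-relation (q ⊖ v) (q ⊖ p) (q ⊖ u) α<0 (ℚP.<⇒≤ (neg-flip< 0<δ)) (neg-flip≤ 0≤β)
        (⊏⇒pos _ _ v⊏q) (⊏⇒pos _ _ p⊏q) (⊏⇒pos _ _ u⊏q)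
        (nested-relation p q u v det-relation₁')

  -- The order is p ⊏ u ⊏ q ⊏ v. Two negative coefficients in `det-relation₁′` force β ≥ 0, and
  -- `γ-nonneg` supplies the last sign needed for separation.
  meet-crossing : q ⊏ v → α ℚ.< 0ℚ → δ ℚ.< 0ℚ → Meet p q u v
  meet-crossing q⊏v α<0 δ<0 =
    meet-if-separated p q u v (ℚP.<⇒≤ α<0) 0≤β (γ-nonneg (⊏-trans p⊏q q⊏v) α<0 0≤β) (ℚP.<⇒≤ δ<0) (den-pos α<0 0≤β)
    where
    0≤β : 0ℚ ℚ.≤ β
    0≤β = ℚP.≮⇒≥ λ β<0 →
      no-relation _ _ _ α<0 (ℚP.<⇒≤ δ<0) (ℚP.<⇒≤ β<0)
        (⊏⇒pos _ _ q⊏v) (⊏⇒pos _ _ p⊏q) (⊏⇒pos _ _ u⊏q) det-relation₁'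

  meet-crossing' : q ⊏ v → 0ℚ ℚ.≤ α → 0ℚ ℚ.≤ δ → Meet p q u v
  meet-crossing' q⊏v 0≤α 0≤δ with 0ℚ ℚP.<? α
  -- The case α = 0 is split off because `no-relation` needs one coefficient that is strictly
  -- negative.
  ... | no ¬0<α = meet-on-line (ℚP.≤-antisym (ℚP.≮⇒≥ ¬0<α) 0≤α)
  ... | yes 0<α =
    Meet-flip p q u v (meet-if-separated p q v u β≤0 0≤α
      (subst (0ℚ ℚ.≤_) (sym (det-swap u v p)) (pos-flip≤ γ≤0))
      (subst (ℚ._≤ 0ℚ) (sym (det-swap u v q)) (neg-flip≤ 0≤δ))
      (sub-pos (ℚP.≤-<-trans β≤0 0<α)))
    where
    β≤0 : β ℚ.≤ 0ℚ
    β≤0 = ℚP.≮⇒≥ λ 0<β →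
      no-relation _ _ _ (neg-flip< 0<α) (neg-flip≤ 0≤δ) (ℚP.<⇒≤ (neg-flip< 0<β))
        (⊏⇒pos _ _ q⊏v) (⊏⇒pos _ _ p⊏q) (⊏⇒pos _ _ u⊏q) (scale-relation _ _ _ det-relation₁')
    γ≤0 : γ ℚ.≤ 0ℚ
    γ≤0 = ℚP.≮⇒≥ λ 0<γ →
      no-relation _ _ _ (neg-flip< 0<α) (neg-flip≤ (pos-flip≤ β≤0)) (ℚP.<⇒≤ (neg-flip< 0<γ))
        (⊏⇒pos _ _ (⊏-trans p⊏q q⊏v)) (⊏⇒pos _ _ p⊏u) (⊏⇒pos _ _ p⊏q) (scale-relation _ _ _ det-relation₂')

private
  -- Since `p` comes first, three orders remain. If `q` precedes `u`, no ray meets a segment and the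
  -- four order bits cancel. If the segments interleave, the order bits sum to 1 and the two
  -- remaining rays must differ; if `uv` is nested in `pq`, the order bits cancel and the two rays
  -- must agree. In both cases the opposite behaviour produces a common point.
  crossB-core : ∀ p q u v → p ⊏ u → p ⊑ q → u ⊑ v → ¬ Meet p q u v → crossB p q u v ≡ false
  crossB-core p q u v p⊏u p⊑q u⊑v disj with tri q u
  ... | equal refl = ⊥-elim (disj (q , OnSeg-end p q , OnSeg-start q v))
  ... | before q⊏u =
    sum8-cong (rayB-triv p u v false (leB-⊐ p⊏u) (leB-⊐ p⊏v)) (rayB-triv q u v false (leB-⊐ q⊏u) (leB-⊐ q⊏v))
              (rayB-triv u p q true (leB-⊏ p⊏u) (leB-⊏ q⊏u)) (rayB-triv v p q true (leB-⊏ p⊏v) (leB-⊏ q⊏v))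
              (leB-⊏ p⊏u) (leB-⊏ p⊏v) (leB-⊏ q⊏u) (leB-⊏ q⊏v)
    where p⊏v = ⊏-⊑-trans p⊏u u⊑v
          q⊏v = ⊏-⊑-trans q⊏u u⊑v
  ... | after u⊏q with tri q v
  ...   | equal refl = ⊥-elim (disj (q , OnSeg-end p q , OnSeg-end u q))
  ...   | before q⊏v = trans
      (sum8-cong (rayB-triv p u v false (leB-⊐ p⊏u) (leB-⊐ p⊏v)) (rayB-cross q u v (leB-⊏ u⊏q) (leB-⊐ q⊏v) (leB-⊑ u⊑v))
              (rayB-cross u p q (leB-⊏ p⊏u) (leB-⊐ u⊏q) (leB-⊑ p⊑q)) (rayB-triv v p q true (leB-⊏ p⊏v) (leB-⊏ q⊏v))
              (leB-⊏ p⊏u) (leB-⊏ p⊏v) (leB-⊐ u⊏q) (leB-⊏ q⊏v))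
      differ
    where
    p⊏v = ⊏-⊑-trans p⊏u u⊑v
    differ : sum8 false (negB (det u v q)) (negB (det p q u)) false true true false true ≡ false
    differ with negB-cases (det u v q) | negB-cases (det p q u)
    ... | inj₁ (_ , e) | inj₂ (_ , f) = cong₂ (λ a b → sum8 false a b false true true false true) e f
    ... | inj₂ (_ , e) | inj₁ (_ , f) = cong₂ (λ a b → sum8 false a b false true true false true) e f
    ... | inj₁ (a , _) | inj₁ (b , _) = ⊥-elim (disj (meet-crossing p q u v p⊏u u⊏q q⊏v b a))
    ... | inj₂ (a , _) | inj₂ (b , _) = ⊥-elim (disj (meet-crossing' p q u v p⊏u u⊏q q⊏v b a))
  crossB-core p q u v p⊏u p⊑q u⊑v disj | after u⊏q | after v⊏q = trans
      (sum8-cong (rayB-triv p u v false (leB-⊐ p⊏u) (leB-⊐ p⊏v)) (rayB-triv q u v true (leB-⊏ u⊏q) (leB-⊏ v⊏q))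
              (rayB-cross u p q (leB-⊏ p⊏u) (leB-⊐ u⊏q) (leB-⊑ p⊑q)) (rayB-cross v p q (leB-⊏ p⊏v) (leB-⊐ v⊏q) (leB-⊑ p⊑q))
              (leB-⊏ p⊏u) (leB-⊏ p⊏v) (leB-⊐ u⊏q) (leB-⊐ v⊏q))
      agree
    where
    p⊏v = ⊏-⊑-trans p⊏u u⊑v
    agree : sum8 false false (negB (det p q u)) (negB (det p q v)) true true false false ≡ false
    agree with negB-cases (det p q u) | negB-cases (det p q v)
    ... | inj₁ (_ , e) | inj₁ (_ , f) = cong₂ (λ a b → sum8 false false a b true true false false) e f
    ... | inj₂ (_ , e) | inj₂ (_ , f) = cong₂ (λ a b → sum8 false false a b true true false false) e f
    ... | inj₁ (a , _) | inj₂ (b , _) = ⊥-elim (disj (meet-nested p q u v p⊏u u⊏q p⊏v v⊏q a b))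
    ... | inj₂ (a , _) | inj₁ (b , _) = ⊥-elim (disj (Meet-flip p q u v (meet-nested p q v u p⊏v v⊏q p⊏u u⊏q b a)))

  crossB-swapˡ : ∀ p q u v → crossB p q u v ≡ crossB q p u v
  crossB-swapˡ p q u v = trans (sum8-swapˡ (rayB p u v) (rayB q u v) (rayB u p q) (rayB v p q) (leB p u) (leB p v) (leB q u) (leB q v))
    (cong₂ (λ x y → sum8 (rayB q u v) (rayB p u v) x y (leB q u) (leB q v) (leB p u) (leB p v)) (rayB-sym u p q) (rayB-sym v p q))

  crossB-swapʳ : ∀ p q u v → crossB p q u v ≡ crossB p q v u
  crossB-swapʳ p q u v = trans (sum8-swapʳ (rayB p u v) (rayB q u v) (rayB u p q) (rayB v p q) (leB p u) (leB p v) (leB q u) (leB q v))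
    (cong₂ (λ x y → sum8 x y (rayB v p q) (rayB u p q) (leB p v) (leB p u) (leB q v) (leB q u)) (rayB-sym p u v) (rayB-sym q u v))

  -- Exchanging the segments negates all four order bits, an even number. The end points must differ
  -- because `leB` is not strict.
  crossB-exchange : ∀ p q u v → p ≢ u → p ≢ v → q ≢ u → q ≢ v → crossB p q u v ≡ crossB u v p q
  crossB-exchange p q u v a b c d = trans (sum8-exchange (rayB p u v) (rayB q u v) (rayB u p q) (rayB v p q) (leB p u) (leB p v) (leB q u) (leB q v))
    (sum8-cong {a = rayB u p q} {rayB v p q} {rayB p u v} {rayB q u v} refl refl refl refl
      (sym (leB-flip a)) (sym (leB-flip c)) (sym (leB-flip b)) (sym (leB-flip d)))

  crossB-sorted : ∀ p q u v → p ⊑ q → u ⊑ v → ¬ Meet p q u v → crossB p q u v ≡ false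
  crossB-sorted p q u v p⊑q u⊑v disj with tri p u
  ... | before a = crossB-core p q u v a p⊑q u⊑v disj
  ... | equal refl = ⊥-elim (disj (p , OnSeg-start p q , OnSeg-start p v))
  ... | after a = trans
    (crossB-exchange p q u v
      (λ e → disj (p , OnSeg-start p q , subst (OnSeg u v) (sym e) (OnSeg-start u v)))
      (λ e → disj (p , OnSeg-start p q , subst (OnSeg u v) (sym e) (OnSeg-end u v)))
      (λ e → disj (q , OnSeg-end p q , subst (OnSeg u v) (sym e) (OnSeg-start u v)))
      (λ e → disj (q , OnSeg-end p q , subst (OnSeg u v) (sym e) (OnSeg-end u v))))
    (crossB-core u v p q a u⊑v p⊑q (λ { (x , s , t) → disj (x , t , s) }))

⊑-total : ∀ p q → p ⊑ q ⊎ q ⊑ p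
⊑-total p q with tri p q
... | before a = inj₁ (inj₁ a)
... | equal a = inj₁ (inj₂ a)
... | after a = inj₂ (inj₁ a)

crossB-disjoint : ∀ p q u v → ¬ Meet p q u v → crossB p q u v ≡ false
crossB-disjoint p q u v disj with ⊑-total p q | ⊑-total u v
... | inj₁ a | inj₁ b = crossB-sorted p q u v a b disj
... | inj₂ a | inj₁ b = trans (crossB-swapˡ p q u v)
   (crossB-sorted q p u v a b (λ { (x , s , t) → disj (x , OnSeg-sym q p x s , t) }))
... | inj₁ a | inj₂ b = trans (crossB-swapʳ p q u v)
   (crossB-sorted p q v u a b (λ { (x , s , t) → disj (x , s , OnSeg-sym v u x t) }))
... | inj₂ a | inj₂ b = trans (crossB-swapˡ p q u v) (trans (crossB-swapʳ q p u v)
   (crossB-sorted q p v u a b (λ { (x , s , t) → disj (x , OnSeg-sym q p x s , OnSeg-sym v u x t) })))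

-- Polygonal chains and the drawing of K₃,₃.

-- A polygonal chain, remembered only through its end points and the parity of
-- its intersection with the upward ray from each point.
record Chain : Set where
  constructor chain
  field
    src tgt : Point
    ray : Point → Bool

-- The formula of `crossB`. As it involves only end points and rays, it is additive under
-- concatenation on either side: the terms at an inner point occur twice.
crossing : Chain → Chain → Bool
crossing (chain a b H) (chain u v K) =
  sum8 (K a) (K b) (H u) (H v) (leB a u) (leB a v) (leB b u) (leB b v)

private
  module Sum8 where
    open xor-∧-Solver
    concatˡ : ∀ Ka Kb Kc Hu Hu' Hv Hv' au av bu bv cu cv →
      sum8 Ka Kc (Hu xor Hu') (Hv xor Hv') au av cu cv
        ≡ sum8 Ka Kb Hu Hv au av bu bv xor sum8 Kb Kc Hu' Hv' bu bv cu cv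
    concatˡ = solve 13 (λ Ka Kb Kc Hu Hu' Hv Hv' au av bu bv cu cv →
      ((Ka :+ Kc) :+ ((Hu :+ Hu') :+ (Hv :+ Hv'))) :+ ((au :+ av) :+ (cu :+ cv))
      := (((Ka :+ Kb) :+ (Hu :+ Hv)) :+ ((au :+ av) :+ (bu :+ bv)))
         :+ (((Kb :+ Kc) :+ (Hu' :+ Hv')) :+ ((bu :+ bv) :+ (cu :+ cv)))) refl
    concatʳ : ∀ Ka Ka' Kb Kb' Hu Hv Hw au av aw bu bv bw →
      sum8 (Ka xor Ka') (Kb xor Kb') Hu Hw au aw bu bw
        ≡ sum8 Ka Kb Hu Hv au av bu bv xor sum8 Ka' Kb' Hv Hw av aw bv bw
    concatʳ = solve 13 (λ Ka Ka' Kb Kb' Hu Hv Hw au av aw bu bv bw →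
      (((Ka :+ Ka') :+ (Kb :+ Kb')) :+ (Hu :+ Hw)) :+ ((au :+ aw) :+ (bu :+ bw))
      := (((Ka :+ Kb) :+ (Hu :+ Hv)) :+ ((au :+ av) :+ (bu :+ bv)))
         :+ (((Ka' :+ Kb') :+ (Hv :+ Hw)) :+ ((av :+ aw) :+ (bv :+ bw)))) refl

    φ : Bool → Bool → Bool → Bool → Bool
    φ a b c d = (a xor b) xor (c xor d)

    -- Adds the parities of the two pairs of disjoint edges on `aᵢ`, `aᵢ′`, `bⱼ`, `bⱼ′`. The order
    -- of `bⱼ` and `bⱼ′` enters as `l` and `not l`, which yields the constant `not`; what is left
    -- beside the terms at the `b`s splits into one φ for each of the two `b`s.
    pair-identity : ∀ K₂a K₂b K₁a K₁b H₁a H₁b H₂a H₂b aa ab₁ ab₂ ba₁ ba₂ l →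
      (K₂b xor K₁b) xor (H₁b xor H₂b)
      ≡ not (φ K₁a H₁a ab₁ ba₁ xor φ K₂a H₂a ab₂ ba₂)
        xor (sum8 K₂a K₂b H₁a H₁b aa ab₂ ba₁ l xor sum8 K₁a K₁b H₂a H₂b aa ab₁ ba₂ (not l))
    pair-identity = solve 14 (λ K₂a K₂b K₁a K₁b H₁a H₁b H₂a H₂b aa ab₁ ab₂ ba₁ ba₂ l →
      (K₂b :+ K₁b) :+ (H₁b :+ H₂b)
      := (con true :+ (((K₁a :+ H₁a) :+ (ab₁ :+ ba₁)) :+ ((K₂a :+ H₂a) :+ (ab₂ :+ ba₂))))
        :+ ((((K₂a :+ K₂b) :+ (H₁a :+ H₁b)) :+ ((aa :+ ab₂) :+ (ba₁ :+ l)))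
        :+ (((K₁a :+ K₁b) :+ (H₂a :+ H₂b)) :+ ((aa :+ ab₁) :+ (ba₂ :+ (con true :+ l)))))) refl

    -- Every φ occurs twice, and the number of pairs among three vertices is odd.
    three-pairs : ∀ φ₀ φ₁ φ₂ → (not (φ₀ xor φ₁) xor not (φ₀ xor φ₂)) xor not (φ₁ xor φ₂) ≡ true
    three-pairs = solve 3 (λ a b c → ((con true :+ (a :+ b)) :+ (con true :+ (a :+ c))) :+ (con true :+ (b :+ c)) := con true) refl

    regroup : ∀ a b c d e f a' b' c' d' e' f' →
      (((a xor b) xor (c xor d)) xor (e xor f)) xor (((a' xor b') xor (c' xor d')) xor (e' xor f'))
      ≡ (((a xor b) xor (a' xor b')) xor ((c xor d) xor (c' xor d'))) xor ((e xor f) xor (e' xor f'))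
    regroup = solve 12 (λ a b c d e f a' b' c' d' e' f' →
      (((a :+ b) :+ (c :+ d)) :+ (e :+ f)) :+ (((a' :+ b') :+ (c' :+ d')) :+ (e' :+ f'))
      := (((a :+ b) :+ (a' :+ b')) :+ ((c :+ d) :+ (c' :+ d'))) :+ ((e :+ f) :+ (e' :+ f'))) refl

segment : Point → Point → Chain
segment p q = chain p q (λ x → rayB x p q)

infixr 5 _⋈_
_⋈_ : (γ δ : Chain) → Chain
chain a _ H ⋈ chain _ c H' = chain a c (λ x → H x xor H' x)

reverseC : Chain → Chain
reverseC (chain a b H) = chain b a H

crossing-⋈ˡ : ∀ γ γ' δ → Chain.tgt γ ≡ Chain.src γ' → crossing γ δ ≡ false → crossing γ' δ ≡ false →
  crossing (γ ⋈ γ') δ ≡ false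
crossing-⋈ˡ (chain a b H) (chain b c H') (chain u v K) refl e f =
  trans (Sum8.concatˡ (K a) (K b) (K c) (H u) (H' u) (H v) (H' v) (leB a u) (leB a v) (leB b u) (leB b v) (leB c u) (leB c v))
        (cong₂ _xor_ e f)

crossing-⋈ʳ : ∀ γ δ δ' → Chain.tgt δ ≡ Chain.src δ' → crossing γ δ ≡ false → crossing γ δ' ≡ false →
  crossing γ (δ ⋈ δ') ≡ false
crossing-⋈ʳ (chain a b H) (chain u v K) (chain v w K') refl e f =
  trans (Sum8.concatʳ (K a) (K' a) (K b) (K' b) (H u) (H v) (H w) (leB a u) (leB a v) (leB a w) (leB b u) (leB b v) (leB b w))
        (cong₂ _xor_ e f)

crossing-reverseˡ : ∀ γ δ → crossing (reverseC γ) δ ≡ crossing γ δ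
crossing-reverseˡ (chain a b H) (chain u v K) =
  sum8-swapˡ (K b) (K a) (H u) (H v) (leB b u) (leB b v) (leB a u) (leB a v)

crossing-reverseʳ : ∀ γ δ → crossing γ (reverseC δ) ≡ crossing γ δ
crossing-reverseʳ (chain a b H) (chain u v K) =
  sum8-swapʳ (K a) (K b) (H v) (H u) (leB a v) (leB a u) (leB b v) (leB b u)

-- Summing the crossing parities over the six pairs of disjoint edges at aᵢ and
-- aᵢ' shows that the parities Gᵢ = Σ_{j≠j'} H_{ij}(b_{j'}) are pairwise
-- different; three booleans cannot be.
module K₃₃ (a b : Fin 3 → Point) (H : Fin 3 → Fin 3 → Point → Bool)
  (b-inj : ∀ j j' → j ≢ j' → b j ≢ b j')
  (disjoint : ∀ i i' j j' → i ≢ i' → j ≢ j' →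
     crossing (chain (a i) (b j) (H i j)) (chain (a i') (b j') (H i' j')) ≡ false) where

  private
    0F 1F 2F : Fin 3
    0F = Fin.zero
    1F = Fin.suc Fin.zero
    2F = Fin.suc (Fin.suc Fin.zero)

    G : Fin 3 → Bool
    G i = ((H i 1F (b 0F) xor H i 0F (b 1F)) xor (H i 2F (b 0F) xor H i 0F (b 2F))) xor (H i 2F (b 1F) xor H i 1F (b 2F))

    φ : Fin 3 → Fin 3 → Fin 3 → Bool
    φ i i' j = Sum8.φ (H i' j (a i)) (H i j (a i')) (leB (a i) (b j)) (leB (b j) (a i'))

    pair : ∀ i i' → i ≢ i' → ∀ j j' → j ≢ j' →
      (H i' j' (b j) xor H i' j (b j')) xor (H i j' (b j) xor H i j (b j')) ≡ not (φ i i' j xor φ i i' j')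
    pair i i' i≢i' j j' j≢j' =
      trans (cong ((H i' j' (b j) xor H i' j (b j')) xor_) (BoolP.xor-comm (H i j' (b j)) (H i j (b j'))))
      (trans (Sum8.pair-identity (H i' j' (a i)) (H i' j' (b j)) (H i' j (a i)) (H i' j (b j'))
            (H i j (a i')) (H i j (b j')) (H i j' (a i')) (H i j' (b j))
            (leB (a i) (a i')) (leB (a i) (b j)) (leB (a i) (b j')) (leB (b j) (a i')) (leB (b j') (a i')) (leB (b j) (b j')))
      (trans (cong₂ (λ x y → not (φ i i' j xor φ i i' j') xor (x xor y))
                (disjoint i i' j j' i≢i' j≢j')
                (trans (cong (sum8 (H i' j (a i)) (H i' j (b j')) (H i j' (a i')) (H i j' (b j)) (leB (a i) (a i')) (leB (a i) (b j)) (leB (b j') (a i')))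
                          (sym (leB-flip (b-inj j j' j≢j'))))
                       (disjoint i i' j' j i≢i' (λ e → j≢j' (sym e)))))
             (BoolP.xor-identityʳ _)))

    G-differ : ∀ i i' → i ≢ i' → G i' xor G i ≡ true
    G-differ i i' ne =
      trans (Sum8.regroup (H i' 1F (b 0F)) (H i' 0F (b 1F)) (H i' 2F (b 0F)) (H i' 0F (b 2F)) (H i' 2F (b 1F)) (H i' 1F (b 2F))
                     (H i 1F (b 0F)) (H i 0F (b 1F)) (H i 2F (b 0F)) (H i 0F (b 2F)) (H i 2F (b 1F)) (H i 1F (b 2F)))
      (trans (cong₂ _xor_ (cong₂ _xor_ (pair i i' ne 0F 1F λ ()) (pair i i' ne 0F 2F λ ())) (pair i i' ne 1F 2F λ ()))
             (Sum8.three-pairs (φ i i' 0F) (φ i i' 1F) (φ i i' 2F)))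

    three-booleans : ∀ x y z → x xor y ≡ true → x xor z ≡ true → y xor z ≡ true → ⊥
    three-booleans false true true _ _ ()
    three-booleans true false false _ _ ()
    three-booleans false false _ () _ _
    three-booleans true true _ () _ _
    three-booleans false true false _ () _
    three-booleans true false true _ () _

  contradiction : ⊥
  contradiction = three-booleans (G 2F) (G 1F) (G 0F) (G-differ 1F 2F λ ()) (G-differ 0F 2F λ ()) (G-differ 0F 1F λ ())

pathRay : ∀ len → (Fin (suc (suc len)) → Point) → Point → Bool
pathRay zero pts x = rayB x (pts Fin.zero) (pts (Fin.suc Fin.zero))
pathRay (suc len) pts x = rayB x (pts Fin.zero) (pts (Fin.suc Fin.zero)) xor pathRay len (λ i → pts (Fin.suc i)) x

pathChain : ∀ len → (Fin (suc (suc len)) → Point) → Chain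
pathChain len pts = chain (pts Fin.zero) (pts (fromℕ (suc len))) (pathRay len pts)

crossing-pathˡ : ∀ len (pts : Fin (suc (suc len)) → Point) δ →
  (∀ i → crossing (segment (pts (inject₁ i)) (pts (Fin.suc i))) δ ≡ false) → crossing (pathChain len pts) δ ≡ false
crossing-pathˡ zero pts δ h = h Fin.zero
crossing-pathˡ (suc len) pts δ h =
  crossing-⋈ˡ (segment (pts Fin.zero) (pts (Fin.suc Fin.zero))) (pathChain len (λ i → pts (Fin.suc i))) δ refl
    (h Fin.zero) (crossing-pathˡ len (λ i → pts (Fin.suc i)) δ (λ i → h (Fin.suc i)))

crossing-pathʳ : ∀ len (pts : Fin (suc (suc len)) → Point) γ →
  (∀ i → crossing γ (segment (pts (inject₁ i)) (pts (Fin.suc i))) ≡ false) → crossing γ (pathChain len pts) ≡ false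
crossing-pathʳ zero pts γ h = h Fin.zero
crossing-pathʳ (suc len) pts γ h =
  crossing-⋈ʳ γ (segment (pts Fin.zero) (pts (Fin.suc Fin.zero))) (pathChain len (λ i → pts (Fin.suc i))) refl
    (h Fin.zero) (crossing-pathʳ len (λ i → pts (Fin.suc i)) γ (λ i → h (Fin.suc i)))

polyChain : PolyPath → Chain
polyChain π = pathChain (PolyPath.len π) (PolyPath.pts π)

crossing-disjoint : ∀ π ρ → (∀ x → PolyPath.OnPath π x → PolyPath.OnPath ρ x → ⊥) →
  crossing (polyChain π) (polyChain ρ) ≡ false
crossing-disjoint π ρ disj =
  crossing-pathˡ (PolyPath.len π) (PolyPath.pts π) (polyChain ρ) λ i →
  crossing-pathʳ (PolyPath.len ρ) (PolyPath.pts ρ) (segment (PolyPath.pts π (inject₁ i)) (PolyPath.pts π (Fin.suc i))) λ j →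
  crossB-disjoint (PolyPath.pts π (inject₁ i)) (PolyPath.pts π (Fin.suc i)) (PolyPath.pts ρ (inject₁ j)) (PolyPath.pts ρ (Fin.suc j))
    λ { (x , s , t) → disj x (i , s) (j , t) }

-- Walks in a plane drawing.

module _ {n : ℕ} (G : Graph n) where
  open Graph G using (adj) renaming (sym to adj-sym; loopless to adj-irrefl)

  -- All vertices of the walk satisfy `P`. Repeated vertices are harmless for parity, so walks need
  -- not be paths, and composition is a constructor that mirrors the concatenation of chains.
  data Walk (P : Fin n → Set) : Fin n → Fin n → Set where
    step : ∀ {u v} → adj u v ≡ true → P u → P v → Walk P u v
    _then_ : ∀ {u v w} → Walk P u v → Walk P v w → Walk P u w

  mapWalk : ∀ {P Q : Fin n → Set} {u v} → (∀ w → P w → Q w) → Walk P u v → Walk Q u v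
  mapWalk f (step e p q) = step e (f _ p) (f _ q)
  mapWalk f (w then w') = mapWalk f w then mapWalk f w'

  module _ (D : PlaneDrawing G) where
    open PlaneDrawing D

    -- A drawing constrains only the arcs from a smaller to a larger vertex; the other direction is
    -- obtained by reversal.
    edgeChain : ∀ u v → Dec (toℕ u < toℕ v) → Chain
    edgeChain u v (yes _) = polyChain (arc u v)
    edgeChain u v (no _) = reverseC (polyChain (arc v u))

    edgeRay : Fin n → Fin n → Point → Bool
    edgeRay u v = Chain.ray (edgeChain u v (toℕ u ℕ.<? toℕ v))

    private
      ordered : ∀ u v → adj u v ≡ true → ¬ (toℕ u < toℕ v) → toℕ v < toℕ u
      ordered u v e ¬l with ℕP.<-cmp (toℕ u) (toℕ v)
      ... | tri< a _ _ = ⊥-elim (¬l a)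
      ... | tri> _ _ a = a
      ... | tri≈ _ a _ with FinP.toℕ-injective a
      ...   | refl = case trans (sym e) (adj-irrefl u) of λ ()

      edgeChain≡ : ∀ u v (d : Dec (toℕ u < toℕ v)) → adj u v ≡ true →
        edgeChain u v d ≡ chain (pos u) (pos v) (Chain.ray (edgeChain u v d))
      edgeChain≡ u v (yes l) e with arc-ok u v l e
      ... | _ , s , t , _ = cong₂ (λ a b → chain a b (Chain.ray (polyChain (arc u v)))) s t
      edgeChain≡ u v (no ¬l) e with arc-ok v u (ordered u v e ¬l) (trans (adj-sym v u) e)
      ... | _ , s , t , _ = cong₂ (λ a b → chain a b (Chain.ray (polyChain (arc v u)))) t s

      arcs-cross : ∀ u v u' v' → toℕ u < toℕ v → toℕ u' < toℕ v' → adj u v ≡ true → adj u' v' ≡ true →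
        (∀ w → (w ≡ u ⊎ w ≡ v) → (w ≡ u' ⊎ w ≡ v') → ⊥) →
        crossing (polyChain (arc u v)) (polyChain (arc u' v')) ≡ false
      arcs-cross u v u' v' l l' e e' disj = crossing-disjoint (arc u v) (arc u' v') λ x p p' →
        let (w , _ , q , q') = arcs-disjoint u v u' v' l e l' e'
              (λ { (refl , _) → disj u (inj₁ refl) (inj₁ refl) }) x p p'
        in disj w q q'

      swap⊎ : ∀ {A B : Set} → A ⊎ B → B ⊎ A
      swap⊎ (inj₁ a) = inj₂ a
      swap⊎ (inj₂ b) = inj₁ b

      edges-cross : ∀ u v u' v' (d : Dec (toℕ u < toℕ v)) (d' : Dec (toℕ u' < toℕ v')) → adj u v ≡ true → adj u' v' ≡ true →
        (∀ w → (w ≡ u ⊎ w ≡ v) → (w ≡ u' ⊎ w ≡ v') → ⊥) →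
        crossing (edgeChain u v d) (edgeChain u' v' d') ≡ false
      edges-cross u v u' v' (yes l) (yes l') e e' disj = arcs-cross u v u' v' l l' e e' disj
      edges-cross u v u' v' (no l) (yes l') e e' disj =
        trans (crossing-reverseˡ (polyChain (arc v u)) (polyChain (arc u' v')))
        (arcs-cross v u u' v' (ordered u v e l) l' (trans (adj-sym v u) e) e' (λ w p → disj w (swap⊎ p)))
      edges-cross u v u' v' (yes l) (no l') e e' disj =
        trans (crossing-reverseʳ (polyChain (arc u v)) (polyChain (arc v' u')))
        (arcs-cross u v v' u' l (ordered u' v' e' l') e (trans (adj-sym v' u') e') (λ w p q → disj w p (swap⊎ q)))
      edges-cross u v u' v' (no l) (no l') e e' disj =
        trans (crossing-reverseˡ (polyChain (arc v u)) (reverseC (polyChain (arc v' u'))))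
        (trans (crossing-reverseʳ (polyChain (arc v u)) (polyChain (arc v' u')))
        (arcs-cross v u v' u' (ordered u v e l) (ordered u' v' e' l') (trans (adj-sym v u) e) (trans (adj-sym v' u') e')
          (λ w p q → disj w (swap⊎ p) (swap⊎ q))))

    walkRay : ∀ {P u v} → Walk P u v → Point → Bool
    walkRay (step {u} {v} _ _ _) = edgeRay u v
    walkRay (w then w') x = walkRay w x xor walkRay w' x

    walkChain : ∀ {P u v} → Walk P u v → Chain
    walkChain {u = u} {v} w = chain (pos u) (pos v) (walkRay w)

    -- By additivity it suffices to treat single edges; those of different walks have no common end,
    -- hence disjoint arcs.
    walks-cross : ∀ {P P' : Fin n → Set} → (∀ w → P w → P' w → ⊥) → ∀ {u v u' v'} (w : Walk P u v) (w' : Walk P' u' v') →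
      crossing (walkChain w) (walkChain w') ≡ false
    walks-cross {P} {P'} disj = go
      where
      go : ∀ {u v u' v'} (w : Walk P u v) (w' : Walk P' u' v') → crossing (walkChain w) (walkChain w') ≡ false
      go (w₁ then w₂) w' = crossing-⋈ˡ (walkChain w₁) (walkChain w₂) (walkChain w') refl (go w₁ w') (go w₂ w')
      go w@(step _ _ _) (w₁' then w₂') = crossing-⋈ʳ (walkChain w) (walkChain w₁') (walkChain w₂') refl (go w w₁') (go w w₂')
      go (step {u} {v} e p q) (step {u'} {v'} e' p' q') =
        trans (sym (cong₂ crossing (edgeChain≡ u v (toℕ u ℕ.<? toℕ v) e) (edgeChain≡ u' v' (toℕ u' ℕ.<? toℕ v') e')))
          (edges-cross u v u' v' (toℕ u ℕ.<? toℕ v) (toℕ u' ℕ.<? toℕ v') e e'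
            λ { w (inj₁ refl) (inj₁ refl) → disj w p p'
              ; w (inj₁ refl) (inj₂ refl) → disj w p q'
              ; w (inj₂ refl) (inj₁ refl) → disj w q p'
              ; w (inj₂ refl) (inj₂ refl) → disj w q q' })

-- Contractions, minors and the linear bound on the number of edges.

Subset : ℕ → Set
Subset n = Fin n → Bool

-- The number of ordered pairs of members of U joined by Γ, that is, twice the number of edges inside U.
edgesIn : ∀ {n} → (Fin n → Fin n → Bool) → Subset n → ℕ
edgesIn Γ U = ∑ᶠ λ u → ∑ᶠ λ v → ⟦ U u ∧ (U v ∧ Γ u v) ⟧

common : ∀ {n} → (Fin n → Fin n → Bool) → Subset n → Fin n → Fin n → ℕ
common Γ U i j = count λ v → U v ∧ (Γ i v ∧ Γ j v)

edgesIn≤square : ∀ {n} (Γ : Fin n → Fin n → Bool) U → edgesIn Γ U ≤ count U * count U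
edgesIn≤square {n} Γ U = begin
  edgesIn Γ U ≤⟨ ∑-mono (allFin n) (λ u → ∑-mono (allFin n) (λ v → bound (U u) (U v) (Γ u v))) ⟩
  (∑ᶠ λ u → ∑ᶠ λ v → ⟦ U u ⟧ * ⟦ U v ⟧) ≡⟨ ∑-cong (allFin n) (λ u → ∑-*ˡ (allFin n) ⟦ U u ⟧ (λ v → ⟦ U v ⟧)) ⟩
  (∑ᶠ λ u → ⟦ U u ⟧ * count U) ≡⟨ ∑-*ʳ (allFin n) (count U) (λ u → ⟦ U u ⟧) ⟩
  count U * count U ∎
  where
  open ℕP.≤-Reasoning
  bound : ∀ a b c → ⟦ a ∧ (b ∧ c) ⟧ ≤ ⟦ a ⟧ * ⟦ b ⟧
  bound true true c = ⟦⟧≤1 c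
  bound true false c = z≤n
  bound false b c = z≤n

module Contraction {n : ℕ} (Γ : Fin n → Fin n → Bool) (Γ-sym : ∀ u v → Γ u v ≡ Γ v u) (Γ-irrefl : ∀ u → Γ u u ≡ false)
  (U : Subset n) (i j : Fin n) (Ui : U i ≡ true) (Uj : U j ≡ true) (Γij : Γ i j ≡ true) where

  -- The contraction of `ij` under the name `i`, which inherits the neighbours of `j`. The relation
  -- still mentions `j`; it disappears by leaving the vertex set, in `U′`.
  Γ′ : Fin n → Fin n → Bool
  Γ′ u v = (Γ u v ∨ (((u == i) ∧ Γ j v) ∨ ((v == i) ∧ Γ u j))) ∧ not (u == v)

  Γ′-sym : ∀ u v → Γ′ u v ≡ Γ′ v u
  Γ′-sym u v rewrite Γ-sym u v | Γ-sym u j | Γ-sym j v | ==-sym u v =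
    cong (λ b → (Γ v u ∨ b) ∧ not (v == u)) (BoolP.∨-comm ((u == i) ∧ Γ v j) ((v == i) ∧ Γ j u))

  Γ′-irrefl : ∀ u → Γ′ u u ≡ false
  Γ′-irrefl u rewrite ==-refl u = BoolP.∧-zeroʳ _

  Γ⇒Γ′ : ∀ u v → Γ u v ≡ true → Γ′ u v ≡ true
  Γ⇒Γ′ u v e rewrite e = cong not (≢⇒== {i = u} {v} (λ { refl → case trans (sym e) (Γ-irrefl u) of λ () }))

  U′ : Subset n
  U′ = without U j

  private
    i≢j : i ≢ j
    i≢j refl = case trans (sym Γij) (Γ-irrefl i) of λ ()

    new : Fin n → Bool
    new v = U′ v ∧ (not (v == i) ∧ (Γ j v ∧ not (Γ i v)))

    xs : List (Fin n)
    xs = allFin n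

    old : Fin n → Fin n → Bool
    old u v = U′ u ∧ (U′ v ∧ Γ u v)

    -- A neighbour of `j` is new for `i`, or common to both, or `i` itself; the last case gives the
    -- 1.
    degree-j : count (λ v → U v ∧ Γ j v) ≤ count new + (common Γ U i j + 1)
    degree-j = begin
      count (λ v → U v ∧ Γ j v) ≤⟨ ∑-mono xs pointwise ⟩
      (∑ᶠ λ v → ⟦ new v ⟧ + (⟦ U v ∧ (Γ i v ∧ Γ j v) ⟧ + ⟦ v == i ⟧)) ≡⟨ ∑-+ xs _ _ ⟩
      count new + (∑ᶠ λ v → ⟦ U v ∧ (Γ i v ∧ Γ j v) ⟧ + ⟦ v == i ⟧) ≡⟨ cong (count new +_) (∑-+ xs _ _) ⟩
      count new + (common Γ U i j + count (_== i)) ≡⟨ cong (λ c → count new + (common Γ U i j + c)) (count-δ i) ⟩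
      count new + (common Γ U i j + 1) ∎
      where
      open ℕP.≤-Reasoning
      cases : ∀ u vj vi gi gj → (vj ≡ true → gj ≡ false) →
        ⟦ u ∧ gj ⟧ ≤ ⟦ (u ∧ not vj) ∧ (not vi ∧ (gj ∧ not gi)) ⟧ + (⟦ u ∧ (gi ∧ gj) ⟧ + ⟦ vi ⟧)
      cases false vj vi gi gj h = z≤n
      cases true vj vi gi false h = z≤n
      cases true true vi gi true h = case h refl of λ ()
      cases true false true gi true h = ℕP.m≤n+m 1 _
      cases true false false true true h = ℕP.≤-refl
      cases true false false false true h = ℕP.≤-refl
      pointwise : ∀ v → ⟦ U v ∧ Γ j v ⟧ ≤ ⟦ new v ⟧ + (⟦ U v ∧ (Γ i v ∧ Γ j v) ⟧ + ⟦ v == i ⟧)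
      pointwise v = cases (U v) (v == j) (v == i) (Γ i v) (Γ j v)
        (λ e → subst (λ w → Γ j w ≡ false) (sym (==⇒≡ {i = v} e)) (Γ-irrefl j))

    edges-split : edgesIn Γ U ≡ (∑ᶠ λ u → count (old u)) + (count (λ v → U v ∧ Γ j v) + count (λ v → U v ∧ Γ j v))
    edges-split = trans (∑-cong xs λ u → trans (∑-cong xs (pointwise u)) (inner u))
      (trans (∑-+ xs _ _) (cong ((∑ᶠ λ u → count (old u)) +_) (trans (∑-+ xs _ _) (cong₂ _+_ (Σ-δ j (λ _ → count (λ v → U v ∧ Γ j v))) last))))
      where
      cases : ∀ u v uj vj g → (uj ≡ true → u ≡ true) → (vj ≡ true → v ≡ true) → (uj ≡ true → vj ≡ true → g ≡ false) →
        ⟦ u ∧ (v ∧ g) ⟧ ≡ ⟦ (u ∧ not uj) ∧ ((v ∧ not vj) ∧ g) ⟧ + (⟦ uj ⟧ * ⟦ v ∧ g ⟧ + ⟦ vj ⟧ * ⟦ u ∧ g ⟧)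
      cases false v true vj g h k l = case h refl of λ ()
      cases false v false true g h k l = refl
      cases false v false false g h k l = refl
      cases true v true true g h k l rewrite l refl refl with v
      ... | true = refl
      ... | false = refl
      cases true false uj true g h k l = case k refl of λ ()
      cases true false true false g h k l = refl
      cases true false false false g h k l = refl
      cases true true true false g h k l with g
      ... | true = refl
      ... | false = refl
      cases true true false true g h k l with g
      ... | true = refl
      ... | false = refl
      cases true true false false g h k l with g
      ... | true = refl
      ... | false = refl
      pointwise : ∀ u v → ⟦ U u ∧ (U v ∧ Γ u v) ⟧ ≡ ⟦ old u v ⟧ + (⟦ u == j ⟧ * ⟦ U v ∧ Γ j v ⟧ + ⟦ v == j ⟧ * ⟦ U u ∧ Γ j u ⟧)
      pointwise u v = trans
        (cases (U u) (U v) (u == j) (v == j) (Γ u v)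
          (λ e → subst (λ w → U w ≡ true) (sym (==⇒≡ {i = u} e)) Uj)
          (λ e → subst (λ w → U w ≡ true) (sym (==⇒≡ {i = v} e)) Uj)
          (λ e e′ → subst₂ (λ a b → Γ a b ≡ false) (sym (==⇒≡ {i = u} e)) (sym (==⇒≡ {i = v} e′)) (Γ-irrefl j)))
        (cong (⟦ old u v ⟧ +_) (cong₂ _+_
           (at-j u (λ w → ⟦ U v ∧ Γ w v ⟧))
           (trans (at-j v (λ w → ⟦ U u ∧ Γ u w ⟧)) (cong (λ b → ⟦ v == j ⟧ * ⟦ U u ∧ b ⟧) (Γ-sym u j)))))
        where
        at-j : ∀ u (f : Fin n → ℕ) → ⟦ u == j ⟧ * f u ≡ ⟦ u == j ⟧ * f j
        at-j u f with u == j in e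
        ... | true rewrite ==⇒≡ {i = u} e = refl
        ... | false = refl
      inner : ∀ u → (∑ᶠ λ v → ⟦ old u v ⟧ + (⟦ u == j ⟧ * ⟦ U v ∧ Γ j v ⟧ + ⟦ v == j ⟧ * ⟦ U u ∧ Γ j u ⟧))
        ≡ count (old u) + (⟦ u == j ⟧ * count (λ v → U v ∧ Γ j v) + ⟦ U u ∧ Γ j u ⟧)
      inner u = trans (∑-+ xs _ _) (cong (count (old u) +_) (trans (∑-+ xs _ _)
        (cong₂ _+_ (∑-*ˡ xs ⟦ u == j ⟧ (λ v → ⟦ U v ∧ Γ j v ⟧)) (Σ-δ j (λ _ → ⟦ U u ∧ Γ j u ⟧)))))
      last : (∑ᶠ λ u → ⟦ U u ∧ Γ j u ⟧) ≡ count (λ v → U v ∧ Γ j v)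
      last = refl

    edges-grow : (∑ᶠ λ u → count (old u)) + (count new + count new) ≤ edgesIn Γ′ U′
    edges-grow = ℕP.≤-trans (ℕP.≤-reflexive (sym
        (trans (∑-cong xs inner) (trans (∑-+ xs _ _) (cong ((∑ᶠ λ u → count (old u)) +_) (trans (∑-+ xs _ _) (cong (_+ count new) (Σ-δ i (λ _ → count new)))))))))
      (∑-mono xs λ u → ∑-mono xs λ v → pointwise u v)
      where
      inner : ∀ u → (∑ᶠ λ v → ⟦ old u v ⟧ + (⟦ u == i ⟧ * ⟦ new v ⟧ + ⟦ v == i ⟧ * ⟦ new u ⟧))
        ≡ count (old u) + (⟦ u == i ⟧ * count new + ⟦ new u ⟧)
      inner u = trans (∑-+ xs _ _) (cong (count (old u) +_) (trans (∑-+ xs _ _)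
        (cong₂ _+_ (∑-*ˡ xs ⟦ u == i ⟧ (λ v → ⟦ new v ⟧)) (Σ-δ i (λ _ → ⟦ new u ⟧)))))
      pointwise : ∀ u v → ⟦ old u v ⟧ + (⟦ u == i ⟧ * ⟦ new v ⟧ + ⟦ v == i ⟧ * ⟦ new u ⟧) ≤ ⟦ U′ u ∧ (U′ v ∧ Γ′ u v) ⟧
      pointwise u v with u == i in eu | v == i in ev
      ... | false | false = ℕP.≤-trans (ℕP.≤-reflexive (ℕP.+-identityʳ _)) (go (U′ u) (U′ v))
        where
        go : ∀ a b → ⟦ a ∧ (b ∧ Γ u v) ⟧ ≤ ⟦ a ∧ (b ∧ ((Γ u v ∨ false) ∧ not (u == v))) ⟧
        go true true with Γ u v in e
        ... | false = z≤n
        ... | true rewrite ≢⇒== {i = u} {v} (λ { refl → case trans (sym e) (Γ-irrefl u) of λ () }) = ℕP.≤-refl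
        go true false = z≤n
        go false b = z≤n
      ... | true | true rewrite ==⇒≡ {i = u} eu | ==⇒≡ {i = v} ev | Γ-irrefl i | ==-refl i
          | BoolP.∧-zeroʳ (U′ i) | BoolP.∧-zeroʳ (U′ i) = z≤n
      ... | true | false rewrite ==⇒≡ {i = u} eu | ==-sym i v | ev = go (U′ i) (U′ v) (Γ i v) (Γ j v) U′i
        where
        U′i : U′ i ≡ true
        U′i = ∧-intro Ui (cong not (≢⇒== i≢j))
        go : ∀ a b g h → a ≡ true → ⟦ a ∧ (b ∧ g) ⟧ + (⟦ b ∧ (true ∧ (h ∧ not g)) ⟧ + 0 + 0) ≤ ⟦ a ∧ (b ∧ ((g ∨ (h ∨ false)) ∧ true)) ⟧
        go true true true true _ = ℕP.≤-refl
        go true true true false _ = ℕP.≤-refl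
        go true true false true _ = ℕP.≤-refl
        go true true false false _ = ℕP.≤-refl
        go true false g h _ = z≤n
      ... | false | true rewrite ==⇒≡ {i = v} ev | eu | Γ-sym u i | Γ-sym u j = go (U′ u) (U′ i) (Γ i u) (Γ j u) U′i
        where
        U′i : U′ i ≡ true
        U′i = ∧-intro Ui (cong not (≢⇒== i≢j))
        go : ∀ a b g h → b ≡ true → ⟦ a ∧ (b ∧ g) ⟧ + (⟦ a ∧ (true ∧ (h ∧ not g)) ⟧ + 0) ≤ ⟦ a ∧ (b ∧ ((g ∨ h) ∧ true)) ⟧
        go true true true true _ = ℕP.≤-refl
        go true true true false _ = ℕP.≤-refl
        go true true false true _ = ℕP.≤-refl
        go true true false false _ = ℕP.≤-refl
        go false true g h _ = z≤n

  -- The contraction loses the edge `ij` and one edge of each triangle on it, and every edge counts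
  -- as two ordered pairs.
  edges-contract : edgesIn Γ U ≤ edgesIn Γ′ U′ + 2 * (common Γ U i j + 1)
  edges-contract = begin
    edgesIn Γ U ≡⟨ edges-split ⟩
    o + (d + d) ≤⟨ ℕP.+-monoʳ-≤ o (ℕP.+-mono-≤ degree-j degree-j) ⟩
    o + ((w + c) + (w + c)) ≡⟨ solve 3 (λ o w c → o :+ ((w :+ c) :+ (w :+ c)) := (o :+ (w :+ w)) :+ con 2 :* c) refl o w c ⟩
    o + (w + w) + 2 * c ≤⟨ ℕP.+-monoˡ-≤ (2 * c) edges-grow ⟩
    edgesIn Γ′ U′ + 2 * c ∎
    where
    open ℕP.≤-Reasoning
    open +-*-Solver
    o = ∑ᶠ λ u → count (old u)
    d = count (λ v → U v ∧ Γ j v)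
    w = count new
    c = common Γ U i j + 1

module _ {n : ℕ} (G : Graph n) (D : PlaneDrawing G) where
  open Graph G using (adj) renaming (sym to adj-sym; loopless to adj-irrefl)

  -- A minor of G: each node stands for the branch set of the vertices it owns,
  -- and contains a base vertex, which we use as the name of the node.
  record Minor (node : Fin n → Set) : Set where
    field
      Γ : Fin n → Fin n → Bool
      Γ-sym : ∀ u v → Γ u v ≡ Γ v u
      Γ-irrefl : ∀ u → Γ u u ≡ false
      owner : Fin n → Fin n
      walk : ∀ u v → node u → node v → Γ u v ≡ true → Walk G (λ w → owner w ≡ u ⊎ owner w ≡ v) u v

  restrict : ∀ {N N′ : Fin n → Set} → (∀ u → N′ u → N u) → Minor N → Minor N′
  restrict f M = record { Minor M ; walk = λ u v p q e → Minor.walk M u v (f u p) (f v q) e }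

  trivial : ∀ {N} → Minor N
  trivial = record
    { Γ = adj ; Γ-sym = adj-sym ; Γ-irrefl = adj-irrefl ; owner = λ u → u
    ; walk = λ u v _ _ e → step e (inj₁ refl) (inj₂ refl) }

  -- The walk for `a i`, `b j` stays in the union of two branch sets, and for i ≠ i′, j ≠ j′ these
  -- unions are disjoint. So the walks satisfy the parity conditions of a drawing of K₃,₃.
  no-K₃₃ : ∀ {N} (M : Minor N) (a b : Fin 3 → Fin n) → (∀ i → N (a i)) → (∀ j → N (b j)) →
    (∀ i i′ → i ≢ i′ → a i ≢ a i′) → (∀ j j′ → j ≢ j′ → b j ≢ b j′) → (∀ i j → a i ≢ b j) →
    (∀ i j → Minor.Γ M (a i) (b j) ≡ true) → ⊥
  no-K₃₃ M a b Na Nb a-inj b-inj a≢b e =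
    K₃₃.contradiction (λ i → pos (a i)) (λ j → pos (b j)) (λ i j → walkRay G D (w i j))
      (λ j j′ ne eq → b-inj j j′ ne (pos-inj _ _ eq))
      (λ i i′ j j′ ne ne′ → walks-cross G D
        (λ { x (inj₁ p) (inj₁ q) → a-inj i i′ ne (trans (sym p) q)
           ; x (inj₁ p) (inj₂ q) → a≢b i j′ (trans (sym p) q)
           ; x (inj₂ p) (inj₁ q) → a≢b i′ j (trans (sym q) p)
           ; x (inj₂ p) (inj₂ q) → b-inj j j′ ne′ (trans (sym p) q) })
        (w i j) (w i′ j′))
    where
    open PlaneDrawing D
    open Minor M
    w : ∀ i j → Walk G (λ x → owner x ≡ a i ⊎ owner x ≡ b j) (a i) (b j)
    w i j = walk (a i) (b j) (Na i) (Nb j) (e i j)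

  triple : (x y z : Fin n) → Fin 3 → Fin n
  triple x y z Fin.zero = x
  triple x y z (Fin.suc Fin.zero) = y
  triple x y z (Fin.suc (Fin.suc Fin.zero)) = z

  triple-inj : ∀ {x y z} → x ≢ y → x ≢ z → y ≢ z → ∀ i j → i ≢ j → triple x y z i ≢ triple x y z j
  triple-inj a b c Fin.zero Fin.zero ne = ⊥-elim (ne refl)
  triple-inj a b c Fin.zero (Fin.suc Fin.zero) ne = a
  triple-inj a b c Fin.zero (Fin.suc (Fin.suc Fin.zero)) ne = b
  triple-inj a b c (Fin.suc Fin.zero) Fin.zero ne e = a (sym e)
  triple-inj a b c (Fin.suc Fin.zero) (Fin.suc Fin.zero) ne = ⊥-elim (ne refl)
  triple-inj a b c (Fin.suc Fin.zero) (Fin.suc (Fin.suc Fin.zero)) ne = c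
  triple-inj a b c (Fin.suc (Fin.suc Fin.zero)) Fin.zero ne e = b (sym e)
  triple-inj a b c (Fin.suc (Fin.suc Fin.zero)) (Fin.suc Fin.zero) ne e = c (sym e)
  triple-inj a b c (Fin.suc (Fin.suc Fin.zero)) (Fin.suc (Fin.suc Fin.zero)) ne = ⊥-elim (ne refl)

  triple-elim : ∀ (P : Fin n → Set) {x y z} → P x → P y → P z → ∀ i → P (triple x y z i)
  triple-elim P a b c Fin.zero = a
  triple-elim P a b c (Fin.suc Fin.zero) = b
  triple-elim P a b c (Fin.suc (Fin.suc Fin.zero)) = c

  -- Contracting an edge with fewer than `density s` triangles removes one vertex and at most 2 ·
  -- `density s` ordered pairs, so this is the ratio that contraction preserves. Three apices lead
  -- to `density 3` = 24, the constant of all later bounds.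
  density : ℕ → ℕ
  density zero = 3
  density (suc s) = 2 * density s

  1≤density : ∀ s → 1 ≤ density s
  1≤density zero = s≤s z≤n
  1≤density (suc s) = ℕP.≤-trans (1≤density s) (ℕP.m≤m+n (density s) (density s + 0))

  -- `s` is the number of apices still missing from the three that form one side of K₃,₃, every apex
  -- being joined to all of `U`; `m` bounds the size of `U` for the induction along contractions.
  NotDense : ℕ → ℕ → Set
  NotDense s m = (apex : List (Fin n)) (U : Subset n) (M : Minor (λ u → u ∈ apex ⊎ U u ≡ true)) →
    length apex + s ≡ 3 → Unique apex → (∀ p → p ∈ apex → U p ≡ false) →
    (∀ p u → p ∈ apex → U u ≡ true → Minor.Γ M p u ≡ true) →
    count U ≤ m → 1 ≤ count U → density s * count U ≤ edgesIn (Minor.Γ M) U → ⊥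

  -- Here 3|U| ≤ e ≤ |U|² gives |U| ≥ 3, and the three apices with three vertices of `U` form K₃,₃.
  not-dense-base : ∀ m → NotDense 0 m
  not-dense-base m (p ∷ q ∷ r ∷ []) U M refl ((p≢q ∷ p≢r ∷ []) ∷ (q≢r ∷ []) ∷ _) fresh joined _ 1≤U dense =
    no-K₃₃ M (triple p q r) (triple x y z)
      (λ i → inj₁ (apex∈ i))
      (triple-elim (λ u → u ∈ p ∷ q ∷ r ∷ [] ⊎ U u ≡ true) (inj₂ Ux) (inj₂ Uy) (inj₂ Uz))
      (triple-inj p≢q p≢r q≢r) (triple-inj x≢y x≢z y≢z)
      (λ i j e → case trans (sym (fresh _ (apex∈ i))) (trans (cong U e) (U∈ j)) of λ ())
      (λ i j → joined _ _ (apex∈ i) (U∈ j))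
    where
    3≤U : 3 ≤ count U
    3≤U = ℕP.*-cancelʳ-≤ 3 (count U) (count U) {{ℕ.>-nonZero 1≤U}} (ℕP.≤-trans dense (edgesIn≤square (Minor.Γ M) U))
    three = pick₃ U 3≤U
    x = proj₁ three
    y = proj₁ (proj₂ three)
    z = proj₁ (proj₂ (proj₂ three))
    Ux = proj₁ (proj₁ (proj₂ (proj₂ (proj₂ three))))
    Uy = proj₁ (proj₂ (proj₁ (proj₂ (proj₂ (proj₂ three)))))
    Uz = proj₂ (proj₂ (proj₁ (proj₂ (proj₂ (proj₂ three)))))
    x≢y = proj₁ (proj₂ (proj₂ (proj₂ (proj₂ three))))
    x≢z = proj₁ (proj₂ (proj₂ (proj₂ (proj₂ (proj₂ three)))))
    y≢z = proj₂ (proj₂ (proj₂ (proj₂ (proj₂ (proj₂ three)))))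
    apex∈ : ∀ i → triple p q r i ∈ p ∷ q ∷ r ∷ []
    apex∈ = triple-elim (_∈ p ∷ q ∷ r ∷ []) (here refl) (there (here refl)) (there (there (here refl)))
    U∈ : ∀ i → U (triple x y z i) ≡ true
    U∈ = triple-elim (λ u → U u ≡ true) Ux Uy Uz
  -- Mader's argument. While some edge of U lies in few triangles, contract it; otherwise the
  -- neighbourhood of a vertex is dense, and that vertex joins the set of apices.
  not-dense-step : ∀ s → (∀ m → NotDense s m) → ∀ m → NotDense (suc s) m
  not-dense-step s rec zero apex U M _ _ _ _ U≤0 1≤U _ = ℕP.<⇒≱ 1≤U U≤0
  not-dense-step s rec (suc m) apex U M len uniq fresh joined U≤m 1≤U dense
    with FinP.any? (λ i → FinP.any? (λ j → (U i BoolP.≟ true) ×-dec (U j BoolP.≟ true) ×-dec (Minor.Γ M i j BoolP.≟ true)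
                                            ×-dec (common (Minor.Γ M) U i j + 1 ℕ.≤? density s)))
  ... | yes (i , j , Ui , Uj , Γij , light) =
    not-dense-step s rec m apex U′ M′ len uniq (λ p p∈ → cong (_∧ not (p == j)) (fresh p p∈))
      (λ p u p∈ U′u → Γ⇒Γ′ p u (joined p u p∈ (proj₁ (∧-true U′u))))
      (ℕP.≤-pred (subst (_≤ suc m) size U≤m))
      (ℕP.≤-trans (ℕP.≤-reflexive (sym (cong ⟦_⟧ (∧-intro Ui (cong not (≢⇒== i≢j)))))) (Σ-∈ (λ u → ⟦ U′ u ⟧) i))
      -- One vertex fewer lowers the required number of pairs by `density (suc s)`, which is also
      -- the most that the contraction can lose.
      (ℕP.+-cancelʳ-≤ (density (suc s)) _ _ (begin
        density (suc s) * count U′ + density (suc s) ≡⟨ ℕP.+-comm _ (density (suc s)) ⟩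
        density (suc s) + density (suc s) * count U′ ≡⟨ sym (ℕP.*-suc (density (suc s)) (count U′)) ⟩
        density (suc s) * suc (count U′) ≡⟨ cong (density (suc s) *_) (sym size) ⟩
        density (suc s) * count U ≤⟨ dense ⟩
        edgesIn Γ U ≤⟨ edges-contract ⟩
        edgesIn Γ′ U′ + 2 * (common Γ U i j + 1) ≤⟨ ℕP.+-monoʳ-≤ (edgesIn Γ′ U′) (ℕP.*-monoʳ-≤ 2 light) ⟩
        edgesIn Γ′ U′ + density (suc s) ∎))
    where
    open ℕP.≤-Reasoning
    open Minor M
    open Contraction Γ Γ-sym Γ-irrefl U i j Ui Uj Γij
    i≢j : i ≢ j
    i≢j refl = case trans (sym Γij) (Γ-irrefl i) of λ ()
    size : count U ≡ suc (count U′)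
    size = count-without U j Uj
    owner′ : Fin n → Fin n
    owner′ w = if owner w == j then i else owner w
    owner-j : ∀ {w} → owner w ≡ j → owner′ w ≡ i
    owner-j {w} e rewrite e | ==-refl j = refl
    owner-other : ∀ {w u} → u ≢ j → owner w ≡ u → owner′ w ≡ u
    owner-other {w} {u} ne e rewrite e | ≢⇒== {i = u} {j} ne = refl
    node≢j : ∀ u → u ∈ apex ⊎ U′ u ≡ true → u ≢ j
    node≢j u (inj₁ u∈) refl = case trans (sym Uj) (fresh u u∈) of λ ()
    node≢j u (inj₂ e) = ==-false (not-true (proj₂ (∧-true {U u} e)))
    weaken : ∀ u → u ∈ apex ⊎ U′ u ≡ true → u ∈ apex ⊎ U u ≡ true
    weaken u (inj₁ p) = inj₁ p
    weaken u (inj₂ e) = inj₂ (proj₁ (∧-true e))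
    inV : ∀ {u v w} → u ≢ j → v ≢ j → owner w ≡ u ⊎ owner w ≡ v → owner′ w ≡ u ⊎ owner′ w ≡ v
    inV a b (inj₁ e) = inj₁ (owner-other a e)
    inV a b (inj₂ e) = inj₂ (owner-other b e)
    cases : ∀ a b c d → (a ∨ (b ∨ c)) ∧ d ≡ true → a ≡ true ⊎ b ≡ true ⊎ c ≡ true
    cases true b c d e = inj₁ refl
    cases false true c d e = inj₂ (inj₁ refl)
    cases false false true d e = inj₂ (inj₂ refl)
    walk′ : ∀ u v → u ∈ apex ⊎ U′ u ≡ true → v ∈ apex ⊎ U′ v ≡ true → Γ′ u v ≡ true →
      Walk G (λ w → owner′ w ≡ u ⊎ owner′ w ≡ v) u v
    walk′ u v Nu Nv e with cases (Γ u v) ((u == i) ∧ Γ j v) ((v == i) ∧ Γ u j) (not (u == v)) e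
    ... | inj₁ g = mapWalk G (λ w → inV (node≢j u Nu) (node≢j v Nv)) (walk u v (weaken u Nu) (weaken v Nv) g)
    ... | inj₂ (inj₁ g) with ∧-true {u == i} g
    ...   | u=i , Γjv with ==⇒≡ {i = u} u=i
    ...     | refl =
      -- An edge inherited from `j` is reached by first walking from `i` to `j`, which stays inside
      -- the merged branch set.
      mapWalk G (λ w → λ { (inj₁ x) → inj₁ (owner-other i≢j x) ; (inj₂ x) → inj₁ (owner-j x) }) (walk i j (inj₂ Ui) (inj₂ Uj) Γij)
      then mapWalk G (λ w → λ { (inj₁ x) → inj₁ (owner-j x) ; (inj₂ x) → inj₂ (owner-other (node≢j v Nv) x) })
             (walk j v (inj₂ Uj) (weaken v Nv) Γjv)
    walk′ u v Nu Nv e | inj₂ (inj₂ g) with ∧-true {v == i} g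
    ...   | v=i , Γuj with ==⇒≡ {i = v} v=i
    ...     | refl =
      mapWalk G (λ w → λ { (inj₁ x) → inj₁ (owner-other (node≢j u Nu) x) ; (inj₂ x) → inj₂ (owner-j x) })
             (walk u j (weaken u Nu) (inj₂ Uj) Γuj)
      then mapWalk G (λ w → λ { (inj₁ x) → inj₂ (owner-j x) ; (inj₂ x) → inj₂ (owner-other i≢j x) })
             (walk j i (inj₂ Uj) (inj₂ Ui) (trans (Γ-sym j i) Γij))
    M′ : Minor (λ u → u ∈ apex ⊎ U′ u ≡ true)
    M′ = record { Γ = Γ′ ; Γ-sym = Γ′-sym ; Γ-irrefl = Γ′-irrefl ; owner = owner′ ; walk = walk′ }
  ... | no all-heavy =
    rec (count N) (v ∷ apex) N (restrict weaken M) (trans (sym (ℕP.+-suc (length apex) s)) len)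
      (All.tabulate (λ {p} p∈ v≡p → case trans (sym (fresh p p∈)) (trans (cong U (sym v≡p)) Uv) of λ ()) ∷ uniq)
      (λ { p (here refl) → trans (cong (U v ∧_) (Γ-irrefl v)) (BoolP.∧-zeroʳ (U v)) ; p (there p∈) → cong (_∧ Γ v p) (fresh p p∈) })
      (λ { p u (here refl) Nu → proj₂ (∧-true {U u} Nu) ; p u (there p∈) Nu → joined p u p∈ (proj₁ (∧-true Nu)) })
      ℕP.≤-refl
      (ℕP.≤-trans (ℕP.≤-reflexive (sym (cong ⟦_⟧ (∧-intro Uw Γvw)))) (Σ-∈ (λ u → ⟦ N u ⟧) w))
      (begin
        density s * count N ≡⟨ ℕP.*-comm (density s) (count N) ⟩
        count N * density s ≡⟨ sym (∑-*ʳ (allFin n) (density s) (λ u → ⟦ N u ⟧)) ⟩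
        (∑ᶠ λ u → ⟦ N u ⟧ * density s) ≤⟨ ∑-mono (allFin n) heavy ⟩
        (∑ᶠ λ u → ⟦ N u ⟧ * count (λ k → N k ∧ Γ u k)) ≡⟨ ∑-cong (allFin n) (λ u → sym (∑-*ˡ (allFin n) ⟦ N u ⟧ (λ k → ⟦ N k ∧ Γ u k ⟧))) ⟩
        (∑ᶠ λ u → ∑ᶠ λ k → ⟦ N u ⟧ * ⟦ N k ∧ Γ u k ⟧) ≡⟨ ∑-cong (allFin n) (λ u → ∑-cong (allFin n) (λ k → sym (⟦∧⟧ (N u) (N k ∧ Γ u k)))) ⟩
        edgesIn Γ N ∎)
    where
    open ℕP.≤-Reasoning
    open Minor M
    edge : 1 ≤ edgesIn Γ U
    edge = ℕP.≤-trans (ℕP.*-mono-≤ (1≤density (suc s)) 1≤U) dense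
    at-v = ∑-positive (allFin n) _ edge
    v = proj₁ at-v
    at-w = ∑-positive (allFin n) _ (proj₂ (proj₂ at-v))
    w = proj₁ at-w
    uvw = ∧-true {U v} (1≤⟦⟧ (proj₂ (proj₂ at-w)))
    Uv : U v ≡ true
    Uv = proj₁ uvw
    Uw : U w ≡ true
    Uw = proj₁ (∧-true (proj₂ uvw))
    Γvw : Γ v w ≡ true
    Γvw = proj₂ (∧-true {U w} (proj₂ uvw))
    N : Subset n
    N u = U u ∧ Γ v u
    weaken : ∀ u → u ∈ v ∷ apex ⊎ N u ≡ true → u ∈ apex ⊎ U u ≡ true
    weaken u (inj₁ (here refl)) = inj₂ Uv
    weaken u (inj₁ (there p)) = inj₁ p
    weaken u (inj₂ e) = inj₂ (proj₁ (∧-true e))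
    -- No edge is light, so `v` and `u` have at least `density s` common neighbours in `U`; these
    -- are the neighbours of `u` inside `N`.
    heavy : ∀ u → ⟦ N u ⟧ * density s ≤ ⟦ N u ⟧ * count (λ k → N k ∧ Γ u k)
    heavy u = ⟦⟧-cond (N u) λ Nu → ℕP.≤-trans
      (ℕP.≮⇒≥ λ lt → all-heavy (v , u , Uv , proj₁ (∧-true Nu) , proj₂ (∧-true {U u} Nu) , subst (_≤ density s) (ℕP.+-comm 1 _) lt))
      (ℕP.≤-reflexive (∑-cong (allFin n) (λ k → cong ⟦_⟧ (sym (BoolP.∧-assoc (U k) (Γ v k) (Γ u k))))))

  not-dense : ∀ s m → NotDense s m
  not-dense zero = not-dense-base
  not-dense (suc s) = not-dense-step s (not-dense s)

  sparse : ∀ U → edgesIn adj U ≤ 24 * count U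
  sparse U = ℕP.≮⇒≥ λ lt → not-dense 3 (count U) [] U trivial refl [] (λ _ ()) (λ _ _ ()) ℕP.≤-refl
    (nonempty (ℕP.≤-trans (s≤s z≤n) lt)) (ℕP.<⇒≤ lt)
    where
    nonempty : 1 ≤ edgesIn adj U → 1 ≤ count U
    nonempty h with count U in e
    ... | suc _ = s≤s z≤n
    ... | zero = ⊥-elim (ℕP.<⇒≱ h (subst (λ c → edgesIn adj U ≤ c * c) e (edgesIn≤square adj U)))

  -- Three common neighbours would give K₃,₃ as a subgraph, which is the minor with singleton branch
  -- sets.
  few-common : ∀ x y z → x ≢ y → x ≢ z → y ≢ z → count (λ v → adj x v ∧ (adj y v ∧ adj z v)) ≤ 2
  few-common x y z x≢y x≢z y≢z = ℕP.≮⇒≥ λ lt →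
    let (a , b , c , (pa , pb , pc) , (a≢b , a≢c , b≢c)) = pick₃ (λ v → adj x v ∧ (adj y v ∧ adj z v)) lt
        joined : ∀ i {v} → adj x v ∧ (adj y v ∧ adj z v) ≡ true → adj (triple x y z i) v ≡ true
        joined i {v} e = triple-elim (λ u → adj u v ≡ true) (proj₁ (∧-true e))
          (proj₁ (∧-true (proj₂ (∧-true {adj x v} e)))) (proj₂ (∧-true {adj y v} (proj₂ (∧-true {adj x v} e)))) i
        joined′ : ∀ i j → adj (triple x y z i) (triple a b c j) ≡ true
        joined′ i = triple-elim (λ v → adj (triple x y z i) v ≡ true) (joined i pa) (joined i pb) (joined i pc)
    -- Every vertex is a node here: the node predicate is constantly an inhabited type, with `x` as
    -- its element.
    in no-K₃₃ {λ _ → Fin n} trivial (triple x y z) (triple a b c) (λ _ → x) (λ _ → x)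
         (triple-inj x≢y x≢z y≢z) (triple-inj a≢b a≢c b≢c)
         (λ i j e → case trans (sym (joined′ i j)) (trans (cong (adj (triple x y z i)) (sym e)) (adj-irrefl _)) of λ ())
         joined′

-- Sublists and the weighted clique inequality.

module _ {A : Set} where

  combos : ℕ → List A → List (List A)
  combos zero xs = [] ∷ []
  combos (suc k) [] = []
  combos (suc k) (x ∷ xs) = map (x ∷_) (combos k xs) ++ combos (suc k) xs

  ∑-combos-∷ : ∀ k x xs (g : List A → ℕ) →
    ∑ (combos (suc k) (x ∷ xs)) g ≡ ∑ (combos k xs) (λ ys → g (x ∷ ys)) + ∑ (combos (suc k) xs) g
  ∑-combos-∷ k x xs g = trans (∑-++ (map (x ∷_) (combos k xs)) (combos (suc k) xs) g)
    (cong (_+ ∑ (combos (suc k) xs) g) (∑-map (x ∷_) (combos k xs) g))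

  combos-length : ∀ k xs {ys} → ys ∈ combos k xs → length ys ≡ k
  combos-length zero xs (here refl) = refl
  combos-length (suc k) (x ∷ xs) m with ∈P.∈-++⁻ (map (x ∷_) (combos k xs)) m
  ... | inj₂ m′ = combos-length (suc k) xs m′
  ... | inj₁ m′ with ∈P.∈-map⁻ (x ∷_) m′
  ...   | zs , m″ , refl = cong suc (combos-length k xs m″)

  combos-∑≤ : ∀ k xs {ys} (f : A → ℕ) → ys ∈ combos k xs → ∑ ys f ≤ ∑ xs f
  combos-∑≤ zero xs f (here refl) = z≤n
  combos-∑≤ (suc k) (x ∷ xs) f m with ∈P.∈-++⁻ (map (x ∷_) (combos k xs)) m
  ... | inj₂ m′ = ℕP.≤-trans (combos-∑≤ (suc k) xs f m′) (ℕP.m≤n+m (∑ xs f) (f x))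
  ... | inj₁ m′ with ∈P.∈-map⁻ (x ∷_) m′
  ...   | zs , m″ , refl = ℕP.+-monoʳ-≤ (f x) (combos-∑≤ k xs f m″)

  ∑-↭ : ∀ {xs ys} (f : A → ℕ) → xs ↭ ys → ∑ xs f ≡ ∑ ys f
  ∑-↭ f Perm.refl = refl
  ∑-↭ f (prep x p) = cong (f x +_) (∑-↭ f p)
  ∑-↭ f (swap {xs} {ys} x y p) = trans (cong (λ s → f x + (f y + s)) (∑-↭ f p))
    (solve 3 (λ a b c → a :+ (b :+ c) := b :+ (a :+ c)) refl (f x) (f y) (∑ ys f))
    where open +-*-Solver
  ∑-↭ f (Perm.trans p q) = trans (∑-↭ f p) (∑-↭ f q)

  -- `combos` depends on the order of the list, but sums of symmetric functions over it do not. This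
  -- permits moving a vertex of least degree to the head.
  ∑-combos-↭ : ∀ k {xs ys} (g : List A → ℕ) → (∀ {as bs} → as ↭ bs → g as ≡ g bs) → xs ↭ ys →
    ∑ (combos k xs) g ≡ ∑ (combos k ys) g
  ∑-combos-↭ zero g h p = refl
  ∑-combos-↭ (suc k) g h Perm.refl = refl
  ∑-combos-↭ (suc k) g h (prep {xs} {ys} x p) =
    trans (∑-combos-∷ k x xs g)
    (trans (cong₂ _+_ (∑-combos-↭ k (g ∘ (x ∷_)) (λ q → h (prep x q)) p) (∑-combos-↭ (suc k) g h p))
    (sym (∑-combos-∷ k x ys g)))
  ∑-combos-↭ (suc zero) g h (swap {xs} {ys} x y p) =
    trans (cong (λ s → g (x ∷ []) + (g (y ∷ []) + s)) (∑-combos-↭ 1 g h p))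
      (solve 3 (λ a b c → a :+ (b :+ c) := b :+ (a :+ c)) refl (g (x ∷ [])) (g (y ∷ [])) (∑ (combos 1 ys) g))
    where open +-*-Solver
  ∑-combos-↭ (suc (suc k)) g h (swap {xs} {ys} x y p) =
    trans (expand x y xs) (trans (cong₂ _+_
        (cong₂ _+_ (trans (∑-combos-↭ k (λ zs → g (x ∷ y ∷ zs)) (λ q → h (prep x (prep y q))) p)
                          (∑-cong (combos k ys) (λ zs → h (swap x y Perm.refl))))
                   (∑-combos-↭ (suc k) (λ zs → g (x ∷ zs)) (λ q → h (prep x q)) p))
        (cong₂ _+_ (∑-combos-↭ (suc k) (λ zs → g (y ∷ zs)) (λ q → h (prep y q)) p)
                   (∑-combos-↭ (suc (suc k)) g h p)))
     (trans (solve 4 (λ a b c d → (a :+ b) :+ (c :+ d) := (a :+ c) :+ (b :+ d)) refl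
              (∑ (combos k ys) (λ zs → g (y ∷ x ∷ zs))) (∑ (combos (suc k) ys) (λ zs → g (x ∷ zs)))
              (∑ (combos (suc k) ys) (λ zs → g (y ∷ zs))) (∑ (combos (suc (suc k)) ys) g))
       (sym (expand y x ys))))
    where
    open +-*-Solver
    expand : ∀ x y xs → ∑ (combos (suc (suc k)) (x ∷ y ∷ xs)) g
      ≡ (∑ (combos k xs) (λ zs → g (x ∷ y ∷ zs)) + ∑ (combos (suc k) xs) (λ zs → g (x ∷ zs)))
        + (∑ (combos (suc k) xs) (λ zs → g (y ∷ zs)) + ∑ (combos (suc (suc k)) xs) g)
    expand x y xs = trans (∑-combos-∷ (suc k) x (y ∷ xs) g)
      (cong₂ _+_ (∑-combos-∷ k y xs (λ zs → g (x ∷ zs))) (∑-combos-∷ (suc k) y xs g))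
  ∑-combos-↭ (suc k) g h (Perm.trans p q) = trans (∑-combos-↭ (suc k) g h p) (∑-combos-↭ (suc k) g h q)

  ∈⇒↭ : ∀ {x : A} {xs} → x ∈ xs → ∃ λ ys → xs ↭ x ∷ ys
  ∈⇒↭ m with ∈P.∈-∃++ m
  ... | ys , zs , refl = ys ++ zs , PermP.shift _ ys zs

  below-average : ∀ x xs (f : A → ℕ) → ∃ λ y → y ∈ x ∷ xs × length (x ∷ xs) * f y ≤ ∑ (x ∷ xs) f
  below-average x [] f = x , here refl , ℕP.≤-refl
  below-average x (x′ ∷ xs) f with below-average x′ xs f
  ... | y , m , h with ℕP.≤-total (f x) (f y)
  ...   | inj₁ fx≤fy = x , here refl , ℕP.+-monoʳ-≤ (f x) (ℕP.≤-trans (ℕP.*-monoʳ-≤ (suc (length xs)) fx≤fy) h)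
  ...   | inj₂ fy≤fx = y , there m , ℕP.+-mono-≤ fy≤fx h

  prod : List A → (A → ℕ) → ℕ
  prod [] f = 1
  prod (x ∷ xs) f = f x * prod xs f

  prod-↭ : ∀ {xs ys} (f : A → ℕ) → xs ↭ ys → prod xs f ≡ prod ys f
  prod-↭ f Perm.refl = refl
  prod-↭ f (prep x p) = cong (f x *_) (prod-↭ f p)
  prod-↭ f (swap {xs} {ys} x y p) = trans (cong (λ s → f x * (f y * s)) (prod-↭ f p))
    (solve 3 (λ a b c → a :* (b :* c) := b :* (a :* c)) refl (f x) (f y) (prod ys f))
    where open +-*-Solver
  prod-↭ f (Perm.trans p q) = trans (prod-↭ f p) (prod-↭ f q)

  module _ (w : A → A → ℕ) where
    pairProd : List A → ℕ
    pairProd [] = 1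
    pairProd (x ∷ xs) = prod xs (w x) * pairProd xs

    pairProd-↭ : (∀ x y → w x y ≡ w y x) → ∀ {xs ys} → xs ↭ ys → pairProd xs ≡ pairProd ys
    pairProd-↭ w-sym Perm.refl = refl
    pairProd-↭ w-sym (prep x p) = cong₂ _*_ (prod-↭ (w x) p) (pairProd-↭ w-sym p)
    pairProd-↭ w-sym (swap {xs} {ys} x y p) =
      trans (cong₂ _*_ (cong₂ _*_ (w-sym x y) (prod-↭ (w x) p)) (cong₂ _*_ (prod-↭ (w y) p) (pairProd-↭ w-sym p)))
      (solve 4 (λ a b c d → (a :* b) :* (c :* d) := (a :* c) :* (b :* d)) refl (w y x) (prod ys (w x)) (prod ys (w y)) (pairProd ys))
      where open +-*-Solver
    pairProd-↭ w-sym (Perm.trans p q) = trans (pairProd-↭ w-sym p) (pairProd-↭ w-sym q)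

    -- The total weight of all pairs, written as the weight of the 2-cliques so that it can be
    -- permuted in the same way as the sums over larger cliques.
    weight : List A → ℕ
    weight xs = ∑ (combos 2 xs) pairProd

    weight-∷ : ∀ x xs → weight (x ∷ xs) ≡ ∑ xs (w x) + weight xs
    weight-∷ x xs = trans (∑-combos-∷ 1 x xs pairProd) (cong (_+ weight xs) (ones xs))
      where
      ones : ∀ xs → ∑ (combos 1 xs) (λ ys → pairProd (x ∷ ys)) ≡ ∑ xs (w x)
      ones [] = refl
      ones (y ∷ ys) = cong₂ _+_ (solve 1 (λ a → (a :* con 1) :* con 1 := a) refl (w x y)) (ones ys)
        where open +-*-Solver

    degree-sum : (∀ x y → w x y ≡ w y x) → (∀ x → w x x ≡ 0) → ∀ xs → ∑ xs (λ x → ∑ xs (w x)) ≡ 2 * weight xs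
    degree-sum w-sym w-irr [] = refl
    degree-sum w-sym w-irr (x ∷ xs) = begin
      (w x x + d) + ∑ xs (λ y → w y x + ∑ xs (w y)) ≡⟨ cong₂ (λ a b → (a + d) + b) (w-irr x) (∑-+ xs (λ y → w y x) _) ⟩
      d + (∑ xs (λ y → w y x) + ∑ xs (λ y → ∑ xs (w y))) ≡⟨ cong₂ (λ a b → d + (a + b)) (∑-cong xs (λ y → w-sym y x)) (degree-sum w-sym w-irr xs) ⟩
      d + (d + 2 * weight xs) ≡⟨ solve 2 (λ d r → d :+ (d :+ con 2 :* r) := con 2 :* (d :+ r)) refl d (weight xs) ⟩
      2 * (d + weight xs) ≡⟨ cong (2 *_) (sym (weight-∷ x xs)) ⟩
      2 * weight (x ∷ xs) ∎
      where
      open ≡-Reasoning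
      open +-*-Solver
      d = ∑ xs (w x)

4ab≤[a+b]² : ∀ a b → 4 * (a * b) ≤ (a + b) * (a + b)
4ab≤[a+b]² a b with ℕP.≤-total a b
... | inj₁ a≤b with ℕP.m≤n⇒∃[o]m+o≡n a≤b
...   | c , refl = ℕP.≤-trans (ℕP.m≤m+n _ (c * c)) (ℕP.≤-reflexive
  (solve 2 (λ a c → con 4 :* (a :* (a :+ c)) :+ c :* c := (a :+ (a :+ c)) :* (a :+ (a :+ c))) refl a c))
  where open +-*-Solver
4ab≤[a+b]² a b | inj₂ b≤a with ℕP.m≤n⇒∃[o]m+o≡n b≤a
...   | c , refl = ℕP.≤-trans (ℕP.m≤m+n _ (c * c)) (ℕP.≤-reflexive
  (solve 2 (λ a c → con 4 :* ((a :+ c) :* a) :+ c :* c := ((a :+ c) :+ a) :* ((a :+ c) :+ a)) refl b c))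
  where open +-*-Solver

private
  -- With b = a + p and c = a + q the two sides differ by 9a((p+q)² - 3pq) + (p+q)³. Splitting off
  -- the minimum avoids subtraction.
  amgm₃-min : ∀ a b c → a ≤ b → a ≤ c → a * (b * c) * 27 ≤ (a + (b + c)) ^ 3
  amgm₃-min a b c a≤b a≤c with ℕP.m≤n⇒∃[o]m+o≡n a≤b | ℕP.m≤n⇒∃[o]m+o≡n a≤c
  ... | p , refl | q , refl = begin
    a * ((a + p) * (a + q)) * 27
      ≡⟨ solve 3 (λ a p q → a :* ((a :+ p) :* (a :+ q)) :* con 27
           := con 27 :* (a :* (a :* a)) :+ con 27 :* (a :* a :* (p :+ q)) :+ con 9 :* a :* (con 3 :* (p :* q))) refl a p q ⟩
    X + 9 * a * (3 * (p * q)) ≤⟨ ℕP.+-monoʳ-≤ X (ℕP.*-monoʳ-≤ (9 * a)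
        (ℕP.≤-trans (ℕP.*-monoˡ-≤ (p * q) {3} {4} (ℕP.n≤1+n 3)) (4ab≤[a+b]² p q))) ⟩
    X + 9 * a * ((p + q) * (p + q)) ≤⟨ ℕP.m≤m+n _ ((p + q) ^ 3) ⟩
    X + 9 * a * ((p + q) * (p + q)) + (p + q) ^ 3
      ≡⟨ solve 3 (λ a p q →
          con 27 :* (a :* (a :* a)) :+ con 27 :* (a :* a :* (p :+ q)) :+ con 9 :* a :* ((p :+ q) :* (p :+ q)) :+ (p :+ q) :^ 3
          := (a :+ ((a :+ p) :+ (a :+ q))) :^ 3) refl a p q ⟩
    (a + ((a + p) + (a + q))) ^ 3 ∎
    where
    open ℕP.≤-Reasoning
    open +-*-Solver
    X = 27 * (a * (a * a)) + 27 * (a * a * (p + q))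

27abc≤[a+b+c]³ : ∀ a b c → a * (b * c) * 27 ≤ (a + (b + c)) ^ 3
27abc≤[a+b+c]³ a b c with ℕP.≤-total a b | ℕP.≤-total a c | ℕP.≤-total b c
... | inj₁ a≤b | inj₁ a≤c | _ = amgm₃-min a b c a≤b a≤c
... | inj₁ a≤b | inj₂ c≤a | _ = subst₂ (λ x y → x * 27 ≤ y ^ 3)
  (solve 3 (λ a b c → c :* (a :* b) := a :* (b :* c)) refl a b c) (solve 3 (λ a b c → c :+ (a :+ b) := a :+ (b :+ c)) refl a b c)
  (amgm₃-min c a b c≤a (ℕP.≤-trans c≤a a≤b))
  where open +-*-Solver
... | inj₂ b≤a | _ | inj₁ b≤c = subst₂ (λ x y → x * 27 ≤ y ^ 3)
  (solve 3 (λ a b c → b :* (a :* c) := a :* (b :* c)) refl a b c) (solve 3 (λ a b c → b :+ (a :+ c) := a :+ (b :+ c)) refl a b c)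
  (amgm₃-min b a c b≤a b≤c)
  where open +-*-Solver
... | inj₂ b≤a | _ | inj₂ c≤b = subst₂ (λ x y → x * 27 ≤ y ^ 3)
  (solve 3 (λ a b c → c :* (a :* b) := a :* (b :* c)) refl a b c) (solve 3 (λ a b c → c :+ (a :+ b) := a :+ (b :+ c)) refl a b c)
  (amgm₃-min c a b (ℕP.≤-trans c≤b b≤a) c≤b)
  where open +-*-Solver

-- The inequality for each of the three pairs, then for the three sums: 46656 = 6⁶ = 4³·27².
amgm₆ : ∀ a b c d e f → (a * b * (c * d * (e * f))) * 46656 ≤ (a + b + (c + d + (e + f))) ^ 6
amgm₆ a b c d e f = begin
  (a * b * (c * d * (e * f))) * 46656
    ≡⟨ regroup 729 4 (a * b) (c * d) (e * f) ⟩
  729 * (4 * (a * b) * (4 * (c * d) * (4 * (e * f))))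
    ≤⟨ ℕP.*-monoʳ-≤ 729 (ℕP.*-mono-≤ (4ab≤[a+b]² a b) (ℕP.*-mono-≤ (4ab≤[a+b]² c d) (4ab≤[a+b]² e f))) ⟩
  729 * (x * x * (y * y * (z * z)))
    ≡⟨ solve 4 (λ c x y z → (c :* c) :* (x :* x :* (y :* y :* (z :* z))) := ((x :* (y :* z)) :* c) :^ 2) refl 27 x y z ⟩
  (x * (y * z) * 27) ^ 2 ≤⟨ ℕP.^-monoˡ-≤ 2 (27abc≤[a+b+c]³ x y z) ⟩
  ((x + (y + z)) ^ 3) ^ 2 ≡⟨ ℕP.^-*-assoc (x + (y + z)) 3 2 ⟩
  (x + (y + z)) ^ 6 ∎
  where
  open ℕP.≤-Reasoning
  open +-*-Solver
  x = a + b
  y = c + d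
  z = e + f
  regroup : ∀ p q x y z → (x * (y * z)) * (p * (q * (q * q))) ≡ p * (q * x * (q * y * (q * z)))
  regroup = solve 5 (λ p q x y z → (x :* (y :* z)) :* (p :* (q :* (q :* q))) := p :* (q :* x :* (q :* y :* (q :* z)))) refl

module _ {A : Set} where

  -- For the cliques through a removed vertex: `a` gives the weights of its edges, `g` the weight of
  -- the rest of the clique, and D/c is the bound from the inequality of the means for the first
  -- factor.
  combos-prod-bound : ∀ k c D (a : A → ℕ) (g : List A → ℕ) xs → (∀ ys → length ys ≡ k → ∑ ys a ≤ ∑ xs a → prod ys a * c ≤ D) →
    ∑ (combos k xs) (λ ys → prod ys a * g ys) * c ≤ D * ∑ (combos k xs) g
  combos-prod-bound k c D a g xs h = begin
    ∑ (combos k xs) (λ ys → prod ys a * g ys) * c ≡⟨ sym (∑-*ʳ (combos k xs) c _) ⟩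
    ∑ (combos k xs) (λ ys → prod ys a * g ys * c) ≤⟨ ∑-mono-∈ (combos k xs) (λ ys m →
        ℕP.≤-trans (ℕP.≤-reflexive (rotate (prod ys a) (g ys) c))
          (ℕP.*-monoˡ-≤ (g ys) (h ys (combos-length k xs m) (combos-∑≤ k xs a m)))) ⟩
    ∑ (combos k xs) (λ ys → D * g ys) ≡⟨ ∑-*ˡ (combos k xs) D g ⟩
    D * ∑ (combos k xs) g ∎
    where
    open ℕP.≤-Reasoning
    open +-*-Solver
    rotate : ∀ p q r → p * q * r ≡ p * r * q
    rotate = solve 3 (λ p q r → p :* q :* r := p :* r :* q) refl

  module _ (w : A → A → ℕ) (w-sym : ∀ x y → w x y ≡ w y x) (w-irr : ∀ x → w x x ≡ 0) where

    private
      clique : ℕ → List A → ℕ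
      clique t xs = ∑ (combos t xs) (pairProd w)

      -- Remove a vertex whose degree is at most the average.
      LightVertex : List A → Set
      LightVertex xs = ∃ λ y → ∃ λ ys → xs ↭ y ∷ ys × length xs * ∑ ys (w y) ≤ 2 * (∑ ys (w y) + weight w ys)

      remove-light : ∀ x xs → LightVertex (x ∷ xs)
      remove-light x xs with below-average x xs (λ y → ∑ (x ∷ xs) (w y))
      ... | y , y∈ , h with ∈⇒↭ y∈
      ...   | ys , p = y , ys , p , subst₂ (λ d s → length (x ∷ xs) * d ≤ s)
        (trans (∑-↭ (w y) p) (cong (_+ ∑ ys (w y)) (w-irr y)))
        (trans (degree-sum w w-sym w-irr (x ∷ xs))
          (cong (2 *_) (trans (∑-combos-↭ 2 (pairProd w) (pairProd-↭ w w-sym) p) (weight-∷ w y ys))))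
        h

      clique-remove : ∀ t {xs y ys} → xs ↭ y ∷ ys → clique (suc t) xs
        ≡ ∑ (combos t ys) (λ zs → prod zs (w y) * pairProd w zs) + clique (suc t) ys
      clique-remove t {y = y} {ys} p =
        trans (∑-combos-↭ (suc t) (pairProd w) (pairProd-↭ w w-sym) p) (∑-combos-∷ t y ys (pairProd w))

      weight-remove : ∀ {xs y ys} → xs ↭ y ∷ ys → weight w xs ≡ ∑ ys (w y) + weight w ys
      weight-remove {y = y} {ys} p = trans (∑-combos-↭ 2 (pairProd w) (pairProd-↭ w w-sym) p) (weight-∷ w y ys)

      length-remove : ∀ {xs : List A} {y ys m} → xs ↭ y ∷ ys → length xs ≤ suc m → length ys ≤ m
      length-remove p h = ℕP.≤-pred (subst (_≤ _) (PermP.↭-length p) h)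

      star₂ : ∀ y ys → ∑ (combos 2 ys) (λ zs → prod zs (w y) * pairProd w zs) * 4 ≤ (∑ ys (w y)) ^ 2 * weight w ys
      star₂ y ys = combos-prod-bound 2 4 _ (w y) (pairProd w) ys
        λ { (a ∷ b ∷ []) refl le → ℕP.≤-trans
              (ℕP.≤-reflexive (trans (ℕP.*-comm (w y a * (w y b * 1)) 4) (cong (λ t → 4 * (w y a * t)) (ℕP.*-identityʳ (w y b)))))
              (ℕP.≤-trans (4ab≤[a+b]² (w y a) (w y b))
                (ℕP.≤-trans (ℕP.≤-reflexive (solve 2 (λ a b → (a :+ b) :* (a :+ b) := (a :+ (b :+ con 0)) :^ 2) refl (w y a) (w y b)))
                  (ℕP.^-monoˡ-≤ 2 le))) }
        where open +-*-Solver

      star₃ : ∀ y ys → ∑ (combos 3 ys) (λ zs → prod zs (w y) * pairProd w zs) * 27 ≤ (∑ ys (w y)) ^ 3 * clique 3 ys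
      star₃ y ys = combos-prod-bound 3 27 _ (w y) (pairProd w) ys
        λ { (a ∷ b ∷ c ∷ []) refl le → ℕP.≤-trans
              (ℕP.≤-reflexive (cong (λ t → w y a * (w y b * t) * 27) (ℕP.*-identityʳ (w y c))))
              (ℕP.≤-trans (27abc≤[a+b+c]³ (w y a) (w y b) (w y c))
                (ℕP.^-monoˡ-≤ 3 (ℕP.≤-trans (ℕP.≤-reflexive (cong (λ t → w y a + (w y b + t)) (sym (ℕP.+-identityʳ (w y c))))) le))) }

      -- The claim reduces to 27d²r + 4r³ ≤ 4(d+r)³, which fails for d much larger than r.
      -- Substituting r = d + s leaves only nonnegative coefficients in the difference.
      cubic-step : ∀ d r f g → d ≤ r → f * 4 ≤ d ^ 2 * r → g * 27 ≤ r ^ 3 → (f + g) * 27 ≤ (d + r) ^ 3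
      cubic-step d r f g d≤r hf hg with ℕP.m≤n⇒∃[o]m+o≡n d≤r
      ... | s , refl = ℕP.*-cancelˡ-≤ 4 (begin
        4 * ((f + g) * 27) ≡⟨ solve 2 (λ f g → con 4 :* ((f :+ g) :* con 27) := con 27 :* (f :* con 4) :+ con 4 :* (g :* con 27)) refl f g ⟩
        27 * (f * 4) + 4 * (g * 27) ≤⟨ ℕP.+-mono-≤ (ℕP.*-monoʳ-≤ 27 hf) (ℕP.*-monoʳ-≤ 4 hg) ⟩
        27 * (d ^ 2 * (d + s)) + 4 * (d + s) ^ 3 ≤⟨ ℕP.m≤m+n _ (d ^ 3 + 9 * d ^ 2 * s + 12 * d * s ^ 2) ⟩
        27 * (d ^ 2 * (d + s)) + 4 * (d + s) ^ 3 + (d ^ 3 + 9 * d ^ 2 * s + 12 * d * s ^ 2)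
          ≡⟨ solve 2 (λ d s → con 27 :* (d :^ 2 :* (d :+ s)) :+ con 4 :* (d :+ s) :^ 3 :+ (d :^ 3 :+ con 9 :* d :^ 2 :* s :+ con 12 :* d :* s :^ 2)
               := con 4 :* (d :+ (d :+ s)) :^ 3) refl d s ⟩
        4 * (d + (d + s)) ^ 3 ∎)
        where
        open ℕP.≤-Reasoning
        open +-*-Solver

      2ab≤a²+b² : ∀ a b → 2 * (a * b) ≤ a * a + b * b
      2ab≤a²+b² a b = ℕP.+-cancelʳ-≤ (2 * (a * b)) _ _ (ℕP.≤-trans
        (ℕP.≤-reflexive (solve 2 (λ a b → con 2 :* (a :* b) :+ con 2 :* (a :* b) := con 4 :* (a :* b)) refl a b))
        (ℕP.≤-trans (4ab≤[a+b]² a b) (ℕP.≤-reflexive (solve 2 (λ a b → (a :+ b) :* (a :+ b) := (a :* a :+ b :* b) :+ con 2 :* (a :* b)) refl a b))))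
        where open +-*-Solver

      14xy≤6x²+6y² : ∀ x y → 9 * y ≤ 4 * x → 14 * (x * y) ≤ 6 * (x * x + y * y)
      14xy≤6x²+6y² x y le with ℕP.m≤n⇒∃[o]m+o≡n le
      ... | s , e = ℕP.*-cancelˡ-≤ 16 (begin
        16 * (14 * (x * y)) ≡⟨ solve 2 (λ x y → con 16 :* (con 14 :* (x :* y)) := con 56 :* ((con 4 :* x) :* y)) refl x y ⟩
        56 * (4 * x * y) ≡⟨ cong (λ X → 56 * (X * y)) (sym e) ⟩
        56 * ((9 * y + s) * y) ≤⟨ ℕP.m≤m+n _ (78 * (y * y) + 52 * (y * s) + 6 * (s * s)) ⟩
        56 * ((9 * y + s) * y) + (78 * (y * y) + 52 * (y * s) + 6 * (s * s))
          ≡⟨ solve 2 (λ y s → con 56 :* ((con 9 :* y :+ s) :* y) :+ (con 78 :* (y :* y) :+ con 52 :* (y :* s) :+ con 6 :* (s :* s))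
               := con 6 :* ((con 9 :* y :+ s) :* (con 9 :* y :+ s)) :+ con 96 :* (y :* y)) refl y s ⟩
        6 * ((9 * y + s) * (9 * y + s)) + 96 * (y * y) ≡⟨ cong (λ X → 6 * (X * X) + 96 * (y * y)) e ⟩
        6 * (4 * x * (4 * x)) + 96 * (y * y)
          ≡⟨ solve 2 (λ x y → con 6 :* (con 4 :* x :* (con 4 :* x)) :+ con 96 :* (y :* y) := con 16 :* (con 6 :* (x :* x :+ y :* y))) refl x y ⟩
        16 * (6 * (x * x + y * y)) ∎)
        where
        open ℕP.≤-Reasoning
        open +-*-Solver

      -- The right side consists of the terms of (d+r)⁶ other than r⁶, 20r³d³ and d⁶. The outer ones
      -- yield 14, by 9d² ≤ 4r², and the inner ones 2·15.
      44d³r³≤ : ∀ d r → 3 * d ≤ 2 * r → 44 * (d ^ 3 * r ^ 3)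
        ≤ r * d * (6 * (r * r * (r * r) + d * d * (d * d))) + 15 * (r * r * (d * d)) * (r * r + d * d)
      44d³r³≤ d r le = begin
        44 * (d ^ 3 * r ^ 3) ≡⟨ solve 2 (λ d r → con 44 :* (d :^ 3 :* r :^ 3)
            := r :* d :* (con 14 :* (r :* r :* (d :* d))) :+ con 15 :* (r :* r :* (d :* d)) :* (con 2 :* (r :* d))) refl d r ⟩
        r * d * (14 * (r * r * (d * d))) + 15 * (r * r * (d * d)) * (2 * (r * d))
          ≤⟨ ℕP.+-mono-≤ (ℕP.*-monoʳ-≤ (r * d) (14xy≤6x²+6y² (r * r) (d * d) 9d²≤4r²)) (ℕP.*-monoʳ-≤ (15 * (r * r * (d * d))) (2ab≤a²+b² r d)) ⟩
        _ ∎
        where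
        open ℕP.≤-Reasoning
        open +-*-Solver
        9d²≤4r² : 9 * (d * d) ≤ 4 * (r * r)
        9d²≤4r² = subst₂ _≤_ (solve 1 (λ d → (con 3 :* d) :* (con 3 :* d) := con 9 :* (d :* d)) refl d)
          (solve 1 (λ d → (con 2 :* d) :* (con 2 :* d) := con 4 :* (d :* d)) refl r) (ℕP.*-mono-≤ le le)

      -- As 46656 = 64·729, it remains to show 64d³r³ + r⁶ ≤ (d+r)⁶. Of the 64, the middle term of
      -- the expansion covers 20, and its neighbours the other 44.
      sextic-step : ∀ d r f g → 3 * d ≤ 2 * r → f * 729 ≤ d ^ 3 * r ^ 3 → g * 46656 ≤ r ^ 6 → (f + g) * 46656 ≤ (d + r) ^ 6
      sextic-step d r f g le hf hg = begin
        (f + g) * 46656 ≡⟨ trans (ℕP.*-distribʳ-+ 46656 f g) (cong (_+ g * 46656) (trans (sym (ℕP.*-assoc f 729 64)) (ℕP.*-comm (f * 729) 64))) ⟩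
        64 * (f * 729) + g * 46656 ≤⟨ ℕP.+-mono-≤ (ℕP.*-monoʳ-≤ 64 hf) hg ⟩
        64 * (d ^ 3 * r ^ 3) + r ^ 6 ≡⟨ cong (_+ r ^ 6) (ℕP.*-distribʳ-+ (d ^ 3 * r ^ 3) 44 20) ⟩
        44 * (d ^ 3 * r ^ 3) + 20 * (d ^ 3 * r ^ 3) + r ^ 6
          ≤⟨ ℕP.+-monoˡ-≤ (r ^ 6) (ℕP.+-monoˡ-≤ (20 * (d ^ 3 * r ^ 3)) (44d³r³≤ d r le)) ⟩
        E + 20 * (d ^ 3 * r ^ 3) + r ^ 6 ≤⟨ ℕP.m≤m+n _ (d ^ 6) ⟩
        E + 20 * (d ^ 3 * r ^ 3) + r ^ 6 + d ^ 6
          ≡⟨ solve 2 (λ d r → r :* d :* (con 6 :* (r :* r :* (r :* r) :+ d :* d :* (d :* d))) :+ con 15 :* (r :* r :* (d :* d)) :* (r :* r :+ d :* d)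
               :+ con 20 :* (d :^ 3 :* r :^ 3) :+ r :^ 6 :+ d :^ 6 := (d :+ r) :^ 6) refl d r ⟩
        (d + r) ^ 6 ∎
        where
        open ℕP.≤-Reasoning
        open +-*-Solver
        E = r * d * (6 * (r * r * (r * r) + d * d * (d * d))) + 15 * (r * r * (d * d)) * (r * r + d * d)

      clique₃ : ∀ x y z → clique 3 (x ∷ y ∷ z ∷ []) ≡ w x y * (w x z * w y z)
      clique₃ x y z = solve 3 (λ a b c → (a :* (b :* con 1)) :* ((c :* con 1) :* (con 1 :* con 1)) :+ con 0 := a :* (b :* c)) refl (w x y) (w x z) (w y z)
        where open +-*-Solver

      weight₃ : ∀ x y z → weight w (x ∷ y ∷ z ∷ []) ≡ w x y + (w x z + w y z)
      weight₃ x y z = trans (weight-∷ w x (y ∷ z ∷ [])) (trans (cong (w x y + (w x z + 0) +_) (weight-∷ w y (z ∷ [])))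
          (solve 3 (λ a b c → (a :+ (b :+ con 0)) :+ ((c :+ con 0) :+ con 0) := a :+ (b :+ c)) refl (w x y) (w x z) (w y z)))
        where open +-*-Solver

      clique₄ : ∀ x y z t → clique 4 (x ∷ y ∷ z ∷ t ∷ []) ≡ w x y * w x z * (w x t * w y z * (w y t * w z t))
      clique₄ x y z t = solve 6 (λ a b c d e f →
            (a :* (b :* (c :* con 1))) :* ((d :* (e :* con 1)) :* ((f :* con 1) :* (con 1 :* con 1))) :+ con 0
            := (a :* b) :* ((c :* d) :* (e :* f))) refl
            (w x y) (w x z) (w x t) (w y z) (w y t) (w z t)
        where open +-*-Solver

      weight₄ : ∀ x y z t → weight w (x ∷ y ∷ z ∷ t ∷ []) ≡ w x y + w x z + (w x t + w y z + (w y t + w z t))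
      weight₄ x y z t = trans (weight-∷ w x (y ∷ z ∷ t ∷ [])) (trans (cong (w x y + (w x z + (w x t + 0)) +_) (weight₃ y z t))
          (solve 6 (λ a b c d e f → (a :+ (b :+ (c :+ con 0))) :+ (d :+ (e :+ f)) := a :+ b :+ (c :+ d :+ (e :+ f))) refl
            (w x y) (w x z) (w x t) (w y z) (w y t) (w z t)))
        where open +-*-Solver

      transport≤ : ∀ c e {s s′ t t′} → s ≡ s′ → t ≡ t′ → s′ * c ≤ t′ ^ e → s * c ≤ t ^ e
      transport≤ c e refl refl h = h

      triangles≤ : ∀ m xs → length xs ≤ m → clique 3 xs * 27 ≤ weight w xs ^ 3
      triangles≤ m [] _ = z≤n
      triangles≤ m (x ∷ []) _ = z≤n
      triangles≤ m (x ∷ y ∷ []) _ = z≤n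
      triangles≤ m (x ∷ y ∷ z ∷ []) _ = transport≤ 27 3 (clique₃ x y z) (weight₃ x y z)
        (27abc≤[a+b+c]³ (w x y) (w x z) (w y z))
      triangles≤ (suc m) (x₁ ∷ x₂ ∷ x₃ ∷ x₄ ∷ xs) h = go (remove-light x₁ (x₂ ∷ x₃ ∷ x₄ ∷ xs))
        where
        go : LightVertex (x₁ ∷ x₂ ∷ x₃ ∷ x₄ ∷ xs) → clique 3 (x₁ ∷ x₂ ∷ x₃ ∷ x₄ ∷ xs) * 27 ≤ weight w (x₁ ∷ x₂ ∷ x₃ ∷ x₄ ∷ xs) ^ 3
        go (y , ys , p , light) = transport≤ 27 3 (clique-remove 2 p) (weight-remove p)
          (cubic-step d (weight w ys) (∑ (combos 2 ys) (λ zs → prod zs (w y) * pairProd w zs)) (clique 3 ys) d≤r (star₂ y ys) (triangles≤ m ys (length-remove p h)))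
          where
          open ℕP.≤-Reasoning
          open +-*-Solver
          d = ∑ ys (w y)
          -- From four vertices on, the least degree satisfies 4d ≤ 2(d+r), twice the total weight.
          d≤r : d ≤ weight w ys
          d≤r = ℕP.*-cancelˡ-≤ 2 (ℕP.+-cancelˡ-≤ (2 * d) (2 * d) (2 * weight w ys) (begin
            2 * d + 2 * d ≡⟨ solve 1 (λ d → con 2 :* d :+ con 2 :* d := con 4 :* d) refl d ⟩
            4 * d ≤⟨ ℕP.*-monoˡ-≤ d (s≤s (s≤s (s≤s (s≤s (z≤n {length xs}))))) ⟩
            (4 + length xs) * d ≤⟨ light ⟩
            2 * (d + weight w ys) ≡⟨ ℕP.*-distribˡ-+ 2 d (weight w ys) ⟩
            2 * d + 2 * weight w ys ∎))

      -- The K₄'s through the removed vertex weigh at most (d/3)³ times the triangles of the rest,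
      -- which weigh at most (r/3)³ by the previous case.
      K₄s≤ : ∀ m xs → length xs ≤ m → clique 4 xs * 46656 ≤ weight w xs ^ 6
      K₄s≤ m [] _ = z≤n
      K₄s≤ m (x ∷ []) _ = z≤n
      K₄s≤ m (x ∷ y ∷ []) _ = z≤n
      K₄s≤ m (x ∷ y ∷ z ∷ []) _ = z≤n
      K₄s≤ m (x ∷ y ∷ z ∷ t ∷ []) _ = transport≤ 46656 6 (clique₄ x y z t) (weight₄ x y z t)
        (amgm₆ (w x y) (w x z) (w x t) (w y z) (w y t) (w z t))
      K₄s≤ (suc m) (x₁ ∷ x₂ ∷ x₃ ∷ x₄ ∷ x₅ ∷ xs) h = go (remove-light x₁ (x₂ ∷ x₃ ∷ x₄ ∷ x₅ ∷ xs))
        where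
        go : LightVertex (x₁ ∷ x₂ ∷ x₃ ∷ x₄ ∷ x₅ ∷ xs) → clique 4 (x₁ ∷ x₂ ∷ x₃ ∷ x₄ ∷ x₅ ∷ xs) * 46656 ≤ weight w (x₁ ∷ x₂ ∷ x₃ ∷ x₄ ∷ x₅ ∷ xs) ^ 6
        go (y , ys , p , light) = transport≤ 46656 6 (clique-remove 3 p) (weight-remove p)
          (sextic-step d (weight w ys) f (clique 4 ys) 3d≤2r star (K₄s≤ m ys (length-remove p h)))
          where
          open ℕP.≤-Reasoning
          open +-*-Solver
          d = ∑ ys (w y)
          -- The case of four vertices was settled directly; five of them give 5d ≤ 2(d+r).
          3d≤2r : 3 * d ≤ 2 * weight w ys
          3d≤2r = ℕP.+-cancelˡ-≤ (2 * d) (3 * d) (2 * weight w ys) (begin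
            2 * d + 3 * d ≡⟨ solve 1 (λ d → con 2 :* d :+ con 3 :* d := con 5 :* d) refl d ⟩
            5 * d ≤⟨ ℕP.*-monoˡ-≤ d (s≤s (s≤s (s≤s (s≤s (s≤s (z≤n {length xs})))))) ⟩
            (5 + length xs) * d ≤⟨ light ⟩
            2 * (d + weight w ys) ≡⟨ ℕP.*-distribˡ-+ 2 d (weight w ys) ⟩
            2 * d + 2 * weight w ys ∎)
          f = ∑ (combos 3 ys) (λ zs → prod zs (w y) * pairProd w zs)
          star : f * 729 ≤ d ^ 3 * weight w ys ^ 3
          star = begin
            f * 729 ≡⟨ sym (ℕP.*-assoc f 27 27) ⟩
            f * 27 * 27 ≤⟨ ℕP.*-monoˡ-≤ 27 (star₃ y ys) ⟩
            d ^ 3 * clique 3 ys * 27 ≡⟨ ℕP.*-assoc (d ^ 3) (clique 3 ys) 27 ⟩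
            d ^ 3 * (clique 3 ys * 27) ≤⟨ ℕP.*-monoʳ-≤ (d ^ 3) (triangles≤ (length ys) ys ℕP.≤-refl) ⟩
            d ^ 3 * weight w ys ^ 3 ∎

    triangle-bound : ∀ xs → ∑ (combos 3 xs) (pairProd w) * 27 ≤ weight w xs ^ 3
    triangle-bound xs = triangles≤ (length xs) xs ℕP.≤-refl

    K₄-bound : ∀ xs → ∑ (combos 4 xs) (pairProd w) * 46656 ≤ weight w xs ^ 6
    K₄-bound xs = K₄s≤ (length xs) xs ℕP.≤-refl

^-superadditive : ∀ a b k → a ^ suc k + b ^ suc k ≤ (a + b) ^ suc k
^-superadditive a b zero = ℕP.≤-reflexive (solve 2 (λ a b → a :* con 1 :+ b :* con 1 := (a :+ b) :* con 1) refl a b)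
  where open +-*-Solver
^-superadditive a b (suc k) = begin
  a * a ^ suc k + b * b ^ suc k ≤⟨ ℕP.+-mono-≤ (ℕP.*-monoʳ-≤ a (ℕP.m≤m+n _ (b ^ suc k))) (ℕP.*-monoʳ-≤ b (ℕP.m≤n+m _ (a ^ suc k))) ⟩
  a * (a ^ suc k + b ^ suc k) + b * (a ^ suc k + b ^ suc k) ≡⟨ sym (ℕP.*-distribʳ-+ (a ^ suc k + b ^ suc k) a b) ⟩
  (a + b) * (a ^ suc k + b ^ suc k) ≤⟨ ℕP.*-monoʳ-≤ (a + b) (^-superadditive a b k) ⟩
  (a + b) * (a + b) ^ suc k ∎
  where open ℕP.≤-Reasoning

∑-^ : ∀ {A : Set} (xs : List A) f k → 1 ≤ k → ∑ xs (λ x → f x ^ k) ≤ ∑ xs f ^ k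
∑-^ [] f (suc k) _ = z≤n
∑-^ (x ∷ xs) f (suc k) h = ℕP.≤-trans (ℕP.+-monoʳ-≤ (f x ^ suc k) (∑-^ xs f (suc k) h)) (^-superadditive (f x) (∑ xs f) k)

-- Counting copies by codes

module _ {A : Set} where

  infix 4 _≋_
  _≋_ : List A → List A → Set
  xs ≋ ys = (∀ {v} → v ∈ xs → v ∈ ys) × (∀ {v} → v ∈ ys → v ∈ xs)

  unique-⊆-length : ∀ {xs ys : List A} → Unique xs → (∀ {v} → v ∈ xs → v ∈ ys) → length xs ≤ length ys
  unique-⊆-length {[]} _ _ = z≤n
  unique-⊆-length {x ∷ xs} {ys} (x∉ ∷ u) sub with ∈⇒↭ (sub (here refl))
  ... | zs , p = ℕP.≤-trans (s≤s (unique-⊆-length u sub′)) (ℕP.≤-reflexive (sym (PermP.↭-length p)))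
    where
    sub′ : ∀ {v} → v ∈ xs → v ∈ zs
    sub′ m with PermP.∈-resp-↭ p (sub (there m))
    ... | there m′ = m′
    ... | here refl = ⊥-elim (All.lookup x∉ m refl)

  unique-≋-length : ∀ {xs ys : List A} → Unique xs → Unique ys → xs ≋ ys → length xs ≡ length ys
  unique-≋-length u v (f , g) = ℕP.≤-antisym (unique-⊆-length u f) (unique-⊆-length v g)

  unique-↭ : ∀ {xs ys : List A} → xs ↭ ys → Unique xs → Unique ys
  unique-↭ Perm.refl u = u
  unique-↭ (prep x p) (x∉ ∷ u) = PermP.All-resp-↭ p x∉ ∷ unique-↭ p u
  unique-↭ (swap x y p) ((x≢y ∷ x∉) ∷ (y∉ ∷ u)) =
    ((λ e → x≢y (sym e)) ∷ PermP.All-resp-↭ p y∉) ∷ (PermP.All-resp-↭ p x∉ ∷ unique-↭ p u)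
  unique-↭ (Perm.trans p q) u = unique-↭ q (unique-↭ p u)

  -- A copy may have several codes; it is only the code that must determine the copy. Deleting the
  -- code of the first copy from `L` therefore leaves the codes of all the others.
  count-by-codes : ∀ {C : Set} (Codes : A → C → Set) → (∀ {a a′ c} → Codes a c → Codes a′ c → a ≡ a′) →
    ∀ (as : List A) (L : List C) → Unique as → (∀ {a} → a ∈ as → ∃ λ c → c ∈ L × Codes a c) → length as ≤ length L
  count-by-codes Codes inj [] L _ _ = z≤n
  count-by-codes Codes inj (a ∷ as) L (a∉ ∷ u) code with code (here refl)
  ... | c , c∈ , ac with ∈⇒↭ c∈
  ...   | L′ , p = ℕP.≤-trans (s≤s (count-by-codes Codes inj as L′ u code′)) (ℕP.≤-reflexive (sym (PermP.↭-length p)))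
    where
    code′ : ∀ {a′} → a′ ∈ as → ∃ λ c′ → c′ ∈ L′ × Codes a′ c′
    code′ m with code (there m)
    ... | c′ , c′∈ , a′c′ with PermP.∈-resp-↭ p c′∈
    ...   | there m′ = c′ , m′ , a′c′
    ...   | here refl = ⊥-elim (All.lookup a∉ m (inj ac a′c′))

  ∈-filterᵇ⁺ : ∀ (p : A → Bool) {x xs} → x ∈ xs → p x ≡ true → x ∈ filterᵇ p xs
  ∈-filterᵇ⁺ p {x} {x ∷ xs} (here refl) e with p x
  ... | true = here refl
  ∈-filterᵇ⁺ p {x} {y ∷ xs} (there m) e with p y
  ... | true = there (∈-filterᵇ⁺ p m e)
  ... | false = ∈-filterᵇ⁺ p m e

  ∈-filterᵇ⁻ : ∀ (p : A → Bool) {x} xs → x ∈ filterᵇ p xs → x ∈ xs × p x ≡ true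
  ∈-filterᵇ⁻ p (y ∷ xs) m with p y in e
  ∈-filterᵇ⁻ p (y ∷ xs) (here refl) | true = here refl , e
  ∈-filterᵇ⁻ p (y ∷ xs) (there m) | true = let (a , b) = ∈-filterᵇ⁻ p xs m in there a , b
  ∈-filterᵇ⁻ p (y ∷ xs) m | false = let (a , b) = ∈-filterᵇ⁻ p xs m in there a , b

  unique-filterᵇ : ∀ (p : A → Bool) {xs} → Unique xs → Unique (filterᵇ p xs)
  unique-filterᵇ p [] = []
  unique-filterᵇ p {x ∷ xs} (x∉ ∷ u) with p x
  ... | true = All.tabulate (λ m → All.lookup x∉ (proj₁ (∈-filterᵇ⁻ p xs m))) ∷ unique-filterᵇ p u
  ... | false = unique-filterᵇ p u

  -- A filter by a stronger predicate is one of the sublists enumerated by combos.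
  filter∈combos : ∀ (q r : A → Bool) → (∀ x → q x ≡ true → r x ≡ true) → ∀ xs →
    filterᵇ q xs ∈ combos (length (filterᵇ q xs)) (filterᵇ r xs)
  filter∈combos q r imp [] = here refl
  filter∈combos q r imp (x ∷ xs) with q x in eq | r x in er
  ... | true | true = ∈P.∈-++⁺ˡ (∈P.∈-map⁺ (x ∷_) (filter∈combos q r imp xs))
  ... | true | false = case trans (sym er) (imp x eq) of λ ()
  ... | false | false = filter∈combos q r imp xs
  ... | false | true with filterᵇ q xs | filter∈combos q r imp xs
  ...   | [] | _ = here refl
  ...   | y ∷ ys | m = ∈P.∈-++⁺ʳ (map (x ∷_) (combos (length ys) (filterᵇ r xs))) m

  combos-⊆ : ∀ k (xs : List A) {ys v} → ys ∈ combos k xs → v ∈ ys → v ∈ xs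
  combos-⊆ zero xs (here refl) ()
  combos-⊆ (suc k) (x ∷ xs) m v∈ with ∈P.∈-++⁻ (map (x ∷_) (combos k xs)) m
  ... | inj₂ m′ = there (combos-⊆ (suc k) xs m′ v∈)
  ... | inj₁ m′ with ∈P.∈-map⁻ (x ∷_) m′
  combos-⊆ (suc k) (x ∷ xs) m (here refl) | inj₁ m′ | zs , m″ , refl = here refl
  combos-⊆ (suc k) (x ∷ xs) m (there v∈) | inj₁ m′ | zs , m″ , refl = there (combos-⊆ k xs m″ v∈)

  combos-unique : ∀ k {xs ys : List A} → Unique xs → ys ∈ combos k xs → Unique ys
  combos-unique zero u (here refl) = []
  combos-unique (suc k) {x ∷ xs} (x∉ ∷ u) m with ∈P.∈-++⁻ (map (x ∷_) (combos k xs)) m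
  ... | inj₂ m′ = combos-unique (suc k) u m′
  ... | inj₁ m′ with ∈P.∈-map⁻ (x ∷_) m′
  ...   | zs , m″ , refl = All.tabulate (λ v∈ → All.lookup x∉ (combos-⊆ k xs m″ v∈)) ∷ combos-unique k u m″

  -- Used to bring a crowded vertex, if there is one, to the head of its class.
  front : (A → Bool) → List A → List A
  front p xs = filterᵇ p xs ++ filterᵇ (not ∘ p) xs

  front-≋ : ∀ p xs → front p xs ≋ xs
  front-≋ p xs = to , from
    where
    to : ∀ {v} → v ∈ front p xs → v ∈ xs
    to m with ∈P.∈-++⁻ (filterᵇ p xs) m
    ... | inj₁ a = proj₁ (∈-filterᵇ⁻ p xs a)
    ... | inj₂ a = proj₁ (∈-filterᵇ⁻ (not ∘ p) xs a)
    from : ∀ {v} → v ∈ xs → v ∈ front p xs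
    from {v} m with p v in e
    ... | true = ∈P.∈-++⁺ˡ (∈-filterᵇ⁺ p m e)
    ... | false = ∈P.∈-++⁺ʳ (filterᵇ p xs) (∈-filterᵇ⁺ (not ∘ p) m (cong not e))

  front-length : ∀ p xs → length (front p xs) ≡ length xs
  front-length p xs = trans (ListP.length-++ (filterᵇ p xs)) (go xs)
    where
    go : ∀ xs → length (filterᵇ p xs) + length (filterᵇ (not ∘ p) xs) ≡ length xs
    go [] = refl
    go (x ∷ xs) with p x
    ... | true = cong suc (go xs)
    ... | false = trans (ℕP.+-suc _ _) (cong suc (go xs))

  front-head : ∀ p {v xs} → v ∈ xs → p v ≡ true → ∃ λ y → ∃ λ ys → front p xs ≡ y ∷ ys × p y ≡ true
  front-head p {v} {xs} m e with filterᵇ p xs in eq | ∈-filterᵇ⁺ p m e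
  ... | y ∷ ys | _ = y , ys ++ filterᵇ (not ∘ p) xs , refl , proj₂ (∈-filterᵇ⁻ p {y} xs (subst (y ∈_) (sym eq) (here refl)))

  search : ∀ (p : A → Bool) xs → (∀ {x} → x ∈ xs → p x ≡ false) ⊎ ∃ λ x → x ∈ xs × p x ≡ true
  search p [] = inj₁ λ ()
  search p (x ∷ xs) with p x in e
  ... | true = inj₂ (x , here refl , e)
  ... | false with search p xs
  ...   | inj₂ (y , m , e′) = inj₂ (y , there m , e′)
  ...   | inj₁ h = inj₁ λ { (here refl) → e ; (there m) → h m }

  pairsOf : List A → List (A × A)
  pairsOf [] = []
  pairsOf (x ∷ xs) = map (x ,_) xs ++ pairsOf xs

  pairsOf-⊆ : ∀ {y y′} xs → (y , y′) ∈ pairsOf xs → y ∈ xs × y′ ∈ xs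
  pairsOf-⊆ (x ∷ xs) m with ∈P.∈-++⁻ (map (x ,_) xs) m
  ... | inj₂ m′ = let (a , b) = pairsOf-⊆ xs m′ in there a , there b
  ... | inj₁ m′ with ∈P.∈-map⁻ (x ,_) m′
  ...   | z , z∈ , refl = here refl , there z∈

  pairsOf-≢ : ∀ {y y′ xs} → Unique xs → (y , y′) ∈ pairsOf xs → y ≢ y′
  pairsOf-≢ {xs = x ∷ xs} (x∉ ∷ u) m with ∈P.∈-++⁻ (map (x ,_) xs) m
  ... | inj₂ m′ = pairsOf-≢ u m′
  ... | inj₁ m′ with ∈P.∈-map⁻ (x ,_) m′
  ...   | z , z∈ , refl = All.lookup x∉ z∈

  pairsOf-complete : ∀ {y y′} xs → y ∈ xs → y′ ∈ xs → y ≢ y′ → (y , y′) ∈ pairsOf xs ⊎ (y′ , y) ∈ pairsOf xs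
  pairsOf-complete (x ∷ xs) (here refl) (here refl) ne = ⊥-elim (ne refl)
  pairsOf-complete (x ∷ xs) (here refl) (there m) ne = inj₁ (∈P.∈-++⁺ˡ (∈P.∈-map⁺ (x ,_) m))
  pairsOf-complete (x ∷ xs) (there m) (here refl) ne = inj₂ (∈P.∈-++⁺ˡ (∈P.∈-map⁺ (x ,_) m))
  pairsOf-complete (x ∷ xs) (there m) (there m′) ne with pairsOf-complete xs m m′ ne
  ... | inj₁ p = inj₁ (∈P.∈-++⁺ʳ (map (x ,_) xs) p)
  ... | inj₂ p = inj₂ (∈P.∈-++⁺ʳ (map (x ,_) xs) p)

-- Copies described by hubs and classes.

-- Hubs are the images in a copy of the vertices of K_t.

-- A new vertex of the blow-up carries proofs about its pair of hubs. They have to be identified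
-- before a class can be seen to have exactly `k` members.
pair-irrelevant : ∀ {t} {i j : Fin t} (p q : toℕ i < toℕ j × K t i j ≡ true) → p ≡ q
pair-irrelevant (a , b) (a′ , b′) = cong₂ _,_ (ℕP.<-irrelevant a a′) (≡-irrelevant b b′)
  where open Decidable⇒UIP BoolP._≟_ using (≡-irrelevant)

module Copies {n : ℕ} where

  V : Set
  V = Fin n

  inS : SubData n → V → Bool
  inS (S , F) u = lookup S u

  edge : SubData n → V → V → Bool
  edge (S , F) u v = lookup (lookup F u) v

  between : SubData n → V → V → List V
  between c y y′ = filterᵇ (λ w → edge c y w ∧ edge c y′ w) (allFin n)

  ∈-between⁺ : ∀ c {y y′ w} → edge c y w ≡ true → edge c y′ w ≡ true → w ∈ between c y y′
  ∈-between⁺ c {w = w} e e′ = ∈-filterᵇ⁺ _ (∈P.∈-allFin w) (∧-intro e e′)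

  ∈-between⁻ : ∀ c {y y′ w} → w ∈ between c y y′ → edge c y w ≡ true × edge c y′ w ≡ true
  ∈-between⁻ c m = ∧-true (proj₂ (∈-filterᵇ⁻ _ (allFin n) m))

  between-sym : ∀ c y y′ {w} → w ∈ between c y y′ → w ∈ between c y′ y
  between-sym c y y′ m = let (a , b) = ∈-between⁻ c m in ∈-between⁺ c b a

  -- What is kept of a copy once its embedding is forgotten. It depends on `ys` only as a set, so
  -- that any hub can be moved to the front.
  record Hubs (G : Graph n) (k : ℕ) (c : SubData n) (ys : List V) : Set where
    field
      uniq : Unique ys
      sub : ∀ u v → edge c u v ≡ true → Graph.adj G u v ≡ true
      edge-sym : ∀ u v → edge c u v ≡ edge c v u
      edge-S : ∀ u v → edge c u v ≡ true → inS c u ≡ true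
      hub-S : ∀ {y} → y ∈ ys → inS c y ≡ true
      class-size : ∀ {y y′} → y ∈ ys → y′ ∈ ys → y ≢ y′ → length (between c y y′) ≡ k
      edges : ∀ u v → edge c u v ≡ true → ∃ λ y → ∃ λ y′ → y ∈ ys × y′ ∈ ys × y ≢ y′ ×
        ((u ≡ y × v ∈ between c y y′) ⊎ (v ≡ y × u ∈ between c y y′))
      verts : ∀ u → inS c u ≡ true → u ∈ ys ⊎ ∃ λ y → ∃ λ y′ → y ∈ ys × y′ ∈ ys × y ≢ y′ × u ∈ between c y y′

  Hubs-≋ : ∀ {G k c ys zs} → Hubs G k c ys → Unique zs → ys ≋ zs → Hubs G k c zs
  Hubs-≋ H u (to , from) = record
    { uniq = u ; sub = sub ; edge-sym = edge-sym ; edge-S = edge-S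
    ; hub-S = λ m → hub-S (from m)
    ; class-size = λ m m′ → class-size (from m) (from m′)
    ; edges = λ u v e → let (y , y′ , m , m′ , r) = edges u v e in y , y′ , to m , to m′ , r
    ; verts = λ u e → case verts u e of λ
        { (inj₁ m) → inj₁ (to m)
        ; (inj₂ (y , y′ , m , m′ , r)) → inj₂ (y , y′ , to m , to m′ , r) } }
    where open Hubs H

  Hubs-↭ : ∀ {G k c ys zs} → Hubs G k c ys → ys ↭ zs → Hubs G k c zs
  Hubs-↭ H p = Hubs-≋ H (unique-↭ p (Hubs.uniq H)) (PermP.∈-resp-↭ p , PermP.∈-resp-↭ (↭-sym p))

  -- One entry for every pair of hubs, together with its class. Neither the order of the entries nor
  -- that within a class affects the subgraph described.
  Code : Set
  Code = List ((V × V) × List V)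

  EntryEdge : V → V → (V × V) × List V → Set
  EntryEdge u v ((y , y′) , B) = ((u ≡ y ⊎ u ≡ y′) × v ∈ B) ⊎ ((v ≡ y ⊎ v ≡ y′) × u ∈ B)

  EntryVertex : V → (V × V) × List V → Set
  EntryVertex u ((y , y′) , B) = (u ≡ y ⊎ u ≡ y′) ⊎ u ∈ B

  record Codes (c : SubData n) (x : Code) : Set where
    field
      edge⁺ : ∀ u v → edge c u v ≡ true → Any (EntryEdge u v) x
      edge⁻ : ∀ u v → Any (EntryEdge u v) x → edge c u v ≡ true
      vert⁺ : ∀ u → inS c u ≡ true → Any (EntryVertex u) x
      vert⁻ : ∀ u → Any (EntryVertex u) x → inS c u ≡ true

  bool-ext : ∀ {a b} → (a ≡ true → b ≡ true) → (b ≡ true → a ≡ true) → a ≡ b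
  bool-ext {true} f g = sym (f refl)
  bool-ext {false} {false} f g = refl
  bool-ext {false} {true} f g = g refl

  vec-ext : ∀ {A : Set} {m} (xs ys : Vec A m) → (∀ i → lookup xs i ≡ lookup ys i) → xs ≡ ys
  vec-ext xs ys h = trans (sym (VecP.tabulate∘lookup xs)) (trans (VecP.tabulate-cong h) (VecP.tabulate∘lookup ys))

  Codes-injective : ∀ {c c′ x} → Codes c x → Codes c′ x → c ≡ c′
  Codes-injective {c} {c′} a b = cong₂ _,_
    (vec-ext _ _ λ u → bool-ext (λ e → B.vert⁻ u (A.vert⁺ u e)) (λ e → A.vert⁻ u (B.vert⁺ u e)))
    (vec-ext _ _ λ u → vec-ext _ _ λ v → bool-ext (λ e → B.edge⁻ u v (A.edge⁺ u v e)) (λ e → A.edge⁻ u v (B.edge⁺ u v e)))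
    where
    module A = Codes a
    module B = Codes b

  codeOf : (V → V → List V) → List V → Code
  codeOf B ys = map (λ (y , y′) → (y , y′) , B y y′) (pairsOf ys)

  -- `B` may list each class in any order. Two hubs are demanded because a hub is recorded only
  -- through the pairs that contain it.
  Hubs⇒Codes : ∀ {G k c y₀ y₁ ys} (B : V → V → List V) → (∀ y y′ → B y y′ ≋ between c y y′) →
    Hubs G k c (y₀ ∷ y₁ ∷ ys) → Codes c (codeOf B (y₀ ∷ y₁ ∷ ys))
  Hubs⇒Codes {c = c} {y₀} {y₁} {ys} B B≋ H = record
    { edge⁺ = λ u v e → case edges u v e of λ
        { (y , y′ , m , m′ , ne , inj₁ (refl , v∈)) → entry m m′ ne
             (λ w∈ → inj₁ (inj₁ refl , w∈ v∈)) (λ w∈ → inj₁ (inj₂ refl , w∈ v∈))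
        ; (y , y′ , m , m′ , ne , inj₂ (refl , u∈)) → entry m m′ ne
             (λ w∈ → inj₂ (inj₁ refl , w∈ u∈)) (λ w∈ → inj₂ (inj₂ refl , w∈ u∈)) }
    ; edge⁻ = λ u v a → let (y , y′ , _ , q) = back a in back-edge y y′ q
    ; vert⁺ = vert⁺
    ; vert⁻ = λ u a → let (y , y′ , p , q) = back a in back-vert y y′ p q }
    where
    open Hubs H
    hubs = y₀ ∷ y₁ ∷ ys
    entry : ∀ {P : (V × V) × List V → Set} {y y′} → y ∈ hubs → y′ ∈ hubs → y ≢ y′ →
      ((∀ {w} → w ∈ between c y y′ → w ∈ B y y′) → P ((y , y′) , B y y′)) →
      ((∀ {w} → w ∈ between c y y′ → w ∈ B y′ y) → P ((y′ , y) , B y′ y)) → Any P (codeOf B hubs)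
    entry {P} {y} {y′} m m′ ne f g with pairsOf-complete hubs m m′ ne
    ... | inj₁ p = Any.map (λ { refl → f (λ w∈ → proj₂ (B≋ y y′) w∈) }) (∈P.∈-map⁺ (λ (y , y′) → (y , y′) , B y y′) p)
    ... | inj₂ p = Any.map (λ { refl → g (λ w∈ → proj₂ (B≋ y′ y) (between-sym c y y′ w∈)) }) (∈P.∈-map⁺ (λ (y , y′) → (y , y′) , B y y′) p)
    back : ∀ {P : (V × V) × List V → Set} → Any P (codeOf B hubs) → ∃ λ y → ∃ λ y′ → (y , y′) ∈ pairsOf hubs × P ((y , y′) , B y y′)
    back a with find a
    ... | e , e∈ , p with ∈P.∈-map⁻ _ e∈
    ...   | (y , y′) , yy′∈ , refl = y , y′ , yy′∈ , p
    back-edge : ∀ {u v} y y′ → EntryEdge u v ((y , y′) , B y y′) → edge c u v ≡ true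
    back-edge y y′ (inj₁ (inj₁ refl , v∈)) = proj₁ (∈-between⁻ c (proj₁ (B≋ y y′) v∈))
    back-edge y y′ (inj₁ (inj₂ refl , v∈)) = proj₂ (∈-between⁻ c (proj₁ (B≋ y y′) v∈))
    back-edge y y′ (inj₂ (inj₁ refl , u∈)) = trans (edge-sym _ _) (proj₁ (∈-between⁻ c (proj₁ (B≋ y y′) u∈)))
    back-edge y y′ (inj₂ (inj₂ refl , u∈)) = trans (edge-sym _ _) (proj₂ (∈-between⁻ c (proj₁ (B≋ y y′) u∈)))
    back-vert : ∀ {u} y y′ → (y , y′) ∈ pairsOf hubs → EntryVertex u ((y , y′) , B y y′) → inS c u ≡ true
    back-vert y y′ p (inj₁ (inj₁ refl)) = hub-S (proj₁ (pairsOf-⊆ hubs p))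
    back-vert y y′ p (inj₁ (inj₂ refl)) = hub-S (proj₂ (pairsOf-⊆ hubs p))
    back-vert {u} y y′ p (inj₂ u∈) = edge-S u y (trans (edge-sym u y) (proj₁ (∈-between⁻ c (proj₁ (B≋ y y′) u∈))))
    y₀≢y₁ : y₀ ≢ y₁
    y₀≢y₁ with uniq
    ... | (ne ∷ _) ∷ _ = ne
    other : ∀ {y} → y ∈ hubs → ∃ λ y′ → y′ ∈ hubs × y ≢ y′
    other (here refl) = y₁ , there (here refl) , y₀≢y₁
    other (there m) = y₀ , here refl , (λ e → case uniq of λ { (y∉ ∷ _) → All.lookup y∉ m (sym e) })
    vert⁺ : ∀ u → inS c u ≡ true → Any (EntryVertex u) (codeOf B hubs)
    vert⁺ u e with verts u e
    ... | inj₁ m = let (y′ , m′ , ne) = other m in entry m m′ ne (λ _ → inj₁ (inj₁ refl)) (λ _ → inj₁ (inj₂ refl))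
    ... | inj₂ (y , y′ , m , m′ , ne , u∈) = entry m m′ ne (λ w∈ → inj₂ (w∈ u∈)) (λ w∈ → inj₂ (w∈ u∈))

  module FromCopy (G : Graph n) (t k : ℕ) (c : SubData n) (copy : IsCopy G (KBlow t k) c) where
    private
      φ = proj₁ (proj₂ (proj₂ copy))
      φ-inj = proj₁ (proj₂ (proj₂ (proj₂ copy)))
      φ-S = proj₁ (proj₂ (proj₂ (proj₂ (proj₂ copy))))
      φ-onto = proj₁ (proj₂ (proj₂ (proj₂ (proj₂ (proj₂ copy)))))
      φ-adj = proj₂ (proj₂ (proj₂ (proj₂ (proj₂ (proj₂ copy)))))
      P = BlowUpV t (K t) k
      A = blowUpAdj t (K t) k

      A-sym : ∀ a b → A a b ≡ A b a
      A-sym (inj₁ _) (inj₁ _) = refl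
      A-sym (inj₁ _) (inj₂ _) = refl
      A-sym (inj₂ _) (inj₁ _) = refl
      A-sym (inj₂ _) (inj₂ _) = refl

      onto : ∀ u v → edge c u v ≡ true → (∃ λ a → φ a ≡ u) × (∃ λ b → φ b ≡ v)
      onto u v e = let (su , sv) = proj₁ (proj₂ copy) u v e in φ-onto u su , φ-onto v sv

    hub : Fin t → V
    hub i = φ (inj₁ i)

    private
      hub-inj : ∀ {i j} → hub i ≡ hub j → i ≡ j
      hub-inj e = case φ-inj _ _ e of λ { refl → refl }

      Between : Fin t → Fin t → V → Set
      Between i j w = ∃ λ p → ∃ λ l → w ≡ φ (inj₂ (i , j , p , l))

      endpoints : ∀ (x i j : Fin t) → (x == i) ∨ (x == j) ≡ true → x ≡ i ⊎ x ≡ j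
      endpoints x i j e with x Fin.≟ i
      ... | yes eq = inj₁ eq
      ... | no _ = inj₂ (==⇒≡ e)

      left : ∀ (i j : Fin t) → (i == i) ∨ (i == j) ≡ true
      left i j rewrite ==-refl i = refl

      right : ∀ (i j : Fin t) → (j == i) ∨ (j == j) ≡ true
      right i j rewrite ==-refl j = BoolP.∨-zeroʳ _

      K-true : ∀ {i j : Fin t} → toℕ i ℕ.< toℕ j → toℕ i ℕ.< toℕ j × K t i j ≡ true
      K-true {i} {j} lt = lt , cong not (≢⇒== {i = i} {j} λ { refl → ℕP.<-irrefl refl lt })

      between-hubs : ∀ {i j} → toℕ i ℕ.< toℕ j → ∀ {w} → w ∈ between c (hub i) (hub j) → Between i j w
      between-hubs {i} {j} lt {w} m with ∈-between⁻ c m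
      ... | e , e′ with proj₂ (onto _ _ e)
      ...   | inj₁ x , refl = case trans (φ-adj (inj₁ i) (inj₁ x)) e of λ ()
      ...   | inj₂ (i′ , j′ , p , l) , refl
        with endpoints i i′ j′ (trans (φ-adj (inj₁ i) (inj₂ (i′ , j′ , p , l))) e) | endpoints j i′ j′ (trans (φ-adj (inj₁ j) (inj₂ (i′ , j′ , p , l))) e′)
      ...     | inj₁ refl | inj₂ refl = p , l , refl
      ...     | inj₁ refl | inj₁ refl = ⊥-elim (ℕP.<-irrefl refl lt)
      ...     | inj₂ refl | inj₂ refl = ⊥-elim (ℕP.<-irrefl refl lt)
      ...     | inj₂ refl | inj₁ refl = ⊥-elim (ℕP.<-asym lt (proj₁ p))

      hubs-between : ∀ {i j} → ∀ {w} → Between i j w → w ∈ between c (hub i) (hub j)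
      hubs-between {i} {j} (p , l , refl) = ∈-between⁺ c
        (trans (sym (φ-adj (inj₁ i) (inj₂ (i , j , p , l)))) (left i j)) (trans (sym (φ-adj (inj₁ j) (inj₂ (i , j , p , l)))) (right i j))

      class-size< : ∀ {i j} → toℕ i ℕ.< toℕ j → length (between c (hub i) (hub j)) ≡ k
      class-size< {i} {j} lt = trans (unique-≋-length
          (unique-filterᵇ _ (UniqueP.allFin⁺ n))
          (UniqueP.map⁺ (λ {l} {l′} e → case φ-inj _ _ e of λ { refl → refl }) (UniqueP.allFin⁺ k))
          ((λ m → let (p , l , e) = between-hubs lt m in
              subst (_∈ map blow (allFin k)) (sym (trans e (cong (λ q → φ (inj₂ (i , j , q , l))) (pair-irrelevant p (K-true lt))))) (∈P.∈-map⁺ blow (∈P.∈-allFin l)))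
          , (λ m → let (l , _ , e) = ∈P.∈-map⁻ blow m in hubs-between (K-true lt , l , e))))
        (trans (ListP.length-map blow (allFin k)) (ListP.length-tabulate {n = k} (λ i → i)))
        where
        blow : Fin k → V
        blow l = φ (inj₂ (i , j , K-true lt , l))

    hubs : List V
    hubs = map hub (allFin t)

    length-hubs : length hubs ≡ t
    length-hubs = trans (ListP.length-map hub (allFin t)) (ListP.length-tabulate {n = t} (λ i → i))

    private
      hub∈ : ∀ i → hub i ∈ hubs
      hub∈ i = ∈P.∈-map⁺ hub (∈P.∈-allFin i)

      class-size′ : ∀ {y y′} → y ∈ hubs → y′ ∈ hubs → y ≢ y′ → length (between c y y′) ≡ k
      class-size′ m m′ ne with ∈P.∈-map⁻ hub m | ∈P.∈-map⁻ hub m′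
      ... | i , _ , refl | j , _ , refl with ℕP.<-cmp (toℕ i) (toℕ j)
      ...   | tri< lt _ _ = class-size< lt
      ...   | tri≈ _ e _ = ⊥-elim (ne (cong hub (FinP.toℕ-injective e)))
      ...   | tri> _ _ gt = trans (unique-≋-length (unique-filterᵇ _ (UniqueP.allFin⁺ n)) (unique-filterᵇ _ (UniqueP.allFin⁺ n))
          (between-sym c (hub i) (hub j) , between-sym c (hub j) (hub i))) (class-size< gt)

      hub≢ : ∀ {i j} → toℕ i ℕ.< toℕ j → hub i ≢ hub j
      hub≢ lt e = ℕP.<-irrefl (cong toℕ (hub-inj e)) lt

      edges′ : ∀ u v → edge c u v ≡ true → ∃ λ y → ∃ λ y′ → y ∈ hubs × y′ ∈ hubs × y ≢ y′ ×
        ((u ≡ y × v ∈ between c y y′) ⊎ (v ≡ y × u ∈ between c y y′))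
      edges′ u v e with onto u v e
      ... | (inj₁ x , refl) , (inj₁ y , refl) = case trans (φ-adj (inj₁ x) (inj₁ y)) e of λ ()
      ... | (inj₂ x , refl) , (inj₂ y , refl) = case trans (φ-adj (inj₂ x) (inj₂ y)) e of λ ()
      ... | (inj₁ x , refl) , (inj₂ (i , j , p , l) , refl) with endpoints x i j (trans (φ-adj (inj₁ x) (inj₂ (i , j , p , l))) e)
      ...   | inj₁ refl = hub i , hub j , hub∈ i , hub∈ j , hub≢ (proj₁ p) , inj₁ (refl , hubs-between (p , l , refl))
      ...   | inj₂ refl = hub j , hub i , hub∈ j , hub∈ i , (λ q → hub≢ (proj₁ p) (sym q)) , inj₁ (refl , between-sym c (hub i) (hub j) (hubs-between (p , l , refl)))
      edges′ u v e | (inj₂ (i , j , p , l) , refl) , (inj₁ x , refl) with endpoints x i j (trans (φ-adj (inj₂ (i , j , p , l)) (inj₁ x)) e)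
      ...   | inj₁ refl = hub i , hub j , hub∈ i , hub∈ j , hub≢ (proj₁ p) , inj₂ (refl , hubs-between (p , l , refl))
      ...   | inj₂ refl = hub j , hub i , hub∈ j , hub∈ i , (λ q → hub≢ (proj₁ p) (sym q)) , inj₂ (refl , between-sym c (hub i) (hub j) (hubs-between (p , l , refl)))

      verts′ : ∀ u → inS c u ≡ true → u ∈ hubs ⊎ ∃ λ y → ∃ λ y′ → y ∈ hubs × y′ ∈ hubs × y ≢ y′ × u ∈ between c y y′
      verts′ u e with φ-onto u e
      ... | inj₁ x , refl = inj₁ (hub∈ x)
      ... | inj₂ (i , j , p , l) , refl = inj₂ (hub i , hub j , hub∈ i , hub∈ j , hub≢ (proj₁ p) , hubs-between (p , l , refl))

      edge-sym′ : ∀ u v → edge c u v ≡ edge c v u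
      edge-sym′ u v = bool-ext (flip-edge u v) (flip-edge v u)
        where
        flip-edge : ∀ u v → edge c u v ≡ true → edge c v u ≡ true
        flip-edge u v e with onto u v e
        ... | (a , refl) , (b , refl) = trans (sym (φ-adj b a)) (trans (A-sym b a) (trans (φ-adj a b) e))

    isHubs : Hubs G k c hubs
    isHubs = record
      { uniq = UniqueP.map⁺ hub-inj (UniqueP.allFin⁺ t)
      ; sub = proj₁ copy
      ; edge-sym = edge-sym′
      ; edge-S = λ u v e → proj₁ (proj₁ (proj₂ copy) u v e)
      ; hub-S = λ m → case ∈P.∈-map⁻ hub m of λ { (i , _ , refl) → φ-S (inj₁ i) }
      ; class-size = class-size′
      ; edges = edges′
      ; verts = verts′ }

-- Enumerations and their sizes.

bind : ∀ {A B C : Set} → (A → B → C) → List A → (A → List B) → List C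
bind f [] g = []
bind f (x ∷ xs) g = map (f x) (g x) ++ bind f xs g

length-bind : ∀ {A B C : Set} (f : A → B → C) xs g → length (bind f xs g) ≡ ∑ xs (λ x → length (g x))
length-bind f [] g = refl
length-bind f (x ∷ xs) g = trans (ListP.length-++ (map (f x) (g x))) (cong₂ _+_ (ListP.length-map (f x) (g x)) (length-bind f xs g))

length-product : ∀ {A B C : Set} (f : A → B → C) xs ys → length (bind f xs (λ _ → ys)) ≡ length xs * length ys
length-product f xs ys = trans (length-bind f xs (λ _ → ys)) (∑-const xs (length ys))

∈-bind : ∀ {A B C : Set} (f : A → B → C) {x xs y} (g : A → List B) → x ∈ xs → y ∈ g x → f x y ∈ bind f xs g
∈-bind f {x} g (here refl) m = ∈P.∈-++⁺ˡ (∈P.∈-map⁺ (f x) m)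
∈-bind f {xs = x ∷ xs} g (there n) m = ∈P.∈-++⁺ʳ (map (f x) (g x)) (∈-bind f g n m)

lists : ∀ {A : Set} → ℕ → List A → List (List A)
lists zero xs = [] ∷ []
lists (suc k) xs = bind _∷_ xs (λ _ → lists k xs)

length-lists : ∀ {A : Set} k (xs : List A) → length (lists k xs) ≡ length xs ^ k
length-lists zero xs = refl
length-lists (suc k) xs = trans (length-product _∷_ xs (lists k xs)) (cong (length xs *_) (length-lists k xs))

∈-lists : ∀ {A : Set} k {xs ys : List A} → length ys ≡ k → (∀ {v} → v ∈ ys → v ∈ xs) → ys ∈ lists k xs
∈-lists zero {ys = []} refl _ = here refl
∈-lists (suc k) {xs} {y ∷ ys} refl h = ∈-bind _∷_ (λ _ → lists k xs) (h (here refl)) (∈-lists k refl (λ m → h (there m)))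

private
  bernoulli : ∀ m k → m ^ suc k + suc k * m ^ k ≤ suc m ^ suc k
  bernoulli m zero = ℕP.≤-reflexive (solve 1 (λ m → m :* con 1 :+ con 1 := (con 1 :+ m) :* con 1) refl m)
    where open +-*-Solver using (solve; _:+_; _:*_; _:^_; _:=_; con)
  bernoulli m (suc k) = begin
    m * (m * p) + suc (suc k) * (m * p)
      ≤⟨ ℕP.m≤m+n _ (suc k * p) ⟩
    m * (m * p) + suc (suc k) * (m * p) + suc k * p
      ≡⟨ solve 3 (λ m k p → m :* (m :* p) :+ (con 2 :+ k) :* (m :* p) :+ (con 1 :+ k) :* p := (con 1 :+ m) :* (m :* p :+ (con 1 :+ k) :* p)) refl m k p ⟩
    suc m * (m ^ suc k + suc k * m ^ k) ≤⟨ ℕP.*-monoʳ-≤ (suc m) (bernoulli m k) ⟩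
    suc m * suc m ^ suc k ∎
    where
    open ℕP.≤-Reasoning
    open +-*-Solver using (solve; _:+_; _:*_; _:^_; _:=_; con)
    p = m ^ k

-- Pascal's recursion for the binomial coefficient, compared with m^(k+1) + (k+1)m^k ≤ (m+1)^(k+1).
combos-count-≤ : ∀ {A : Set} k (xs : List A) → k ! * length (combos k xs) ≤ length xs ^ k
combos-count-≤ zero xs = ℕP.≤-refl
combos-count-≤ (suc k) [] = ℕP.≤-reflexive (ℕP.*-zeroʳ (suc k !))
combos-count-≤ (suc k) (x ∷ xs) = begin
  suc k ! * length (combos (suc k) (x ∷ xs))
    ≡⟨ cong (suc k ! *_) (trans (ListP.length-++ (map (x ∷_) (combos k xs))) (cong (_+ length (combos (suc k) xs)) (ListP.length-map (x ∷_) (combos k xs)))) ⟩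
  suc k ! * (a + b) ≡⟨ solve 4 (λ k f a b → ((con 1 :+ k) :* f) :* (a :+ b) := ((con 1 :+ k) :* f) :* b :+ (con 1 :+ k) :* (f :* a)) refl k (k !) a b ⟩
  suc k ! * b + suc k * (k ! * a) ≤⟨ ℕP.+-mono-≤ (combos-count-≤ (suc k) xs) (ℕP.*-monoʳ-≤ (suc k) (combos-count-≤ k xs)) ⟩
  length xs ^ suc k + suc k * length xs ^ k ≤⟨ bernoulli (length xs) k ⟩
  suc (length xs) ^ suc k ∎
  where
  open ℕP.≤-Reasoning
  open +-*-Solver using (solve; _:+_; _:*_; _:^_; _:=_; con)
  a = length (combos k xs)
  b = length (combos (suc k) xs)

-- The sum `e j` is the binomial coefficient of s over j, where s entries satisfy `p`. The last
-- conclusion (s < 3 leaves at most one pair) is the one applied; the other two carry the induction.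
∑-combos-≤1 : ∀ {A : Set} (p : A → Bool) xs → let e = λ j → ∑ (combos j xs) (λ ys → prod ys (λ y → ⟦ p y ⟧)) in
  (e 1 ≡ 0 → e 2 ≡ 0) × (e 2 ≡ 0 → e 1 ≤ 1) × (e 3 ≡ 0 → e 2 ≤ 1)
∑-combos-≤1 {A} p [] = (λ _ → refl) , (λ _ → z≤n) , (λ _ → z≤n)
∑-combos-≤1 {A} p (x ∷ xs) with ∑-combos-≤1 p xs
... | h₁ , h₂ , h₃ = go (p x) refl
  where
  e : ℕ → List A → ℕ
  e j xs = ∑ (combos j xs) (λ ys → prod ys (λ y → ⟦ p y ⟧))
  step-e : ∀ j → e (suc j) (x ∷ xs) ≡ ⟦ p x ⟧ * e j xs + e (suc j) xs
  step-e j = trans (∑-combos-∷ j x xs _) (cong (_+ e (suc j) xs) (∑-*ˡ (combos j xs) ⟦ p x ⟧ _))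
  go : ∀ b → p x ≡ b → (e 1 (x ∷ xs) ≡ 0 → e 2 (x ∷ xs) ≡ 0) × (e 2 (x ∷ xs) ≡ 0 → e 1 (x ∷ xs) ≤ 1) × (e 3 (x ∷ xs) ≡ 0 → e 2 (x ∷ xs) ≤ 1)
  go false px = subst₂ (λ a b → (a ≡ 0 → b ≡ 0) × (b ≡ 0 → a ≤ 1) × (e 3 (x ∷ xs) ≡ 0 → b ≤ 1)) (same 0) (same 1)
      (h₁ , h₂ , λ z → h₃ (trans (same 2) z))
    where
    same : ∀ j → e (suc j) xs ≡ e (suc j) (x ∷ xs)
    same j = sym (trans (step-e j) (cong (λ b → ⟦ b ⟧ * e j xs + e (suc j) xs) px))
  go true px = (λ z → case trans (sym (more 0)) z of λ ())
    , (λ z → subst (_≤ 1) (sym (more 0)) (s≤s (ℕP.≤-reflexive (ℕP.m+n≡0⇒m≡0 (e 1 xs) (trans (sym (more 1)) z)))))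
    , (λ z → let e2=0 = ℕP.m+n≡0⇒m≡0 (e 2 xs) (trans (sym (more 2)) z) in
        subst (_≤ 1) (sym (trans (more 1) (trans (cong (e 1 xs +_) e2=0) (ℕP.+-identityʳ _)))) (h₂ e2=0))
    where
    more : ∀ j → e (suc j) (x ∷ xs) ≡ e j xs + e (suc j) xs
    more j = trans (step-e j) (trans (cong (λ b → ⟦ b ⟧ * e j xs + e (suc j) xs) px) (cong (_+ e (suc j) xs) (ℕP.+-identityʳ (e j xs))))

⌊≤⌋-true : ∀ {a b} → ⌊ a ℕ.≤? b ⌋ ≡ true → a ≤ b
⌊≤⌋-true {a} {b} e with a ℕ.≤? b
... | yes p = p

⌊≤⌋-false : ∀ {a b} → ⌊ a ℕ.≤? b ⌋ ≡ false → b < a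
⌊≤⌋-false {a} {b} e with a ℕ.≤? b
... | no ¬p = ℕP.≰⇒> ¬p

prod-pairsOf : ∀ {A : Set} (w : A → A → ℕ) xs → prod (pairsOf xs) (λ (y , y′) → w y y′) ≡ pairProd w xs
prod-pairsOf w [] = refl
prod-pairsOf w (x ∷ xs) = trans (prod-++ (map (x ,_) xs) (pairsOf xs)) (cong₂ _*_ (prod-map xs) (prod-pairsOf w xs))
  where
  prod-++ : ∀ as bs → prod (as ++ bs) (λ (y , y′) → w y y′) ≡ prod as (λ (y , y′) → w y y′) * prod bs (λ (y , y′) → w y y′)
  prod-++ [] bs = sym (ℕP.+-identityʳ _)
  prod-++ ((y , y′) ∷ as) bs = trans (cong (w y y′ *_) (prod-++ as bs)) (sym (ℕP.*-assoc (w y y′) _ _))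
  prod-map : ∀ ys → prod (map (x ,_) ys) (λ (y , y′) → w y y′) ≡ prod ys (w x)
  prod-map [] = refl
  prod-map (y ∷ ys) = cong (w x y *_) (prod-map ys)

^-distribʳ-* : ∀ k m n → (m * n) ^ k ≡ m ^ k * n ^ k
^-distribʳ-* zero m n = refl
^-distribʳ-* (suc k) m n = trans (cong (m * n *_) (^-distribʳ-* k m n))
  (solve 4 (λ a b c d → (a :* b) :* (c :* d) := (a :* c) :* (b :* d)) refl m n (m ^ k) (n ^ k))
  where open +-*-Solver using (solve; _:+_; _:*_; _:^_; _:=_; con)

memb : ∀ {n} → List (Fin n) → Fin n → Bool
memb [] v = false
memb (y ∷ ys) v = (y == v) ∨ memb ys v

memb⁺ : ∀ {n} {ys : List (Fin n)} {v} → v ∈ ys → memb ys v ≡ true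
memb⁺ {ys = y ∷ ys} (here refl) rewrite ==-refl y = refl
memb⁺ {ys = y ∷ ys} {v} (there m) rewrite memb⁺ m = BoolP.∨-zeroʳ (y == v)

memb⁻ : ∀ {n} (ys : List (Fin n)) {v} → memb ys v ≡ true → v ∈ ys
memb⁻ (y ∷ ys) {v} e with y == v in eq
... | true = here (sym (==⇒≡ {i = y} eq))
... | false = there (memb⁻ ys e)

-- Large vertices and the main term.

module Large {n : ℕ} (G : Graph n) (D : PlaneDrawing G) (1≤n : 1 ≤ n) (τ : ℕ) where
  open Graph G using (adj) renaming (sym to adj-sym; loopless to adj-irrefl)
  open Copies {n}

  private
    vs : List V
    vs = allFin n

  deg : V → ℕ
  deg x = count (adj x)

  everything : Subset n
  everything _ = true

  count-everything : count everything ≡ n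
  count-everything = trans (∑-1 vs) length-allFin

  nbrs : V → List V
  nbrs x = filterᵇ (adj x) vs

  length-nbrs : ∀ x → length (nbrs x) ≡ deg x
  length-nbrs x = length-filter (adj x) vs

  ∈-nbrs : ∀ {x v} → adj x v ≡ true → v ∈ nbrs x
  ∈-nbrs {x} {v} e = ∈-filterᵇ⁺ (adj x) (∈P.∈-allFin v) e

  degree-total : ∑ᶠ deg ≤ 24 * n
  degree-total = subst (λ c → ∑ᶠ deg ≤ 24 * c) count-everything (sparse G D everything)

  edgeList : Subset n → List (V × V)
  edgeList U = bind _,_ vs (λ u → filterᵇ (λ v → U u ∧ (U v ∧ adj u v)) vs)

  length-edgeList : ∀ U → length (edgeList U) ≡ edgesIn adj U
  length-edgeList U = trans (length-bind _,_ vs _) (∑-cong vs (λ u → length-filter _ vs))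

  ∈-edgeList : ∀ U {u v} → U u ≡ true → U v ≡ true → adj u v ≡ true → (u , v) ∈ edgeList U
  ∈-edgeList U {u} {v} a b e = ∈-bind _,_ _ (∈P.∈-allFin u) (∈-filterᵇ⁺ _ (∈P.∈-allFin v) (∧-intro a (∧-intro b e)))

  length-all-edges : length (edgeList everything) ≤ 24 * n
  length-all-edges = subst (_≤ 24 * n) (sym (length-edgeList everything)) degree-total

  large : V → Bool
  large x = ⌊ n ℕ.≤? τ * deg x ⌋

  small-deg : ∀ {x} → large x ≡ false → τ * deg x ≤ n
  small-deg e = ℕP.<⇒≤ (⌊≤⌋-false e)

  A : List V
  A = filterᵇ large vs

  A-unique : Unique A
  A-unique = unique-filterᵇ large (UniqueP.allFin⁺ n)

  -- Markov's inequality for the degrees.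
  A-size : count large ≤ 24 * τ
  A-size = ℕP.*-cancelʳ-≤ (count large) (24 * τ) n {{ℕ.>-nonZero 1≤n}} (begin
    count large * n ≡⟨ sym (∑-*ʳ vs n (λ x → ⟦ large x ⟧)) ⟩
    (∑ᶠ λ x → ⟦ large x ⟧ * n) ≤⟨ ∑-mono vs (λ x → ℕP.≤-trans (⟦⟧-cond (large x) ⌊≤⌋-true) (⟦⟧*≤ (large x) _)) ⟩
    (∑ᶠ λ x → τ * deg x) ≡⟨ ∑-*ˡ vs τ deg ⟩
    τ * ∑ᶠ deg ≤⟨ ℕP.*-monoʳ-≤ τ degree-total ⟩
    τ * (24 * n) ≡⟨ solve 3 (λ t c n → t :* (c :* n) := c :* t :* n) refl τ 24 n ⟩
    24 * τ * n ∎)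
    where
    open ℕP.≤-Reasoning
    open +-*-Solver using (solve; _:+_; _:*_; _:^_; _:=_; con)

  -- Positive exactly if `b` has three neighbours in `A`. In this form the crowded vertices are
  -- double counted by interchanging two sums.
  triples : V → ℕ
  triples b = ∑ (combos 3 A) (λ ys → prod ys (λ y → ⟦ adj y b ⟧))

  crowded : V → Bool
  crowded b = ⌊ 1 ℕ.≤? triples b ⌋

  -- Each triple from `A` has at most two common neighbours, and there are at most |A|³ triples.
  crowded-count : count crowded ≤ 2 * count large ^ 3
  crowded-count = begin
    count crowded ≤⟨ ∑-mono vs (λ b → indicator (triples b)) ⟩
    ∑ᶠ triples ≡⟨ ∑-swap vs (combos 3 A) (λ b ys → prod ys (λ y → ⟦ adj y b ⟧)) ⟩
    ∑ (combos 3 A) (λ ys → ∑ᶠ λ b → prod ys (λ y → ⟦ adj y b ⟧)) ≤⟨ ∑-mono-∈ (combos 3 A) (λ ys m → few ys (combos-length 3 A m) (combos-unique 3 A-unique m)) ⟩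
    ∑ (combos 3 A) (λ _ → 2) ≡⟨ trans (∑-const (combos 3 A) 2) (ℕP.*-comm (length (combos 3 A)) 2) ⟩
    2 * length (combos 3 A) ≤⟨ ℕP.*-monoʳ-≤ 2 (ℕP.≤-trans (ℕP.m≤n*m (length (combos 3 A)) 6) (combos-count-≤ 3 A)) ⟩
    2 * length A ^ 3 ≡⟨ cong (λ c → 2 * c ^ 3) (length-filter large vs) ⟩
    2 * count large ^ 3 ∎
    where
    open ℕP.≤-Reasoning
    indicator : ∀ m → ⟦ ⌊ 1 ℕ.≤? m ⌋ ⟧ ≤ m
    indicator zero = z≤n
    indicator (suc m) = s≤s z≤n
    few : ∀ ys → length ys ≡ 3 → Unique ys → (∑ᶠ λ b → prod ys (λ y → ⟦ adj y b ⟧)) ≤ 2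
    few (x ∷ y ∷ z ∷ []) refl ((x≢y ∷ x≢z ∷ []) ∷ (y≢z ∷ []) ∷ _) = ℕP.≤-trans
      (ℕP.≤-reflexive (∑-cong vs (λ b → sym (trans (⟦∧⟧ (adj x b) (adj y b ∧ adj z b))
        (cong (⟦ adj x b ⟧ *_) (trans (⟦∧⟧ (adj y b) (adj z b)) (cong (⟦ adj y b ⟧ *_) (sym (ℕP.*-identityʳ ⟦ adj z b ⟧)))))))))
      (few-common G D x y z x≢y x≢z y≢z)

  -- The first factor makes the weights vanish on the diagonal, as the clique inequality requires.
  joins : V → V → V → Bool
  joins y y′ v = not (y == y′) ∧ (adj y v ∧ (adj y′ v ∧ not (crowded v)))

  Com : V → V → List V
  Com y y′ = filterᵇ (joins y y′) vs

  w : V → V → ℕ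
  w y y′ = length (Com y y′)

  private
    w-count : ∀ y y′ → w y y′ ≡ count (joins y y′)
    w-count y y′ = length-filter (joins y y′) vs

    w-sym : ∀ y y′ → w y y′ ≡ w y′ y
    w-sym y y′ = trans (w-count y y′) (trans (∑-cong vs (λ v → cong₂ (λ a b → ⟦ not a ∧ b ⟧) (==-sym y y′) (flip-∧ (adj y v) (adj y′ v) (not (crowded v))))) (sym (w-count y′ y)))
      where
      flip-∧ : ∀ a b c → a ∧ (b ∧ c) ≡ b ∧ (a ∧ c)
      flip-∧ true b c = refl
      flip-∧ false b c = sym (BoolP.∧-zeroʳ b)

    w-irr : ∀ y → w y y ≡ 0
    w-irr y = trans (w-count y y) (trans (∑-cong vs (λ v → cong (λ a → ⟦ not a ∧ (adj y v ∧ (adj y v ∧ not (crowded v))) ⟧) (==-refl y))) (∑-zero vs))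

  weight≤n : weight w A ≤ n
  weight≤n = begin
    weight w A ≤⟨ ∑-mono-∈ (combos 2 A) (λ ys m → pair ys (combos-length 2 A m)) ⟩
    ∑ (combos 2 A) (λ ys → ∑ᶠ λ b → ⟦ not (crowded b) ⟧ * prod ys (λ y → ⟦ adj y b ⟧)) ≡⟨ ∑-swap (combos 2 A) vs _ ⟩
    (∑ᶠ λ b → ∑ (combos 2 A) (λ ys → ⟦ not (crowded b) ⟧ * prod ys (λ y → ⟦ adj y b ⟧))) ≤⟨ ∑-mono vs once ⟩
    ∑ vs (λ _ → 1) ≡⟨ count-everything ⟩
    n ∎
    where
    open ℕP.≤-Reasoning
    pair : ∀ ys → length ys ≡ 2 → pairProd w ys ≤ (∑ᶠ λ b → ⟦ not (crowded b) ⟧ * prod ys (λ y → ⟦ adj y b ⟧))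
    pair (y ∷ y′ ∷ []) refl = ℕP.≤-trans
      (ℕP.≤-reflexive (trans (ℕP.*-identityʳ _) (trans (ℕP.*-identityʳ _) (w-count y y′))))
      (∑-mono vs (λ b → bound (not (y == y′)) (adj y b) (adj y′ b) (not (crowded b))))
      where
      bound : ∀ e a a′ c → ⟦ e ∧ (a ∧ (a′ ∧ c)) ⟧ ≤ ⟦ c ⟧ * (⟦ a ⟧ * (⟦ a′ ⟧ * 1))
      bound false a a′ c = z≤n
      bound true false a′ c = z≤n
      bound true true false c = z≤n
      bound true true true true = ℕP.≤-refl
      bound true true true false = ℕP.≤-refl
    once : ∀ b → ∑ (combos 2 A) (λ ys → ⟦ not (crowded b) ⟧ * prod ys (λ y → ⟦ adj y b ⟧)) ≤ 1
    once b = ℕP.≤-trans (ℕP.≤-reflexive (∑-*ˡ (combos 2 A) ⟦ not (crowded b) ⟧ _)) (go (crowded b) refl)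
      where
      go : ∀ c → crowded b ≡ c → ⟦ not c ⟧ * ∑ (combos 2 A) (λ ys → prod ys (λ y → ⟦ adj y b ⟧)) ≤ 1
      go true _ = z≤n
      go false e = ℕP.≤-trans (ℕP.≤-reflexive (ℕP.*-identityˡ _))
        (proj₂ (proj₂ (∑-combos-≤1 (λ y → adj y b) A)) (ℕP.n<1⇒n≡0 (⌊≤⌋-false e)))

  triangle-weight : ∑ (combos 3 A) (pairProd w) * 27 ≤ n ^ 3
  triangle-weight = ℕP.≤-trans (triangle-bound w w-sym w-irr A) (ℕP.^-monoˡ-≤ 3 weight≤n)

  K₄-weight : ∑ (combos 4 A) (pairProd w) * 46656 ≤ n ^ 6
  K₄-weight = ℕP.≤-trans (K₄-bound w w-sym w-irr A) (ℕP.^-monoˡ-≤ 6 weight≤n)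

  -- These copies give the main term.
  classChoices : ℕ → List (V × V) → List Code
  classChoices k [] = [] ∷ []
  classChoices k ((y , y′) ∷ ps) = bind (λ B x → ((y , y′) , B) ∷ x) (combos k (Com y y′)) (λ _ → classChoices k ps)

  mainCodes : ℕ → ℕ → List Code
  mainCodes t k = bind (λ _ x → x) (combos t A) (λ ys → classChoices k (pairsOf ys))

  ∈-classChoices : ∀ k ps (B : V → V → List V) → (∀ {y y′} → (y , y′) ∈ ps → B y y′ ∈ combos k (Com y y′)) →
    map (λ (y , y′) → (y , y′) , B y y′) ps ∈ classChoices k ps
  ∈-classChoices k [] B h = here refl
  ∈-classChoices k ((y , y′) ∷ ps) B h = ∈-bind _ _ (h (here refl)) (∈-classChoices k ps B (λ m → h (there m)))

  classChoices-count : ∀ k ps → (k !) ^ length ps * length (classChoices k ps) ≤ prod ps (λ (y , y′) → w y y′) ^ k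
  classChoices-count k [] = ℕP.≤-reflexive (trans (ℕP.+-identityʳ 1) (sym (ℕP.^-zeroˡ k)))
  classChoices-count k ((y , y′) ∷ ps) = begin
    (k !) ^ suc (length ps) * length (classChoices k ((y , y′) ∷ ps))
      ≡⟨ cong ((k !) ^ suc (length ps) *_) (length-product _ (combos k (Com y y′)) (classChoices k ps)) ⟩
    k ! * (k !) ^ length ps * (c * r) ≡⟨ solve 4 (λ a b c d → a :* b :* (c :* d) := (a :* c) :* (b :* d)) refl (k !) ((k !) ^ length ps) c r ⟩
    k ! * c * ((k !) ^ length ps * r) ≤⟨ ℕP.*-mono-≤ (combos-count-≤ k (Com y y′)) (classChoices-count k ps) ⟩
    w y y′ ^ k * prod ps (λ (y , y′) → w y y′) ^ k ≡⟨ sym (^-distribʳ-* k (w y y′) _) ⟩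
    (w y y′ * prod ps (λ (y , y′) → w y y′)) ^ k ∎
    where
    open ℕP.≤-Reasoning
    open +-*-Solver using (solve; _:+_; _:*_; _:^_; _:=_; con)
    c = length (combos k (Com y y′))
    r = length (classChoices k ps)

  -- Choosing k-sets instead of single vertices raises the weight of every clique to the power k. A
  -- sum of k-th powers is at most the k-th power of the sum, so the inequality for single vertices
  -- suffices.
  mainCodes-count : ∀ t e k → 1 ≤ k → (∀ ys → length ys ≡ t → length (pairsOf {V} ys) ≡ e) →
    (k !) ^ e * length (mainCodes t k) ≤ ∑ (combos t A) (pairProd w) ^ k
  mainCodes-count t e k 1≤k pairs≡ = begin
    (k !) ^ e * length (mainCodes t k) ≡⟨ cong ((k !) ^ e *_) (length-bind (λ _ x → x) (combos t A) _) ⟩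
    (k !) ^ e * ∑ (combos t A) (λ ys → length (classChoices k (pairsOf ys))) ≡⟨ sym (∑-*ˡ (combos t A) ((k !) ^ e) _) ⟩
    ∑ (combos t A) (λ ys → (k !) ^ e * length (classChoices k (pairsOf ys))) ≤⟨ ∑-mono-∈ (combos t A) each ⟩
    ∑ (combos t A) (λ ys → pairProd w ys ^ k) ≤⟨ ∑-^ (combos t A) (pairProd w) k 1≤k ⟩
    ∑ (combos t A) (pairProd w) ^ k ∎
    where
    open ℕP.≤-Reasoning
    each : ∀ ys → ys ∈ combos t A → (k !) ^ e * length (classChoices k (pairsOf ys)) ≤ pairProd w ys ^ k
    each ys m = subst₂ (λ a b → (k !) ^ a * length (classChoices k (pairsOf ys)) ≤ b ^ k) (pairs≡ ys (combos-length t A m)) (prod-pairsOf w ys)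
      (classChoices-count k (pairsOf ys))

  -- The hubs are relisted in the order of all vertices first, since `combos t A` contains each set
  -- of hubs in that order only.
  main-code : ∀ {t k c ys} → 2 ≤ t → length ys ≡ t → Hubs G k c ys → (∀ {y} → y ∈ ys → large y ≡ true) →
    (∀ {y y′ v} → y ∈ ys → y′ ∈ ys → y ≢ y′ → v ∈ between c y y′ → crowded v ≡ false) →
    ∃ λ x → x ∈ mainCodes t k × Codes c x
  main-code {t} {k} {c} {ys} 2≤t len H all-large calm = go zs zs∈ H′ (subst (2 ≤_) (sym len′) 2≤t) λ m → proj₂ zs≋ m
    where
    zs : List V
    zs = filterᵇ (memb ys) vs
    zs≋ : ys ≋ zs
    zs≋ = (λ m → ∈-filterᵇ⁺ _ (∈P.∈-allFin _) (memb⁺ m)) , (λ m → memb⁻ ys (proj₂ (∈-filterᵇ⁻ _ vs m)))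
    H′ : Hubs G k c zs
    H′ = Hubs-≋ H (unique-filterᵇ _ (UniqueP.allFin⁺ n)) zs≋
    len′ : length zs ≡ t
    len′ = trans (unique-≋-length (Hubs.uniq H′) (Hubs.uniq H) (proj₂ zs≋ , proj₁ zs≋)) len
    zs∈ : zs ∈ combos t A
    zs∈ = subst (λ m → zs ∈ combos m A) len′ (filter∈combos (memb ys) large (λ x e → all-large (memb⁻ ys e)) vs)
    go : ∀ zs → zs ∈ combos t A → Hubs G k c zs → 2 ≤ length zs → (∀ {v} → v ∈ zs → v ∈ ys) → ∃ λ x → x ∈ mainCodes t k × Codes c x
    go (y₀ ∷ []) _ _ (s≤s ())
    go zs@(y₀ ∷ y₁ ∷ _) m H′ _ sub = codeOf (between c) zs
      , ∈-bind (λ _ x → x) _ m (∈-classChoices k (pairsOf zs) (between c) class)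
      , Hubs⇒Codes (between c) (λ y y′ → (λ v → v) , (λ v → v)) H′
      where
      open Hubs H′ using () renaming (sub to edge-sub)
      class : ∀ {y y′} → (y , y′) ∈ pairsOf zs → between c y y′ ∈ combos k (Com y y′)
      class {y} {y′} p = subst (λ j → between c y y′ ∈ combos j (Com y y′)) (Hubs.class-size H′ (proj₁ yy′) (proj₂ yy′) y≢y′)
        (filter∈combos _ (joins y y′) (λ v e → ∧-intro (cong not (≢⇒== y≢y′)) (∧-intro (edge-sub y v (proj₁ (∧-true e)))
          (∧-intro (edge-sub y′ v (proj₂ (∧-true {edge c y v} e)))
            (cong not (calm (sub (proj₁ yy′)) (sub (proj₂ yy′)) y≢y′ (∈-between⁺ c (proj₁ (∧-true e)) (proj₂ (∧-true {edge c y v} e)))))))) vs)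
        where
        yy′ = pairsOf-⊆ zs p
        y≢y′ = pairsOf-≢ (Hubs.uniq H′) p

-- Error terms: crowded vertices and small hubs.

∈-bind⁻ : ∀ {A B C : Set} (f : A → B → C) xs (g : A → List B) {z} → z ∈ bind f xs g → ∃ λ x → ∃ λ y → x ∈ xs × y ∈ g x × z ≡ f x y
∈-bind⁻ f (x ∷ xs) g m with ∈P.∈-++⁻ (map (f x) (g x)) m
... | inj₁ m′ = let (y , y∈ , e) = ∈P.∈-map⁻ (f x) m′ in x , y , here refl , y∈ , e
... | inj₂ m′ = let (x′ , y , x∈ , y∈ , e) = ∈-bind⁻ f xs g m′ in x′ , y , there x∈ , y∈ , e

infixr 5 _⊗_
_⊗_ : ∀ {A B : Set} → List A → List B → List (A × B)
xs ⊗ ys = bind _,_ xs (λ _ → ys)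

length-⊗ : ∀ {A B : Set} (xs : List A) (ys : List B) → length (xs ⊗ ys) ≡ length xs * length ys
length-⊗ = length-product _,_

∈-⊗ : ∀ {A B : Set} {x : A} {y : B} {xs ys} → x ∈ xs → y ∈ ys → (x , y) ∈ xs ⊗ ys
∈-⊗ {ys = ys} = ∈-bind _,_ (λ _ → ys)

-- A wrapped bound on a length: the lists then appear as indices and are inferred when bounds are
-- multiplied along `⊗`.
record Card≤ {A : Set} (xs : List A) (a : ℕ) : Set where
  constructor card≤
  field card : length xs ≤ a
open Card≤

infixr 5 _⊗≤_
_⊗≤_ : ∀ {A B : Set} {xs : List A} {ys : List B} {a b} → Card≤ xs a → Card≤ ys b → Card≤ (xs ⊗ ys) (a * b)
_⊗≤_ {xs = xs} {ys} (card≤ p) (card≤ q) = card≤ (ℕP.≤-trans (ℕP.≤-reflexive (length-⊗ xs ys)) (ℕP.*-mono-≤ p q))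

two-front : ∀ {A : Set} {y y′ : A} {ys} → y ∈ ys → y′ ∈ ys → y ≢ y′ → ∃ λ zs → ys ↭ y ∷ y′ ∷ zs
two-front m m′ ne with ∈⇒↭ m
... | zs , p with PermP.∈-resp-↭ p m′
...   | here e = ⊥-elim (ne (sym e))
...   | there m″ with ∈⇒↭ m″
...     | ws , q = ws , Perm.trans p (prep _ q)

nonempty : ∀ {A : Set} {k} (xs : List A) → length xs ≡ suc k → ∃ λ y → ∃ λ ys → xs ≡ y ∷ ys
nonempty (y ∷ ys) _ = y , ys , refl

module Classify {n : ℕ} (G : Graph n) (D : PlaneDrawing G) (1≤n : 1 ≤ n) (τ : ℕ) where
  open Graph G using (adj) renaming (sym to adj-sym; loopless to adj-irrefl)
  open Copies {n}
  open Large G D 1≤n τ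

  vs : List V
  vs = allFin n

  members : SubData n → List V → List ((V × V) × V)
  members c ys = bind _,_ (pairsOf ys) (λ (y , y′) → between c y y′)

  ∈-members⁺ : ∀ c {ys y y′ v} → y ∈ ys → y′ ∈ ys → y ≢ y′ → v ∈ between c y y′ → ∃ λ p → (p , v) ∈ members c ys
  ∈-members⁺ c {ys} {y} {y′} m m′ ne v∈ with pairsOf-complete ys m m′ ne
  ... | inj₁ p = (y , y′) , ∈-bind _,_ _ p v∈
  ... | inj₂ p = (y′ , y) , ∈-bind _,_ _ p (between-sym c y y′ v∈)

  ∈-members⁻ : ∀ c {ys y y′ v} → Unique ys → ((y , y′) , v) ∈ members c ys → y ∈ ys × y′ ∈ ys × y ≢ y′ × v ∈ between c y y′
  ∈-members⁻ c {ys} u m with ∈-bind⁻ _,_ (pairsOf ys) _ m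
  ... | (y , y′) , v , p , v∈ , refl = proj₁ (pairsOf-⊆ ys p) , proj₂ (pairsOf-⊆ ys p) , pairsOf-≢ u p , v∈

  record CrowdedPair (k : ℕ) (c : SubData n) (t : ℕ) : Set where
    field
      x y : V
      zs : List V
      len : length (x ∷ y ∷ zs) ≡ t
      hubs : Hubs G k c (x ∷ y ∷ zs)
      x-large : large x ≡ true
      v : V
      v∈ : v ∈ between c x y
      v-crowded : crowded v ≡ true

  classify : ∀ {t k c ys} → 2 ≤ t → length ys ≡ t → Hubs G k c ys → (∀ {y} → y ∈ ys → large y ≡ true) →
    (∃ λ x → x ∈ mainCodes t k × Codes c x) ⊎ CrowdedPair k c t
  classify {c = c} {ys} 2≤t len H all-large with search (crowded ∘ proj₂) (members c ys)
  ... | inj₁ calm = inj₁ (main-code 2≤t len H all-large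
          (λ m m′ ne v∈ → let (p , q) = ∈-members⁺ c m m′ ne v∈ in calm q))
  ... | inj₂ (((y , y′) , v) , m , v-crowded) with ∈-members⁻ c (Hubs.uniq H) m
  ...   | y∈ , y′∈ , y≢y′ , v∈ with two-front y∈ y′∈ y≢y′
  ...     | zs , p = inj₂ record
    { x = y ; y = y′ ; zs = zs ; len = trans (sym (PermP.↭-length p)) len ; hubs = Hubs-↭ H p
    ; x-large = all-large y∈ ; v = v ; v∈ = v∈ ; v-crowded = v-crowded }

  -- An edge from a large hub to a crowded vertex lies inside this set of O(τ³) vertices, so by
  -- sparsity there are only O(τ³) such edges instead of O(n).
  Busy : Subset n
  Busy x = large x ∨ crowded x

  edgesList : List (V × V)
  edgesList = edgeList everything

  busyEdges : List (V × V)
  busyEdges = edgeList Busy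

  count-Busy : count Busy ≤ count large + count crowded
  count-Busy = ℕP.≤-trans (∑-mono vs (λ x → bound (large x) (crowded x))) (ℕP.≤-reflexive (∑-+ vs _ _))
    where
    bound : ∀ a b → ⟦ a ∨ b ⟧ ≤ ⟦ a ⟧ + ⟦ b ⟧
    bound true b = s≤s z≤n
    bound false b = ℕP.≤-refl

  -- The outer 24 comes from sparsity, the inner 24 from the number of large vertices and 2·24³ from
  -- the crowded ones; τ is bounded by τ³.
  busy-edges-bound : ∀ m → 1 ≤ τ → m * τ ^ 3 ≤ n → m * length busyEdges ≤ n * (24 * (24 + 2 * 24 ^ 3))
  busy-edges-bound m 1≤τ mτ³≤n = estimate 24 (length busyEdges) (count large) (count crowded) A-size crowded-count
      (ℕP.≤-trans (ℕP.≤-reflexive (length-edgeList Busy)) (ℕP.≤-trans (sparse G D Busy) (ℕP.*-monoʳ-≤ 24 count-Busy)))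
    where
    open +-*-Solver using (solve; _:+_; _:*_; _:^_; _:=_; con)
    open ℕP.≤-Reasoning
    estimate : ∀ a E L C → L ≤ a * τ → C ≤ 2 * L ^ 3 → E ≤ a * (L + C) → m * E ≤ n * (a * (a + 2 * a ^ 3))
    estimate a E L C hL hC hE = begin
      m * E ≤⟨ ℕP.*-monoʳ-≤ m (ℕP.≤-trans hE (ℕP.*-monoʳ-≤ a (ℕP.+-mono-≤ hL (ℕP.≤-trans hC (ℕP.*-monoʳ-≤ 2 (ℕP.^-monoˡ-≤ 3 hL)))))) ⟩
      m * (a * (a * τ + 2 * (a * τ) ^ 3)) ≤⟨ ℕP.*-monoʳ-≤ m (ℕP.*-monoʳ-≤ a (ℕP.+-monoˡ-≤ _ (ℕP.*-monoʳ-≤ a τ≤τ³))) ⟩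
      m * (a * (a * τ ^ 3 + 2 * (a * τ) ^ 3))
        ≡⟨ solve 3 (λ m a t → m :* (a :* (a :* t :^ 3 :+ con 2 :* (a :* t) :^ 3)) := m :* t :^ 3 :* (a :* (a :+ con 2 :* a :^ 3))) refl m a τ ⟩
      m * τ ^ 3 * (a * (a + 2 * a ^ 3)) ≤⟨ ℕP.*-monoˡ-≤ (a * (a + 2 * a ^ 3)) mτ³≤n ⟩
      n * (a * (a + 2 * a ^ 3)) ∎
      where
      τ≤τ³ : τ ≤ τ ^ 3
      τ≤τ³ = ℕP.≤-trans (ℕP.≤-reflexive (sym (ℕP.*-identityʳ τ))) (ℕP.*-monoʳ-≤ τ (ℕP.*-mono-≤ 1≤τ (ℕP.*-mono-≤ 1≤τ (ℕP.≤-refl {1}))))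

  starSum : ℕ → ℕ
  starSum j = ∑ᶠ λ x → ⟦ not (large x) ⟧ * deg x ^ j

  -- Of the j+1 factors deg x of a small vertex, j are at most n/τ each and the last is summed over
  -- all vertices.
  starSum-bound : ∀ m C j → m ≤ C * τ ^ j → m * starSum (suc j) ≤ C * (n ^ j * (24 * n))
  starSum-bound m C j m≤ = begin
    m * starSum (suc j) ≤⟨ ℕP.*-monoˡ-≤ (starSum (suc j)) m≤ ⟩
    C * τ ^ j * starSum (suc j) ≡⟨ ℕP.*-assoc C (τ ^ j) _ ⟩
    C * (τ ^ j * starSum (suc j)) ≡⟨ cong (C *_) (sym (∑-*ˡ vs (τ ^ j) _)) ⟩
    C * (∑ᶠ λ x → τ ^ j * (⟦ not (large x) ⟧ * deg x ^ suc j)) ≤⟨ ℕP.*-monoʳ-≤ C (∑-mono vs pointwise) ⟩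
    C * (∑ᶠ λ x → n ^ j * deg x) ≡⟨ cong (C *_) (∑-*ˡ vs (n ^ j) deg) ⟩
    C * (n ^ j * ∑ᶠ deg) ≤⟨ ℕP.*-monoʳ-≤ C (ℕP.*-monoʳ-≤ (n ^ j) degree-total) ⟩
    C * (n ^ j * (24 * n)) ∎
    where
    open ℕP.≤-Reasoning
    open +-*-Solver using (solve; _:+_; _:*_; _:^_; _:=_; con)
    pointwise : ∀ x → τ ^ j * (⟦ not (large x) ⟧ * deg x ^ suc j) ≤ n ^ j * deg x
    pointwise x = go (large x) refl
      where
      go : ∀ b → large x ≡ b → τ ^ j * (⟦ not b ⟧ * deg x ^ suc j) ≤ n ^ j * deg x
      go true _ = ℕP.≤-trans (ℕP.≤-reflexive (ℕP.*-zeroʳ (τ ^ j))) z≤n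
      go false e = begin
        τ ^ j * (1 * (deg x * deg x ^ j)) ≡⟨ solve 3 (λ t d p → t :* (con 1 :* (d :* p)) := (t :* p) :* d) refl (τ ^ j) (deg x) (deg x ^ j) ⟩
        τ ^ j * deg x ^ j * deg x ≡⟨ cong (_* deg x) (sym (^-distribʳ-* j τ (deg x))) ⟩
        (τ * deg x) ^ j * deg x ≤⟨ ℕP.*-monoˡ-≤ (deg x) (ℕP.^-monoˡ-≤ j (small-deg e)) ⟩
        n ^ j * deg x ∎

  smalls : List V
  smalls = filterᵇ (not ∘ large) vs

  ∈-smalls : ∀ {x} → large x ≡ false → x ∈ smalls
  ∈-smalls e = ∈-filterᵇ⁺ (not ∘ large) (∈P.∈-allFin _) (cong not e)

  ∑-smalls : ∀ f → ∑ smalls f ≡ ∑ᶠ λ x → ⟦ not (large x) ⟧ * f x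
  ∑-smalls = ∑-filter (not ∘ large) vs

  edges≤ : Card≤ edgesList (24 * n)
  edges≤ = card≤ length-all-edges

  vlists≤ : ∀ k → Card≤ (lists k vs) (n ^ k)
  vlists≤ k = card≤ (ℕP.≤-reflexive (trans (length-lists k vs) (cong (_^ k) length-allFin)))

  ∈-vlists : ∀ {k ys} → length ys ≡ k → ys ∈ lists k vs
  ∈-vlists {k} e = ∈-lists k e (λ {v} _ → ∈P.∈-allFin v)

  length-nbr-lists : ∀ k x → length (lists k (nbrs x)) ≡ deg x ^ k
  length-nbr-lists k x = trans (length-lists k (nbrs x)) (cong (_^ k) (length-nbrs x))

  class : SubData n → V → V → List V
  class c y y′ = front crowded (between c y y′)

  class-≋ : ∀ c y y′ → class c y y′ ≋ between c y y′
  class-≋ c y y′ = front-≋ crowded (between c y y′)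

  module _ {k c ys} (H : Hubs G k c ys) where
    open Hubs H

    class-length : ∀ {y y′} → y ∈ ys → y′ ∈ ys → y ≢ y′ → length (class c y y′) ≡ k
    class-length {y} {y′} m m′ ne = trans (front-length crowded (between c y y′)) (class-size m m′ ne)

    class-adj : ∀ y y′ {v} → v ∈ class c y y′ → adj y v ≡ true
    class-adj y y′ m = sub y _ (proj₁ (∈-between⁻ c (proj₁ (class-≋ c y y′) m)))

    class-adj′ : ∀ y y′ {v} → v ∈ class c y y′ → adj y′ v ≡ true
    class-adj′ y y′ m = sub y′ _ (proj₂ (∈-between⁻ c (proj₁ (class-≋ c y y′) m)))

    class-∈-nbrs : ∀ {y y′} → y ∈ ys → y′ ∈ ys → y ≢ y′ → class c y y′ ∈ lists k (nbrs y)
    class-∈-nbrs {y} {y′} m m′ ne = ∈-lists k (class-length m m′ ne) (λ v∈ → ∈-nbrs (class-adj y y′ v∈))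

  ∈-edgesList : ∀ {u v} → adj u v ≡ true → (u , v) ∈ edgesList
  ∈-edgesList e = ∈-edgeList everything refl refl e

  module _ {c x y} {v} (v∈ : v ∈ between c x y) (v-crowded : crowded v ≡ true) where
    crowded-head : ∃ λ b → ∃ λ P → class c x y ≡ b ∷ P × crowded b ≡ true
    crowded-head = front-head crowded v∈ v-crowded

  busy-edge : ∀ {x b} → large x ≡ true → crowded b ≡ true → adj x b ≡ true → (x , b) ∈ busyEdges
  busy-edge {x} {b} p q e = ∈-edgeList Busy (cong (_∨ crowded x) p) (trans (cong (large b ∨_) q) (BoolP.∨-zeroʳ (large b))) e

  -- For K₃ the hubs are x, y, z; for K₄ they are x, y, z, t. The hubs are matched with
  -- adjacent vertices of distinct classes, so that each of them costs O(n) choices of an edge.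
  module K₃-codes (k : ℕ) where

    -- The matching: `x` with the crowded `b` of the class `xy`, `y` with `r` of `yz`, and `z` with
    -- `q` of `xz`. Every class loses one vertex and has size k+1.
    Crowded₃ : List ((V × V) × (V × V) × (V × V) × List V × List V × List V)
    Crowded₃ = busyEdges ⊗ edgesList ⊗ edgesList ⊗ lists k vs ⊗ lists k vs ⊗ lists k vs

    crowded₃ : (V × V) × (V × V) × (V × V) × List V × List V × List V → Code
    crowded₃ ((x , b) , (y , r) , (z , q) , P , Q , R) = ((x , y) , b ∷ P) ∷ ((x , z) , q ∷ Q) ∷ ((y , z) , r ∷ R) ∷ []

    crowded₃-code : ∀ {c} → CrowdedPair (suc k) c 3 → ∃ λ e → e ∈ map crowded₃ Crowded₃ × Codes c e
    crowded₃-code {c} record { x = x ; y = y ; zs = z ∷ [] ; len = refl ; hubs = H ; x-large = x-large ; v∈ = v∈ ; v-crowded = v-crowded } =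
      codeOf (class c) (x ∷ y ∷ z ∷ [])
      , subst (_∈ map crowded₃ Crowded₃) (cong₂ _∷_ (cong ((x , y) ,_) (sym eP)) (cong₂ _∷_ (cong ((x , z) ,_) (sym eQ)) (cong (_∷ []) (cong ((y , z) ,_) (sym eR)))))
          (∈P.∈-map⁺ crowded₃ (∈-⊗ (busy-edge x-large b-crowded (class-adj H x y (subst (b ∈_) (sym eP) (here refl))))
            (∈-⊗ (∈-edgesList (class-adj H y z (subst (r ∈_) (sym eR) (here refl))))
            (∈-⊗ (∈-edgesList (class-adj′ H x z (subst (q ∈_) (sym eQ) (here refl))))
            (∈-⊗ (tail∈ eP (class-length H x∈ y∈ x≢y)) (∈-⊗ (tail∈ eQ (class-length H x∈ z∈ x≢z)) (tail∈ eR (class-length H y∈ z∈ y≢z))))))))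
      , Hubs⇒Codes (class c) (class-≋ c) H
      where
      x∈ : x ∈ x ∷ y ∷ z ∷ []
      x∈ = here refl
      y∈ : y ∈ x ∷ y ∷ z ∷ []
      y∈ = there (here refl)
      z∈ : z ∈ x ∷ y ∷ z ∷ []
      z∈ = there (there (here refl))
      x≢y = case Hubs.uniq H of λ { ((p ∷ _) ∷ _) → p }
      x≢z = case Hubs.uniq H of λ { ((_ ∷ p ∷ _) ∷ _) → p }
      y≢z = case Hubs.uniq H of λ { (_ ∷ (p ∷ _) ∷ _) → p }
      headP = crowded-head {c} {x} {y} v∈ v-crowded
      b = proj₁ headP
      P = proj₁ (proj₂ headP)
      eP = proj₁ (proj₂ (proj₂ headP))
      b-crowded = proj₂ (proj₂ (proj₂ headP))
      headQ = nonempty (class c x z) (class-length H x∈ z∈ x≢z)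
      q = proj₁ headQ
      eQ = proj₂ (proj₂ headQ)
      headR = nonempty (class c y z) (class-length H y∈ z∈ y≢z)
      r = proj₁ headR
      eR = proj₂ (proj₂ headR)
      tail∈ : ∀ {u xs ys} → xs ≡ u ∷ ys → length xs ≡ suc k → ys ∈ lists k vs
      tail∈ refl e = ∈-vlists (ℕP.suc-injective e)

    crowded₃-count : ∀ m → 1 ≤ τ → m * τ ^ 3 ≤ n →
      m * length (map crowded₃ Crowded₃) ≤ n ^ (3 * suc k) * (24 * (24 + 2 * 24 ^ 3) * (24 * 24))
    crowded₃-count m 1≤τ mτ³≤n = begin
      m * length (map crowded₃ Crowded₃) ≡⟨ cong (m *_) (trans (ListP.length-map crowded₃ Crowded₃) (length-⊗ busyEdges rest)) ⟩
      m * (length busyEdges * length rest) ≡⟨ sym (ℕP.*-assoc m (length busyEdges) (length rest)) ⟩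
      m * length busyEdges * length rest ≤⟨ ℕP.*-mono-≤ (busy-edges-bound m 1≤τ mτ³≤n)
          (card (edges≤ ⊗≤ edges≤ ⊗≤ vlists≤ k ⊗≤ vlists≤ k ⊗≤ vlists≤ k)) ⟩
      n * b * (24 * n * (24 * n * (n ^ k * (n ^ k * n ^ k)))) ≡⟨ collect 24 b ⟩
      (n ^ suc k) ^ 3 * (b * (24 * 24)) ≡⟨ cong (_* (b * (24 * 24))) (trans (ℕP.^-*-assoc n (suc k) 3) (cong (n ^_) (ℕP.*-comm (suc k) 3))) ⟩
      n ^ (3 * suc k) * (b * (24 * 24)) ∎
      where
      open ℕP.≤-Reasoning
      open +-*-Solver using (solve; _:+_; _:*_; _:^_; _:=_; con)
      b = 24 * (24 + 2 * 24 ^ 3)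
      rest = edgesList ⊗ edgesList ⊗ lists k vs ⊗ lists k vs ⊗ lists k vs
      collect : ∀ a b → n * b * (a * n * (a * n * (n ^ k * (n ^ k * n ^ k)))) ≡ (n ^ suc k) ^ 3 * (b * (a * a))
      collect a b = solve 4 (λ n p a b → n :* b :* (a :* n :* (a :* n :* (p :* (p :* p)))) := (n :* p) :^ 3 :* (b :* (a :* a))) refl n (n ^ k) a b

    -- The same with a small hub x: its classes consist of neighbours of x.
    Stars₃ : List (V × List V × List V)
    Stars₃ = bind _,_ smalls (λ x → lists (suc (suc k)) (nbrs x) ⊗ lists (suc (suc k)) (nbrs x))

    -- Both classes at `x` are used up by its star, so `y` and `z` have to be matched with two
    -- vertices `r`, `r′` of the one remaining class. Here classes have size k+2.
    Small₃ : List ((V × List V × List V) × (V × V) × (V × V) × List V)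
    Small₃ = Stars₃ ⊗ edgesList ⊗ edgesList ⊗ lists k vs

    small₃ : (V × List V × List V) × (V × V) × (V × V) × List V → Code
    small₃ ((x , P , Q) , (y , r) , (z , r′) , R) = ((x , y) , P) ∷ ((x , z) , Q) ∷ ((y , z) , r ∷ r′ ∷ R) ∷ []

    small₃-code : ∀ {c x y z} → Hubs G (suc (suc k)) c (x ∷ y ∷ z ∷ []) → large x ≡ false → ∃ λ e → e ∈ map small₃ Small₃ × Codes c e
    small₃-code {c} {x} {y} {z} H x-small =
      codeOf (class c) (x ∷ y ∷ z ∷ [])
      , subst (_∈ map small₃ Small₃) (cong (λ R → ((x , y) , class c x y) ∷ ((x , z) , class c x z) ∷ ((y , z) , R) ∷ []) (sym eR′))
          (∈P.∈-map⁺ small₃ (∈-⊗ (∈-bind _,_ _ (∈-smalls x-small) (∈-⊗ (class-∈-nbrs H x∈ y∈ x≢y) (class-∈-nbrs H x∈ z∈ x≢z)))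
            (∈-⊗ (∈-edgesList (class-adj H y z (subst (r ∈_) (sym eR′) (here refl))))
            (∈-⊗ (∈-edgesList (class-adj′ H y z (subst (r′ ∈_) (sym eR′) (there (here refl)))))
              (∈-vlists (ℕP.suc-injective (ℕP.suc-injective (trans (sym (cong length eR′)) (class-length H y∈ z∈ y≢z)))))))))
      , Hubs⇒Codes (class c) (class-≋ c) H
      where
      x∈ : x ∈ x ∷ y ∷ z ∷ []
      x∈ = here refl
      y∈ : y ∈ x ∷ y ∷ z ∷ []
      y∈ = there (here refl)
      z∈ : z ∈ x ∷ y ∷ z ∷ []
      z∈ = there (there (here refl))
      x≢y = case Hubs.uniq H of λ { ((p ∷ _) ∷ _) → p }
      x≢z = case Hubs.uniq H of λ { ((_ ∷ p ∷ _) ∷ _) → p }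
      y≢z = case Hubs.uniq H of λ { (_ ∷ (p ∷ _) ∷ _) → p }
      headR = nonempty (class c y z) (class-length H y∈ z∈ y≢z)
      r = proj₁ headR
      headR′ = nonempty (proj₁ (proj₂ headR)) (ℕP.suc-injective (trans (sym (cong length (proj₂ (proj₂ headR)))) (class-length H y∈ z∈ y≢z)))
      r′ = proj₁ headR′
      R = proj₁ (proj₂ headR′)
      eR′ : class c y z ≡ r ∷ r′ ∷ R
      eR′ = trans (proj₂ (proj₂ headR)) (cong (r ∷_) (proj₂ (proj₂ headR′)))

    -- With classes of size K = k+2 the two stars at `x` contribute deg x to the power 2K; all but
    -- one of these factors save τ, whence the exponent 2K-1.
    small₃-count : ∀ m C → m ≤ C * τ ^ (suc k + suc (suc k)) →
      m * length (map small₃ Small₃) ≤ n ^ (3 * suc (suc k)) * (C * (24 * (24 * 24)))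
    small₃-count m C m≤ = begin
      m * length (map small₃ Small₃) ≡⟨ cong (m *_) (trans (ListP.length-map small₃ Small₃) (length-⊗ Stars₃ rest)) ⟩
      m * (length Stars₃ * length rest) ≡⟨ cong (λ s → m * (s * length rest)) stars ⟩
      m * (starSum (suc j) * length rest) ≡⟨ sym (ℕP.*-assoc m (starSum (suc j)) (length rest)) ⟩
      m * starSum (suc j) * length rest ≤⟨ ℕP.*-mono-≤ (starSum-bound m C j m≤) (card (edges≤ ⊗≤ edges≤ ⊗≤ vlists≤ k)) ⟩
      C * (n ^ j * (24 * n)) * (24 * n * (24 * n * n ^ k)) ≡⟨ collect 24 ⟩
      (n ^ suc (suc k)) ^ 3 * (C * (24 * (24 * 24))) ≡⟨ cong (_* (C * (24 * (24 * 24)))) (trans (ℕP.^-*-assoc n (suc (suc k)) 3) (cong (n ^_) (ℕP.*-comm (suc (suc k)) 3))) ⟩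
      n ^ (3 * suc (suc k)) * (C * (24 * (24 * 24))) ∎
      where
      open ℕP.≤-Reasoning
      open +-*-Solver using (solve; _:+_; _:*_; _:^_; _:=_; con)
      j = suc k + suc (suc k)
      rest = edgesList ⊗ edgesList ⊗ lists k vs
      stars : length Stars₃ ≡ starSum (suc j)
      stars = trans (length-bind _,_ smalls _) (trans (∑-smalls _) (∑-cong vs λ x → cong (⟦ not (large x) ⟧ *_)
        (trans (length-⊗ (lists (suc (suc k)) (nbrs x)) (lists (suc (suc k)) (nbrs x))) (trans (cong₂ _*_ (length-nbr-lists (suc (suc k)) x) (length-nbr-lists (suc (suc k)) x))
          (sym (ℕP.^-distribˡ-+-* (deg x) (suc (suc k)) (suc (suc k))))))))
      collect : ∀ a → C * (n ^ j * (a * n)) * (a * n * (a * n * n ^ k)) ≡ (n ^ suc (suc k)) ^ 3 * (C * (a * (a * a)))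
      collect a = trans (cong (λ p → C * (p * (a * n)) * (a * n * (a * n * n ^ k))) (ℕP.^-distribˡ-+-* n (suc k) (suc (suc k))))
        (solve 4 (λ n p C a → C :* ((n :* p :* (n :* (n :* p))) :* (a :* n)) :* (a :* n :* (a :* n :* p)) := (n :* (n :* p)) :^ 3 :* (C :* (a :* (a :* a)))) refl n (n ^ k) C a)

  module K₄-codes (k : ℕ) where

    -- The hubs are matched along the cycle x, y, z, t: `b` in `xy`, `r` in `yz`, `s` in `zt`, `q`
    -- in `xt`. The diagonal classes `xz` and `yt` keep all k+1 vertices to be chosen.
    Crowded₄ : List ((V × V) × (V × V) × (V × V) × (V × V) × List V × List V × List V × List V × List V × List V)
    Crowded₄ = busyEdges ⊗ edgesList ⊗ edgesList ⊗ edgesList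
      ⊗ lists k vs ⊗ lists (suc k) vs ⊗ lists k vs ⊗ lists k vs ⊗ lists (suc k) vs ⊗ lists k vs

    crowded₄ : (V × V) × (V × V) × (V × V) × (V × V) × List V × List V × List V × List V × List V × List V → Code
    crowded₄ ((x , b) , (y , r) , (z , s) , (t , q) , XY , XZ , XT , YZ , YT , ZT) =
      ((x , y) , b ∷ XY) ∷ ((x , z) , XZ) ∷ ((x , t) , q ∷ XT) ∷ ((y , z) , r ∷ YZ) ∷ ((y , t) , YT) ∷ ((z , t) , s ∷ ZT) ∷ []

    private
      tail∈ : ∀ {u xs ys} → xs ≡ u ∷ ys → length xs ≡ suc k → ys ∈ lists k vs
      tail∈ refl e = ∈-vlists (ℕP.suc-injective e)

    module Four {c x y z t} (H : Hubs G (suc k) c (x ∷ y ∷ z ∷ t ∷ [])) where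
      x∈ : x ∈ x ∷ y ∷ z ∷ t ∷ []
      x∈ = here refl
      y∈ : y ∈ x ∷ y ∷ z ∷ t ∷ []
      y∈ = there (here refl)
      z∈ : z ∈ x ∷ y ∷ z ∷ t ∷ []
      z∈ = there (there (here refl))
      t∈ : t ∈ x ∷ y ∷ z ∷ t ∷ []
      t∈ = there (there (there (here refl)))
      x≢y = case Hubs.uniq H of λ { ((p ∷ _) ∷ _) → p }
      x≢z = case Hubs.uniq H of λ { ((_ ∷ p ∷ _) ∷ _) → p }
      x≢t = case Hubs.uniq H of λ { ((_ ∷ _ ∷ p ∷ _) ∷ _) → p }
      y≢z = case Hubs.uniq H of λ { (_ ∷ (p ∷ _) ∷ _) → p }
      y≢t = case Hubs.uniq H of λ { (_ ∷ (_ ∷ p ∷ _) ∷ _) → p }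
      z≢t = case Hubs.uniq H of λ { (_ ∷ _ ∷ (p ∷ _) ∷ _) → p }
      XT = nonempty (class c x t) (class-length H x∈ t∈ x≢t)
      YZ = nonempty (class c y z) (class-length H y∈ z∈ y≢z)
      YT = nonempty (class c y t) (class-length H y∈ t∈ y≢t)
      ZT = nonempty (class c z t) (class-length H z∈ t∈ z≢t)

    crowded₄-code : ∀ {c} → CrowdedPair (suc k) c 4 → ∃ λ e → e ∈ map crowded₄ Crowded₄ × Codes c e
    crowded₄-code {c} record { x = x ; y = y ; zs = z ∷ t ∷ [] ; len = refl ; hubs = H ; x-large = x-large ; v∈ = v∈ ; v-crowded = v-crowded } =
      codeOf (class c) (x ∷ y ∷ z ∷ t ∷ [])
      , subst (_∈ map crowded₄ Crowded₄)
          (cong₂ _∷_ (cong ((x , y) ,_) (sym eXY)) (cong (((x , z) , class c x z) ∷_) (cong₂ _∷_ (cong ((x , t) ,_) (sym (proj₂ (proj₂ XT))))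
            (cong₂ _∷_ (cong ((y , z) ,_) (sym (proj₂ (proj₂ YZ)))) (cong (((y , t) , class c y t) ∷_) (cong (_∷ []) (cong ((z , t) ,_) (sym (proj₂ (proj₂ ZT)))))))))
          )
          (∈P.∈-map⁺ crowded₄ (∈-⊗ (busy-edge x-large b-crowded (class-adj H x y (subst (b ∈_) (sym eXY) (here refl))))
            (∈-⊗ (∈-edgesList (class-adj H y z (subst (proj₁ YZ ∈_) (sym (proj₂ (proj₂ YZ))) (here refl))))
            (∈-⊗ (∈-edgesList (class-adj H z t (subst (proj₁ ZT ∈_) (sym (proj₂ (proj₂ ZT))) (here refl))))
            (∈-⊗ (∈-edgesList (class-adj′ H x t (subst (proj₁ XT ∈_) (sym (proj₂ (proj₂ XT))) (here refl))))
            (∈-⊗ (tail∈ eXY (class-length H x∈ y∈ x≢y))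
            (∈-⊗ (∈-vlists (class-length H x∈ z∈ x≢z))
            (∈-⊗ (tail∈ (proj₂ (proj₂ XT)) (class-length H x∈ t∈ x≢t))
            (∈-⊗ (tail∈ (proj₂ (proj₂ YZ)) (class-length H y∈ z∈ y≢z))
            (∈-⊗ (∈-vlists (class-length H y∈ t∈ y≢t))
                 (tail∈ (proj₂ (proj₂ ZT)) (class-length H z∈ t∈ z≢t))))))))))))
      , Hubs⇒Codes (class c) (class-≋ c) H
      where
      open Four H
      headXY = crowded-head {c} {x} {y} v∈ v-crowded
      b = proj₁ headXY
      eXY = proj₁ (proj₂ (proj₂ headXY))
      b-crowded = proj₂ (proj₂ (proj₂ headXY))

    crowded₄-count : ∀ m → 1 ≤ τ → m * τ ^ 3 ≤ n →
      m * length (map crowded₄ Crowded₄) ≤ n ^ (6 * suc k) * (24 * (24 + 2 * 24 ^ 3) * (24 * (24 * 24)))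
    crowded₄-count m 1≤τ mτ³≤n = begin
      m * length (map crowded₄ Crowded₄) ≡⟨ cong (m *_) (trans (ListP.length-map crowded₄ Crowded₄) (length-⊗ busyEdges rest)) ⟩
      m * (length busyEdges * length rest) ≡⟨ sym (ℕP.*-assoc m (length busyEdges) (length rest)) ⟩
      m * length busyEdges * length rest ≤⟨ ℕP.*-mono-≤ (busy-edges-bound m 1≤τ mτ³≤n)
          (card (edges≤ ⊗≤ edges≤ ⊗≤ edges≤ ⊗≤ vlists≤ k ⊗≤ vlists≤ (suc k) ⊗≤ vlists≤ k ⊗≤ vlists≤ k ⊗≤ vlists≤ (suc k) ⊗≤ vlists≤ k)) ⟩
      n * b * (24 * n * (24 * n * (24 * n * (n ^ k * (n ^ suc k * (n ^ k * (n ^ k * (n ^ suc k * n ^ k)))))))) ≡⟨ collect 24 b ⟩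
      (n ^ suc k) ^ 6 * (b * (24 * (24 * 24))) ≡⟨ cong (_* (b * (24 * (24 * 24)))) (trans (ℕP.^-*-assoc n (suc k) 6) (cong (n ^_) (ℕP.*-comm (suc k) 6))) ⟩
      n ^ (6 * suc k) * (b * (24 * (24 * 24))) ∎
      where
      open ℕP.≤-Reasoning
      open +-*-Solver using (solve; _:+_; _:*_; _:^_; _:=_; con)
      b = 24 * (24 + 2 * 24 ^ 3)
      rest = edgesList ⊗ edgesList ⊗ edgesList ⊗ lists k vs ⊗ lists (suc k) vs ⊗ lists k vs ⊗ lists k vs ⊗ lists (suc k) vs ⊗ lists k vs
      collect : ∀ a b → n * b * (a * n * (a * n * (a * n * (n ^ k * (n ^ suc k * (n ^ k * (n ^ k * (n ^ suc k * n ^ k)))))))) ≡ (n ^ suc k) ^ 6 * (b * (a * (a * a)))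
      collect a b = solve 4 (λ n p a b → n :* b :* (a :* n :* (a :* n :* (a :* n :* (p :* ((n :* p) :* (p :* (p :* ((n :* p) :* p)))))))) := (n :* p) :^ 6 :* (b :* (a :* (a :* a)))) refl n (n ^ k) a b

    Stars₄ : List (V × List V × List V × List V)
    Stars₄ = bind _,_ smalls (λ x → lists (suc k) (nbrs x) ⊗ lists (suc k) (nbrs x) ⊗ lists (suc k) (nbrs x))

    -- The star at `x` takes three classes, and the triangle of the other hubs still has one class
    -- for each of them. Unlike for K₃, classes of size one are enough.
    Small₄ : List ((V × List V × List V × List V) × (V × V) × (V × V) × (V × V) × List V × List V × List V)
    Small₄ = Stars₄ ⊗ edgesList ⊗ edgesList ⊗ edgesList ⊗ lists k vs ⊗ lists k vs ⊗ lists k vs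

    small₄ : (V × List V × List V × List V) × (V × V) × (V × V) × (V × V) × List V × List V × List V → Code
    small₄ ((x , XY , XZ , XT) , (y , r) , (z , s) , (t , q) , YZ , YT , ZT) =
      ((x , y) , XY) ∷ ((x , z) , XZ) ∷ ((x , t) , XT) ∷ ((y , z) , r ∷ YZ) ∷ ((y , t) , q ∷ YT) ∷ ((z , t) , s ∷ ZT) ∷ []

    small₄-code : ∀ {c x y z t} → Hubs G (suc k) c (x ∷ y ∷ z ∷ t ∷ []) → large x ≡ false → ∃ λ e → e ∈ map small₄ Small₄ × Codes c e
    small₄-code {c} {x} {y} {z} {t} H x-small =
      codeOf (class c) (x ∷ y ∷ z ∷ t ∷ [])
      , subst (_∈ map small₄ Small₄)
          (cong (λ e → ((x , y) , class c x y) ∷ ((x , z) , class c x z) ∷ ((x , t) , class c x t) ∷ e)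
            (cong₂ _∷_ (cong ((y , z) ,_) (sym (proj₂ (proj₂ YZ)))) (cong₂ _∷_ (cong ((y , t) ,_) (sym (proj₂ (proj₂ YT)))) (cong (_∷ []) (cong ((z , t) ,_) (sym (proj₂ (proj₂ ZT))))))))
          (∈P.∈-map⁺ small₄ (∈-⊗ (∈-bind _,_ _ (∈-smalls x-small) (∈-⊗ (class-∈-nbrs H x∈ y∈ x≢y) (∈-⊗ (class-∈-nbrs H x∈ z∈ x≢z) (class-∈-nbrs H x∈ t∈ x≢t))))
            (∈-⊗ (∈-edgesList (class-adj H y z (subst (proj₁ YZ ∈_) (sym (proj₂ (proj₂ YZ))) (here refl))))
            (∈-⊗ (∈-edgesList (class-adj H z t (subst (proj₁ ZT ∈_) (sym (proj₂ (proj₂ ZT))) (here refl))))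
            (∈-⊗ (∈-edgesList (class-adj′ H y t (subst (proj₁ YT ∈_) (sym (proj₂ (proj₂ YT))) (here refl))))
            (∈-⊗ (tail∈ (proj₂ (proj₂ YZ)) (class-length H y∈ z∈ y≢z))
            (∈-⊗ (tail∈ (proj₂ (proj₂ YT)) (class-length H y∈ t∈ y≢t))
                 (tail∈ (proj₂ (proj₂ ZT)) (class-length H z∈ t∈ z≢t)))))))))
      , Hubs⇒Codes (class c) (class-≋ c) H
      where
      open Four H

    small₄-count : ∀ m C → m ≤ C * τ ^ (k + (suc k + suc k)) →
      m * length (map small₄ Small₄) ≤ n ^ (6 * suc k) * (C * (24 * (24 * (24 * 24))))
    small₄-count m C m≤ = begin
      m * length (map small₄ Small₄) ≡⟨ cong (m *_) (trans (ListP.length-map small₄ Small₄) (length-⊗ Stars₄ rest)) ⟩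
      m * (length Stars₄ * length rest) ≡⟨ cong (λ s → m * (s * length rest)) stars ⟩
      m * (starSum (suc j) * length rest) ≡⟨ sym (ℕP.*-assoc m (starSum (suc j)) (length rest)) ⟩
      m * starSum (suc j) * length rest ≤⟨ ℕP.*-mono-≤ (starSum-bound m C j m≤) (card (edges≤ ⊗≤ edges≤ ⊗≤ edges≤ ⊗≤ vlists≤ k ⊗≤ vlists≤ k ⊗≤ vlists≤ k)) ⟩
      C * (n ^ j * (24 * n)) * (24 * n * (24 * n * (24 * n * (n ^ k * (n ^ k * n ^ k))))) ≡⟨ collect 24 ⟩
      (n ^ suc k) ^ 6 * (C * (24 * (24 * (24 * 24)))) ≡⟨ cong (_* (C * (24 * (24 * (24 * 24))))) (trans (ℕP.^-*-assoc n (suc k) 6) (cong (n ^_) (ℕP.*-comm (suc k) 6))) ⟩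
      n ^ (6 * suc k) * (C * (24 * (24 * (24 * 24)))) ∎
      where
      open ℕP.≤-Reasoning
      open +-*-Solver using (solve; _:+_; _:*_; _:^_; _:=_; con)
      j = k + (suc k + suc k)
      rest = edgesList ⊗ edgesList ⊗ edgesList ⊗ lists k vs ⊗ lists k vs ⊗ lists k vs
      powers : ∀ d → d ^ j ≡ d ^ k * (d ^ suc k * d ^ suc k)
      powers d = trans (ℕP.^-distribˡ-+-* d k (suc k + suc k)) (cong (d ^ k *_) (ℕP.^-distribˡ-+-* d (suc k) (suc k)))
      stars : length Stars₄ ≡ starSum (suc j)
      stars = trans (length-bind _,_ smalls _) (trans (∑-smalls _) (∑-cong vs λ x → cong (⟦ not (large x) ⟧ *_)
        (trans (length-⊗ (lists (suc k) (nbrs x)) (lists (suc k) (nbrs x) ⊗ lists (suc k) (nbrs x)))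
        (trans (cong₂ _*_ (length-nbr-lists (suc k) x) (trans (length-⊗ (lists (suc k) (nbrs x)) (lists (suc k) (nbrs x))) (cong₂ _*_ (length-nbr-lists (suc k) x) (length-nbr-lists (suc k) x))))
        (trans (ℕP.*-assoc (deg x) (deg x ^ k) _) (cong (deg x *_) (sym (powers (deg x)))))))))
      collect : ∀ a → C * (n ^ j * (a * n)) * (a * n * (a * n * (a * n * (n ^ k * (n ^ k * n ^ k))))) ≡ (n ^ suc k) ^ 6 * (C * (a * (a * (a * a))))
      collect a = trans (cong (λ p → C * (p * (a * n)) * (a * n * (a * n * (a * n * (n ^ k * (n ^ k * n ^ k)))))) (powers n))
        (solve 4 (λ n p C a → C :* ((p :* ((n :* p) :* (n :* p))) :* (a :* n)) :* (a :* n :* (a :* n :* (a :* n :* (p :* (p :* p))))) := (n :* p) :^ 6 :* (C :* (a :* (a :* (a :* a))))) refl n (n ^ k) C a)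

-- Hexagons.

-- K₃^(1) is a hexagon; rotating it exchanges the hubs with the other vertices.
module Hexagon where

  Vertex : Set
  Vertex = BlowUpV 3 (K 3) 1

  -- The cyclic order around the hexagon, with the hubs at the even positions, so that a rotation by
  -- one step turns them into class vertices.
  vertex : Fin 6 → Vertex
  vertex Fin.zero = inj₁ (# 0)
  vertex (Fin.suc Fin.zero) = inj₂ (# 0 , # 1 , (s≤s z≤n , refl) , # 0)
  vertex (Fin.suc (Fin.suc Fin.zero)) = inj₁ (# 1)
  vertex (Fin.suc (Fin.suc (Fin.suc Fin.zero))) = inj₂ (# 1 , # 2 , (s≤s (s≤s z≤n) , refl) , # 0)
  vertex (Fin.suc (Fin.suc (Fin.suc (Fin.suc Fin.zero)))) = inj₁ (# 2)
  vertex (Fin.suc (Fin.suc (Fin.suc (Fin.suc (Fin.suc Fin.zero))))) = inj₂ (# 0 , # 2 , (s≤s z≤n , refl) , # 0)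

  index : Vertex → Fin 6
  index (inj₁ Fin.zero) = # 0
  index (inj₁ (Fin.suc Fin.zero)) = # 2
  index (inj₁ (Fin.suc (Fin.suc Fin.zero))) = # 4
  index (inj₂ (Fin.zero , Fin.suc Fin.zero , _)) = # 1
  index (inj₂ (Fin.suc Fin.zero , Fin.suc (Fin.suc Fin.zero) , _)) = # 3
  index (inj₂ (Fin.zero , Fin.suc (Fin.suc Fin.zero) , _)) = # 5
  -- Only pairs that are not increasing remain; they carry no vertex, and the value is arbitrary.
  index (inj₂ (_ , _ , _)) = # 0

  vertex-index : ∀ a → vertex (index a) ≡ a
  vertex-index (inj₁ Fin.zero) = refl
  vertex-index (inj₁ (Fin.suc Fin.zero)) = refl
  vertex-index (inj₁ (Fin.suc (Fin.suc Fin.zero))) = refl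
  vertex-index (inj₂ (Fin.zero , Fin.suc Fin.zero , p , Fin.zero)) = cong (λ q → inj₂ (_ , _ , q , Fin.zero)) (pair-irrelevant {3} {# 0} {# 1} (s≤s z≤n , refl) p)
  vertex-index (inj₂ (Fin.suc Fin.zero , Fin.suc (Fin.suc Fin.zero) , p , Fin.zero)) = cong (λ q → inj₂ (_ , _ , q , Fin.zero)) (pair-irrelevant {3} {# 1} {# 2} (s≤s (s≤s z≤n) , refl) p)
  vertex-index (inj₂ (Fin.zero , Fin.suc (Fin.suc Fin.zero) , p , Fin.zero)) = cong (λ q → inj₂ (_ , _ , q , Fin.zero)) (pair-irrelevant {3} {# 0} {# 2} (s≤s z≤n , refl) p)
  vertex-index (inj₂ (Fin.zero , Fin.zero , (() , _) , _))
  vertex-index (inj₂ (Fin.suc Fin.zero , Fin.zero , (() , _) , _))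
  vertex-index (inj₂ (Fin.suc Fin.zero , Fin.suc Fin.zero , (s≤s () , _) , _))
  vertex-index (inj₂ (Fin.suc (Fin.suc Fin.zero) , Fin.zero , (() , _) , _))
  vertex-index (inj₂ (Fin.suc (Fin.suc Fin.zero) , Fin.suc Fin.zero , (s≤s () , _) , _))
  vertex-index (inj₂ (Fin.suc (Fin.suc Fin.zero) , Fin.suc (Fin.suc Fin.zero) , (s≤s (s≤s ()) , _) , _))

  next prev : Fin 6 → Fin 6
  next Fin.zero = # 1
  next (Fin.suc Fin.zero) = # 2
  next (Fin.suc (Fin.suc Fin.zero)) = # 3
  next (Fin.suc (Fin.suc (Fin.suc Fin.zero))) = # 4
  next (Fin.suc (Fin.suc (Fin.suc (Fin.suc Fin.zero)))) = # 5
  next (Fin.suc (Fin.suc (Fin.suc (Fin.suc (Fin.suc Fin.zero))))) = # 0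
  prev Fin.zero = # 5
  prev (Fin.suc Fin.zero) = # 0
  prev (Fin.suc (Fin.suc Fin.zero)) = # 1
  prev (Fin.suc (Fin.suc (Fin.suc Fin.zero))) = # 2
  prev (Fin.suc (Fin.suc (Fin.suc (Fin.suc Fin.zero)))) = # 3
  prev (Fin.suc (Fin.suc (Fin.suc (Fin.suc (Fin.suc Fin.zero))))) = # 4

  rotate unrotate : Vertex → Vertex
  rotate a = vertex (next (index a))
  unrotate a = vertex (prev (index a))

  private
    index-vertex : ∀ i → index (vertex i) ≡ i
    index-vertex = from-yes (FinP.all? λ i → index (vertex i) Fin.≟ i)

    next-prev : ∀ i → next (prev i) ≡ i
    next-prev = from-yes (FinP.all? λ i → next (prev i) Fin.≟ i)

    prev-next : ∀ i → prev (next i) ≡ i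
    prev-next = from-yes (FinP.all? λ i → prev (next i) Fin.≟ i)

    adjacent : Vertex → Vertex → Bool
    adjacent = blowUpAdj 3 (K 3) 1

    next-adjacent : ∀ i j → adjacent (vertex (next i)) (vertex (next j)) ≡ adjacent (vertex i) (vertex j)
    next-adjacent = from-yes (FinP.all? λ i → FinP.all? λ j → adjacent (vertex (next i)) (vertex (next j)) BoolP.≟ adjacent (vertex i) (vertex j))

  rotate-unrotate : ∀ a → rotate (unrotate a) ≡ a
  rotate-unrotate a = trans (cong (vertex ∘ next) (index-vertex (prev (index a)))) (trans (cong vertex (next-prev (index a))) (vertex-index a))

  unrotate-rotate : ∀ a → unrotate (rotate a) ≡ a
  unrotate-rotate a = trans (cong (vertex ∘ prev) (index-vertex (next (index a)))) (trans (cong vertex (prev-next (index a))) (vertex-index a))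

  rotate-adjacent : ∀ a b → adjacent (rotate a) (rotate b) ≡ adjacent a b
  rotate-adjacent a b = trans (next-adjacent (index a) (index b)) (cong₂ adjacent (vertex-index a) (vertex-index b))

  -- The subgraph stays the same and only its embedding is composed with the rotation, so the same
  -- copy can be coded with other hubs.
  rotate-copy : ∀ {n} {G : Graph n} {c} → IsCopy G (KBlow 3 1) c → IsCopy G (KBlow 3 1) c
  rotate-copy (sub , inS , φ , φ-inj , φ-S , φ-onto , φ-adj) =
    sub , inS , (λ a → φ (rotate a))
    , (λ a b e → trans (sym (unrotate-rotate a)) (trans (cong unrotate (φ-inj _ _ e)) (unrotate-rotate b)))
    , (λ a → φ-S (rotate a))
    , (λ u e → let (a , p) = φ-onto u e in unrotate a , trans (cong φ (rotate-unrotate a)) p)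
    , (λ a b → trans (sym (rotate-adjacent a b)) (φ-adj (rotate a) (rotate b)))

below : ℕ → List ℕ
below zero = []
below (suc n) = n ∷ below n

∑-below : ∀ n m → ∑ (below n) (λ s → ⟦ ⌊ suc s ℕ.≤? m ⌋ ⟧) ≡ n ⊓ m
∑-below zero m = refl
∑-below (suc n) m with suc n ℕ.≤? m
... | yes n<m = trans (cong suc (trans (∑-below n m) (ℕP.m≤n⇒m⊓n≡m (ℕP.<⇒≤ n<m)))) (sym (ℕP.m≤n⇒m⊓n≡m n<m))
... | no n≮m = trans (∑-below n m) (trans (ℕP.m≥n⇒m⊓n≡n m≤n) (sym (ℕP.m≥n⇒m⊓n≡n (ℕP.m≤n⇒m≤1+n m≤n))))
  where m≤n = ℕP.≮⇒≥ n≮m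

∑-bind : ∀ {A B C : Set} (f : A → B → C) xs (g : A → List B) (h : C → ℕ) → ∑ (bind f xs g) h ≡ ∑ xs (λ x → ∑ (g x) (λ y → h (f x y)))
∑-bind f [] g h = refl
∑-bind f (x ∷ xs) g h = trans (∑-++ (map (f x) (g x)) (bind f xs g) h) (cong₂ _+_ (∑-map (f x) (g x) h) (∑-bind f xs g h))

singleton : ∀ {A : Set} (xs : List A) → length xs ≡ 1 → ∃ λ x → xs ≡ x ∷ []
singleton (x ∷ []) _ = x , refl

module HexagonCodes {n : ℕ} (G : Graph n) (D : PlaneDrawing G) (1≤n : 1 ≤ n) (τ : ℕ) where
  open Graph G using (adj) renaming (sym to adj-sym; loopless to adj-irrefl)
  open Copies {n}
  open Large G D 1≤n τ
  open Classify G D 1≤n τ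

  deg≤n : ∀ x → deg x ≤ n
  deg≤n x = count≤n (adj x)

  minSum : ℕ
  minSum = ∑ᶠ λ u → ∑ᶠ λ v → ⟦ adj u v ⟧ * (deg u ⊓ deg v)

  -- Chiba and Nishizeki's bound: layer the minimum over the sets of vertices of degree > s.
  minSum-bound : minSum ≤ 24 * (24 * n)
  minSum-bound = begin
    minSum ≤⟨ ∑-mono vs (λ u → ∑-mono vs (λ v → layers u v)) ⟩
    (∑ᶠ λ u → ∑ᶠ λ v → ∑ (below n) (λ s → ⟦ over s u ∧ (over s v ∧ adj u v) ⟧)) ≡⟨ ∑-cong vs (λ u → ∑-swap vs (below n) _) ⟩
    (∑ᶠ λ u → ∑ (below n) (λ s → ∑ᶠ λ v → ⟦ over s u ∧ (over s v ∧ adj u v) ⟧)) ≡⟨ ∑-swap vs (below n) _ ⟩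
    ∑ (below n) (λ s → edgesIn adj (over s)) ≤⟨ ∑-mono (below n) (λ s → sparse G D (over s)) ⟩
    ∑ (below n) (λ s → 24 * count (over s)) ≡⟨ ∑-*ˡ (below n) 24 _ ⟩
    24 * ∑ (below n) (λ s → count (over s)) ≡⟨ cong (24 *_) (∑-swap (below n) vs _) ⟩
    24 * (∑ᶠ λ u → ∑ (below n) (λ s → ⟦ over s u ⟧)) ≤⟨ ℕP.*-monoʳ-≤ 24 (∑-mono vs (λ u → ℕP.≤-trans (ℕP.≤-reflexive (∑-below n (deg u))) (ℕP.m⊓n≤n n (deg u)))) ⟩
    24 * ∑ᶠ deg ≤⟨ ℕP.*-monoʳ-≤ 24 degree-total ⟩
    24 * (24 * n) ∎
    where
    open ℕP.≤-Reasoning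
    over : ℕ → Subset n
    over s u = ⌊ suc s ℕ.≤? deg u ⌋
    both : ∀ s a b → ⟦ ⌊ suc s ℕ.≤? a ⊓ b ⌋ ⟧ ≤ ⟦ ⌊ suc s ℕ.≤? a ⌋ ∧ (⌊ suc s ℕ.≤? b ⌋ ∧ true) ⟧
    both s a b with suc s ℕ.≤? a ⊓ b | suc s ℕ.≤? a | suc s ℕ.≤? b
    ... | no _ | _ | _ = z≤n
    ... | yes _ | yes _ | yes _ = ℕP.≤-refl
    ... | yes p | no q | _ = ⊥-elim (q (ℕP.≤-trans p (ℕP.m⊓n≤m a b)))
    ... | yes p | yes _ | no q = ⊥-elim (q (ℕP.≤-trans p (ℕP.m⊓n≤n a b)))
    layers : ∀ u v → ⟦ adj u v ⟧ * (deg u ⊓ deg v) ≤ ∑ (below n) (λ s → ⟦ over s u ∧ (over s v ∧ adj u v) ⟧)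
    layers u v = go (adj u v)
      where
      go : ∀ a → ⟦ a ⟧ * (deg u ⊓ deg v) ≤ ∑ (below n) (λ s → ⟦ over s u ∧ (over s v ∧ a) ⟧)
      go false = z≤n
      go true = ℕP.≤-trans (ℕP.≤-reflexive (trans (ℕP.+-identityʳ _)
        (trans (sym (ℕP.m≥n⇒m⊓n≡n (ℕP.≤-trans (ℕP.m⊓n≤m (deg u) (deg v)) (deg≤n u)))) (sym (∑-below n (deg u ⊓ deg v))))))
        (∑-mono (below n) (λ s → both s (deg u) (deg v)))

  -- A small hub `x` next to a small class vertex `p`: the hexagon consists of the edge `xp`, a
  -- further neighbour of each of its ends, and the opposite edge `zr`.
  Near : List (((V × V) × (V × V)) × (V × V))
  Near = bind _,_ smallEdges (λ (x , p) → nbrs x ⊗ nbrs p) ⊗ edgesList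
    where
    smallEdges = bind _,_ vs (λ x → filterᵇ (λ p → not (large x) ∧ (not (large p) ∧ adj x p)) vs)

  near : ((V × V) × (V × V)) × (V × V) → Code
  near (((x , p) , (q , y)) , (z , r)) = ((x , y) , p ∷ []) ∷ ((x , z) , q ∷ []) ∷ ((y , z) , r ∷ []) ∷ []

  -- The inner vertices of the walks of length three from `x` to `r`.
  linked : V → V → List (V × V)
  linked x r = bind _,_ (nbrs x) (λ p → filterᵇ (λ y → adj r y ∧ adj p y) vs)

  -- A small hub `x` and a small class vertex `r` opposite to it; the hexagon is a pair of paths of
  -- length three between them.
  Far : List ((V × V) × ((V × V) × (V × V)))
  Far = bind _,_ (smalls ⊗ smalls) (λ (x , r) → linked x r ⊗ linked x r)

  far : (V × V) × ((V × V) × (V × V)) → Code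
  far ((x , r) , ((p , y) , (q , z))) = ((x , y) , p ∷ []) ∷ ((x , z) , q ∷ []) ∷ ((y , z) , r ∷ []) ∷ []

  module _ {c x y z} (H : Hubs G 1 c (x ∷ y ∷ z ∷ [])) (x-small : large x ≡ false) where
    private
      open Hubs H
      x∈ : x ∈ x ∷ y ∷ z ∷ []
      x∈ = here refl
      y∈ : y ∈ x ∷ y ∷ z ∷ []
      y∈ = there (here refl)
      z∈ : z ∈ x ∷ y ∷ z ∷ []
      z∈ = there (there (here refl))
      P = singleton (between c x y) (class-size x∈ y∈ (case uniq of λ { ((p ∷ _) ∷ _) → p }))
      Q = singleton (between c x z) (class-size x∈ z∈ (case uniq of λ { ((_ ∷ p ∷ _) ∷ _) → p }))
      R = singleton (between c y z) (class-size y∈ z∈ (case uniq of λ { (_ ∷ (p ∷ _) ∷ _) → p }))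
      p = proj₁ P
      q = proj₁ Q
      r = proj₁ R
      ends : ∀ {u v w} → between c u v ≡ w ∷ [] → adj u w ≡ true × adj v w ≡ true
      ends {u} {v} {w} e = let (a , b) = ∈-between⁻ c (subst (w ∈_) (sym e) (here refl)) in sub u w a , sub v w b
      flip : ∀ {u v} → adj u v ≡ true → adj v u ≡ true
      flip {u} {v} e = trans (adj-sym v u) e
      same : ((x , y) , between c x y) ∷ ((x , z) , between c x z) ∷ ((y , z) , between c y z) ∷ []
        ≡ ((x , y) , p ∷ []) ∷ ((x , z) , q ∷ []) ∷ ((y , z) , r ∷ []) ∷ []
      same = entries (proj₂ P) (proj₂ Q) (proj₂ R)
        where
        entries : ∀ {B B′ C C′ E E′ : List V} → B ≡ B′ → C ≡ C′ → E ≡ E′ →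
          _≡_ {A = Code} (((x , y) , B) ∷ ((x , z) , C) ∷ ((y , z) , E) ∷ []) (((x , y) , B′) ∷ ((x , z) , C′) ∷ ((y , z) , E′) ∷ [])
        entries refl refl refl = refl
      codes = Hubs⇒Codes (between c) (λ y y′ → (λ v → v) , (λ v → v)) H

    near-code : ∀ {v} → v ∈ between c x y → large v ≡ false → ∃ λ e → e ∈ map near Near × Codes c e
    near-code {v} v∈ v-small = _ , subst (_∈ map near Near) (sym same) (∈P.∈-map⁺ near
      (∈-⊗ (∈-bind _,_ _ (∈-bind _,_ _ (∈P.∈-allFin x) (∈-filterᵇ⁺ _ (∈P.∈-allFin p) (∧-intro (cong not x-small) (∧-intro (cong not p-small) (proj₁ (ends (proj₂ P)))))))
              (∈-⊗ (∈-nbrs (proj₁ (ends (proj₂ Q)))) (∈-nbrs (flip (proj₂ (ends (proj₂ P)))))))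
           (∈-edgesList (proj₂ (ends (proj₂ R)))))) , codes
      where
      p-small : large p ≡ false
      p-small with subst (v ∈_) (proj₂ P) v∈
      ... | here refl = v-small

    far-code : ∀ {v} → v ∈ between c y z → large v ≡ false → ∃ λ e → e ∈ map far Far × Codes c e
    far-code {v} v∈ v-small = _ , subst (_∈ map far Far) (sym same) (∈P.∈-map⁺ far
      (∈-bind _,_ _ (∈-⊗ (∈-smalls x-small) (∈-smalls r-small))
        (∈-⊗ (link (proj₁ (ends (proj₂ P))) (flip (proj₁ (ends (proj₂ R)))) (flip (proj₂ (ends (proj₂ P)))))
             (link (proj₁ (ends (proj₂ Q))) (flip (proj₂ (ends (proj₂ R)))) (flip (proj₂ (ends (proj₂ Q)))))))) , codes
      where
      r-small : large r ≡ false
      r-small with subst (v ∈_) (proj₂ R) v∈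
      ... | here refl = v-small
      link : ∀ {p y} → adj x p ≡ true → adj r y ≡ true → adj p y ≡ true → (p , y) ∈ linked x r
      link {p} {y} a b e = ∈-bind _,_ _ (∈-nbrs a) (∈-filterᵇ⁺ _ (∈P.∈-allFin y) (∧-intro b e))

  -- For small ends the larger degree is at most n/τ, so τ · deg x · deg p ≤ n · min(deg x, deg p),
  -- and the sum of these minima over the edges is O(n).
  near-count : ∀ m C → m ≤ C * τ ^ 1 → m * length (map near Near) ≤ n ^ 3 * (C * (24 * (24 * 24)))
  near-count m C m≤ = begin
    m * length (map near Near) ≡⟨ cong (m *_) (trans (ListP.length-map near Near) (length-⊗ first edgesList)) ⟩
    m * (length first * length edgesList) ≤⟨ ℕP.*-mono-≤ m≤ (ℕP.*-monoʳ-≤ (length first) length-all-edges) ⟩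
    C * (τ * 1) * (length first * (24 * n)) ≡⟨ solve 5 (λ C t f a n → C :* (t :* con 1) :* (f :* (a :* n)) := t :* f :* (C :* (a :* n))) refl C τ (length first) 24 n ⟩
    τ * length first * (C * (24 * n)) ≤⟨ ℕP.*-monoˡ-≤ (C * (24 * n)) first-bound ⟩
    n * (24 * (24 * n)) * (C * (24 * n)) ≡⟨ solve 3 (λ n a C → n :* (a :* (a :* n)) :* (C :* (a :* n)) := n :^ 3 :* (C :* (a :* (a :* a)))) refl n 24 C ⟩
    n ^ 3 * (C * (24 * (24 * 24))) ∎
    where
    open ℕP.≤-Reasoning
    open +-*-Solver using (solve; _:+_; _:*_; _:^_; _:=_; con)
    smallEdges = bind _,_ vs (λ x → filterᵇ (λ p → not (large x) ∧ (not (large p) ∧ adj x p)) vs)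
    first = bind _,_ smallEdges (λ (x , p) → nbrs x ⊗ nbrs p)
    both-small : V → V → Bool
    both-small x p = not (large x) ∧ (not (large p) ∧ adj x p)
    length-first : length first ≡ ∑ᶠ λ x → ∑ᶠ λ p → ⟦ both-small x p ⟧ * (deg x * deg p)
    length-first = trans (length-bind _,_ smallEdges _) (trans (∑-bind _,_ vs _ _)
      (∑-cong vs λ x → trans (∑-filter (both-small x) vs _)
        (∑-cong vs λ p → cong (⟦ both-small x p ⟧ *_) (trans (length-⊗ (nbrs x) (nbrs p)) (cong₂ _*_ (length-nbrs x) (length-nbrs p))))))
    min-max : ∀ a b → τ * a ≤ n → τ * b ≤ n → τ * (a * b) ≤ n * (a ⊓ b)
    min-max a b ha hb with ℕP.≤-total a b
    ... | inj₁ a≤b = ℕP.≤-trans (ℕP.≤-reflexive (solve 3 (λ t a b → t :* (a :* b) := (t :* b) :* a) refl τ a b))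
          (subst (λ c → τ * b * a ≤ n * c) (sym (ℕP.m≤n⇒m⊓n≡m a≤b)) (ℕP.*-monoˡ-≤ a hb))
    ... | inj₂ b≤a = ℕP.≤-trans (ℕP.≤-reflexive (sym (ℕP.*-assoc τ a b)))
          (subst (λ c → τ * a * b ≤ n * c) (sym (ℕP.m≥n⇒m⊓n≡n b≤a)) (ℕP.*-monoˡ-≤ b ha))
    pointwise : ∀ x p → τ * (⟦ both-small x p ⟧ * (deg x * deg p)) ≤ n * (⟦ adj x p ⟧ * (deg x ⊓ deg p))
    pointwise x p = go (large x) (large p) (adj x p) refl refl
      where
      go : ∀ a b e → large x ≡ a → large p ≡ b → τ * (⟦ not a ∧ (not b ∧ e) ⟧ * (deg x * deg p)) ≤ n * (⟦ e ⟧ * (deg x ⊓ deg p))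
      go true b e _ _ = ℕP.≤-trans (ℕP.≤-reflexive (ℕP.*-zeroʳ τ)) z≤n
      go false true e _ _ = ℕP.≤-trans (ℕP.≤-reflexive (ℕP.*-zeroʳ τ)) z≤n
      go false false false _ _ = ℕP.≤-trans (ℕP.≤-reflexive (ℕP.*-zeroʳ τ)) z≤n
      go false false true ex ep = ℕP.≤-trans (ℕP.≤-reflexive (cong (τ *_) (ℕP.+-identityʳ (deg x * deg p))))
        (ℕP.≤-trans (min-max (deg x) (deg p) (small-deg ex) (small-deg ep)) (ℕP.≤-reflexive (cong (n *_) (sym (ℕP.+-identityʳ _)))))
    first-bound : τ * length first ≤ n * (24 * (24 * n))
    first-bound = begin
      τ * length first ≡⟨ cong (τ *_) length-first ⟩
      τ * (∑ᶠ λ x → ∑ᶠ λ p → ⟦ both-small x p ⟧ * (deg x * deg p)) ≡⟨ sym (trans (∑-cong vs (λ x → ∑-*ˡ vs τ _)) (∑-*ˡ vs τ _)) ⟩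
      (∑ᶠ λ x → ∑ᶠ λ p → τ * (⟦ both-small x p ⟧ * (deg x * deg p))) ≤⟨ ∑-mono vs (λ x → ∑-mono vs (pointwise x)) ⟩
      (∑ᶠ λ x → ∑ᶠ λ p → n * (⟦ adj x p ⟧ * (deg x ⊓ deg p))) ≡⟨ trans (∑-cong vs (λ x → ∑-*ˡ vs n _)) (∑-*ˡ vs n _) ⟩
      n * minSum ≤⟨ ℕP.*-monoʳ-≤ n minSum-bound ⟩
      n * (24 * (24 * n)) ∎

  links : V → V → ℕ
  links x r = ∑ᶠ λ p → ⟦ adj x p ⟧ * count (λ y → adj r y ∧ adj p y)

  length-linked : ∀ x r → length (linked x r) ≡ links x r
  length-linked x r = trans (length-bind _,_ (nbrs x) _) (trans (∑-filter (adj x) vs _)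
    (∑-cong vs λ p → cong (⟦ adj x p ⟧ *_) (length-filter _ vs)))

  -- The edges between N(x) and N(r) lie inside N(x) ∪ N(r).
  links-bound : ∀ x r → links x r ≤ 24 * (deg x + deg r)
  links-bound x r = begin
    links x r ≡⟨ ∑-cong vs (λ p → sym (∑-*ˡ vs ⟦ adj x p ⟧ _)) ⟩
    (∑ᶠ λ p → ∑ᶠ λ y → ⟦ adj x p ⟧ * ⟦ adj r y ∧ adj p y ⟧) ≤⟨ ∑-mono vs (λ p → ∑-mono vs (λ y → inside (adj x p) (adj r p) (adj x y) (adj r y) (adj p y))) ⟩
    edgesIn adj near-both ≤⟨ sparse G D near-both ⟩
    24 * count near-both ≤⟨ ℕP.*-monoʳ-≤ 24 (ℕP.≤-trans (∑-mono vs (λ v → union (adj x v) (adj r v))) (ℕP.≤-reflexive (∑-+ vs _ _))) ⟩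
    24 * (deg x + deg r) ∎
    where
    open ℕP.≤-Reasoning
    near-both : Subset n
    near-both v = adj x v ∨ adj r v
    union : ∀ a b → ⟦ a ∨ b ⟧ ≤ ⟦ a ⟧ + ⟦ b ⟧
    union true b = s≤s z≤n
    union false b = ℕP.≤-refl
    inside : ∀ xp rp xy ry py → ⟦ xp ⟧ * ⟦ ry ∧ py ⟧ ≤ ⟦ (xp ∨ rp) ∧ ((xy ∨ ry) ∧ py) ⟧
    inside false rp xy ry py = z≤n
    inside true rp xy false py = z≤n
    inside true rp true true py = ℕP.≤-reflexive (ℕP.+-identityʳ _)
    inside true rp false true py = ℕP.≤-reflexive (ℕP.+-identityʳ _)

  -- Counted by its middle edge `py`, which extends in deg p · deg y ways; the larger degree is at
  -- most n, and `minSum` bounds the rest.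
  links-total : (∑ᶠ λ x → ∑ᶠ λ r → links x r) ≤ n * (24 * (24 * n))
  links-total = begin
    (∑ᶠ λ x → ∑ᶠ λ r → links x r) ≡⟨ ∑-swap vs vs links ⟩
    (∑ᶠ λ r → ∑ᶠ λ x → links x r) ≡⟨ ∑-cong vs (λ r → trans (∑-swap vs vs (λ x p → ⟦ adj x p ⟧ * g r p)) (∑-cong vs (λ p → trans (∑-*ʳ vs (g r p) (λ x → ⟦ adj x p ⟧)) (cong (_* g r p) (in-degree p))))) ⟩
    (∑ᶠ λ r → ∑ᶠ λ p → deg p * g r p) ≡⟨ ∑-swap vs vs _ ⟩
    (∑ᶠ λ p → ∑ᶠ λ r → deg p * g r p) ≡⟨ ∑-cong vs (λ p → trans (∑-*ˡ vs (deg p) _) (cong (deg p *_) (∑-swap vs vs (λ r y → ⟦ adj r y ∧ adj p y ⟧)))) ⟩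
    (∑ᶠ λ p → deg p * ∑ᶠ λ y → ∑ᶠ λ r → ⟦ adj r y ∧ adj p y ⟧) ≡⟨ ∑-cong vs (λ p → cong (deg p *_) (∑-cong vs (λ y →
        trans (∑-cong vs (λ r → ⟦∧⟧ (adj r y) (adj p y))) (trans (∑-*ʳ vs ⟦ adj p y ⟧ _) (cong (_* ⟦ adj p y ⟧) (in-degree y)))))) ⟩
    (∑ᶠ λ p → deg p * ∑ᶠ λ y → deg y * ⟦ adj p y ⟧) ≡⟨ ∑-cong vs (λ p → sym (∑-*ˡ vs (deg p) _)) ⟩
    (∑ᶠ λ p → ∑ᶠ λ y → deg p * (deg y * ⟦ adj p y ⟧)) ≤⟨ ∑-mono vs (λ p → ∑-mono vs (λ y → product≤ (adj p y) (deg p) (deg y) (deg≤n p) (deg≤n y))) ⟩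
    (∑ᶠ λ p → ∑ᶠ λ y → n * (⟦ adj p y ⟧ * (deg p ⊓ deg y))) ≡⟨ trans (∑-cong vs (λ x → ∑-*ˡ vs n _)) (∑-*ˡ vs n _) ⟩
    n * minSum ≤⟨ ℕP.*-monoʳ-≤ n minSum-bound ⟩
    n * (24 * (24 * n)) ∎
    where
    open ℕP.≤-Reasoning
    open +-*-Solver using (solve; _:+_; _:*_; _:^_; _:=_; con)
    g : V → V → ℕ
    g r p = count (λ y → adj r y ∧ adj p y)
    in-degree : ∀ p → (∑ᶠ λ x → ⟦ adj x p ⟧) ≡ deg p
    in-degree p = ∑-cong vs (λ x → cong ⟦_⟧ (adj-sym x p))
    product≤ : ∀ e a b → a ≤ n → b ≤ n → a * (b * ⟦ e ⟧) ≤ n * (⟦ e ⟧ * (a ⊓ b))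
    product≤ false a b _ _ = ℕP.≤-trans (ℕP.≤-reflexive (trans (cong (a *_) (ℕP.*-zeroʳ b)) (ℕP.*-zeroʳ a))) z≤n
    product≤ true a b ha hb with ℕP.≤-total a b
    ... | inj₁ a≤b = ℕP.≤-trans (ℕP.≤-reflexive (solve 2 (λ a b → a :* (b :* con 1) := b :* a) refl a b))
       (subst (λ c → b * a ≤ n * c) (sym (trans (ℕP.+-identityʳ _) (ℕP.m≤n⇒m⊓n≡m a≤b))) (ℕP.*-monoˡ-≤ a hb))
    ... | inj₂ b≤a = ℕP.≤-trans (ℕP.≤-reflexive (solve 2 (λ a b → a :* (b :* con 1) := a :* b) refl a b))
       (subst (λ c → a * b ≤ n * c) (sym (trans (ℕP.+-identityʳ _) (ℕP.m≥n⇒m⊓n≡n b≤a))) (ℕP.*-monoˡ-≤ b ha))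

  -- The pairs of paths number `links x r` squared. For small `x` and `r` one factor is at most
  -- 24·2n/τ by `links-bound`, and the other is summed by `links-total`.
  far-count : ∀ m C → m ≤ C * τ ^ 1 → m * length (map far Far) ≤ n ^ 3 * (C * (24 * (24 * 24) * 2))
  far-count m C m≤ = begin
    m * length (map far Far) ≡⟨ cong (m *_) (trans (ListP.length-map far Far) length-Far) ⟩
    m * (∑ᶠ λ x → ⟦ not (large x) ⟧ * ∑ᶠ λ r → ⟦ not (large r) ⟧ * (links x r * links x r)) ≤⟨ ℕP.*-monoˡ-≤ _ m≤ ⟩
    C * (τ * 1) * X ≡⟨ solve 3 (λ C t X → C :* (t :* con 1) :* X := C :* (t :* X)) refl C τ X ⟩
    C * (τ * X) ≤⟨ ℕP.*-monoʳ-≤ C X-bound ⟩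
    C * (24 * (n + n) * (n * (24 * (24 * n)))) ≡⟨ solve 3 (λ n a C → C :* (a :* (n :+ n) :* (n :* (a :* (a :* n)))) := n :^ 3 :* (C :* (a :* (a :* a) :* con 2))) refl n 24 C ⟩
    n ^ 3 * (C * (24 * (24 * 24) * 2)) ∎
    where
    open ℕP.≤-Reasoning
    open +-*-Solver using (solve; _:+_; _:*_; _:^_; _:=_; con)
    X = ∑ᶠ λ x → ⟦ not (large x) ⟧ * ∑ᶠ λ r → ⟦ not (large r) ⟧ * (links x r * links x r)
    length-Far : length Far ≡ X
    length-Far = trans (length-bind _,_ (smalls ⊗ smalls) _) (trans (∑-bind _,_ smalls _ _) (trans (∑-smalls _)
      (∑-cong vs λ x → cong (⟦ not (large x) ⟧ *_) (trans (∑-smalls _) (∑-cong vs λ r → cong (⟦ not (large r) ⟧ *_)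
        (trans (length-⊗ (linked x r) (linked x r)) (cong₂ _*_ (length-linked x r) (length-linked x r))))))))
    distribute : ∀ x → τ * (⟦ not (large x) ⟧ * ∑ᶠ λ r → ⟦ not (large r) ⟧ * (links x r * links x r))
      ≡ ∑ᶠ λ r → τ * (⟦ not (large x) ⟧ * (⟦ not (large r) ⟧ * (links x r * links x r)))
    distribute x = sym (trans (∑-*ˡ vs τ _) (cong (τ *_) (∑-*ˡ vs ⟦ not (large x) ⟧ _)))
    pointwise : ∀ x r → τ * (⟦ not (large x) ⟧ * (⟦ not (large r) ⟧ * (links x r * links x r))) ≤ 24 * (n + n) * links x r
    pointwise x r = go (large x) (large r) refl refl
      where
      go : ∀ a b → large x ≡ a → large r ≡ b → τ * (⟦ not a ⟧ * (⟦ not b ⟧ * (links x r * links x r))) ≤ 24 * (n + n) * links x r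
      go true b _ _ = ℕP.≤-trans (ℕP.≤-reflexive (ℕP.*-zeroʳ τ)) z≤n
      go false true _ _ = ℕP.≤-trans (ℕP.≤-reflexive (ℕP.*-zeroʳ τ)) z≤n
      go false false ex er = begin
        τ * (1 * (1 * (links x r * links x r))) ≡⟨ solve 2 (λ t l → t :* (con 1 :* (con 1 :* (l :* l))) := t :* l :* l) refl τ (links x r) ⟩
        τ * links x r * links x r ≤⟨ ℕP.*-monoˡ-≤ (links x r) (ℕP.*-monoʳ-≤ τ (links-bound x r)) ⟩
        τ * (24 * (deg x + deg r)) * links x r ≡⟨ cong (_* links x r) (solve 4 (λ t a d e → t :* (a :* (d :+ e)) := a :* (t :* d :+ t :* e)) refl τ 24 (deg x) (deg r)) ⟩
        24 * (τ * deg x + τ * deg r) * links x r ≤⟨ ℕP.*-monoˡ-≤ (links x r) (ℕP.*-monoʳ-≤ 24 (ℕP.+-mono-≤ (small-deg ex) (small-deg er))) ⟩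
        24 * (n + n) * links x r ∎
    X-bound : τ * X ≤ 24 * (n + n) * (n * (24 * (24 * n)))
    X-bound = begin
      τ * X ≡⟨ sym (∑-*ˡ vs τ _) ⟩
      (∑ᶠ λ x → τ * (⟦ not (large x) ⟧ * ∑ᶠ λ r → ⟦ not (large r) ⟧ * (links x r * links x r))) ≡⟨ ∑-cong vs distribute ⟩
      (∑ᶠ λ x → ∑ᶠ λ r → τ * (⟦ not (large x) ⟧ * (⟦ not (large r) ⟧ * (links x r * links x r)))) ≤⟨ ∑-mono vs (λ x → ∑-mono vs (pointwise x)) ⟩
      (∑ᶠ λ x → ∑ᶠ λ r → 24 * (n + n) * links x r) ≡⟨ trans (∑-cong vs (λ x → ∑-*ˡ vs (24 * (n + n)) _)) (∑-*ˡ vs (24 * (n + n)) _) ⟩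
      24 * (n + n) * (∑ᶠ λ x → ∑ᶠ λ r → links x r) ≤⟨ ℕP.*-monoʳ-≤ (24 * (n + n)) links-total ⟩
      24 * (n + n) * (n * (24 * (24 * n))) ∎

-- Assembling the upper bound.

⁻notlarge : ∀ {b} → not b ≡ false → b ≡ true
⁻notlarge {true} _ = refl

-- Of the M copies, L are counted by the main term and E by the error terms.
combine : ∀ M L E N K B m c → M ≤ L + E → K * L * B ≤ N → m * E ≤ N * c → m * (M * (B * K)) ≤ m * N + N * (c * (B * K))
combine M L E N K B m c hM hL hE = begin
  m * (M * (B * K)) ≤⟨ ℕP.*-monoʳ-≤ m (ℕP.*-monoˡ-≤ (B * K) hM) ⟩
  m * ((L + E) * (B * K)) ≡⟨ solve 5 (λ m L E B K → m :* ((L :+ E) :* (B :* K)) := m :* (K :* L :* B) :+ m :* E :* (B :* K)) refl m L E B K ⟩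
  m * (K * L * B) + m * E * (B * K) ≤⟨ ℕP.+-mono-≤ (ℕP.*-monoʳ-≤ m hL) (ℕP.*-monoˡ-≤ (B * K) hE) ⟩
  m * N + N * c * (B * K) ≡⟨ cong (m * N +_) (ℕP.*-assoc N c (B * K)) ⟩
  m * N + N * (c * (B * K)) ∎
  where
  open ℕP.≤-Reasoning
  open +-*-Solver using (solve; _:+_; _:*_; _:^_; _:=_; con)

opaque
  -- The multiple of `C` bounds the copies with a small hub, the rest those with a crowded vertex.
  -- In `errorConst₃` the multiple is the sum for the near and the far hexagons, which also covers
  -- larger classes.
  errorConst₃ errorConst₄ : ℕ → ℕ
  errorConst₃ C = C * (24 * (24 * 24) + 24 * (24 * 24) * 2) + 24 * (24 + 2 * 24 ^ 3) * (24 * 24)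
  errorConst₄ C = C * (24 * (24 * (24 * 24))) + 24 * (24 + 2 * 24 ^ 3) * (24 * (24 * 24))

  errorConst₃-split : ∀ N C → N * (C * (24 * (24 * 24) + 24 * (24 * 24) * 2)) + N * (24 * (24 + 2 * 24 ^ 3) * (24 * 24)) ≤ N * errorConst₃ C
  errorConst₃-split N C = ℕP.≤-reflexive (sym (ℕP.*-distribˡ-+ N (C * (24 * (24 * 24) + 24 * (24 * 24) * 2)) (24 * (24 + 2 * 24 ^ 3) * (24 * 24))))

  errorConst₄-split : ∀ N C → N * (C * (24 * (24 * (24 * 24)))) + N * (24 * (24 + 2 * 24 ^ 3) * (24 * (24 * 24))) ≤ N * errorConst₄ C
  errorConst₄-split N C = ℕP.≤-reflexive (sym (ℕP.*-distribˡ-+ N (C * (24 * (24 * (24 * 24)))) (24 * (24 + 2 * 24 ^ 3) * (24 * (24 * 24)))))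

module UpperBound {n : ℕ} (G : Graph n) (D : PlaneDrawing G) (1≤n : 1 ≤ n) (τ : ℕ) (1≤τ : 1 ≤ τ) (m : ℕ) (mτ³≤n : m * τ ^ 3 ≤ n) where
  open Copies {n}
  open Large G D 1≤n τ
  open Classify G D 1≤n τ
  open HexagonCodes G D 1≤n τ

  private
    main-power : ∀ e k K L f → K * L ≤ f ^ k → f * e ^ e ≤ n ^ e → K * L * e ^ (e * k) ≤ n ^ (e * k)
    main-power e k K L f hL hf = begin
      K * L * e ^ (e * k) ≤⟨ ℕP.*-monoˡ-≤ (e ^ (e * k)) hL ⟩
      f ^ k * e ^ (e * k) ≡⟨ cong (f ^ k *_) (sym (ℕP.^-*-assoc e e k)) ⟩
      f ^ k * (e ^ e) ^ k ≡⟨ sym (^-distribʳ-* k f (e ^ e)) ⟩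
      (f * e ^ e) ^ k ≤⟨ ℕP.^-monoˡ-≤ k hf ⟩
      (n ^ e) ^ k ≡⟨ ℕP.^-*-assoc n e k ⟩
      n ^ (e * k) ∎
      where open ℕP.≤-Reasoning

    errors : ∀ a b c E₁ E₂ → m * E₁ ≤ a → m * E₂ ≤ b → b + a ≤ c → m * (E₁ + E₂) ≤ c
    errors a b c E₁ E₂ h₁ h₂ h = ℕP.≤-trans (ℕP.≤-reflexive (ℕP.*-distribˡ-+ m E₁ E₂)) (ℕP.≤-trans (ℕP.+-mono-≤ h₁ h₂) (subst (_≤ c) (ℕP.+-comm b a) h))

    module _ (X Y Z : List Code) {c : SubData n} where
      to-first : (∃ λ x → x ∈ X × Codes c x) → ∃ λ x → x ∈ X ++ (Y ++ Z) × Codes c x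
      to-first (x , m , h) = x , ∈P.∈-++⁺ˡ m , h
      to-second : (∃ λ x → x ∈ Y × Codes c x) → ∃ λ x → x ∈ X ++ (Y ++ Z) × Codes c x
      to-second (x , m , h) = x , ∈P.∈-++⁺ʳ X (∈P.∈-++⁺ˡ m) , h
      to-third : (∃ λ x → x ∈ Z × Codes c x) → ∃ λ x → x ∈ X ++ (Y ++ Z) × Codes c x
      to-third (x , m , h) = x , ∈P.∈-++⁺ʳ X (∈P.∈-++⁺ʳ Y m) , h

    length-++₃ : ∀ (X Y Z : List Code) → length (X ++ (Y ++ Z)) ≡ length X + (length Y + length Z)
    length-++₃ X Y Z = trans (ListP.length-++ X) (cong (length X +_) (ListP.length-++ Y))

    pairs₃ : ∀ (ys : List V) → length ys ≡ 3 → length (pairsOf ys) ≡ 3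
    pairs₃ (_ ∷ _ ∷ _ ∷ []) refl = refl

    pairs₄ : ∀ (ys : List V) → length ys ≡ 4 → length (pairsOf ys) ≡ 6
    pairs₄ (_ ∷ _ ∷ _ ∷ _ ∷ []) refl = refl

  AreCopies : ℕ → ℕ → List (SubData n) → Set
  AreCopies t k cs = Unique cs × (∀ {c} → c ∈ cs → IsCopy G (KBlow t k) c)

  private
    tally : ∀ t e k (X Y : List Code) c → 1 ≤ k → (∀ ys → length ys ≡ t → length (pairsOf {V} ys) ≡ e) →
      ∑ (combos t A) (pairProd w) * e ^ e ≤ n ^ e →
      m * (length X + length Y) ≤ n ^ (e * k) * c →
      ∀ cs → Unique cs → (∀ {c} → c ∈ cs → ∃ λ x → x ∈ mainCodes t k ++ (X ++ Y) × Codes c x) →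
      m * (length cs * (e ^ (e * k) * (k !) ^ e)) ≤ m * n ^ (e * k) + n ^ (e * k) * (c * (e ^ (e * k) * (k !) ^ e))
    tally t e k X Y c 1≤k pairs≡ weight≤ hXY cs uniq code =
      combine (length cs) (length (mainCodes t k)) (length X + length Y) (n ^ (e * k)) ((k !) ^ e) (e ^ (e * k)) m c
        (ℕP.≤-trans (count-by-codes Codes Codes-injective cs _ uniq code) (ℕP.≤-reflexive (length-++₃ (mainCodes t k) X Y)))
        (main-power e k ((k !) ^ e) (length (mainCodes t k)) _ (mainCodes-count t e k 1≤k pairs≡) weight≤)
        hXY

  upper-K₄ : ∀ k C → m ≤ C * τ ^ (k + (suc k + suc k)) → ∀ cs → AreCopies 4 (suc k) cs →
    m * (length cs * (6 ^ (6 * suc k) * (suc k !) ^ 6)) ≤ m * n ^ (6 * suc k)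
      + n ^ (6 * suc k) * (errorConst₄ C * (6 ^ (6 * suc k) * (suc k !) ^ 6))
  upper-K₄ k C m≤ cs (uniq , copies) =
    tally 4 6 (suc k) (map crowded₄ Crowded₄) (map small₄ Small₄) (errorConst₄ C) (s≤s z≤n) pairs₄ K₄-weight
      (errors _ _ _ _ _ (crowded₄-count m 1≤τ mτ³≤n) (small₄-count m C m≤) (errorConst₄-split (n ^ (6 * suc k)) C)) cs uniq code
    where
    open K₄-codes k
    code : ∀ {c} → c ∈ cs → ∃ λ x → x ∈ mainCodes 4 (suc k) ++ (map crowded₄ Crowded₄ ++ map small₄ Small₄) × Codes c x
    code {c} c∈ = go (search (not ∘ large) hubs)
      where
      open FromCopy G 4 (suc k) c (copies c∈)
      small : ∀ {x} zs → length zs ≡ 3 → Hubs G (suc k) c (x ∷ zs) → large x ≡ false → ∃ λ e → e ∈ map small₄ Small₄ × Codes c e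
      small (_ ∷ _ ∷ _ ∷ []) refl H e = small₄-code H e
      go : _ → ∃ λ x → x ∈ mainCodes 4 (suc k) ++ (map crowded₄ Crowded₄ ++ map small₄ Small₄) × Codes c x
      go (inj₁ all-large) = case classify (s≤s (s≤s z≤n)) length-hubs isHubs (λ y∈ → ⁻notlarge (all-large y∈)) of λ
        { (inj₁ main) → to-first (mainCodes 4 (suc k)) (map crowded₄ Crowded₄) (map small₄ Small₄) main ; (inj₂ pair) → to-second (mainCodes 4 (suc k)) (map crowded₄ Crowded₄) (map small₄ Small₄) (crowded₄-code pair) }
      go (inj₂ (x , x∈ , e)) = let (zs , p) = ∈⇒↭ x∈ in
        to-third (mainCodes 4 (suc k)) (map crowded₄ Crowded₄) (map small₄ Small₄)
          (small zs (ℕP.suc-injective (trans (sym (PermP.↭-length p)) length-hubs)) (Hubs-↭ isHubs p) (not-true e))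

  -- The induction variable only separates classes of size one, for which `small₃` has no second
  -- vertex in the class opposite the small hub.
  upper-K₃ : ∀ k C → m ≤ C * τ ^ (k + suc k) → ∀ cs → AreCopies 3 (suc k) cs →
    m * (length cs * (3 ^ (3 * suc k) * (suc k !) ^ 3)) ≤ m * n ^ (3 * suc k)
      + n ^ (3 * suc k) * (errorConst₃ C * (3 ^ (3 * suc k) * (suc k !) ^ 3))
  upper-K₃ (suc k) C m≤ cs (uniq , copies) =
    tally 3 3 (suc (suc k)) (map crowded₃ Crowded₃) (map small₃ Small₃) (errorConst₃ C) (s≤s z≤n) pairs₃ triangle-weight
      (errors _ _ _ _ _ (crowded₃-count m 1≤τ mτ³≤n)
        (ℕP.≤-trans (small₃-count m C m≤) (ℕP.*-monoʳ-≤ (n ^ (3 * suc (suc k))) (ℕP.*-monoʳ-≤ C (ℕP.m≤m+n (24 * (24 * 24)) (24 * (24 * 24) * 2)))))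
        (errorConst₃-split (n ^ (3 * suc (suc k))) C))
      cs uniq code
    where
    -- The classes have size k+2; the crowded codes single out one vertex of a class, the small
    -- codes two of them, hence the different parameters.
    open K₃-codes (suc k) using (Crowded₃; crowded₃; crowded₃-code; crowded₃-count)
    open K₃-codes k using (Small₃; small₃; small₃-code; small₃-count)
    code : ∀ {c} → c ∈ cs → ∃ λ x → x ∈ mainCodes 3 (suc (suc k)) ++ (map crowded₃ Crowded₃ ++ map small₃ Small₃) × Codes c x
    code {c} c∈ = go (search (not ∘ large) hubs)
      where
      open FromCopy G 3 (suc (suc k)) c (copies c∈)
      small : ∀ {x} zs → length zs ≡ 2 → Hubs G (suc (suc k)) c (x ∷ zs) → large x ≡ false → ∃ λ e → e ∈ map small₃ Small₃ × Codes c e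
      small (_ ∷ _ ∷ []) refl H e = small₃-code H e
      go : _ → ∃ λ x → x ∈ mainCodes 3 (suc (suc k)) ++ (map crowded₃ Crowded₃ ++ map small₃ Small₃) × Codes c x
      go (inj₁ all-large) = case classify (s≤s (s≤s z≤n)) length-hubs isHubs (λ y∈ → ⁻notlarge (all-large y∈)) of λ
        { (inj₁ main) → to-first (mainCodes 3 (suc (suc k))) (map crowded₃ Crowded₃) (map small₃ Small₃) main ; (inj₂ pair) → to-second (mainCodes 3 (suc (suc k))) (map crowded₃ Crowded₃) (map small₃ Small₃) (crowded₃-code pair) }
      go (inj₂ (x , x∈ , e)) = let (zs , p) = ∈⇒↭ x∈ in
        to-third (mainCodes 3 (suc (suc k))) (map crowded₃ Crowded₃) (map small₃ Small₃)
          (small zs (ℕP.suc-injective (trans (sym (PermP.↭-length p)) length-hubs)) (Hubs-↭ isHubs p) (not-true e))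
  upper-K₃ zero C m≤ cs (uniq , copies) =
    tally 3 3 1 (map crowded₃ Crowded₃) (map near Near ++ map far Far) (errorConst₃ C) (s≤s z≤n) pairs₃ triangle-weight
      (errors _ _ _ _ _ (crowded₃-count m 1≤τ mτ³≤n) hexagons (errorConst₃-split (n ^ 3) C))
      cs uniq code
    where
    open K₃-codes 0
    hexagon-split : ∀ N → N * (C * (24 * (24 * 24) * 2)) + N * (C * (24 * (24 * 24))) ≤ N * (C * (24 * (24 * 24) + 24 * (24 * 24) * 2))
    hexagon-split N = ℕP.≤-reflexive (solve 3 (λ N C a → N :* (C :* (a :* con 2)) :+ N :* (C :* a) := N :* (C :* (a :+ a :* con 2))) refl N C (24 * (24 * 24)))
      where open +-*-Solver using (solve; _:+_; _:*_; _:^_; _:=_; con)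
    hexagons : m * length (map near Near ++ map far Far) ≤ n ^ 3 * (C * (24 * (24 * 24) + 24 * (24 * 24) * 2))
    hexagons = ℕP.≤-trans (ℕP.≤-reflexive (cong (m *_) (ListP.length-++ (map near Near))))
      (errors _ _ _ _ _ (near-count m C m≤) (far-count m C m≤) (hexagon-split (n ^ 3)))
    Found : SubData n → Set
    Found c = ∃ λ x → x ∈ mainCodes 3 1 ++ (map crowded₃ Crowded₃ ++ (map near Near ++ map far Far)) × Codes c x
    found-near : ∀ {c} → (∃ λ e → e ∈ map near Near × Codes c e) → Found c
    found-near (e , e∈ , h) = to-third (mainCodes 3 1) (map crowded₃ Crowded₃) (map near Near ++ map far Far) (e , ∈P.∈-++⁺ˡ e∈ , h)
    found-far : ∀ {c} → (∃ λ e → e ∈ map far Far × Codes c e) → Found c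
    found-far (e , e∈ , h) = to-third (mainCodes 3 1) (map crowded₃ Crowded₃) (map near Near ++ map far Far) (e , ∈P.∈-++⁺ʳ (map near Near) e∈ , h)
    hubs-large : ∀ {c ys} → length ys ≡ 3 → Hubs G 1 c ys → (∀ {y} → y ∈ ys → large y ≡ true) → Found c
    hubs-large len H all-large = case classify (s≤s (s≤s z≤n)) len H all-large of λ
        { (inj₁ main) → to-first (mainCodes 3 1) (map crowded₃ Crowded₃) (map near Near ++ map far Far) main ; (inj₂ pair) → to-second (mainCodes 3 1) (map crowded₃ Crowded₃) (map near Near ++ map far Far) (crowded₃-code pair) }
    code : ∀ {c} → c ∈ cs → Found c
    code {c} c∈ = go (search (not ∘ large) hubs)
      where
      copy = copies c∈
      open FromCopy G 3 1 c copy
      rotated = Hexagon.rotate-copy {G = G} {c} copy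
      module R = FromCopy G 3 1 c rotated
      φ = proj₁ (proj₂ (proj₂ copy))
      φ-adj = proj₂ (proj₂ (proj₂ (proj₂ (proj₂ (proj₂ copy)))))
      hub∈ : ∀ i → hub i ∈ hubs
      hub∈ i = ∈P.∈-map⁺ hub (∈P.∈-allFin i)
      hub≢ : ∀ i j → i ≢ j → hub i ≢ hub j
      hub≢ i j ne e = case proj₁ (proj₂ (proj₂ (proj₂ copy))) (inj₁ i) (inj₁ j) e of λ { refl → ne refl }
      -- The hubs of the rotated copy are the class vertices of the original one.
      others-large : (∀ {p} → p ∈ members c hubs → not (large (proj₂ p)) ≡ false) → ∀ {y} → y ∈ R.hubs → large y ≡ true
      others-large h = λ { (here refl) → class-vertex (# 0) (# 1) (# 1) (λ ()) refl refl
                         ; (there (here refl)) → class-vertex (# 1) (# 2) (# 3) (λ ()) refl refl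
                         ; (there (there (here refl))) → class-vertex (# 0) (# 2) (# 5) (λ ()) refl refl }
        where
        class-vertex : ∀ i j l → i ≢ j → blowUpAdj 3 (K 3) 1 (inj₁ i) (Hexagon.vertex l) ≡ true → blowUpAdj 3 (K 3) 1 (inj₁ j) (Hexagon.vertex l) ≡ true →
          large (φ (Hexagon.vertex l)) ≡ true
        class-vertex i j l ne e e′ = let (_ , p∈) = ∈-members⁺ c (hub∈ i) (hub∈ j) (hub≢ i j ne)
                                            (∈-between⁺ c (trans (sym (φ-adj (inj₁ i) (Hexagon.vertex l))) e) (trans (sym (φ-adj (inj₁ j) (Hexagon.vertex l))) e′))
                                     in ⁻notlarge (h p∈)
      -- In the hexagon the class vertex `v` is either a neighbour of the hub `x` or opposite to it.
      small-pair : ∀ {x y y′ v} → x ∈ hubs → large x ≡ false → y ∈ hubs → y′ ∈ hubs → y ≢ y′ → v ∈ between c y y′ → large v ≡ false → Found c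
      small-pair {x} {y} {y′} x∈ x-small y∈ y′∈ y≢y′ v∈ v-small with x Fin.≟ y | x Fin.≟ y′
      ... | yes refl | _ = let (zs , p) = two-front y∈ y′∈ y≢y′ in go₂ zs (trans (sym (PermP.↭-length p)) length-hubs) (Hubs-↭ isHubs p)
        where
        go₂ : ∀ zs → length (x ∷ y′ ∷ zs) ≡ 3 → Hubs G 1 c (x ∷ y′ ∷ zs) → Found c
        go₂ (_ ∷ []) refl H = found-near (near-code H x-small v∈ v-small)
      ... | no _ | yes refl = let (zs , p) = two-front y′∈ y∈ (λ e → y≢y′ (sym e)) in go₂ zs (trans (sym (PermP.↭-length p)) length-hubs) (Hubs-↭ isHubs p)
        where
        go₂ : ∀ zs → length (x ∷ y ∷ zs) ≡ 3 → Hubs G 1 c (x ∷ y ∷ zs) → Found c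
        go₂ (_ ∷ []) refl H = found-near (near-code H x-small (between-sym c y x v∈) v-small)
      ... | no x≢y | no x≢y′ with two-front x∈ y∈ x≢y
      ...   | zs , p = go₂ zs (trans (sym (PermP.↭-length p)) length-hubs) (Hubs-↭ isHubs p) (PermP.∈-resp-↭ p y′∈)
        where
        go₂ : ∀ zs → length (x ∷ y ∷ zs) ≡ 3 → Hubs G 1 c (x ∷ y ∷ zs) → y′ ∈ x ∷ y ∷ zs → Found c
        go₂ (_ ∷ []) refl H (there (there (here refl))) = found-far (far-code H x-small v∈ v-small)
        go₂ (_ ∷ []) refl H (here e) = ⊥-elim (x≢y′ (sym e))
        go₂ (_ ∷ []) refl H (there (here e)) = ⊥-elim (y≢y′ (sym e))
      go : _ → Found c
      go (inj₁ all-large) = hubs-large length-hubs isHubs (λ y∈ → ⁻notlarge (all-large y∈))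
      -- With a small hub present, either all class vertices are large and the rotated copy has
      -- large hubs only, or a small hub and a small class vertex are available together.
      go (inj₂ (x , x∈ , e)) = go′ (search (not ∘ large ∘ proj₂) (members c hubs))
        where
        go′ : _ → Found c
        go′ (inj₁ h) = hubs-large R.length-hubs R.isHubs (others-large h)
        go′ (inj₂ (((y , y′) , v) , m , e′)) =
          let (y∈ , y′∈ , ne , v∈) = ∈-members⁻ c (Hubs.uniq isHubs) m in
          small-pair x∈ (not-true e) y∈ y′∈ ne v∈ (not-true e′)

-- The construction for the lower bound: a plane drawing from separating affine functions.

open Data.Vec using ([]; _∷_)

Affine : Set
Affine = ℚ × ℚ × ℚ

opaque
  eval : Affine → Point → ℚ
  eval (a , b , k) (x , y) = a ℚ.* x ℚ.+ b ℚ.* y ℚ.+ k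

  along : Point → Point → ℚ → Point
  along (p₁ , p₂) (q₁ , q₂) s = p₁ ℚ.+ s ℚ.* (q₁ ℚ.- p₁) , p₂ ℚ.+ s ℚ.* (q₂ ℚ.- p₂)

  mix : ℚ → ℚ → ℚ → ℚ
  mix s A B = (1ℚ ℚ.- s) ℚ.* A ℚ.+ s ℚ.* B

  eval-along : ∀ f p q s → eval f (along p q s) ≡ mix s (eval f p) (eval f q)
  eval-along (a , b , k) (p₁ , p₂) (q₁ , q₂) s = alg a b k p₁ p₂ q₁ q₂ s
    where
    open ℚSolver.+-*-Solver using (solve; _:+_; _:*_; _:-_; _:=_; con)
    alg : ∀ a b k p₁ p₂ q₁ q₂ s → a ℚ.* (p₁ ℚ.+ s ℚ.* (q₁ ℚ.- p₁)) ℚ.+ b ℚ.* (p₂ ℚ.+ s ℚ.* (q₂ ℚ.- p₂)) ℚ.+ k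
      ≡ (1ℚ ℚ.- s) ℚ.* (a ℚ.* p₁ ℚ.+ b ℚ.* p₂ ℚ.+ k) ℚ.+ s ℚ.* (a ℚ.* q₁ ℚ.+ b ℚ.* q₂ ℚ.+ k)
    alg = solve 8 (λ a b k p₁ p₂ q₁ q₂ s → a :* (p₁ :+ s :* (q₁ :- p₁)) :+ b :* (p₂ :+ s :* (q₂ :- p₂)) :+ k
      := (con 1ℚ :- s) :* (a :* p₁ :+ b :* p₂ :+ k) :+ s :* (a :* q₁ :+ b :* q₂ :+ k)) refl

  along-0 : ∀ p q → along p q 0ℚ ≡ p
  along-0 (p₁ , p₂) (q₁ , q₂) = cong₂ _,_ (alg p₁ q₁) (alg p₂ q₂)
    where
    alg : ∀ p q → p ℚ.+ 0ℚ ℚ.* (q ℚ.- p) ≡ p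
    alg p q = trans (cong (p ℚ.+_) (ℚP.*-zeroˡ (q ℚ.- p))) (ℚP.+-identityʳ p)

  along-1 : ∀ p q → along p q 1ℚ ≡ q
  along-1 (p₁ , p₂) (q₁ , q₂) = cong₂ _,_ (alg p₁ q₁) (alg p₂ q₂)
    where
    open ℚSolver.+-*-Solver using (solve; _:+_; _:*_; _:-_; _:=_; con)
    alg : ∀ p q → p ℚ.+ 1ℚ ℚ.* (q ℚ.- p) ≡ q
    alg = solve 2 (λ p q → p :+ con 1ℚ :* (q :- p) := q) refl

private
  0≤*0≤ : ∀ {a x} → 0ℚ ℚ.≤ a → 0ℚ ℚ.≤ x → 0ℚ ℚ.≤ a ℚ.* x
  0≤*0≤ {a} {x} p q = ℚP.nonNegative⁻¹ (a ℚ.* x) {{ℚP.nonNeg*nonNeg⇒nonNeg a {{ℚ.nonNegative p}} x {{ℚ.nonNegative q}}}}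

  0<*0< : ∀ {a x} → 0ℚ ℚ.< a → 0ℚ ℚ.< x → 0ℚ ℚ.< a ℚ.* x
  0<*0< {a} {x} p q = ℚP.positive⁻¹ (a ℚ.* x) {{ℚP.pos*pos⇒pos a {{ℚ.positive p}} x {{ℚ.positive q}}}}

  0≤-sub : ∀ {x y} → x ℚ.≤ y → 0ℚ ℚ.≤ y ℚ.- x
  0≤-sub {x} {y} le = subst (ℚ._≤ y ℚ.- x) (ℚP.+-inverseʳ x) (ℚP.+-monoˡ-≤ (ℚ.- x) le)

record Unit (s : ℚ) : Set where
  constructor unit
  field
    0≤s : 0ℚ ℚ.≤ s
    s≤1 : s ℚ.≤ 1ℚ
open Unit

opaque
  unfolding mix
  mix-nonneg : ∀ {s A B} → Unit s → 0ℚ ℚ.≤ A → 0ℚ ℚ.≤ B → 0ℚ ℚ.≤ mix s A B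
  mix-nonneg u a b = ℚP.+-mono-≤ (0≤*0≤ (0≤-sub (s≤1 u)) a) (0≤*0≤ (0≤s u) b)

  mix-pos : ∀ {s A B} → Unit s → 0ℚ ℚ.≤ A → 0ℚ ℚ.< s → 0ℚ ℚ.< B → 0ℚ ℚ.< mix s A B
  mix-pos u a s b = ℚP.+-mono-≤-< (0≤*0≤ (0≤-sub (s≤1 u)) a) (0<*0< s b)

  mix-neg : ∀ s A B → mix s (ℚ.- A) (ℚ.- B) ≡ ℚ.- mix s A B
  mix-neg = solve 3 (λ s A B → (con 1ℚ :- s) :* (:- A) :+ s :* (:- B) := :- ((con 1ℚ :- s) :* A :+ s :* B)) refl
    where open ℚSolver.+-*-Solver using (solve; _:+_; _:*_; _:-_; :-_; _:=_; con)

-- A segment from a closed to an open half plane touches the boundary only at its start.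
mix-zero : ∀ {s A B} → Unit s → 0ℚ ℚ.≤ A → 0ℚ ℚ.< B → mix s A B ℚ.≤ 0ℚ → s ≡ 0ℚ
mix-zero u a b le = ℚP.≤-antisym (ℚP.≮⇒≥ λ 0<s → ℚP.<-irrefl refl (ℚP.<-≤-trans (mix-pos u a 0<s b) le)) (0≤s u)

mix-zero-neg : ∀ {s A B} → Unit s → A ℚ.≤ 0ℚ → B ℚ.< 0ℚ → 0ℚ ℚ.≤ mix s A B → s ≡ 0ℚ
mix-zero-neg {s} {A} {B} u a b le = mix-zero u (ℚP.neg-antimono-≤ a) (ℚP.neg-antimono-< b)
  (subst (ℚ._≤ 0ℚ) (sym (mix-neg s A B)) (ℚP.neg-antimono-≤ le))

neg-mix-neg : ∀ s A B → ℚ.- mix s (ℚ.- A) (ℚ.- B) ≡ mix s A B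
neg-mix-neg s A B = trans (cong ℚ.-_ (mix-neg s A B)) (neg-neg (mix s A B))
  where
  open ℚSolver.+-*-Solver using (solve; :-_; _:=_)
  neg-neg : ∀ x → ℚ.- (ℚ.- x) ≡ x
  neg-neg = solve 1 (λ x → :- (:- x) := x) refl

mix-nonpos : ∀ {s A B} → Unit s → A ℚ.≤ 0ℚ → B ℚ.≤ 0ℚ → mix s A B ℚ.≤ 0ℚ
mix-nonpos {s} {A} {B} u a b = subst (ℚ._≤ 0ℚ) (neg-mix-neg s A B)
  (ℚP.neg-antimono-≤ (mix-nonneg u (ℚP.neg-antimono-≤ a) (ℚP.neg-antimono-≤ b)))

mix-negative : ∀ {s A B} → Unit s → A ℚ.≤ 0ℚ → 0ℚ ℚ.< s → B ℚ.< 0ℚ → mix s A B ℚ.< 0ℚ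
mix-negative {s} {A} {B} u a 0<s b = subst (ℚ._< 0ℚ) (neg-mix-neg s A B)
  (ℚP.neg-antimono-< (mix-pos u (ℚP.neg-antimono-≤ a) 0<s (ℚP.neg-antimono-< b)))

opaque
  unfolding mix
  mix-right-0 : ∀ s A → mix s A 0ℚ ≡ (1ℚ ℚ.- s) ℚ.* A
  mix-right-0 s A = trans (cong ((1ℚ ℚ.- s) ℚ.* A ℚ.+_) (ℚP.*-zeroʳ s)) (ℚP.+-identityʳ ((1ℚ ℚ.- s) ℚ.* A))

  mix-left-0 : ∀ s B → mix s 0ℚ B ≡ s ℚ.* B
  mix-left-0 s B = trans (cong (ℚ._+ s ℚ.* B) (ℚP.*-zeroʳ (1ℚ ℚ.- s))) (ℚP.+-identityˡ (s ℚ.* B))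

  mix-0-0 : ∀ s → mix s 0ℚ 0ℚ ≡ 0ℚ
  mix-0-0 s = trans (cong₂ ℚ._+_ (ℚP.*-zeroʳ (1ℚ ℚ.- s)) (ℚP.*-zeroʳ s)) (ℚP.+-identityʳ 0ℚ)

cancel-nonzero : ∀ {x y b} → b ≢ 0ℚ → x ℚ.* b ≡ y ℚ.* b → x ≡ y
cancel-nonzero {x} {y} {b} b≢0 e = begin
  x ≡⟨ sym (back x) ⟩
  x ℚ.* b ℚ.* i ≡⟨ cong (ℚ._* i) e ⟩
  y ℚ.* b ℚ.* i ≡⟨ back y ⟩
  y ∎
  where
  open ≡-Reasoning
  instance
    nz : ℚ.NonZero b
    nz = ℚ.≢-nonZero b≢0
  i = ℚ.1/ b
  back : ∀ x → x ℚ.* b ℚ.* i ≡ x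
  back x = trans (ℚP.*-assoc x b i) (trans (cong (x ℚ.*_) (ℚP.*-inverseʳ b)) (ℚP.*-identityʳ x))

opaque
  -- Infinitely many distinct parameters in (0,1], so that one layout provides places for classes of
  -- every size.
  halves : ℕ → ℚ
  halves zero = 1ℚ
  halves (suc l) = ½ ℚ.* halves l

  halves-pos : ∀ l → 0ℚ ℚ.< halves l
  halves-pos zero = ℚP.positive⁻¹ 1ℚ
  halves-pos (suc l) = 0<*0< (ℚP.positive⁻¹ ½) (halves-pos l)

  halves-step : ∀ l → halves (suc l) ℚ.< halves l
  halves-step l = subst (½ ℚ.* halves l ℚ.<_) (ℚP.*-identityˡ (halves l))
    (ℚP.*-monoˡ-<-pos (halves l) {{ℚ.positive (halves-pos l)}} (from-yes (½ ℚP.<? 1ℚ)))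

  halves-anti : ∀ {l m} → l < m → halves m ℚ.< halves l
  halves-anti {l} {suc m} (s≤s l≤m) with ℕP.m≤n⇒m<n∨m≡n l≤m
  ... | inj₁ l<m = ℚP.<-trans (halves-step m) (halves-anti l<m)
  ... | inj₂ refl = halves-step l

  halves-inj : ∀ l m → halves l ≡ halves m → l ≡ m
  halves-inj l m e with ℕP.<-cmp l m
  ... | tri< a _ _ = ⊥-elim (ℚP.<-irrefl (sym e) (halves-anti a))
  ... | tri≈ _ a _ = a
  ... | tri> _ _ a = ⊥-elim (ℚP.<-irrefl e (halves-anti a))

  halves-unit : ∀ l → Unit (halves l)
  halves-unit zero = unit (ℚP.<⇒≤ (ℚP.positive⁻¹ 1ℚ)) ℚP.≤-refl
  halves-unit (suc l) = unit (ℚP.<⇒≤ (halves-pos (suc l))) (ℚP.<⇒≤ (ℚP.<-≤-trans (halves-step l) (s≤1 (halves-unit l))))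

opaque
  unfolding along
  OnSeg⇒along : ∀ p q x → OnSeg p q x → ∃ λ s → Unit s × x ≡ along p q s
  OnSeg⇒along (p₁ , p₂) (q₁ , q₂) (x₁ , x₂) (s , u , v , e , e′) = s , unit u v , cong₂ _,_ e e′

-- The hubs are placed at P; the class c of vertices joined to two hubs occupies the points
-- W c l of the segment from M c to N c, where M c lies on the segment between these hubs.
record Layout (t e : ℕ) : Set where
  field
    ends : Fin e → Fin t × Fin t
    P : Fin t → Point
    M N : Fin e → Point
    -- `separator` keeps the regions of two classes apart; `across c` vanishes on the line through
    -- `M c` and `N c`, with the two hubs strictly on different sides; `offset c` vanishes on the
    -- line through the hubs.
    separator : Fin e → Fin e → Affine
    across offset : Fin e → Affine
  a : Fin e → Fin t
  a c = proj₁ (ends c)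
  b : Fin e → Fin t
  b c = proj₂ (ends c)
  Positive : Affine → Fin e → Set
  Positive f c = 0ℚ ℚ.≤ eval f (P (a c)) × 0ℚ ℚ.≤ eval f (P (b c)) × 0ℚ ℚ.< eval f (M c) × 0ℚ ℚ.< eval f (N c)
  Negative : Affine → Fin e → Set
  Negative f c = eval f (P (a c)) ℚ.≤ 0ℚ × eval f (P (b c)) ℚ.≤ 0ℚ × eval f (M c) ℚ.< 0ℚ × eval f (N c) ℚ.< 0ℚ
  field
    separated : ∀ c c′ → c ≡ c′ ⊎ Positive (separator c c′) c × Negative (separator c c′) c′
    crossed : ∀ c → eval (across c) (P (a c)) ℚ.< 0ℚ × 0ℚ ℚ.< eval (across c) (P (b c)) ×
      eval (across c) (M c) ≡ 0ℚ × eval (across c) (N c) ≡ 0ℚ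
    off : ∀ c → eval (offset c) (P (a c)) ≡ 0ℚ × eval (offset c) (P (b c)) ≡ 0ℚ ×
      eval (offset c) (M c) ≡ 0ℚ × 0ℚ ℚ.< eval (offset c) (N c)
    P-injective : ∀ i j → P i ≡ P j → i ≡ j
    ends-< : ∀ c → toℕ (a c) < toℕ (b c)
    ends-injective : ∀ c c′ → ends c ≡ ends c′ → c ≡ c′
    ends-complete : ∀ i j → toℕ i < toℕ j → ∃ λ c → ends c ≡ (i , j)
    incident : ∀ i → ∃ λ c → i ≡ a c ⊎ i ≡ b c

module Drawing {t e : ℕ} (L : Layout t e) where
  open Layout L

  Label : Set
  Label = Fin t ⊎ (Fin e × ℕ)

  W : Fin e → ℕ → Point
  W c l = along (M c) (N c) (halves l)

  place : Label → Point
  place (inj₁ i) = P i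
  place (inj₂ (c , l)) = W c l

  End : Fin t → Fin e → Set
  End i c = i ≡ a c ⊎ i ≡ b c

  -- x is the point of parameter s on the segment from the hub i to W c l
  record On (i : Fin t) (c : Fin e) (l : ℕ) (s : ℚ) (x : Point) : Set where
    constructor on
    field
      bounds : Unit s
      position : x ≡ along (P i) (W c l) s
  open On

  private
    a≢b : ∀ c → a c ≢ b c
    a≢b c e = ℕP.<-irrefl (cong toℕ e) (ends-< c)

    W-pos : ∀ f c l → 0ℚ ℚ.< eval f (M c) → 0ℚ ℚ.< eval f (N c) → 0ℚ ℚ.< eval f (W c l)
    W-pos f c l m n = subst (0ℚ ℚ.<_) (sym (eval-along f (M c) (N c) (halves l)))
      (mix-pos (halves-unit l) (ℚP.<⇒≤ m) (halves-pos l) n)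

    W-neg : ∀ f c l → eval f (M c) ℚ.< 0ℚ → eval f (N c) ℚ.< 0ℚ → eval f (W c l) ℚ.< 0ℚ
    W-neg f c l m n = subst (ℚ._< 0ℚ) (sym (eval-along f (M c) (N c) (halves l)))
      (mix-negative (halves-unit l) (ℚP.<⇒≤ m) (halves-pos l) n)

    ends-nonneg : ∀ f {i c} → Positive f c → End i c → 0ℚ ℚ.≤ eval f (P i)
    ends-nonneg f (p , q , _) (inj₁ refl) = p
    ends-nonneg f (p , q , _) (inj₂ refl) = q

    ends-nonpos : ∀ f {i c} → Negative f c → End i c → eval f (P i) ℚ.≤ 0ℚ
    ends-nonpos f (p , q , _) (inj₁ refl) = p
    ends-nonpos f (p , q , _) (inj₂ refl) = q

    separate : ∀ c c′ → c ≢ c′ → Positive (separator c c′) c × Negative (separator c c′) c′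
    separate c c′ ne with separated c c′
    ... | inj₁ eq = ⊥-elim (ne eq)
    ... | inj₂ s = s

    eval-On : ∀ f {i c l s x} → On i c l s x → eval f x ≡ mix s (eval f (P i)) (eval f (W c l))
    eval-On f {i} {c} {l} {s} (on _ refl) = eval-along f (P i) (W c l) s

    W-across : ∀ c l → eval (across c) (W c l) ≡ 0ℚ
    W-across c l = let (_ , _ , m , n) = crossed c in trans (eval-along (across c) (M c) (N c) (halves l))
      (trans (cong₂ (mix (halves l)) m n) (mix-0-0 (halves l)))

    W-offset : ∀ c l → eval (offset c) (W c l) ≡ halves l ℚ.* eval (offset c) (N c)
    W-offset c l = let (_ , _ , m , _) = off c in trans (eval-along (offset c) (M c) (N c) (halves l))
      (trans (cong (λ z → mix (halves l) z (eval (offset c) (N c))) m) (mix-left-0 (halves l) _))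

    P-offset : ∀ {i c} → End i c → eval (offset c) (P i) ≡ 0ℚ
    P-offset {c = c} (inj₁ refl) = proj₁ (off c)
    P-offset {c = c} (inj₂ refl) = proj₁ (proj₂ (off c))

    P-across≢0 : ∀ {i c} → End i c → eval (across c) (P i) ≢ 0ℚ
    P-across≢0 {c = c} (inj₁ refl) e = ℚP.<-irrefl e (proj₁ (crossed c))
    P-across≢0 {c = c} (inj₂ refl) e = ℚP.<-irrefl (sym e) (proj₁ (proj₂ (crossed c)))

    across-On : ∀ {i c l s x} → On i c l s x → eval (across c) x ≡ (1ℚ ℚ.- s) ℚ.* eval (across c) (P i)
    across-On {i} {c} {l} {s} o = trans (eval-On (across c) o) (trans (cong (mix s (eval (across c) (P i))) (W-across c l)) (mix-right-0 s _))

    offset-On : ∀ {i c l s x} → End i c → On i c l s x → eval (offset c) x ≡ s ℚ.* (halves l ℚ.* eval (offset c) (N c))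
    offset-On {i} {c} {l} {s} en o = trans (eval-On (offset c) o) (trans (cong₂ (mix s) (P-offset en) (W-offset c l)) (mix-left-0 s _))

    complement-inj : ∀ s s′ → 1ℚ ℚ.- s ≡ 1ℚ ℚ.- s′ → s ≡ s′
    complement-inj s s′ e = trans (alg s) (trans (cong (λ z → 1ℚ ℚ.- z) e) (sym (alg s′)))
      where
      open ℚSolver.+-*-Solver using (solve; _:-_; _:=_; con)
      alg : ∀ s → s ≡ 1ℚ ℚ.- (1ℚ ℚ.- s)
      alg = solve 1 (λ s → s := con 1ℚ :- (con 1ℚ :- s)) refl

    start : ∀ {i c l s x} → On i c l s x → s ≡ 0ℚ → x ≡ P i
    start {i} {c} {l} (on _ refl) refl = along-0 (P i) (W c l)

  -- The separator is nonnegative on one segment and nonpositive on the other, so it vanishes at a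
  -- common point; on either segment that can happen only at the hub.
  different-classes : ∀ {i c l s i′ c′ l′ s′ x} → End i c → End i′ c′ → c ≢ c′ → On i c l s x → On i′ c′ l′ s′ x → x ≡ P i × x ≡ P i′
  different-classes {i} {c} {l} {s} {i′} {c′} {l′} {s′} {x} en en′ ne o o′ =
    start o (mix-zero (bounds o) A≥0 B>0 (subst (ℚ._≤ 0ℚ) (trans (sym v′) v) v′≤0))
    , start o′ (mix-zero-neg (bounds o′) A′≤0 B′<0 (subst (0ℚ ℚ.≤_) (trans (sym v) v′) v≥0))
    where
    f = separator c c′
    pos = proj₁ (separate c c′ ne)
    neg = proj₂ (separate c c′ ne)
    A≥0 = ends-nonneg f {i} {c} pos en
    B>0 = W-pos f c l (proj₁ (proj₂ (proj₂ pos))) (proj₂ (proj₂ (proj₂ pos)))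
    A′≤0 = ends-nonpos f {i′} {c′} neg en′
    B′<0 = W-neg f c′ l′ (proj₁ (proj₂ (proj₂ neg))) (proj₂ (proj₂ (proj₂ neg)))
    v = eval-On f o
    v′ = eval-On f o′
    v≥0 = mix-nonneg (bounds o) A≥0 (ℚP.<⇒≤ B>0)
    v′≤0 = mix-nonpos (bounds o′) A′≤0 (ℚP.<⇒≤ B′<0)

  -- On both segments `across` is the same function of the parameter, so s = s′. Then `offset`
  -- equates s·2^(-l) with s·2^(-l′), and s = 0 remains.
  same-hub : ∀ {i c l s l′ s′ x} → End i c → l ≢ l′ → On i c l s x → On i c l′ s′ x → x ≡ P i
  same-hub {i} {c} {l} {s} {l′} {s′} {x} en ne o o′ = start o s≡0
    where
    s≡s′ : s ≡ s′
    s≡s′ = complement-inj s s′ (cancel-nonzero (P-across≢0 en) (trans (sym (across-On o)) (across-On o′)))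
    N≢0 : eval (offset c) (N c) ≢ 0ℚ
    N≢0 e = ℚP.<-irrefl (sym e) (proj₂ (proj₂ (proj₂ (off c))))
    sε≡sε′ : s ℚ.* halves l ≡ s ℚ.* halves l′
    sε≡sε′ = cancel-nonzero N≢0 (trans (ℚP.*-assoc s _ _) (trans (trans (sym (offset-On en o)) (offset-On en o′))
      (trans (cong (ℚ._* (halves l′ ℚ.* eval (offset c) (N c))) (sym s≡s′)) (sym (ℚP.*-assoc s _ _)))))
    s≡0 : s ≡ 0ℚ
    s≡0 with s ℚP.≟ 0ℚ
    ... | yes e = e
    ... | no s≢0 = ⊥-elim (ne (halves-inj l l′ (cancel-nonzero s≢0 (trans (ℚP.*-comm (halves l) s) (trans sε≡sε′ (ℚP.*-comm s (halves l′)))))))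

  -- `across` is nonpositive on the segments from one hub and nonnegative on those from the other,
  -- and vanishes only at their outer ends.
  opposite-hubs : ∀ {c l s l′ s′ x} → On (a c) c l s x → On (b c) c l′ s′ x → x ≡ W c l × x ≡ W c l′
  opposite-hubs {c} {l} {s} {l′} {s′} {x} o o′ = finish o (at-end (P-across≢0 (inj₁ refl)) (trans (sym (across-On o)) v≡0))
                                              , finish o′ (at-end (P-across≢0 (inj₂ refl)) (trans (sym (across-On o′)) v≡0))
    where
    f = across c
    v = eval f x
    v≤0 : v ℚ.≤ 0ℚ
    v≤0 = subst (ℚ._≤ 0ℚ) (sym (eval-On f o)) (mix-nonpos (bounds o) (ℚP.<⇒≤ (proj₁ (crossed c))) (ℚP.≤-reflexive (W-across c l)))
    v≥0 : 0ℚ ℚ.≤ v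
    v≥0 = subst (0ℚ ℚ.≤_) (sym (eval-On f o′)) (mix-nonneg (bounds o′) (ℚP.<⇒≤ (proj₁ (proj₂ (crossed c)))) (ℚP.≤-reflexive (sym (W-across c l′))))
    v≡0 : v ≡ 0ℚ
    v≡0 = ℚP.≤-antisym v≤0 v≥0
    at-end : ∀ {s A} → A ≢ 0ℚ → (1ℚ ℚ.- s) ℚ.* A ≡ 0ℚ → s ≡ 1ℚ
    at-end {s} {A} A≢0 e = complement-inj s 1ℚ (cancel-nonzero A≢0 (trans e (sym (trans (cong (ℚ._* A) (ℚP.+-inverseʳ 1ℚ)) (ℚP.*-zeroˡ A)))))
    finish : ∀ {i l s} → On i c l s x → s ≡ 1ℚ → x ≡ W c l
    finish {i} {l} (on _ refl) refl = along-1 (P i) (W c l)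

  private
    on-end : ∀ i c l → On i c l 1ℚ (W c l)
    on-end i c l = on (unit (ℚP.<⇒≤ (ℚP.positive⁻¹ 1ℚ)) ℚP.≤-refl) (sym (along-1 (P i) (W c l)))

    on-start : ∀ i c l → On i c l 0ℚ (P i)
    on-start i c l = on (unit ℚP.≤-refl (ℚP.<⇒≤ (ℚP.positive⁻¹ 1ℚ))) (sym (along-0 (P i) (W c l)))

    W≢P-end : ∀ {i c} l → End i c → W c l ≢ P i
    W≢P-end {i} {c} l en e = P-across≢0 en (trans (cong (eval (across c)) (sym e)) (W-across c l))

    -- Vertices are treated as points of the segments between hubs and class vertices, at parameter
    -- 1 for `W` and 0 for a hub. A coincidence becomes an intersection of two segments, and
    -- `incident` supplies one at the hub `i`.
    W≢P : ∀ c l i → W c l ≢ P i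
    W≢P c l i e with incident i
    ... | c′ , en with c Fin.≟ c′
    ...   | yes refl = W≢P-end l en e
    ...   | no ne = W≢P-end l (inj₁ refl) (proj₁ (different-classes {i = a c} {c} {l} {1ℚ} {i} {c′} {0} {0ℚ} (inj₁ refl) en ne (on-end (a c) c l)
                       (subst (On i c′ 0 0ℚ) (sym e) (on-start i c′ 0))))

  place-injective : ∀ u v → place u ≡ place v → u ≡ v
  place-injective (inj₁ i) (inj₁ j) e = cong inj₁ (P-injective i j e)
  place-injective (inj₁ i) (inj₂ (c , l)) e = ⊥-elim (W≢P c l i (sym e))
  place-injective (inj₂ (c , l)) (inj₁ i) e = ⊥-elim (W≢P c l i e)
  place-injective (inj₂ (c , l)) (inj₂ (c′ , l′)) e with c Fin.≟ c′
  ... | no ne = ⊥-elim (W≢P c l (a c) (proj₁ (different-classes {i = a c} {c} {l} {1ℚ} {a c′} {c′} {l′} {1ℚ} (inj₁ refl) (inj₁ refl) ne (on-end (a c) c l)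
                       (subst (On (a c′) c′ l′ 1ℚ) (sym e) (on-end (a c′) c′ l′)))))
  ... | yes refl with l ℕ.≟ l′
  ...   | yes refl = refl
  ...   | no ne = ⊥-elim (W≢P c l (a c) (same-hub {a c} {c} {l} {1ℚ} {l′} {1ℚ} (inj₁ refl) ne (on-end (a c) c l)
                       (subst (On (a c) c l′ 1ℚ) (sym e) (on-end (a c) c l′))))

  joined : Label → Label → Bool
  joined (inj₁ i) (inj₂ (c , _)) = (i == a c) ∨ (i == b c)
  joined (inj₂ (c , _)) (inj₁ i) = (i == a c) ∨ (i == b c)
  joined (inj₁ _) (inj₁ _) = false
  joined (inj₂ _) (inj₂ _) = false

  joined-sym : ∀ u v → joined u v ≡ joined v u
  joined-sym (inj₁ _) (inj₁ _) = refl
  joined-sym (inj₁ _) (inj₂ _) = refl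
  joined-sym (inj₂ _) (inj₁ _) = refl
  joined-sym (inj₂ _) (inj₂ _) = refl

  joined-irrefl : ∀ u → joined u u ≡ false
  joined-irrefl (inj₁ _) = refl
  joined-irrefl (inj₂ _) = refl

  private
    end : ∀ {i c} → (i == a c) ∨ (i == b c) ≡ true → End i c
    end {i} {c} p with i == a c in q
    ... | true = inj₁ (==⇒≡ {i = i} q)
    ... | false = inj₂ (==⇒≡ {i = i} p)

    OnSeg⇒On : ∀ i c l x → OnSeg (P i) (W c l) x → ∃ λ s → On i c l s x
    OnSeg⇒On i c l x o = let (s , u , e) = OnSeg⇒along (P i) (W c l) x o in s , on u e

    Shared : Label → Label → Label → Label → Point → Set
    Shared u v u′ v′ x = ∃ λ w → x ≡ place w × (w ≡ u ⊎ w ≡ v) × (w ≡ u′ ⊎ w ≡ v′)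

    spokes : ∀ {i c l s i′ c′ l′ s′ x} → End i c → End i′ c′ → ¬ (i ≡ i′ × c ≡ c′ × l ≡ l′) → On i c l s x → On i′ c′ l′ s′ x →
      Shared (inj₁ i) (inj₂ (c , l)) (inj₁ i′) (inj₂ (c′ , l′)) x
    spokes {i} {c} {l} {s} {i′} {c′} {l′} {s′} en en′ ne o o′ with c Fin.≟ c′
    ... | no c≢c′ = let (p , p′) = different-classes en en′ c≢c′ o o′ in
                    inj₁ i , p , inj₁ refl , inj₁ (cong inj₁ (P-injective i i′ (trans (sym p) p′)))
    ... | yes refl with i Fin.≟ i′
    ...   | yes refl = inj₁ i , same-hub {i} {c} {l} {s} {l′} {s′} en (λ e → ne (refl , refl , e)) o o′ , inj₁ refl , inj₁ refl
    ...   | no i≢i′ = opposite en en′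
      where
      meet : ∀ {x} → x ≡ W c l × x ≡ W c l′ → Shared (inj₁ i) (inj₂ (c , l)) (inj₁ i′) (inj₂ (c , l′)) x
      meet (p , p′) = inj₂ (c , l) , p , inj₂ refl , inj₂ (place-injective (inj₂ (c , l)) (inj₂ (c , l′)) (trans (sym p) p′))
      opposite : End i c → End i′ c → Shared (inj₁ i) (inj₂ (c , l)) (inj₁ i′) (inj₂ (c , l′)) _
      opposite (inj₁ refl) (inj₁ refl) = ⊥-elim (i≢i′ refl)
      opposite (inj₂ refl) (inj₂ refl) = ⊥-elim (i≢i′ refl)
      opposite (inj₁ refl) (inj₂ refl) = meet (opposite-hubs {c} {l} {s} {l′} {s′} o o′)
      opposite (inj₂ refl) (inj₁ refl) = let (p , p′) = opposite-hubs {c} {l′} {s′} {l} {s} o′ o in meet (p′ , p)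

    swap-right : ∀ {A B : Set} → A ⊎ B → B ⊎ A
    swap-right (inj₁ x) = inj₂ x
    swap-right (inj₂ x) = inj₁ x

  segments-meet : ∀ u v u′ v′ x → joined u v ≡ true → joined u′ v′ ≡ true → ¬ (u ≡ u′ × v ≡ v′) → ¬ (u ≡ v′ × v ≡ u′) →
    OnSeg (place u) (place v) x → OnSeg (place u′) (place v′) x → Shared u v u′ v′ x
  segments-meet (inj₁ i) (inj₂ (c , l)) (inj₁ i′) (inj₂ (c′ , l′)) x j j′ ne _ o o′ =
    spokes (end j) (end j′) (λ { (refl , refl , refl) → ne (refl , refl) }) (proj₂ (OnSeg⇒On i c l x o)) (proj₂ (OnSeg⇒On i′ c′ l′ x o′))
  segments-meet (inj₂ (c , l)) (inj₁ i) (inj₁ i′) (inj₂ (c′ , l′)) x j j′ _ ne o o′ =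
    let (w , p , q , q′) = spokes (end j) (end j′) (λ { (refl , refl , refl) → ne (refl , refl) })
                             (proj₂ (OnSeg⇒On i c l x (OnSeg-sym (W c l) (P i) x o))) (proj₂ (OnSeg⇒On i′ c′ l′ x o′))
    in w , p , swap-right q , q′
  segments-meet (inj₁ i) (inj₂ (c , l)) (inj₂ (c′ , l′)) (inj₁ i′) x j j′ _ ne o o′ =
    let (w , p , q , q′) = spokes (end j) (end j′) (λ { (refl , refl , refl) → ne (refl , refl) })
                             (proj₂ (OnSeg⇒On i c l x o)) (proj₂ (OnSeg⇒On i′ c′ l′ x (OnSeg-sym (W c′ l′) (P i′) x o′)))
    in w , p , q , swap-right q′
  segments-meet (inj₂ (c , l)) (inj₁ i) (inj₂ (c′ , l′)) (inj₁ i′) x j j′ ne _ o o′ =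
    let (w , p , q , q′) = spokes (end j) (end j′) (λ { (refl , refl , refl) → ne (refl , refl) })
                             (proj₂ (OnSeg⇒On i c l x (OnSeg-sym (W c l) (P i) x o))) (proj₂ (OnSeg⇒On i′ c′ l′ x (OnSeg-sym (W c′ l′) (P i′) x o′)))
    in w , p , swap-right q , swap-right q′

  -- Every vertex lies on an edge that is not the given one, unless it is an end of it.
  vertex-off-segment : ∀ u v w → joined u v ≡ true → w ≢ u → w ≢ v → ¬ OnSeg (place u) (place v) (place w)
  vertex-off-segment u v w j w≢u w≢v o = go w w≢u w≢v o
    where
    shared : ∀ {z w} z′ → w ≢ u → w ≢ v → Shared u v w z (place z′) → z′ ≡ w → ⊥
    shared z′ w≢u w≢v (y , p , q , _) refl with place-injective z′ y p
    shared z′ w≢u w≢v (y , p , inj₁ refl , _) refl | refl = w≢u refl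
    shared z′ w≢u w≢v (y , p , inj₂ refl , _) refl | refl = w≢v refl
    go : ∀ w → w ≢ u → w ≢ v → ¬ OnSeg (place u) (place v) (place w)
    go (inj₁ i) ≢u ≢v o with incident i
    ... | c , en = shared {inj₂ (c , 0)} (inj₁ i) ≢u ≢v (segments-meet u v (inj₁ i) (inj₂ (c , 0)) (P i) j (is-end en)
          (λ { (e , _) → ≢u (sym e) }) (λ { (_ , e) → ≢v (sym e) }) o (OnSeg-start (P i) (W c 0))) refl
      where
      is-end : End i c → (i == a c) ∨ (i == b c) ≡ true
      is-end (inj₁ e) rewrite e | ==-refl (a c) = refl
      is-end (inj₂ e) rewrite e | ==-refl (b c) = BoolP.∨-zeroʳ (b c == a c)
    go (inj₂ (c , l)) ≢u ≢v o = shared {inj₁ (a c)} (inj₂ (c , l)) ≢u ≢v (segments-meet u v (inj₂ (c , l)) (inj₁ (a c)) (W c l) j is-end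
          (λ { (e , _) → ≢u (sym e) }) (λ { (_ , e) → ≢v (sym e) }) o (OnSeg-start (W c l) (P (a c)))) refl
      where
      is-end : (a c == a c) ∨ (a c == b c) ≡ true
      is-end rewrite ==-refl (a c) = refl

  module Plane {n : ℕ} (label : Fin n → Label) (label-injective : ∀ u v → label u ≡ label v → u ≡ v) where

    private
      matrix : Vec (Vec Bool n) n
      matrix = tabulate (λ u → tabulate (λ v → joined (label u) (label v)))

      entry : ∀ u v → lookup (lookup matrix u) v ≡ joined (label u) (label v)
      entry u v = trans (cong (λ row → lookup row v) (VecP.lookup∘tabulate _ u)) (VecP.lookup∘tabulate _ v)

    graph : Graph n
    graph = record
      { adjM = matrix
      ; sym = λ u v → trans (entry u v) (trans (joined-sym (label u) (label v)) (sym (entry v u)))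
      ; loopless = λ u → trans (entry u u) (joined-irrefl (label u)) }

    adj-joined : ∀ u v → Graph.adj graph u v ≡ joined (label u) (label v)
    adj-joined = entry

    private
      pos : Fin n → Point
      pos u = place (label u)

      arc : Fin n → Fin n → PolyPath
      arc u v = record { len = 0 ; pts = λ { Fin.zero → pos u ; (Fin.suc _) → pos v } }

      on-path : ∀ {u v x} → PolyPath.OnPath (arc u v) x → OnSeg (pos u) (pos v) x
      on-path (Fin.zero , o) = o

    planar : Planar graph
    planar = record
      { pos = pos
      ; pos-inj = λ u v e → label-injective u v (place-injective _ _ e)
      ; arc = arc
      ; arc-ok = λ u v u<v e →
          ( (λ { Fin.zero eq → ℕP.<-irrefl (cong toℕ (label-injective u v (place-injective _ _ eq))) u<v })
          , (λ { Fin.zero Fin.zero () }) ) , refl , refl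
          , (λ w w≢u w≢v o → vertex-off-segment (label u) (label v) (label w) (trans (sym (entry u v)) e)
               (λ eq → w≢u (label-injective w u eq)) (λ eq → w≢v (label-injective w v eq)) (on-path {u} {v} o))
      ; arcs-disjoint = λ u v u′ v′ u<v e u′<v′ e′ ne x o o′ →
          let (w , p , q , q′) = segments-meet (label u) (label v) (label u′) (label v′) x (trans (sym (entry u v)) e) (trans (sym (entry u′ v′)) e′)
                (λ { (r , r′) → ne (label-injective u u′ r , label-injective v v′ r′) })
                (λ { (r , r′) → ℕP.<-asym u′<v′ (subst₂ (λ y z → toℕ y < toℕ z) (label-injective u v′ r) (label-injective v u′ r′) u<v) })
                (on-path {u} {v} o) (on-path {u′} {v′} o′)
          in conclude u v u′ v′ x w p q q′ }
      where
      conclude : ∀ u v u′ v′ x w → x ≡ place w → (w ≡ label u ⊎ w ≡ label v) → (w ≡ label u′ ⊎ w ≡ label v′) →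
        ∃ λ w → x ≡ pos w × (w ≡ u ⊎ w ≡ v) × (w ≡ u′ ⊎ w ≡ v′)
      conclude u v u′ v′ x w p (inj₁ q) q′ = u , trans p (cong place q) , inj₁ refl , back u q q′
        where
        back : ∀ u {w} → w ≡ label u → (w ≡ label u′ ⊎ w ≡ label v′) → u ≡ u′ ⊎ u ≡ v′
        back u q (inj₁ r) = inj₁ (label-injective _ _ (trans (sym q) r))
        back u q (inj₂ r) = inj₂ (label-injective _ _ (trans (sym q) r))
      conclude u v u′ v′ x w p (inj₂ q) q′ = v , trans p (cong place q) , inj₂ refl , back v q q′
        where
        back : ∀ u {w} → w ≡ label u → (w ≡ label u′ ⊎ w ≡ label v′) → u ≡ u′ ⊎ u ≡ v′
        back u q (inj₁ r) = inj₁ (label-injective _ _ (trans (sym q) r))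
        back u q (inj₂ r) = inj₂ (label-injective _ _ (trans (sym q) r))

-- A straight-line drawing of K₄ with a thin triangle on each edge; separators holds, for each pair
-- of edges, an affine function that is nonnegative on the first triangle and nonpositive on the second.
module Coordinates where
  open import Data.Integer using (+_; -[1+_])

  point : ℤ → ℤ → Point
  point x y = x ℚ./ 1 , y ℚ./ 1

  affine : ℤ → ℤ → ℤ → Affine
  affine a b k = a ℚ./ 1 , b ℚ./ 1 , k ℚ./ 1

  hubPoints : Vec Point 4
  hubPoints = point (+ 0) (+ 8) ∷ point (-[1+ 7 ]) (-[1+ 3 ]) ∷ point (+ 8) (-[1+ 3 ]) ∷ point (+ 0) (+ 0) ∷ []

  -- Each tip lies one unit to the right of its midpoint, or above it for the horizontal edge, so
  -- that the functions in `acrosses` depend on one coordinate only.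
  midpoints tips : Vec Point 6
  midpoints = point (-[1+ 3 ]) (+ 2) ∷ point (+ 4) (+ 2) ∷ point (+ 0) (+ 4) ∷ point (+ 0) (-[1+ 3 ]) ∷ point (-[1+ 3 ]) (-[1+ 1 ]) ∷ point (+ 4) (-[1+ 1 ]) ∷ []
  tips = point (-[1+ 2 ]) (+ 2) ∷ point (+ 5) (+ 2) ∷ point (+ 1) (+ 4) ∷ point (+ 0) (-[1+ 2 ]) ∷ point (-[1+ 2 ]) (-[1+ 1 ]) ∷ point (+ 5) (-[1+ 1 ]) ∷ []

  separators : Vec (Vec Affine 6) 6
  separators = (affine (+ 0) (+ 0) (+ 0) ∷ affine (-[1+ 0 ]) (+ 0) (+ 0) ∷ affine (-[1+ 2 ]) (+ 1) (-[1+ 7 ]) ∷ affine (-[1+ 0 ]) (+ 2) (+ 0) ∷ affine (-[1+ 0 ]) (+ 1) (-[1+ 3 ]) ∷ affine (-[1+ 0 ]) (+ 0) (+ 0) ∷ [])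
    ∷ (affine (+ 1) (+ 0) (+ 0) ∷ affine (+ 0) (+ 0) (+ 0) ∷ affine (+ 2) (+ 1) (-[1+ 7 ]) ∷ affine (+ 1) (+ 2) (+ 0) ∷ affine (+ 1) (+ 0) (+ 0) ∷ affine (+ 1) (+ 1) (-[1+ 3 ]) ∷ [])
    ∷ (affine (+ 3) (-[1+ 0 ]) (+ 8) ∷ affine (-[1+ 1 ]) (-[1+ 0 ]) (+ 8) ∷ affine (+ 0) (+ 0) (+ 0) ∷ affine (+ 0) (+ 1) (+ 0) ∷ affine (+ 0) (+ 1) (+ 0) ∷ affine (+ 0) (+ 1) (+ 0) ∷ [])
    ∷ (affine (+ 1) (-[1+ 1 ]) (+ 0) ∷ affine (-[1+ 0 ]) (-[1+ 1 ]) (+ 0) ∷ affine (+ 0) (-[1+ 0 ]) (+ 0) ∷ affine (+ 0) (+ 0) (+ 0) ∷ affine (+ 1) (-[1+ 2 ]) (-[1+ 3 ]) ∷ affine (-[1+ 0 ]) (-[1+ 2 ]) (-[1+ 3 ]) ∷ [])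
    ∷ (affine (+ 1) (-[1+ 0 ]) (+ 4) ∷ affine (-[1+ 0 ]) (+ 0) (+ 0) ∷ affine (+ 0) (-[1+ 0 ]) (+ 0) ∷ affine (-[1+ 0 ]) (+ 3) (+ 4) ∷ affine (+ 0) (+ 0) (+ 0) ∷ affine (-[1+ 0 ]) (+ 0) (+ 0) ∷ [])
    ∷ (affine (+ 1) (+ 0) (+ 0) ∷ affine (-[1+ 0 ]) (-[1+ 0 ]) (+ 4) ∷ affine (+ 0) (-[1+ 0 ]) (+ 0) ∷ affine (+ 1) (+ 3) (+ 4) ∷ affine (+ 1) (+ 0) (+ 0) ∷ affine (+ 0) (+ 0) (+ 0) ∷ [])
    ∷ []

  acrosses offsets : Vec Affine 6
  acrosses = affine (+ 0) (-[1+ 0 ]) (+ 2) ∷ affine (+ 0) (-[1+ 0 ]) (+ 2) ∷ affine (+ 0) (-[1+ 0 ]) (+ 4) ∷ affine (+ 1) (+ 0) (+ 0) ∷ affine (+ 0) (+ 1) (+ 2) ∷ affine (+ 0) (+ 1) (+ 2) ∷ []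
  offsets = affine (+ 12) (-[1+ 7 ]) (+ 64) ∷ affine (+ 12) (+ 8) (-[1+ 63 ]) ∷ affine (+ 8) (+ 0) (+ 0) ∷ affine (+ 0) (+ 16) (+ 64) ∷ affine (+ 4) (-[1+ 7 ]) (+ 0) ∷ affine (+ 4) (+ 8) (+ 0) ∷ []

open Coordinates

module Concrete (t e : ℕ) (ends : Fin e → Fin t × Fin t) (hubIndex : Fin t → Fin 4) (classIndex : Fin e → Fin 6) where
  P : Fin t → Point
  P i = lookup hubPoints (hubIndex i)
  M N : Fin e → Point
  M c = lookup midpoints (classIndex c)
  N c = lookup tips (classIndex c)
  separator : Fin e → Fin e → Affine
  separator c c′ = lookup (lookup separators (classIndex c)) (classIndex c′)
  across offset : Fin e → Affine
  across c = lookup acrosses (classIndex c)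
  offset c = lookup offsets (classIndex c)
  a b : Fin e → Fin t
  a c = proj₁ (ends c)
  b c = proj₂ (ends c)

  separated? : Dec (∀ c c′ → c ≡ c′ ⊎
    (0ℚ ℚ.≤ eval (separator c c′) (P (a c)) × 0ℚ ℚ.≤ eval (separator c c′) (P (b c)) × 0ℚ ℚ.< eval (separator c c′) (M c) × 0ℚ ℚ.< eval (separator c c′) (N c)) ×
    (eval (separator c c′) (P (a c′)) ℚ.≤ 0ℚ × eval (separator c c′) (P (b c′)) ℚ.≤ 0ℚ × eval (separator c c′) (M c′) ℚ.< 0ℚ × eval (separator c c′) (N c′) ℚ.< 0ℚ))
  separated? = FinP.all? λ c → FinP.all? λ c′ → (c Fin.≟ c′) ⊎-dec
    ((0ℚ ℚP.≤? eval (separator c c′) (P (a c))) ×-dec (0ℚ ℚP.≤? eval (separator c c′) (P (b c))) ×-dec (0ℚ ℚP.<? eval (separator c c′) (M c)) ×-dec (0ℚ ℚP.<? eval (separator c c′) (N c))) ×-dec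
    ((eval (separator c c′) (P (a c′)) ℚP.≤? 0ℚ) ×-dec (eval (separator c c′) (P (b c′)) ℚP.≤? 0ℚ) ×-dec (eval (separator c c′) (M c′) ℚP.<? 0ℚ) ×-dec (eval (separator c c′) (N c′) ℚP.<? 0ℚ))

  crossed? : Dec (∀ c → eval (across c) (P (a c)) ℚ.< 0ℚ × 0ℚ ℚ.< eval (across c) (P (b c)) ×
      eval (across c) (M c) ≡ 0ℚ × eval (across c) (N c) ≡ 0ℚ)
  crossed? = FinP.all? λ c → (eval (across c) (P (a c)) ℚP.<? 0ℚ) ×-dec (0ℚ ℚP.<? eval (across c) (P (b c))) ×-dec
      (eval (across c) (M c) ℚP.≟ 0ℚ) ×-dec (eval (across c) (N c) ℚP.≟ 0ℚ)

  off? : Dec (∀ c → eval (offset c) (P (a c)) ≡ 0ℚ × eval (offset c) (P (b c)) ≡ 0ℚ ×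
      eval (offset c) (M c) ≡ 0ℚ × 0ℚ ℚ.< eval (offset c) (N c))
  off? = FinP.all? λ c → (eval (offset c) (P (a c)) ℚP.≟ 0ℚ) ×-dec (eval (offset c) (P (b c)) ℚP.≟ 0ℚ) ×-dec
      (eval (offset c) (M c) ℚP.≟ 0ℚ) ×-dec (0ℚ ℚP.<? eval (offset c) (N c))

  P-injective? : Dec (∀ i j → P i ≡ P j → i ≡ j)
  P-injective? = FinP.all? λ i → FinP.all? λ j → ProductP.≡-dec ℚP._≟_ ℚP._≟_ (P i) (P j) →-dec (i Fin.≟ j)

  ends-<? : Dec (∀ c → toℕ (a c) < toℕ (b c))
  ends-<? = FinP.all? λ c → toℕ (a c) ℕ.<? toℕ (b c)

  _≟ₑ_ : (p q : Fin t × Fin t) → Dec (p ≡ q)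
  _≟ₑ_ = ProductP.≡-dec Fin._≟_ Fin._≟_

  ends-injective? : Dec (∀ c c′ → ends c ≡ ends c′ → c ≡ c′)
  ends-injective? = FinP.all? λ c → FinP.all? λ c′ → (ends c ≟ₑ ends c′) →-dec (c Fin.≟ c′)

  ends-complete? : Dec (∀ i j → toℕ i < toℕ j → ∃ λ c → ends c ≡ (i , j))
  ends-complete? = FinP.all? λ i → FinP.all? λ j → (toℕ i ℕ.<? toℕ j) →-dec FinP.any? (λ c → ends c ≟ₑ (i , j))

  incident? : Dec (∀ i → ∃ λ c → i ≡ a c ⊎ i ≡ b c)
  incident? = FinP.all? λ i → FinP.any? λ c → (i Fin.≟ a c) ⊎-dec (i Fin.≟ b c)

private
  ends₃ : Fin 3 → Fin 3 × Fin 3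
  ends₃ = lookup ((# 0 , # 1) ∷ (# 0 , # 2) ∷ (# 1 , # 2) ∷ [])

  ends₄ : Fin 6 → Fin 4 × Fin 4
  ends₄ = lookup ((# 0 , # 1) ∷ (# 0 , # 2) ∷ (# 0 , # 3) ∷ (# 1 , # 2) ∷ (# 1 , # 3) ∷ (# 2 , # 3) ∷ [])

  -- The triangle is part of the drawing of K₄: its edges 01, 02 and 12 are numbered 0, 1 and 3
  -- there.
  module C₃ = Concrete 3 3 ends₃ Fin.inject₁ (lookup (# 0 ∷ # 1 ∷ # 3 ∷ []))
  module C₄ = Concrete 4 6 ends₄ (λ i → i) (λ c → c)

opaque
  unfolding eval
  layout₃ : Layout 3 3
  layout₃ = record
    { ends = ends₃ ; P = C₃.P ; M = C₃.M ; N = C₃.N ; separator = C₃.separator ; across = C₃.across ; offset = C₃.offset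
    ; separated = from-yes C₃.separated? ; crossed = from-yes C₃.crossed? ; off = from-yes C₃.off?
    ; P-injective = from-yes C₃.P-injective? ; ends-< = from-yes C₃.ends-<? ; ends-injective = from-yes C₃.ends-injective?
    ; ends-complete = from-yes C₃.ends-complete? ; incident = from-yes C₃.incident? }

  layout₄ : Layout 4 6
  layout₄ = record
    { ends = ends₄ ; P = C₄.P ; M = C₄.M ; N = C₄.N ; separator = C₄.separator ; across = C₄.across ; offset = C₄.offset
    ; separated = from-yes C₄.separated? ; crossed = from-yes C₄.crossed? ; off = from-yes C₄.off?
    ; P-injective = from-yes C₄.P-injective? ; ends-< = from-yes C₄.ends-<? ; ends-injective = from-yes C₄.ends-injective?
    ; ends-complete = from-yes C₄.ends-complete? ; incident = from-yes C₄.incident? }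

-- Counting the copies in the construction.

-- The counterpart of `bernoulli`, with the larger base on the right, as Pascal's recursion needs
-- for a lower bound.
mean-value : ∀ m k → suc m ^ suc k ≤ m ^ suc k + suc k * suc m ^ k
mean-value m zero = ℕP.≤-reflexive (solve 1 (λ m → (con 1 :+ m) :* con 1 := m :* con 1 :+ con 1) refl m)
  where open +-*-Solver using (solve; _:+_; _:*_; _:=_; con)
mean-value m (suc k) = begin
  suc m * p ≡⟨ ℕP.+-comm p (m * p) ⟩
  m * p + p ≤⟨ ℕP.+-monoˡ-≤ p (ℕP.*-monoʳ-≤ m (mean-value m k)) ⟩
  m * (m ^ suc k + suc k * suc m ^ k) + p ≤⟨ ℕP.+-monoˡ-≤ p (ℕP.≤-trans (ℕP.≤-reflexive (ℕP.*-distribˡ-+ m (m ^ suc k) _))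
      (ℕP.+-monoʳ-≤ (m * m ^ suc k) (ℕP.≤-trans (ℕP.≤-reflexive (swap* m (suc k) (suc m ^ k))) (ℕP.*-monoʳ-≤ (suc k) (ℕP.*-monoˡ-≤ (suc m ^ k) (ℕP.n≤1+n m)))))) ⟩
  m ^ suc (suc k) + suc k * p + p ≡⟨ solve 3 (λ a k p → a :+ (con 1 :+ k) :* p :+ p := a :+ (con 2 :+ k) :* p) refl (m ^ suc (suc k)) k p ⟩
  m ^ suc (suc k) + suc (suc k) * p ∎
  where
  open ℕP.≤-Reasoning
  open +-*-Solver using (solve; _:+_; _:*_; _:=_; con)
  p = suc m ^ suc k
  swap* : ∀ a b c → a * (b * c) ≡ b * (a * c)
  swap* = solve 3 (λ a b c → a :* (b :* c) := b :* (a :* c)) refl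

-- With k spare elements every factor of (m+k)⋯(m+1) is at least m, which gives a bound by a pure
-- power.
combos-count-≥ : ∀ {A : Set} k m (xs : List A) → length xs ≡ m + k → m ^ k ≤ k ! * length (combos k xs)
combos-count-≥ zero m xs _ = ℕP.≤-refl
combos-count-≥ (suc k) zero xs _ = z≤n
combos-count-≥ (suc k) (suc m) (x ∷ xs) e = begin
  suc m ^ suc k ≤⟨ mean-value m k ⟩
  m ^ suc k + suc k * suc m ^ k ≤⟨ ℕP.+-mono-≤ (combos-count-≥ (suc k) m xs (ℕP.suc-injective e))
      (ℕP.*-monoʳ-≤ (suc k) (combos-count-≥ k (suc m) xs (trans (ℕP.suc-injective e) (ℕP.+-suc m k)))) ⟩
  suc k ! * b + suc k * (k ! * a) ≡⟨ solve 4 (λ k f a b → ((con 1 :+ k) :* f) :* b :+ (con 1 :+ k) :* (f :* a) := ((con 1 :+ k) :* f) :* (a :+ b)) refl k (k !) a b ⟩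
  suc k ! * (a + b) ≡⟨ cong (suc k ! *_) (sym (trans (ListP.length-++ (map (x ∷_) (combos k xs))) (cong (_+ b) (ListP.length-map (x ∷_) (combos k xs))))) ⟩
  suc k ! * length (combos (suc k) (x ∷ xs)) ∎
  where
  open ℕP.≤-Reasoning
  open +-*-Solver using (solve; _:+_; _:*_; _:=_; con)
  a = length (combos k xs)
  b = length (combos (suc k) xs)

module _ {A : Set} where

  Unique-combos : ∀ k {xs : List A} → Unique xs → Unique (combos k xs)
  Unique-combos zero _ = [] ∷ []
  Unique-combos (suc k) {[]} _ = []
  Unique-combos (suc k) {x ∷ xs} (x∉ ∷ u) = UniqueP.++⁺ (UniqueP.map⁺ (λ { refl → refl }) (Unique-combos k u)) (Unique-combos (suc k) u)
    λ (m , m′) → case ∈P.∈-map⁻ (x ∷_) m of λ { (zs , _ , refl) → All.lookup x∉ (combos-⊆ (suc k) xs m′ (here refl)) refl }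

  combos-≋ : ∀ k {xs ys zs : List A} → Unique xs → ys ∈ combos k xs → zs ∈ combos k xs → ys ≋ zs → ys ≡ zs
  combos-≋ zero u (here refl) (here refl) _ = refl
  combos-≋ (suc k) {x ∷ xs} (x∉ ∷ u) m m′ (f , g) with ∈P.∈-++⁻ (map (x ∷_) (combos k xs)) m | ∈P.∈-++⁻ (map (x ∷_) (combos k xs)) m′
  ... | inj₂ p | inj₂ p′ = combos-≋ (suc k) u p p′ (f , g)
  ... | inj₁ p | inj₂ p′ with ∈P.∈-map⁻ (x ∷_) p
  ...   | ys , _ , refl = ⊥-elim (All.lookup x∉ (combos-⊆ (suc k) xs p′ (f (here refl))) refl)
  combos-≋ (suc k) {x ∷ xs} (x∉ ∷ u) m m′ (f , g) | inj₂ p | inj₁ p′ with ∈P.∈-map⁻ (x ∷_) p′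
  ...   | zs , _ , refl = ⊥-elim (All.lookup x∉ (combos-⊆ (suc k) xs p (g (here refl))) refl)
  combos-≋ (suc k) {x ∷ xs} (x∉ ∷ u) m m′ (f , g) | inj₁ p | inj₁ p′ with ∈P.∈-map⁻ (x ∷_) p | ∈P.∈-map⁻ (x ∷_) p′
  ...   | ys , q , refl | zs , q′ , refl = cong (x ∷_) (combos-≋ k u q q′ (drop q f , drop q′ g))
    where
    drop : ∀ {as bs} → as ∈ combos k xs → (∀ {v} → v ∈ x ∷ as → v ∈ x ∷ bs) → ∀ {v} → v ∈ as → v ∈ bs
    drop q h m with h (there m)
    ... | there m″ = m″
    ... | here refl = ⊥-elim (All.lookup x∉ (combos-⊆ k xs q m) refl)

  unique-map-on : ∀ {B : Set} (f : A → B) xs → Unique xs → (∀ {x y} → x ∈ xs → y ∈ xs → f x ≡ f y → x ≡ y) → Unique (map f xs)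
  unique-map-on f [] _ _ = []
  unique-map-on f (x ∷ xs) (x∉ ∷ u) inj = All.tabulate (λ m e → case ∈P.∈-map⁻ f m of λ
      { (y , y∈ , refl) → All.lookup x∉ y∈ (inj (here refl) (there y∈) e) })
    ∷ unique-map-on f xs u (λ m m′ → inj (there m) (there m′))

  length-cartesianProductWith : ∀ {B C : Set} (f : A → B → C) xs ys → length (cartesianProductWith f xs ys) ≡ length xs * length ys
  length-cartesianProductWith f [] ys = refl
  length-cartesianProductWith f (x ∷ xs) ys = trans (ListP.length-++ (map (f x) ys)) (cong₂ _+_ (ListP.length-map (f x) ys) (length-cartesianProductWith f xs ys))

  vectors : ∀ {m} → (Fin m → List A) → List (Vec A m)
  vectors {zero} f = [] ∷ []
  vectors {suc m} f = cartesianProductWith _∷_ (f Fin.zero) (vectors (f ∘ Fin.suc))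

  ∈-vectors⁺ : ∀ {m} (f : Fin m → List A) v → (∀ i → lookup v i ∈ f i) → v ∈ vectors f
  ∈-vectors⁺ f [] h = here refl
  ∈-vectors⁺ f (x ∷ v) h = ∈P.∈-cartesianProductWith⁺ _∷_ (h Fin.zero) (∈-vectors⁺ (f ∘ Fin.suc) v (λ i → h (Fin.suc i)))

  ∈-vectors⁻ : ∀ {m} (f : Fin m → List A) {v} → v ∈ vectors f → ∀ i → lookup v i ∈ f i
  ∈-vectors⁻ {suc m} f v∈ i with ∈P.∈-cartesianProductWith⁻ _∷_ (f Fin.zero) (vectors (f ∘ Fin.suc)) v∈
  ∈-vectors⁻ {suc m} f v∈ Fin.zero | _ , _ , x∈ , _ , refl = x∈
  ∈-vectors⁻ {suc m} f v∈ (Fin.suc i) | _ , _ , _ , v′∈ , refl = ∈-vectors⁻ (f ∘ Fin.suc) v′∈ i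

  Unique-vectors : ∀ {m} (f : Fin m → List A) → (∀ i → Unique (f i)) → Unique (vectors f)
  Unique-vectors {zero} f u = [] ∷ []
  Unique-vectors {suc m} f u = UniqueP.cartesianProductWith⁺ _∷_ (λ { refl → refl , refl }) (u Fin.zero) (Unique-vectors (f ∘ Fin.suc) (λ i → u (Fin.suc i)))

  vectors-count : ∀ {m} (f : Fin m → List A) a c → (∀ i → a ≤ c * length (f i)) → a ^ m ≤ c ^ m * length (vectors f)
  vectors-count {zero} f a c h = ℕP.≤-refl
  vectors-count {suc m} f a c h = begin
    a * a ^ m ≤⟨ ℕP.*-mono-≤ (h Fin.zero) (vectors-count (f ∘ Fin.suc) a c (λ i → h (Fin.suc i))) ⟩
    c * length (f Fin.zero) * (c ^ m * length (vectors (f ∘ Fin.suc)))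
      ≡⟨ solve 4 (λ c l p r → c :* l :* (p :* r) := c :* p :* (l :* r)) refl c (length (f Fin.zero)) (c ^ m) (length (vectors (f ∘ Fin.suc))) ⟩
    c ^ suc m * (length (f Fin.zero) * length (vectors (f ∘ Fin.suc)))
      ≡⟨ cong (c ^ suc m *_) (sym (length-cartesianProductWith _∷_ (f Fin.zero) (vectors (f ∘ Fin.suc)))) ⟩
    c ^ suc m * length (vectors f) ∎
    where
    open ℕP.≤-Reasoning
    open +-*-Solver using (solve; _:+_; _:*_; _:=_; con)

  at : ∀ {k} (xs : List A) → length xs ≡ k → Fin k → A
  at (x ∷ xs) refl Fin.zero = x
  at (x ∷ xs) refl (Fin.suc i) = at xs refl i

  at-∈ : ∀ {k} (xs : List A) (e : length xs ≡ k) i → at xs e i ∈ xs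
  at-∈ (x ∷ xs) refl Fin.zero = here refl
  at-∈ (x ∷ xs) refl (Fin.suc i) = there (at-∈ xs refl i)

  at-surjective : ∀ {k} (xs : List A) (e : length xs ≡ k) {v} → v ∈ xs → ∃ λ i → at xs e i ≡ v
  at-surjective (x ∷ xs) refl (here refl) = Fin.zero , refl
  at-surjective (x ∷ xs) refl (there m) = let (i , p) = at-surjective xs refl m in Fin.suc i , p

  at-injective : ∀ {k} (xs : List A) (e : length xs ≡ k) → Unique xs → ∀ i j → at xs e i ≡ at xs e j → i ≡ j
  at-injective (x ∷ xs) refl u Fin.zero Fin.zero p = refl
  at-injective (x ∷ xs) refl (x∉ ∷ u) Fin.zero (Fin.suc j) p = ⊥-elim (All.lookup x∉ (at-∈ xs refl j) p)
  at-injective (x ∷ xs) refl (x∉ ∷ u) (Fin.suc i) Fin.zero p = ⊥-elim (All.lookup x∉ (at-∈ xs refl i) (sym p))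
  at-injective (x ∷ xs) refl (x∉ ∷ u) (Fin.suc i) (Fin.suc j) p = cong Fin.suc (at-injective xs refl u i j p)

  -- Excluded middle is irrefutable at one element, and irrefutable statements can be combined along
  -- a finite list.
  ¬¬-decide : ∀ (P : A → Set) xs → ¬ ¬ (∀ {x} → x ∈ xs → Dec (P x))
  ¬¬-decide P [] k = k λ ()
  ¬¬-decide P (x ∷ xs) k = ¬¬-decide P xs λ h →
    k λ { (here refl) → no λ p → k λ { (here refl) → yes p ; (there m) → h m } ; (there m) → h m }

-- For an arbitrary H being a copy is undecidable; the inequalities to be derived are stable.
¬¬-CopyCount : ∀ {n} (G : Graph n) H → ¬ ¬ (∃ λ N → CopyCount G H N)
¬¬-CopyCount {n} G H k = ¬¬-decide (IsCopy G H) everything λ dec →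
  let P? = λ x → dec (complete x)
      cs = filter P? unique-list
  in k (length cs , cs , UniqueP.filter⁺ P? (deduplicate-! _≟_ everything) , refl
       , λ x → mk⇔ (λ m → proj₂ (∈P.∈-filter⁻ P? {xs = unique-list} m)) (λ p → ∈P.∈-filter⁺ P? (∈P.∈-deduplicate⁺ _≟_ (complete x)) p))
  where
  bools : ∀ {m} → Fin m → List Bool
  bools _ = true ∷ false ∷ []
  bool∈ : ∀ b → b ∈ true ∷ false ∷ []
  bool∈ true = here refl
  bool∈ false = there (here refl)
  everything : List (SubData n)
  everything = cartesianProductWith _,_ (vectors bools) (vectors (λ _ → vectors bools))
  complete : ∀ x → x ∈ everything
  complete (S , F) = ∈P.∈-cartesianProductWith⁺ _,_ (∈-vectors⁺ _ S (λ i → bool∈ _)) (∈-vectors⁺ _ F (λ i → ∈-vectors⁺ _ _ (λ j → bool∈ _)))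
  _≟_ : (x y : SubData n) → Dec (x ≡ y)
  _≟_ = ProductP.≡-dec (VecP.≡-dec BoolP._≟_) (VecP.≡-dec (VecP.≡-dec BoolP._≟_))
  unique-list : List (SubData n)
  unique-list = deduplicate _≟_ everything

module BlowUpGraph {t e : ℕ} (L : Layout t e) .{{_ : ℕ.NonZero e}} (k q n : ℕ) (fits : t + (q + k) * e ≤ n) where
  open Layout L
  open Drawing L
  open Copies {n} using (V; bool-ext; vec-ext)

  private
    Q = q + k

    -- The first `t` vertices are the hubs, and the others are dealt out to the `e` classes in turn.
    -- All n vertices find a place, and every class receives at least `Q` of them.
    toLabel : ∀ v → Dec (v < t) → Label
    toLabel v (yes v<t) = inj₁ (Fin.fromℕ< v<t)
    toLabel v (no _) = inj₂ ((v ∸ t) mod e , (v ∸ t) / e)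

    divmod-injective : ∀ r r′ → r mod e ≡ r′ mod e → r / e ≡ r′ / e → r ≡ r′
    divmod-injective r r′ p p′ = trans (m≡m%n+[m/n]*n r e) (trans (cong₂ (λ x y → x + y * e)
      (trans (sym (FinP.toℕ-fromℕ< (m%n<n r e))) (trans (cong toℕ p) (FinP.toℕ-fromℕ< (m%n<n r′ e)))) p′) (sym (m≡m%n+[m/n]*n r′ e)))

    toLabel-injective : ∀ u v d d′ → toLabel u d ≡ toLabel v d′ → u ≡ v
    toLabel-injective u v (yes p) (yes p′) eq = trans (sym (FinP.toℕ-fromℕ< p)) (trans (cong (λ { (inj₁ i) → toℕ i ; (inj₂ _) → 0 }) eq) (FinP.toℕ-fromℕ< p′))
    toLabel-injective u v (no p) (no p′) eq = ℕP.∸-cancelʳ-≡ (ℕP.≮⇒≥ p) (ℕP.≮⇒≥ p′)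
      (divmod-injective (u ∸ t) (v ∸ t) (cong proj₁ (unwrap eq)) (cong proj₂ (unwrap eq)))
      where
      unwrap : ∀ {x y : Fin e × ℕ} → inj₂ {A = Fin t} x ≡ inj₂ y → x ≡ y
      unwrap refl = refl

  label : V → Label
  label v = toLabel (toℕ v) (toℕ v ℕ.<? t)

  label-injective : ∀ u v → label u ≡ label v → u ≡ v
  label-injective u v eq = FinP.toℕ-injective (toLabel-injective (toℕ u) (toℕ v) (toℕ u ℕ.<? t) (toℕ v ℕ.<? t) eq)

  open Plane label label-injective

  private
    hub-bound : ∀ (i : Fin t) → toℕ i < n
    hub-bound i = ℕP.<-≤-trans (FinP.toℕ<n i) (ℕP.≤-trans (ℕP.m≤m+n t (Q * e)) fits)

    hubV : Fin t → V
    hubV i = Fin.fromℕ< (hub-bound i)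

    label-hub : ∀ i → label (hubV i) ≡ inj₁ i
    label-hub i = go (toℕ (hubV i)) (FinP.toℕ-fromℕ< (hub-bound i)) (toℕ (hubV i) ℕ.<? t)
      where
      go : ∀ v → v ≡ toℕ i → (d : Dec (v < t)) → toLabel v d ≡ inj₁ i
      go v refl (yes p) = cong inj₁ (FinP.fromℕ<-toℕ i p)
      go v refl (no p) = ⊥-elim (p (FinP.toℕ<n i))

    class-bound : ∀ (c : Fin e) (l : Fin Q) → t + (toℕ c + toℕ l * e) < n
    class-bound c l = ℕP.<-≤-trans (ℕP.+-monoʳ-< t (ℕP.<-≤-trans (ℕP.+-monoˡ-< (toℕ l * e) (FinP.toℕ<n c)) (ℕP.*-monoˡ-≤ e (FinP.toℕ<n l)))) fits

    classV : Fin e → Fin Q → V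
    classV c l = Fin.fromℕ< (class-bound c l)

    label-class : ∀ c l → label (classV c l) ≡ inj₂ (c , toℕ l)
    label-class c l = go (toℕ (classV c l)) (FinP.toℕ-fromℕ< (class-bound c l)) (toℕ (classV c l) ℕ.<? t)
      where
      r = toℕ c + toℕ l * e
      remainder : r % e ≡ toℕ c
      remainder = trans ([m+kn]%n≡m%n (toℕ c) (toℕ l) e) (m<n⇒m%n≡m (FinP.toℕ<n c))
      quotient : r / e ≡ toℕ l
      quotient = ℕP.*-cancelʳ-≡ (r / e) (toℕ l) e (ℕP.+-cancelˡ-≡ (toℕ c) _ _ (trans (cong (_+ r / e * e) (sym remainder)) (sym (m≡m%n+[m/n]*n r e))))
      go : ∀ v → v ≡ t + r → (d : Dec (v < t)) → toLabel v d ≡ inj₂ (c , toℕ l)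
      go v refl (yes p) = ⊥-elim (ℕP.<⇒≱ p (ℕP.m≤m+n t r))
      go v refl (no p) = cong inj₂ (cong₂ _,_
        (FinP.toℕ-injective (trans (FinP.toℕ-fromℕ< (m%n<n (t + r ∸ t) e)) (trans (cong (_% e) (ℕP.m+n∸m≡n t r)) remainder)))
        (trans (cong (_/ e) (ℕP.m+n∸m≡n t r)) quotient))

  classList : Fin e → List V
  classList c = map (classV c) (allFin Q)

  private
    length-classList : ∀ c → length (classList c) ≡ Q
    length-classList c = trans (ListP.length-map (classV c) (allFin Q)) (ListP.length-tabulate {n = Q} (λ i → i))

    ∈-classList : ∀ {c v} → v ∈ classList c → ∃ λ l → label v ≡ inj₂ (c , l)
    ∈-classList {c} m = case ∈P.∈-map⁻ (classV c) m of λ { (l , _ , refl) → toℕ l , label-class c l }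

    Unique-classList : ∀ c → Unique (classList c)
    Unique-classList c = UniqueP.map⁺ (λ {l} {l′} eq → FinP.toℕ-injective (second (trans (sym (label-class c l)) (trans (cong label eq) (label-class c l′)))))
      (UniqueP.allFin⁺ Q)
      where
      second : ∀ {x y : ℕ} → inj₂ {A = Fin t} (c , x) ≡ inj₂ (c , y) → x ≡ y
      second refl = refl

  choices : List (Vec (List V) e)
  choices = vectors (λ c → combos k (classList c))

  choices-count : (q ^ k) ^ e ≤ (k !) ^ e * length choices
  choices-count = vectors-count (λ c → combos k (classList c)) (q ^ k) (k !) (λ c → combos-count-≥ k q (classList c) (length-classList c))

  private
    chosen : Vec (List V) e → Label → V → Bool
    chosen Bs (inj₁ _) v = true
    chosen Bs (inj₂ (c , _)) v = memb (lookup Bs c) v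

    inCopy : Vec (List V) e → V → Bool
    inCopy Bs v = chosen Bs (label v) v

    edgeB : Vec (List V) e → V → V → Bool
    edgeB Bs u v = inCopy Bs u ∧ (inCopy Bs v ∧ joined (label u) (label v))

  subgraph : Vec (List V) e → SubData n
  subgraph Bs = tabulate (inCopy Bs) , tabulate (λ u → tabulate (edgeB Bs u))

  private
    lookup-S : ∀ Bs u → lookup (proj₁ (subgraph Bs)) u ≡ inCopy Bs u
    lookup-S Bs u = VecP.lookup∘tabulate (inCopy Bs) u

    lookup-F : ∀ Bs u v → lookup (lookup (proj₂ (subgraph Bs)) u) v ≡ edgeB Bs u v
    lookup-F Bs u v = trans (cong (λ row → lookup row v) (VecP.lookup∘tabulate _ u)) (VecP.lookup∘tabulate _ v)

    module _ {Bs} (Bs∈ : Bs ∈ choices) where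
      B∈ : ∀ c → lookup Bs c ∈ combos k (classList c)
      B∈ = ∈-vectors⁻ _ Bs∈

      B-label : ∀ c {v} → v ∈ lookup Bs c → ∃ λ l → label v ≡ inj₂ (c , l)
      B-label c m = ∈-classList (combos-⊆ k (classList c) (B∈ c) m)

      B-chosen : ∀ c {v} → v ∈ lookup Bs c → inCopy Bs v ≡ true
      B-chosen c {v} m = let (l , eq) = B-label c m in trans (cong (λ x → chosen Bs x v) eq) (memb⁺ m)

      chosen-B : ∀ c l {v} → label v ≡ inj₂ (c , l) → inCopy Bs v ≡ true → v ∈ lookup Bs c
      chosen-B c l {v} eq p = memb⁻ (lookup Bs c) (trans (sym (cong (λ x → chosen Bs x v) eq)) p)

      B-length : ∀ c → length (lookup Bs c) ≡ k
      B-length c = combos-length k (classList c) (B∈ c)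

      φ : BlowUpV t (K t) k → V
      φ (inj₁ i) = hubV i
      φ (inj₂ (i , j , (i<j , _) , l)) = at (lookup Bs c) (B-length c) l
        where c = proj₁ (ends-complete i j i<j)

      hub-in : ∀ i → inCopy Bs (hubV i) ≡ true
      hub-in i = cong (λ x → chosen Bs x (hubV i)) (label-hub i)

      φ-in : ∀ x → inCopy Bs (φ x) ≡ true
      φ-in (inj₁ i) = hub-in i
      φ-in (inj₂ (i , j , (i<j , _) , l)) = B-chosen c (at-∈ (lookup Bs c) (B-length c) l)
        where c = proj₁ (ends-complete i j i<j)

      φ-label : ∀ i j p l → ∃ λ c → ∃ λ m → label (φ (inj₂ (i , j , p , l))) ≡ inj₂ (c , m) × ends c ≡ (i , j)
      φ-label i j (i<j , _) l = let (c , eq) = ends-complete i j i<j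
                                    (m , eq′) = B-label c (at-∈ (lookup Bs c) (B-length c) l) in c , m , eq′ , eq

      φ-injective : ∀ x y → φ x ≡ φ y → x ≡ y
      φ-injective (inj₁ i) (inj₁ j) eq = cong inj₁ (first (trans (sym (label-hub i)) (trans (cong label eq) (label-hub j))))
        where
        first : ∀ {x y : Fin t} → inj₁ {B = Fin e × ℕ} x ≡ inj₁ y → x ≡ y
        first refl = refl
      φ-injective (inj₁ i) (inj₂ (i′ , j′ , p , l)) eq = let (c , m , eq′ , _) = φ-label i′ j′ p l in
        case trans (sym (label-hub i)) (trans (cong label eq) eq′) of λ ()
      φ-injective (inj₂ (i′ , j′ , p , l)) (inj₁ i) eq = let (c , m , eq′ , _) = φ-label i′ j′ p l in
        case trans (sym (label-hub i)) (trans (cong label (sym eq)) eq′) of λ ()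
      φ-injective (inj₂ (i , j , p , l)) (inj₂ (i′ , j′ , p′ , l′)) eq
        with φ-label i j p l | φ-label i′ j′ p′ l′
      ... | c , m , lab , en | c′ , m′ , lab′ , en′ with trans (sym lab) (trans (cong label eq) lab′)
      ...   | refl with trans (sym en) en′
      ...     | refl with pair-irrelevant p p′
      ...       | refl = cong (λ l → inj₂ (i , j , p , l)) (at-injective (lookup Bs d) (B-length d) (combos-unique k (Unique-classList d) (B∈ d)) l l′ eq)
        where d = proj₁ (ends-complete i j (proj₁ p))

      K-true : ∀ {i j : Fin t} → toℕ i < toℕ j → K t i j ≡ true
      K-true {i} {j} i<j = cong not (≢⇒== {i = i} {j} λ { refl → ℕP.<-irrefl refl i<j })

      φ-surjective : ∀ u → inCopy Bs u ≡ true → ∃ λ x → φ x ≡ u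
      φ-surjective u p with label u in eq
      ... | inj₁ i = inj₁ i , label-injective _ _ (trans (label-hub i) (sym eq))
      ... | inj₂ (c , l) = inj₂ (a c , b c , (ends-< c , K-true (ends-< c)) , proj₁ index) , proj₂ index
        where
        d = proj₁ (ends-complete (a c) (b c) (ends-< c))
        d≡c : d ≡ c
        d≡c = ends-injective d c (proj₂ (ends-complete (a c) (b c) (ends-< c)))
        u∈ : u ∈ lookup Bs d
        u∈ = subst (λ x → u ∈ lookup Bs x) (sym d≡c) (memb⁻ (lookup Bs c) p)
        index = at-surjective (lookup Bs d) (B-length d) u∈

      joined-φ : ∀ x y → blowUpAdj t (K t) k x y ≡ joined (label (φ x)) (label (φ y))
      joined-φ (inj₁ i) (inj₁ j) rewrite label-hub i | label-hub j = refl
      joined-φ (inj₁ x) (inj₂ (i , j , p , l)) with φ-label i j p l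
      ... | c , m , eq , en rewrite label-hub x | eq | en = refl
      joined-φ (inj₂ (i , j , p , l)) (inj₁ x) with φ-label i j p l
      ... | c , m , eq , en rewrite label-hub x | eq | en = refl
      joined-φ (inj₂ (i , j , p , l)) (inj₂ (i′ , j′ , p′ , l′)) with φ-label i j p l | φ-label i′ j′ p′ l′
      ... | c , m , eq , _ | c′ , m′ , eq′ , _ rewrite eq | eq′ = refl

      isCopy : IsCopy graph (KBlow t k) (subgraph Bs)
      isCopy =
        (λ u v p → trans (adj-joined u v) (proj₂ (∧-true {inCopy Bs v} (proj₂ (∧-true {inCopy Bs u} (trans (sym (lookup-F Bs u v)) p))))))
        , (λ u v p → trans (lookup-S Bs u) (proj₁ (∧-true (trans (sym (lookup-F Bs u v)) p)))
                   , trans (lookup-S Bs v) (proj₁ (∧-true (proj₂ (∧-true {inCopy Bs u} (trans (sym (lookup-F Bs u v)) p))))))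
        , φ , φ-injective
        , (λ x → trans (lookup-S Bs (φ x)) (φ-in x))
        , (λ u p → φ-surjective u (trans (sym (lookup-S Bs u)) p))
        , (λ x y → trans (joined-φ x y) (sym (trans (lookup-F Bs (φ x) (φ y))
            (trans (cong (_∧ (inCopy Bs (φ y) ∧ joined (label (φ x)) (label (φ y)))) (φ-in x)) (cong (_∧ joined (label (φ x)) (label (φ y))) (φ-in y))))))

    subgraph-injective : ∀ {Bs Bs′} → Bs ∈ choices → Bs′ ∈ choices → subgraph Bs ≡ subgraph Bs′ → Bs ≡ Bs′
    subgraph-injective {Bs} {Bs′} m m′ eq = vec-ext Bs Bs′ λ c →
      combos-≋ k (Unique-classList c) (B∈ m c) (B∈ m′ c) (transfer m m′ eq c , transfer m′ m (sym eq) c)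
      where
      transfer : ∀ {Bs Bs′} → Bs ∈ choices → Bs′ ∈ choices → subgraph Bs ≡ subgraph Bs′ → ∀ c {v} → v ∈ lookup Bs c → v ∈ lookup Bs′ c
      transfer {Bs} {Bs′} m m′ eq c {v} v∈ = let (l , lab) = B-label m c v∈ in chosen-B m′ c l lab
        (trans (sym (lookup-S Bs′ v)) (trans (cong (λ s → lookup (proj₁ s) v) (sym eq)) (trans (lookup-S Bs v) (B-chosen m c v∈))))

  choices≤copies : ∀ {N} → CopyCount graph (KBlow t k) N → length choices ≤ N
  choices≤copies (cs , uniq , refl , iff) = subst (_≤ length cs) (ListP.length-map subgraph choices)
    (unique-⊆-length (unique-map-on subgraph choices (Unique-vectors _ (λ c → Unique-combos k (Unique-classList c))) subgraph-injective)
      (λ m → case ∈P.∈-map⁻ subgraph m of λ { (Bs , Bs∈ , refl) → Equivalence.from (iff (subgraph Bs)) (isCopy Bs∈) }))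

  lower-bound : ∀ {M} → IsNP n (KBlow t k) M → (q ^ k) ^ e ≤ (k !) ^ e * M
  lower-bound {M} (_ , maximal) with (q ^ k) ^ e ℕ.≤? (k !) ^ e * M
  ... | yes p = p
  ... | no ¬p = ⊥-elim (¬¬-CopyCount graph (KBlow t k) λ (N , count) → ¬p
      (ℕP.≤-trans choices-count (ℕP.*-monoʳ-≤ ((k !) ^ e) (ℕP.≤-trans (choices≤copies count) (maximal graph planar N count)))))

-- Choice of the thresholds and the asymptotic statement.

largest : ∀ (P : ℕ → Set) → (∀ x → Dec (P x)) → P 1 → ∀ b → ¬ P (suc b) → ∃ λ x → 1 ≤ x × P x × ¬ P (suc x)
largest P P? P1 zero ¬P = ⊥-elim (¬P P1)
largest P P? P1 (suc b) ¬P with P? (suc b)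
... | yes p = suc b , s≤s z≤n , p , ¬P
... | no ¬p = largest P P? P1 b ¬p

private
  suc≤double : ∀ {x} → 1 ≤ x → suc x ≤ 2 * x
  suc≤double {x} h = ℕP.≤-trans (ℕP.+-monoˡ-≤ x h) (ℕP.≤-reflexive (cong (x +_) (sym (ℕP.+-identityʳ x))))

  self≤power : ∀ x a → x ≤ x ^ suc a
  self≤power zero a = z≤n
  self≤power (suc x) a = ℕP.≤-trans (ℕP.≤-reflexive (sym (ℕP.*-identityʳ (suc x)))) (ℕP.*-monoʳ-≤ (suc x) (ℕP.m^n>0 (suc x) a))

  ^-cancel-≤ : ∀ a {x y} → x ^ suc a ≤ y ^ suc a → x ≤ y
  ^-cancel-≤ a {x} {y} h = ℕP.≮⇒≥ λ y<x → ℕP.<⇒≱ (ℕP.^-monoˡ-< (suc a) y<x) h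

-- m ≈ n^(k/(k+4)) is the relative precision to be reached, and hubs of degree at least n/τ are large.
record Thresholds (n k : ℕ) : Set where
  field
    m τ : ℕ
    1≤m : 1 ≤ m
    1≤τ : 1 ≤ τ
    m≤n : m ≤ n
    precise : n ^ suc k ≤ (2 * m) ^ (suc k + 4)
    mτ³≤n : m * τ ^ 3 ≤ n
    m≤τ : m ≤ 8 ^ suc k * τ ^ (k + suc k)

-- With K = k+1, m is the integer part of n^(K/(K+4)) and τ that of the cube root of n/m; rounding
-- costs the factors 2 and 8 = 2³. From n ≤ 8τ³m and m^(K+4) ≤ n^K follows m⁴ ≤ 8^K · τ^(3K), and 3K
-- ≤ 4(2K-1) gives the last condition.
thresholds : ∀ n k → 1 ≤ n → Thresholds n k
thresholds n k 1≤n = record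
  { m = m ; τ = τ ; 1≤m = 1≤m ; 1≤τ = 1≤τ ; m≤n = m≤n
  ; precise = ℕP.≤-trans (ℕP.<⇒≤ (ℕP.≰⇒> ¬suc-m)) (ℕP.^-monoˡ-≤ (suc k + 4) (suc≤double 1≤m))
  ; mτ³≤n = mτ³≤n ; m≤τ = m≤τ }
  where
  open +-*-Solver using (solve; _:+_; _:*_; _:^_; _:=_; con)
  instance
    n-nonZero : ℕ.NonZero n
    n-nonZero = ℕ.>-nonZero 1≤n
  root = largest (λ x → x ^ (suc k + 4) ≤ n ^ suc k) (λ x → x ^ (suc k + 4) ℕ.≤? n ^ suc k)
    (subst (_≤ n ^ suc k) (sym (ℕP.^-zeroˡ (suc k + 4))) (ℕP.m^n>0 n (suc k))) (n ^ suc k)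
    (λ h → ℕP.<⇒≱ (ℕP.≤-trans (self≤power (suc (n ^ suc k)) (k + 4)) h) ℕP.≤-refl)
  m = proj₁ root
  1≤m = proj₁ (proj₂ root)
  m^≤ = proj₁ (proj₂ (proj₂ root))
  ¬suc-m = proj₂ (proj₂ (proj₂ root))
  m≤n : m ≤ n
  m≤n = ^-cancel-≤ (k + 4) (ℕP.≤-trans m^≤ (ℕP.^-monoʳ-≤ n (ℕP.m≤m+n (suc k) 4)))
  cube = largest (λ x → m * x ^ 3 ≤ n) (λ x → m * x ^ 3 ℕ.≤? n) (subst (_≤ n) (sym (ℕP.*-identityʳ m)) m≤n) n
    (λ h → ℕP.<⇒≱ (ℕP.≤-trans (self≤power (suc n) 2) (ℕP.≤-trans (ℕP.m≤n*m (suc n ^ 3) m {{ℕ.>-nonZero 1≤m}}) h)) ℕP.≤-refl)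
  τ = proj₁ cube
  1≤τ = proj₁ (proj₂ cube)
  mτ³≤n = proj₁ (proj₂ (proj₂ cube))
  n≤ : n ≤ 8 * τ ^ 3 * m
  n≤ = ℕP.≤-trans (ℕP.<⇒≤ (ℕP.≰⇒> (proj₂ (proj₂ (proj₂ cube)))))
    (ℕP.≤-trans (ℕP.*-monoʳ-≤ m (ℕP.^-monoˡ-≤ 3 (suc≤double 1≤τ)))
      (ℕP.≤-reflexive (solve 2 (λ m t → m :* (con 2 :* t) :^ 3 := con 8 :* t :^ 3 :* m) refl m τ)))
  C = 8 ^ suc k
  j = k + suc k
  m⁴≤ : m ^ 4 ≤ C * τ ^ (3 * suc k)
  m⁴≤ = ℕP.*-cancelˡ-≤ (m ^ suc k) {{ℕP.m^n≢0 m (suc k) {{ℕ.>-nonZero 1≤m}}}} (begin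
    m ^ suc k * m ^ 4 ≡⟨ sym (ℕP.^-distribˡ-+-* m (suc k) 4) ⟩
    m ^ (suc k + 4) ≤⟨ m^≤ ⟩
    n ^ suc k ≤⟨ ℕP.^-monoˡ-≤ (suc k) n≤ ⟩
    (8 * τ ^ 3 * m) ^ suc k ≡⟨ ^-distribʳ-* (suc k) (8 * τ ^ 3) m ⟩
    (8 * τ ^ 3) ^ suc k * m ^ suc k ≡⟨ cong (_* m ^ suc k) (trans (^-distribʳ-* (suc k) 8 (τ ^ 3)) (cong (C *_) (ℕP.^-*-assoc τ 3 (suc k)))) ⟩
    C * τ ^ (3 * suc k) * m ^ suc k ≡⟨ ℕP.*-comm _ (m ^ suc k) ⟩
    m ^ suc k * (C * τ ^ (3 * suc k)) ∎)
    where open ℕP.≤-Reasoning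
  m≤τ : m ≤ C * τ ^ j
  m≤τ = ^-cancel-≤ 3 (begin
    m ^ 4 ≤⟨ m⁴≤ ⟩
    C * τ ^ (3 * suc k) ≤⟨ ℕP.*-mono-≤ (self≤power C 3) (ℕP.^-monoʳ-≤ τ {{ℕ.>-nonZero 1≤τ}} 3k≤4j) ⟩
    C ^ 4 * τ ^ (j * 4) ≡⟨ cong (C ^ 4 *_) (sym (ℕP.^-*-assoc τ j 4)) ⟩
    C ^ 4 * (τ ^ j) ^ 4 ≡⟨ sym (^-distribʳ-* 4 C (τ ^ j)) ⟩
    (C * τ ^ j) ^ 4 ∎)
    where
    open ℕP.≤-Reasoning
    3k≤4j : 3 * suc k ≤ j * 4
    3k≤4j = ℕP.≤-trans (ℕP.m≤m+n (3 * suc k) (suc (5 * k)))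
      (ℕP.≤-reflexive (solve 1 (λ k → con 3 :* (con 1 :+ k) :+ (con 1 :+ con 5 :* k) := (k :+ (con 1 :+ k)) :* con 4) refl k))

-- The estimate n^p - y^p ≤ p·D·n^(p-1), multiplied by n to avoid the exponent p-1.
power-difference : ∀ n y D p → n ≤ y + D → y ≤ n → n * n ^ p ≤ n * y ^ p + p * D * n ^ p
power-difference n y D zero h y≤n = ℕP.≤-reflexive (sym (ℕP.+-identityʳ (n * 1)))
power-difference n y D (suc p) h y≤n = begin
  n * (n * n ^ p) ≤⟨ ℕP.*-monoʳ-≤ n (power-difference n y D p h y≤n) ⟩
  n * (n * y ^ p + p * D * n ^ p) ≤⟨ ℕP.*-monoʳ-≤ n (ℕP.+-monoˡ-≤ (p * D * n ^ p) (ℕP.*-monoˡ-≤ (y ^ p) h)) ⟩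
  n * ((y + D) * y ^ p + p * D * n ^ p)
    ≡⟨ solve 6 (λ n y D a p b → n :* ((y :+ D) :* a :+ p :* D :* b) := n :* (y :* a) :+ D :* a :* n :+ p :* D :* (n :* b)) refl n y D (y ^ p) p (n ^ p) ⟩
  n * y ^ suc p + D * y ^ p * n + p * D * n ^ suc p
    ≤⟨ ℕP.+-monoˡ-≤ (p * D * n ^ suc p) (ℕP.+-monoʳ-≤ (n * y ^ suc p) (ℕP.*-monoˡ-≤ n (ℕP.*-monoʳ-≤ D (ℕP.^-monoˡ-≤ p y≤n)))) ⟩
  n * y ^ suc p + D * n ^ p * n + p * D * n ^ suc p
    ≡⟨ solve 5 (λ n D p a b → a :+ D :* b :* n :+ p :* D :* (n :* b) := a :+ (con 1 :+ p) :* D :* (n :* b)) refl n D p (n * y ^ suc p) (n ^ p) ⟩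
  n * y ^ suc p + suc p * D * n ^ suc p ∎
  where
  open ℕP.≤-Reasoning
  open +-*-Solver using (solve; _:+_; _:*_; _:=_; con)

-- The lower bound has relative error d/n, which is at most d/m as m ≤ n; so both sides end up with
-- precision 1/m.
distance-bound : ∀ m n X N c d → m ≤ n → m * X ≤ m * N + N * c → n * N ≤ n * X + d * N → m * ∣ ℤ.+ X ℤ.- ℤ.+ N ∣ ≤ (c + d) * N
distance-bound m n X N c d m≤n upper lower with ℕP.≤-total N X
... | inj₁ N≤X = begin
  m * ∣ ℤ.+ X ℤ.- ℤ.+ N ∣ ≡⟨ cong (λ z → m * ∣ z ∣) (trans (ℤP.m-n≡m⊖n X N) (ℤP.⊖-≥ N≤X)) ⟩
  m * (X ∸ N) ≡⟨ ℕP.*-distribˡ-∸ m X N ⟩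
  m * X ∸ m * N ≤⟨ ℕP.m≤n+o⇒m∸n≤o (m * X) (m * N) upper ⟩
  N * c ≡⟨ ℕP.*-comm N c ⟩
  c * N ≤⟨ ℕP.*-monoˡ-≤ N (ℕP.m≤m+n c d) ⟩
  (c + d) * N ∎
  where open ℕP.≤-Reasoning
... | inj₂ X≤N = begin
  m * ∣ ℤ.+ X ℤ.- ℤ.+ N ∣ ≡⟨ cong (m *_) (trans (cong ∣_∣ (ℤP.m-n≡m⊖n X N)) (trans (ℤP.∣m⊖n∣≡∣n⊖m∣ X N) (cong ∣_∣ (ℤP.⊖-≥ X≤N)))) ⟩
  m * (N ∸ X) ≤⟨ ℕP.*-monoˡ-≤ (N ∸ X) m≤n ⟩
  n * (N ∸ X) ≡⟨ ℕP.*-distribˡ-∸ n N X ⟩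
  n * N ∸ n * X ≤⟨ ℕP.m≤n+o⇒m∸n≤o (n * N) (n * X) lower ⟩
  d * N ≤⟨ ℕP.*-monoˡ-≤ N (ℕP.m≤n+m d c) ⟩
  (c + d) * N ∎
  where open ℕP.≤-Reasoning

-- An error bound m d ≤ c n^(ek) with m ≈ n^(k/(k+4)), freed of the root.
clear-root : ∀ n k e m d c → 1 ≤ n → 1 ≤ e → n ^ suc k ≤ (2 * m) ^ (suc k + 4) → m * d ≤ c * n ^ (e * suc k) →
  d ^ (suc k + 4) ≤ (2 * c) ^ (suc k + 4) * n ^ ((e * suc k) * (suc k + 4) ∸ suc k)
clear-root n k e m d c 1≤n 1≤e precise bound = ℕP.*-cancelˡ-≤ (n ^ suc k) {{ℕP.m^n≢0 n (suc k) {{ℕ.>-nonZero 1≤n}}}} (begin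
  n ^ suc k * d ^ s ≤⟨ ℕP.*-monoˡ-≤ (d ^ s) precise ⟩
  (2 * m) ^ s * d ^ s ≡⟨ sym (^-distribʳ-* s (2 * m) d) ⟩
  (2 * m * d) ^ s ≤⟨ ℕP.^-monoˡ-≤ s (ℕP.≤-trans (ℕP.≤-reflexive (ℕP.*-assoc 2 m d)) (ℕP.≤-trans (ℕP.*-monoʳ-≤ 2 bound) (ℕP.≤-reflexive (sym (ℕP.*-assoc 2 c _))))) ⟩
  (2 * c * n ^ (e * suc k)) ^ s ≡⟨ ^-distribʳ-* s (2 * c) _ ⟩
  (2 * c) ^ s * (n ^ (e * suc k)) ^ s ≡⟨ cong ((2 * c) ^ s *_) (trans (ℕP.^-*-assoc n (e * suc k) s) (trans (cong (n ^_) (sym (ℕP.m+[n∸m]≡n k≤))) (ℕP.^-distribˡ-+-* n (suc k) r))) ⟩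
  (2 * c) ^ s * (n ^ suc k * n ^ r) ≡⟨ solve 3 (λ a b c → a :* (b :* c) := b :* (a :* c)) refl ((2 * c) ^ s) (n ^ suc k) (n ^ r) ⟩
  n ^ suc k * ((2 * c) ^ s * n ^ r) ∎)
  where
  open ℕP.≤-Reasoning
  open +-*-Solver using (solve; _:+_; _:*_; _:=_; con)
  s = suc k + 4
  r = (e * suc k) * s ∸ suc k
  k≤ : suc k ≤ (e * suc k) * s
  k≤ = ℕP.≤-trans (ℕP.≤-trans (ℕP.≤-reflexive (sym (ℕP.*-identityˡ (suc k)))) (ℕP.*-monoˡ-≤ (suc k) 1≤e))
         (ℕP.≤-trans (ℕP.≤-reflexive (sym (ℕP.*-identityʳ (e * suc k)))) (ℕP.*-monoʳ-≤ (e * suc k) (s≤s (z≤n {k + 4}))))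

module Asymptotics {t e : ℕ} (L : Layout t e) {{e≢0 : ℕ.NonZero e}} (k c : ℕ)
  (upper : ∀ {n} (G : Graph n) (D : PlaneDrawing G) → 1 ≤ n → ∀ m τ → 1 ≤ τ → m * τ ^ 3 ≤ n → m ≤ 8 ^ suc k * τ ^ (k + suc k) →
    ∀ cs → Unique cs → (∀ {x} → x ∈ cs → IsCopy G (KBlow t (suc k)) x) →
    m * (length cs * (e ^ (e * suc k) * (suc k !) ^ e)) ≤ m * n ^ (e * suc k) + n ^ (e * suc k) * c) where

  private
    p = e * suc k
    -- The part of n missing from q·e: the hubs, the spare vertices of each class for the binomial
    -- bound, and the remainder of the division by e.
    D = t + suc k * e + e

    -- the q largest with t + (q + k) e ≤ n
    lower : ∀ n M → t + suc k * e ≤ n → IsNP n (KBlow t (suc k)) M →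
      n * n ^ p ≤ n * (M * (e ^ p * (suc k !) ^ e)) + p * D * n ^ p
    lower n M n≥ np = begin
      n * n ^ p ≤⟨ power-difference n (q * e) D p n≤ (ℕP.≤-trans (ℕP.*-monoˡ-≤ e (ℕP.m≤m+n q (suc k))) (ℕP.≤-trans (ℕP.m≤n+m _ t) fits)) ⟩
      n * (q * e) ^ p + p * D * n ^ p ≤⟨ ℕP.+-monoˡ-≤ (p * D * n ^ p) (ℕP.*-monoʳ-≤ n (begin
          (q * e) ^ p ≡⟨ ^-distribʳ-* p q e ⟩
          q ^ p * e ^ p ≡⟨ cong (_* e ^ p) (trans (cong (q ^_) (ℕP.*-comm e (suc k))) (sym (ℕP.^-*-assoc q (suc k) e))) ⟩
          (q ^ suc k) ^ e * e ^ p ≤⟨ ℕP.*-monoˡ-≤ (e ^ p) (BlowUpGraph.lower-bound L (suc k) q n fits np) ⟩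
          (suc k !) ^ e * M * e ^ p ≡⟨ solve 3 (λ f M b → f :* M :* b := M :* (b :* f)) refl ((suc k !) ^ e) M (e ^ p) ⟩
          M * (e ^ p * (suc k !) ^ e) ∎)) ⟩
      n * (M * (e ^ p * (suc k !) ^ e)) + p * D * n ^ p ∎
      where
      open ℕP.≤-Reasoning
      open +-*-Solver using (solve; _:+_; _:*_; _:=_; con)
      t≤n : t ≤ n
      t≤n = ℕP.≤-trans (ℕP.m≤m+n t (suc k * e)) n≥
      s = (n ∸ t) / e
      n∸t≡ : n ∸ t ≡ (n ∸ t) % e + s * e
      n∸t≡ = m≡m%n+[m/n]*n (n ∸ t) e
      n∸t< : n ∸ t < suc s * e
      n∸t< = subst (_< suc s * e) (sym n∸t≡) (ℕP.+-monoˡ-< (s * e) (m%n<n (n ∸ t) e))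
      k≤s : suc k ≤ s
      k≤s = ℕP.≤-pred (ℕP.*-cancelʳ-< e (suc k) (suc s) (ℕP.≤-<-trans (ℕP.+-cancelˡ-≤ t _ _ (ℕP.≤-trans n≥ (ℕP.≤-reflexive (sym (ℕP.m+[n∸m]≡n t≤n))))) n∸t<))
      q = s ∸ suc k
      q+k≡s : q + suc k ≡ s
      q+k≡s = ℕP.m∸n+n≡m k≤s
      fits : t + (q + suc k) * e ≤ n
      fits = begin
        t + (q + suc k) * e ≡⟨ cong (λ x → t + x * e) q+k≡s ⟩
        t + s * e ≤⟨ ℕP.+-monoʳ-≤ t (ℕP.≤-trans (ℕP.m≤n+m (s * e) ((n ∸ t) % e)) (ℕP.≤-reflexive (sym n∸t≡))) ⟩
        t + (n ∸ t) ≡⟨ ℕP.m+[n∸m]≡n t≤n ⟩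
        n ∎
      n≤ : n ≤ q * e + D
      n≤ = begin
        n ≡⟨ sym (ℕP.m+[n∸m]≡n t≤n) ⟩
        t + (n ∸ t) ≤⟨ ℕP.+-monoʳ-≤ t (ℕP.<⇒≤ n∸t<) ⟩
        t + suc s * e ≡⟨ cong (λ x → t + suc x * e) (sym q+k≡s) ⟩
        t + suc (q + suc k) * e ≡⟨ solve 4 (λ t q k e → t :+ (con 1 :+ (q :+ k)) :* e := q :* e :+ (t :+ k :* e :+ e)) refl t q (suc k) e ⟩
        q * e + D ∎

  asymptotic : AsymptoticNP (KBlow t (suc k)) e (suc k)
  -- Beyond this n₀ there is room for the hubs and for the spare vertices of all classes; the
  -- successor ensures n ≥ 1.
  asymptotic = (2 * (c + p * D)) ^ (suc k + 4) , suc (t + suc k * e) , λ n n≥ M np →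
    let 1≤n = ℕP.≤-trans (s≤s z≤n) n≥
        ((G , planar , cs , uniq , len , iff) , _) = np
        open Thresholds (thresholds n k 1≤n)
        upper′ = upper G planar 1≤n m τ 1≤τ mτ³≤n m≤τ cs uniq (λ {x} x∈ → Equivalence.to (iff x) x∈)
    in clear-root n k e m _ (c + p * D) 1≤n (ℕ.>-nonZero⁻¹ e) precise
         (distance-bound m n (M * (e ^ p * (suc k !) ^ e)) (n ^ p) c (p * D) m≤n
           (subst (λ N → m * (N * (e ^ p * (suc k !) ^ e)) ≤ m * n ^ p + n ^ p * c) len upper′)
           (lower n M (ℕP.≤-trans (ℕP.n≤1+n _) n≥) np))

asymptotic-K₃ : ∀ k → AsymptoticNP (KBlow 3 (suc k)) 3 (suc k)
asymptotic-K₃ k = Asymptotics.asymptotic layout₃ k (errorConst₃ (8 ^ suc k) * (3 ^ (3 * suc k) * (suc k !) ^ 3))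
  λ G D 1≤n m τ 1≤τ mτ³≤n m≤τ cs uniq copies → UpperBound.upper-K₃ G D 1≤n τ 1≤τ m mτ³≤n k (8 ^ suc k) m≤τ cs (uniq , copies)

asymptotic-K₄ : ∀ k → AsymptoticNP (KBlow 4 (suc k)) 6 (suc k)
asymptotic-K₄ k = Asymptotics.asymptotic layout₄ k (errorConst₄ (8 ^ suc k) * (6 ^ (6 * suc k) * (suc k !) ^ 6))
  λ G D 1≤n m τ 1≤τ mτ³≤n m≤τ cs uniq copies → UpperBound.upper-K₄ G D 1≤n τ 1≤τ m mτ³≤n k (8 ^ suc k)
    -- A small hub of K₄ saves τ^(3k+2), so the condition with exponent 2k+1 that serves K₃ is more
    -- than enough.
    (ℕP.≤-trans m≤τ (ℕP.*-monoʳ-≤ (8 ^ suc k) (ℕP.^-monoʳ-≤ τ {{ℕ.>-nonZero 1≤τ}} (ℕP.+-monoʳ-≤ k (ℕP.m≤m+n (suc k) (suc k))))))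
    cs (uniq , copies)

theorem1p5 : ∀ (k : ℕ) → 1 ≤ k →
    AsymptoticNP (KBlow 3 k) 3 k × AsymptoticNP (KBlow 4 k) 6 k
theorem1p5 (suc k) _ = asymptotic-K₃ k , asymptotic-K₄ k
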